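{- For every integer $m\ge1$, \[ \triangle(q)^{2m(m+1)}=\frac{1}{\left(\prod_{i=1}^m i!\right)^2}\sum_{J\subset\{1,\dots,m\}}(-1)^{|J|}\sum_{\vec k,\vec r\in\mathbb{Z}^m_J}q^{2\sum_{1\le i\le j\le m}k_ik_j+\sum_{j=1}^m(2k_j-1)r_j-\frac{m(m+1)}{2}}\prod_{i=1}^m(k_i+r_i+|\vec k|)\prod_{1\le i<j\le m}(k_i+r_i-k_j-r_j)(r_i-r_j). \]
   Context: $\triangle(q)=\sum_{n\ge0}q^{n(n+1)/2}$. For $J\subset\{1,\dots,m\}$, $\mathbb{Z}^m_J=\{\vec k=(k_1,\dots,k_m)\in\mathbb{Z}^m : J=\{j: k_j\le 0\}\}$; the inner sum is over pairs $\vec k=(k_1,\dots,k_m)$, $\vec r=(r_1,\dots,r_m)$ both in $\mathbb{Z}^m_J$. $|\vec k|=k_1+\cdots+k_m$. -}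

module Defs where

open import Data.Nat as ℕ using (ℕ; zero; suc)
open import Data.Nat using (_!)
open import Data.Nat.ListAction using (sum)
open import Data.Integer as ℤ using (ℤ; +_; -[1+_])
open import Data.Fin using (Fin; toℕ)
open import Data.Fin.Subset using (Subset; inside; outside; ∣_∣; _∈_)
open import Data.Fin.Subset.Properties using (_∈?_)
open import Data.Vec using (Vec; []; _∷_; lookup)
open import Data.List using (List; []; _∷_; map; concatMap; allFin; upTo; filterᵇ; foldr)
open import Data.Bool using (Bool; true; false; _∧_; if_then_else_)
open import Relation.Nullary.Decidable using (does)
open import Data.Product using (_×_; _,_)
import Data.Fin as F

-- coefficient of q^n in △(q) = Σ_{k≥0} q^{k(k+1)/2}
-- (number of k with k(k+1)/2 = n; such k satisfy k ≤ n)
triCoeff : ℕ → ℕ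
triCoeff n = sum (map (λ k → if does (k ℕ.* suc k ℕ.≟ 2 ℕ.* n) then 1 else 0) (upTo (suc n)))

_⊛_ : (ℕ → ℕ) → (ℕ → ℕ) → (ℕ → ℕ)
(f ⊛ g) n = sum (map (λ i → f i ℕ.* g (n ℕ.∸ i)) (upTo (suc n)))

one : ℕ → ℕ
one zero = 1
one (suc _) = 0

_^ˢ_ : (ℕ → ℕ) → ℕ → (ℕ → ℕ)
f ^ˢ zero = one
f ^ˢ suc e = f ⊛ (f ^ˢ e)

lhsCoeff : ℕ → ℤ → ℤ
lhsCoeff m (+ n) = + ((triCoeff ^ˢ (2 ℕ.* m ℕ.* suc m)) n)
lhsCoeff m -[1+ _ ] = + 0

facProd : ℕ → ℕ
facProd zero = 1
facProd (suc m) = (suc m) ! ℕ.* facProd m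

allSubsets : (m : ℕ) → List (Subset m)
allSubsets zero = [] ∷ []
allSubsets (suc m) = concatMap (λ J → (inside ∷ J) ∷ (outside ∷ J) ∷ []) (allSubsets m)

intRange : ℕ → List ℤ
intRange B = map (λ i → + i ℤ.- + B) (upTo (suc (2 ℕ.* B)))

box : ℕ → (m : ℕ) → List (Vec ℤ m)
box B zero = [] ∷ []
box B (suc m) = concatMap (λ x → map (x ∷_) (box B m)) (intRange B)

inZJ : ∀ {m} → Subset m → Vec ℤ m → Bool
inZJ {m} J k = foldr _∧_ true
  (map (λ j → eqB (does (j ∈? J)) (does (lookup k j ℤ.≤? + 0))) (allFin m))
  where
  eqB : Bool → Bool → Bool
  eqB true b = b
  eqB false true = false
  eqB false false = true

pairsLe : (m : ℕ) → List (Fin m × Fin m)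
pairsLe m = concatMap (λ i → map (i ,_) (filterᵇ (λ j → does (i F.≤? j)) (allFin m))) (allFin m)

pairsLt : (m : ℕ) → List (Fin m × Fin m)
pairsLt m = concatMap (λ i → map (i ,_) (filterᵇ (λ j → does (i F.<? j)) (allFin m))) (allFin m)

sumℤ : List ℤ → ℤ
sumℤ = foldr ℤ._+_ (+ 0)

prodℤ : List ℤ → ℤ
prodℤ = foldr ℤ._*_ (+ 1)

normℤ : ∀ {m} → Vec ℤ m → ℤ
normℤ {m} k = sumℤ (map (lookup k) (allFin m))

expo : ∀ {m} → Vec ℤ m → Vec ℤ m → ℤ
expo {m} k r =
  + 2 ℤ.* sumℤ (map (λ { (i , j) → lookup k i ℤ.* lookup k j }) (pairsLe m))
  ℤ.+ sumℤ (map (λ j → (+ 2 ℤ.* lookup k j ℤ.- + 1) ℤ.* lookup r j) (allFin m))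
  ℤ.- + ((m ℕ.* suc m) ℕ./ 2)

weight : ∀ {m} → Vec ℤ m → Vec ℤ m → ℤ
weight {m} k r =
  prodℤ (map (λ i → lookup k i ℤ.+ lookup r i ℤ.+ normℤ k) (allFin m))
  ℤ.* prodℤ (map (λ { (i , j) → (lookup k i ℤ.+ lookup r i ℤ.- lookup k j ℤ.- lookup r j)
                                 ℤ.* (lookup r i ℤ.- lookup r j) }) (pairsLt m))

sgn : ℕ → ℤ
sgn zero = + 1
sgn (suc n) = ℤ.- sgn n

-- coefficient of q^N in the right-hand sum (without the 1/(∏ i!)^2 prefactor),
-- truncated to k, r ∈ [-B, B]^m:
--   Σ_J (-1)^{|J|} Σ_{k, r ∈ ℤ^m_J ∩ [-B,B]^m, expo k r = N} weight k r
rhsCoeffTrunc : (m : ℕ) → ℕ → ℤ → ℤ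
rhsCoeffTrunc m B N = sumℤ (map termJ (allSubsets m))
  where
  termJ : Subset m → ℤ
  termJ J = sgn ∣ J ∣ ℤ.* sumℤ (concatMap (λ k → concatMap (λ r →
      if inZJ J k ∧ inZJ J r ∧ does (expo k r ℤ.≟ N) then weight k r ∷ [] else [])
      (box B m)) (box B m))

-- Let A = Σ_{k,r} ε(k,r) q^(k²+(2k−1)r) u^k v^r with ε(k,r) = [r ≥ 1] − [k ≤ 0], so that Σ_J (−1)^|J| over the J with k, r ∈ ℤ^m_J
-- is ∏ ε(k_i,r_i), and let θ = Σ_k q^(k²) u^k, ∂x = u∂_u + v∂_v, ∂y = v∂_v.  Expanding the determinant W_m of size m + 1 with
-- rows ∂y^(m−1) A, …, ∂y A, A, θ and columns ∂x^m, …, ∂x, 1 over monomials gives a Vandermonde product in the k_i + r_i and, by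
-- symmetrisation, one in the r_i; in the constant term with respect to u the index of θ is −|k|.  Hence the right-hand
-- sum is, up to the power q^(m(m+1)/2), m! times this constant term at v = 1.
-- By the Desnanot–Jacobi identity 2 W_{m+1} W_{m−1} is the Hirota bilinear form of W_m.  A theta function addition formula shows
-- that W_m ψ^(m(m+1)) = c_m J^(m(m+1)) T_m solves this recursion, where ψ = Σ (−1)^k q^(k²) v^k, J = Σ (4i+1) q^(4i²+2i),
-- T_m = Σ_k q^(k²−km+m(m+1)/2) u^k v^(km−m(m+1)/2) and c_m = (∏ i!)² / m!; the case m = 1 is a direct
-- computation with coefficients.  Finally J = △² ψ at v = 1.
-- Series are graded by twice the exponent of q plus the exponent of u: all degrees are then nonnegative, and T_m has
-- a single term of lowest degree and can be cancelled.
module Submission where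

open import Defs
open import Data.Nat as ℕ using (ℕ; zero; suc; _≤_; z≤n; s≤s; _!)
import Data.Nat.Properties as ℕ
open import Data.Nat.DivMod using (m*n/n≡m)
open import Data.Nat.ListAction using () renaming (sum to sumℕ)
open import Data.Nat.Tactic.RingSolver using () renaming (solve-∀ to ℕ-solve)
open import Data.Integer as ℤ using (ℤ; +_; -[1+_])
import Data.Integer.Properties as ℤ
open import Data.Integer.DivMod using (_/ℕ_; _%ℕ_; a≡a%ℕn+[a/ℕn]*n; n%ℕd<d)
open import Data.Integer.Tactic.RingSolver using (solve-∀)
open import Data.Bool using (Bool; true; false; if_then_else_; _∧_; not)
open import Data.Fin as F using (Fin; zero; suc)
open import Data.Fin.Subset using (Subset; inside; outside) renaming (∣_∣ to ∣_∣ˢ)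
open import Data.Fin.Subset.Properties using (_∈?_)
open import Data.List as List using (List; []; _∷_; map; concatMap; _++_; length; upTo; allFin; tabulate; filterᵇ; foldr)
import Data.List.Properties as List
open import Data.List.Membership.Propositional using () renaming (_∈_ to _∈ᴸ_)
open import Data.List.Membership.Propositional.Properties using (∈-map⁺; ∈-upTo⁺; ∈-upTo⁻)
open import Data.List.Relation.Binary.Pointwise using (Pointwise; []; _∷_)
open import Data.List.Relation.Unary.All as LAll using ([]; _∷_)
import Data.List.Relation.Unary.All.Properties as LAll
import Data.List.Relation.Unary.AllPairs as AP
open import Data.List.Relation.Unary.Any using (here; there)
open import Data.List.Relation.Unary.Unique.Propositional using (Unique)
import Data.List.Relation.Unary.Unique.Propositional.Properties as Uniq
open import Data.Maybe using (just; nothing)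
open import Data.Vec using (Vec; []; _∷_; head; lookup)
import Data.Vec.Properties as Vec
open import Data.Vec.Relation.Unary.All using (All; []; _∷_)
open import Data.Product using (_×_; _,_; proj₁; proj₂; ∃-syntax; ∃₂; Σ-syntax)
open import Data.Sum using (_⊎_; inj₁; inj₂)
open import Data.Empty using (⊥-elim)
open import Data.Unit using (tt)
open import Algebra.Bundles using (CommutativeRing)
open import Algebra.Properties.AbelianGroup ℤ.+-0-abelianGroup using () renaming (∙-cancelʳ to +-cancelʳ)
open import Algebra.Solver.Ring.AlmostCommutativeRing using (_-Raw-AlmostCommutative⟶_; fromCommutativeRing; Induced-equivalence)
open import Function using (_∘_; id; _⟨_⟩_)
open import Level using (0ℓ)
open import Relation.Binary.Definitions using (WeaklyDecidable)
open import Relation.Binary.PropositionalEquality as ≡ using (_≡_)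
open import Relation.Nullary using (Dec; yes; no; does; ¬_)
open import Relation.Nullary.Decidable using (True; toWitness)

-- `H f / f²` is twice a mixed logarithmic derivative, so it is additive on products: this is why
-- the Toda recursion for `W m`, multiplied by a power of `ψ`, becomes a single bilinear identity
-- for `T`. The variable `v` is kept until the end because the rows need a derivation that
-- multiplies a monomial by its `r`. Two obstacles shape the rest. The theorem speaks of all large
-- boxes, so a series is a family of finite sums, and every rearrangement of an infinite sum has to
-- be justified by a bound on its support. For `A` such bounds are delicate: the form
-- `k² + (2k − 1) r` is indefinite and is controlled only where `ε` does not vanish, so a change of
-- variables has to carry the sign pattern along. And nothing can be divided: the determinant
-- identities carry an extra common factor until it is known to be cancellable, logarithmic
-- derivatives appear multiplied out, and the identity for `J` is proved by doubling the precision
-- to which it holds.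

module IntegerSolver (𝓡 : CommutativeRing 0ℓ 0ℓ)
  (μ : ℤ.+-*-rawRing -Raw-AlmostCommutative⟶ fromCommutativeRing 𝓡) where
  private
    _coeff≟_ : WeaklyDecidable (Induced-equivalence μ)
    x coeff≟ y with x ℤ.≟ y
    ... | yes e = just (CommutativeRing.reflexive 𝓡 (≡.cong (_-Raw-AlmostCommutative⟶_.⟦_⟧ μ) e))
    ... | no _ = nothing

  open import Algebra.Solver.Ring ℤ.+-*-rawRing (fromCommutativeRing 𝓡) μ _coeff≟_ public

-- Determinants as iterated contractions

module Determinant (𝓡 : CommutativeRing 0ℓ 0ℓ)
  (μ : ℤ.+-*-rawRing -Raw-AlmostCommutative⟶ fromCommutativeRing 𝓡) where

  open CommutativeRing 𝓡
  open IntegerSolver 𝓡 μ using (solve; _:=_; _:+_; _:*_; :-_; _:-_; con)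
  open import Algebra.Properties.Ring ring using (-0#≈0#; -‿distribʳ-*; -1*x≈-x)
  open import Relation.Binary.Reasoning.Setoid setoid

  x-[x-y]≈y : ∀ x y → x - (x - y) ≈ y
  x-[x-y]≈y = solve 2 (λ x y → x :- (x :- y) := y) refl

  -- Contraction of an alternating form with a functional; antisymmetry of determinants in their columns is
  -- the fact that contractions anticommute.
  contract : ∀ {X : Set} → (X → Carrier) → List X → (List X → Carrier) → Carrier
  contract f [] F = 0#
  contract f (x ∷ xs) F = f x * F xs - contract f xs (λ ys → F (x ∷ ys))

  -- The columns are functionals on the rows.
  det : ∀ {X : Set} → List (X → Carrier) → List X → Carrier
  det [] [] = 1#
  det [] (_ ∷ _) = 0#
  det (f ∷ fs) xs = contract f xs (det fs)

  module _ {X : Set} where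
    private
      Functional = X → Carrier
      Form = List X → Carrier

    contract-cong : ∀ {f g : Functional} {F G : Form} → (∀ x → f x ≈ g x) → (∀ ys → F ys ≈ G ys) →
      ∀ xs → contract f xs F ≈ contract g xs G
    contract-cong e E [] = refl
    contract-cong e E (x ∷ xs) = +-cong (*-cong (e x) (E xs)) (-‿cong (contract-cong e (λ ys → E (x ∷ ys)) xs))

    contract-congʳ : ∀ f {F G : Form} → (∀ ys → F ys ≈ G ys) → ∀ xs → contract f xs F ≈ contract f xs G
    contract-congʳ f = contract-cong (λ _ → refl)

    contract-+ˡ : (f : Functional) (g : Functional) (F : Form) (xs : List X) → contract (λ x → f x + g x) xs F ≈ contract f xs F + contract g xs F
    contract-+ˡ f g F [] = sym (+-identityˡ 0#)
    contract-+ˡ f g F (x ∷ xs) = trans (+-congˡ (-‿cong (contract-+ˡ f g _ xs)))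
      (solve 5 (λ a b c d e → (a :+ b) :* c :- (d :+ e) := (a :* c :- d) :+ (b :* c :- e)) refl _ _ _ _ _)

    contract-*ˡ : (k : Carrier) (f : Functional) (F : Form) (xs : List X) → contract (λ x → k * f x) xs F ≈ k * contract f xs F
    contract-*ˡ k f F [] = sym (zeroʳ k)
    contract-*ˡ k f F (x ∷ xs) = trans (+-congˡ (-‿cong (contract-*ˡ k f _ xs)))
      (solve 4 (λ k a b c → k :* a :* b :- k :* c := k :* (a :* b :- c)) refl _ _ _ _)

    contract-+ʳ : (f : Functional) (F : Form) (G : Form) (xs : List X) → contract f xs (λ ys → F ys + G ys) ≈ contract f xs F + contract f xs G
    contract-+ʳ f F G [] = sym (+-identityˡ 0#)
    contract-+ʳ f F G (x ∷ xs) = trans (+-congˡ (-‿cong (contract-+ʳ f _ _ xs)))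
      (solve 5 (λ a b c d e → a :* (b :+ c) :- (d :+ e) := (a :* b :- d) :+ (a :* c :- e)) refl _ _ _ _ _)

    contract-*ʳ : (f : Functional) (k : Carrier) (F : Form) (xs : List X) → contract f xs (λ ys → k * F ys) ≈ k * contract f xs F
    contract-*ʳ f k F [] = sym (zeroʳ k)
    contract-*ʳ f k F (x ∷ xs) = trans (+-congˡ (-‿cong (contract-*ʳ f k _ xs)))
      (solve 4 (λ k a b c → a :* (k :* b) :- k :* c := k :* (a :* b :- c)) refl _ _ _ _)

    contract-neg : (f : Functional) (F : Form) (xs : List X) → contract f xs (λ ys → - F ys) ≈ - contract f xs F
    contract-neg f F [] = sym -0#≈0#
    contract-neg f F (x ∷ xs) = trans (+-congˡ (-‿cong (contract-neg f _ xs)))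
      (solve 3 (λ a b c → a :* (:- b) :- (:- c) := :- (a :* b :- c)) refl _ _ _)

    contract-0 : (f : Functional) (xs : List X) → contract f xs (λ _ → 0#) ≈ 0#
    contract-0 f [] = refl
    contract-0 f (x ∷ xs) = trans (+-cong (zeroʳ (f x)) (-‿cong (contract-0 f xs))) (-‿inverseʳ 0#)

    contract-vanish : ∀ (f : Functional) {F : Form} → (∀ ys → F ys ≈ 0#) → ∀ xs → contract f xs F ≈ 0#
    contract-vanish f e xs = trans (contract-congʳ f e xs) (contract-0 f xs)

    contract-vanishˡ : ∀ {f : Functional} xs F → LAll.All (λ x → f x ≈ 0#) xs → contract f xs F ≈ 0#
    contract-vanishˡ [] F [] = refl
    contract-vanishˡ (x ∷ xs) F (e ∷ es) = trans (+-cong (trans (*-congʳ e) (zeroˡ _))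
      (-‿cong (contract-vanishˡ xs _ es))) (-‿inverseʳ 0#)

    -- The two orders of removing a pair of entries carry opposite signs. Anticommutation with
    -- itself would only give `x ≈ - x`, which is too weak where 2 cannot be cancelled; hence a
    -- separate induction.
    contract-twice : (f : Functional) (F : Form) (xs : List X) → contract f xs (λ ys → contract f ys F) ≈ 0#
    contract-twice f F [] = refl
    contract-twice f F (x ∷ xs) = begin
      f x * contract f xs F - contract f xs (λ ys → f x * F ys - contract f ys (λ zs → F (x ∷ zs)))
        ≈⟨ +-congˡ (-‿cong (trans (contract-+ʳ f _ _ xs)
             (+-cong (contract-*ʳ f (f x) F xs) (trans (contract-neg f _ xs) (-‿cong (contract-twice f _ xs)))))) ⟩
      f x * contract f xs F - (f x * contract f xs F - 0#)
        ≈⟨ x-[x-y]≈y _ 0# ⟩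
      0# ∎

    contract-anticomm : (f : Functional) (g : Functional) (F : Form) (xs : List X) → contract f xs (λ ys → contract g ys F) ≈ - contract g xs (λ ys → contract f ys F)
    contract-anticomm f g F [] = sym -0#≈0#
    contract-anticomm f g F (x ∷ xs) = begin
      f x * contract g xs F - contract f xs (λ ys → g x * F ys - contract g ys (λ zs → F (x ∷ zs)))
        ≈⟨ +-congˡ (-‿cong (expand f g)) ⟩
      f x * contract g xs F - (g x * contract f xs F - contract f xs (λ ys → contract g ys (λ zs → F (x ∷ zs))))
        ≈⟨ +-congˡ (-‿cong (+-congˡ (-‿cong (contract-anticomm f g _ xs)))) ⟩
      f x * contract g xs F - (g x * contract f xs F - - contract g xs (λ ys → contract f ys (λ zs → F (x ∷ zs))))
        ≈⟨ solve 3 (λ a b c → a :- (b :- :- c) := :- (b :- (a :- c))) refl _ _ _ ⟩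
      - (g x * contract f xs F - (f x * contract g xs F - contract g xs (λ ys → contract f ys (λ zs → F (x ∷ zs)))))
        ≈⟨ -‿cong (+-congˡ (-‿cong (expand g f))) ⟨
      - (g x * contract f xs F - contract g xs (λ ys → f x * F ys - contract f ys (λ zs → F (x ∷ zs)))) ∎
      where
      expand : ∀ f g → contract f xs (λ ys → g x * F ys - contract g ys (λ zs → F (x ∷ zs))) ≈
        g x * contract f xs F - contract f xs (λ ys → contract g ys (λ zs → F (x ∷ zs)))
      expand f g = trans (contract-+ʳ f _ _ xs) (+-cong (contract-*ʳ f (g x) F xs) (contract-neg f _ xs))

    -- The front copy of `f` moves past `gs` by anticommutation until it meets the other copy.
    det-equal-columns : ∀ (f : Functional) gs hs xs → det (f ∷ gs ++ f ∷ hs) xs ≈ 0#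
    det-equal-columns f [] hs xs = contract-twice f (det hs) xs
    det-equal-columns f (g ∷ gs) hs xs = begin
      contract f xs (λ ys → contract g ys (det (gs ++ f ∷ hs)))   ≈⟨ contract-anticomm f g _ xs ⟩
      - contract g xs (det (f ∷ gs ++ f ∷ hs))  ≈⟨ -‿cong (contract-vanish g (det-equal-columns f gs hs) xs) ⟩
      - 0#                                      ≈⟨ -0#≈0# ⟩
      0# ∎

    -- `same` is a field of its own because it does not follow from `swap` unless 2 can be
    -- cancelled.
    record Alternating (F : Form) : Set where
      field
        swap : ∀ pre x y zs → F (pre ++ x ∷ y ∷ zs) ≈ - F (pre ++ y ∷ x ∷ zs)
        same : ∀ pre x zs → F (pre ++ x ∷ x ∷ zs) ≈ 0#

      same-∈ : ∀ pre {x zs} → x ∈ᴸ zs → F (pre ++ x ∷ zs) ≈ 0#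
      same-∈ pre {x} {_ ∷ zs} (here ≡.refl) = same pre x zs
      same-∈ pre {x} {z ∷ zs} (there p) = trans (swap pre x z zs) (trans (-‿cong (begin
        F (pre ++ z ∷ x ∷ zs)             ≡⟨ ≡.cong F (List.++-assoc pre (z ∷ []) (x ∷ zs)) ⟨
        F ((pre ++ z ∷ []) ++ x ∷ zs)     ≈⟨ same-∈ (pre ++ z ∷ []) p ⟩
        0# ∎)) -0#≈0#)

    Alternating-∷ : ∀ {F : Form} x → Alternating F → Alternating (λ ys → F (x ∷ ys))
    Alternating-∷ x alt = record { swap = λ pre → swap (x ∷ pre) ; same = λ pre → same (x ∷ pre) }
      where open Alternating alt

    contract-alternating : ∀ (f : Functional) {F : Form} → Alternating F → Alternating (λ xs → contract f xs F)
    contract-alternating f alt = record { swap = sw alt ; same = sa alt }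
      where
      open Alternating
      sw : ∀ {F} → Alternating F → ∀ pre x y zs → contract f (pre ++ x ∷ y ∷ zs) F ≈ - contract f (pre ++ y ∷ x ∷ zs) F
      sw {F} a (p ∷ pre) x y zs = trans (+-cong (*-congˡ (swap a pre x y zs)) (-‿cong (sw (Alternating-∷ p a) pre x y zs)))
        (solve 3 (λ a b c → a :* (:- b) :- (:- c) := :- (a :* b :- c)) refl _ _ _)
      sw {F} a [] x y zs = trans (+-congˡ (-‿cong (+-congˡ (-‿cong (trans (contract-congʳ f (swap a [] x y) zs) (contract-neg f _ zs))))))
        (solve 3 (λ a b c → a :- (b :- :- c) := :- (b :- (a :- c))) refl _ _ _)
      sa : ∀ {F} → Alternating F → ∀ pre x zs → contract f (pre ++ x ∷ x ∷ zs) F ≈ 0#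
      sa {F} a (p ∷ pre) x zs = trans (+-cong (trans (*-congˡ (same a pre x zs)) (zeroʳ _)) (-‿cong (sa (Alternating-∷ p a) pre x zs))) (-‿inverseʳ 0#)
      sa {F} a [] x zs = trans (x-[x-y]≈y _ _) (contract-vanish f (same a [] x) zs)

    det-alternating : ∀ (fs : List Functional) → Alternating (det fs)
    det-alternating [] = record { swap = s ; same = z }
      where
      s : ∀ pre x y zs → det [] (pre ++ x ∷ y ∷ zs) ≈ - det [] (pre ++ y ∷ x ∷ zs)
      s [] x y zs = sym -0#≈0#
      s (_ ∷ _) x y zs = sym -0#≈0#
      z : ∀ pre x zs → det [] (pre ++ x ∷ x ∷ zs) ≈ 0#
      z [] x zs = refl
      z (_ ∷ _) x zs = refl
    det-alternating (f ∷ fs) = contract-alternating f (det-alternating fs)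

    Kills : X → Form → Set
    Kills z F = ∀ pre zs → F (pre ++ z ∷ zs) ≈ 0#

    det-kills : ∀ {z} (fs : List Functional) → LAll.All (λ f → f z ≈ 0#) fs → Kills z (det fs)
    det-kills [] [] [] zs = refl
    det-kills [] [] (_ ∷ _) zs = refl
    det-kills {z} (f ∷ fs) (e ∷ es) = go (det-kills fs es)
      where
      go : ∀ {F} → Kills z F → Kills z (λ xs → contract f xs F)
      go k [] zs = trans (+-cong (trans (*-congʳ e) (zeroˡ _)) (-‿cong (contract-vanish f (k []) zs))) (-‿inverseʳ 0#)
      go k (p ∷ pre) zs = trans (+-cong (trans (*-congˡ (k pre zs)) (zeroʳ _)) (-‿cong (go (λ pre′ → k (p ∷ pre′)) pre zs))) (-‿inverseʳ 0#)

    det-linear : ∀ {e a b} k l (fs : List Functional) → LAll.All (λ f → f e ≈ k * f a + l * f b) fs → ∀ zs →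
      det fs (e ∷ zs) ≈ k * det fs (a ∷ zs) + l * det fs (b ∷ zs)
    det-linear k l [] [] zs = sym (trans (+-cong (zeroʳ k) (zeroʳ l)) (+-identityˡ 0#))
    det-linear {e} {a} {b} k l (f ∷ fs) (p ∷ ps) zs = trans
      (+-cong (*-congʳ p) (-‿cong (trans (contract-congʳ f (det-linear k l fs ps) zs)
        (trans (contract-+ʳ f _ _ zs) (+-cong (contract-*ʳ f k _ zs) (contract-*ʳ f l _ zs))))))
      (solve 7 (λ k l a b c d e → (k :* a :+ l :* b) :* c :- (k :* d :+ l :* e) := k :* (a :* c :- d) :+ l :* (b :* c :- e))
        refl k l _ _ _ _ _)

    det-factor : ∀ (h : Functional) fs xs → det (map (λ f x → f x * h x) fs) xs ≈ List.foldr (λ x r → h x * r) 1# xs * det fs xs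
    det-factor h [] [] = sym (*-identityˡ 1#)
    det-factor h [] (x ∷ xs) = sym (zeroʳ _)
    det-factor h (f ∷ fs) xs = trans (contract-congʳ _ (det-factor h fs) xs) (go xs (det fs))
      where
      Π : List X → Carrier
      Π = List.foldr (λ x r → h x * r) 1#
      go : ∀ xs F → contract (λ x → f x * h x) xs (λ ys → Π ys * F ys) ≈ Π xs * contract f xs F
      go [] F = sym (zeroʳ _)
      go (x ∷ xs) F = trans (+-congˡ (-‿cong (trans (contract-congʳ _ (λ ys → *-assoc (h x) (Π ys) (F (x ∷ ys))) xs)
        (trans (contract-*ʳ _ (h x) _ xs) (*-congˡ (go xs (λ ys → F (x ∷ ys))))))))
        (solve 5 (λ f h p F c → f :* h :* (p :* F) :- h :* (p :* c) := h :* p :* (f :* F :- c)) refl _ _ _ _ _)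

    det-cong : ∀ (fs : List Functional) (t : Functional → Functional) → (∀ f x → t f x ≈ f x) → ∀ xs → det (map t fs) xs ≈ det fs xs
    det-cong [] t e [] = refl
    det-cong [] t e (_ ∷ _) = refl
    det-cong (f ∷ fs) t e xs = contract-cong (e f) (det-cong fs t e) xs

  det-map : ∀ {X Y : Set} (t : Y → X) fs ys → det fs (map t ys) ≈ det (map (_∘ t) fs) ys
  det-map t [] [] = refl
  det-map t [] (_ ∷ _) = refl
  det-map t (f ∷ fs) ys = trans (go ys (det fs)) (contract-congʳ _ (det-map t fs) ys)
    where
    go : ∀ ys F → contract f (map t ys) F ≈ contract (f ∘ t) ys (λ zs → F (map t zs))
    go [] F = refl
    go (y ∷ ys) F = +-congˡ (-‿cong (go ys _))

  -- The Desnanot–Jacobi identity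

  Row : Set
  Row = ℕ → Carrier

  cols : ℕ → List (Row → Carrier)
  cols zero = []
  cols (suc n) = (λ r → r n) ∷ cols n

  cols-All : ∀ n {P : (Row → Carrier) → Set} → (∀ j → j ℕ.< n → P (λ r → r j)) → LAll.All P (cols n)
  cols-All zero h = []
  cols-All (suc n) h = h n ℕ.≤-refl ∷ cols-All n (λ j j<n → h j (ℕ.m≤n⇒m≤1+n j<n))

  cols-∋ : ∀ {j} n → j ℕ.< n → ∃₂ λ gs hs → cols n ≡ gs ++ (λ r → r j) ∷ hs
  cols-∋ {j} (suc n) (ℕ.s≤s j≤n) with j ℕ.≟ n
  ... | yes ≡.refl = [] , cols n , ≡.refl
  ... | no j≢n with cols-∋ n (ℕ.≤∧≢⇒< j≤n j≢n)
  ...   | gs , hs , e = (λ r → r n) ∷ gs , hs , ≡.cong (_ ∷_) e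

  cols-repeated : ∀ {j} n → j ℕ.< n → ∀ xs → det ((λ r → r j) ∷ cols n) xs ≈ 0#
  cols-repeated n j<n xs with cols n | cols-∋ n j<n
  ... | _ | gs , hs , ≡.refl = det-equal-columns _ gs hs xs

  -- Read as a vector, this is the linear combination of the rows `rs` in which each row has as
  -- coefficient the signed value of `G` on the remaining ones.
  combination : List Row → (List Row → Carrier) → Row
  combination rs G j = contract (λ r → r j) rs G

  det-combination : ∀ n rs G zs → LAll.All (_∈ᴸ zs) rs → det (cols n) (combination rs G ∷ zs) ≈ 0#
  det-combination n [] G zs [] = det-kills (cols n) (cols-All n λ _ _ → refl) [] zs
  det-combination n (r ∷ rs) G zs (p ∷ ps) = begin
    det (cols n) (combination (r ∷ rs) G ∷ zs)
      ≈⟨ det-linear (G rs) (- 1#) (cols n) (cols-All n λ j _ → +-cong (*-comm _ _) (sym (-1*x≈-x _))) zs ⟩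
    G rs * det (cols n) (r ∷ zs) + - 1# * det (cols n) (combination rs (λ ys → G (r ∷ ys)) ∷ zs)
      ≈⟨ +-cong (*-congˡ (Alternating.same-∈ (det-alternating (cols n)) [] p)) (*-congˡ (det-combination n rs _ zs ps)) ⟩
    G rs * 0# + - 1# * 0#  ≈⟨ +-cong (zeroʳ _) (zeroʳ _) ⟩
    0# + 0#                ≈⟨ +-identityˡ 0# ⟩
    0# ∎

  -- Subtracting a combination of the rows rs from a multiple of a, this row is zero in the first n columns.
  eliminate : ℕ → List Row → Row → Row
  eliminate n rs a j = det ((λ r → r j) ∷ cols n) (a ∷ rs)

  -- For `j < n` the entry in column `j` is a determinant in which this column occurs twice.
  eliminate-kills : ∀ n rs a → Kills (eliminate n rs a) (det (cols n))
  eliminate-kills n rs a = det-kills (cols n) (cols-All n λ j j<n → cols-repeated n j<n (a ∷ rs))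

  det-eliminate : ∀ m n rs a zs → LAll.All (_∈ᴸ zs) rs →
    det (cols m) (eliminate n rs a ∷ zs) ≈ det (cols n) rs * det (cols m) (a ∷ zs)
  det-eliminate m n rs a zs ps = begin
    det (cols m) (eliminate n rs a ∷ zs)
      ≈⟨ det-linear (det (cols n) rs) (- 1#) (cols m) (cols-All m λ j _ → +-cong (*-comm _ _) (sym (-1*x≈-x _))) zs ⟩
    det (cols n) rs * det (cols m) (a ∷ zs) + - 1# * det (cols m) (combination rs (λ ys → det (cols n) (a ∷ ys)) ∷ zs)
      ≈⟨ +-congˡ (trans (*-congˡ (det-combination m rs _ zs ps)) (zeroʳ _)) ⟩
    det (cols n) rs * det (cols m) (a ∷ zs) + 0#  ≈⟨ +-identityʳ _ ⟩
    det (cols n) rs * det (cols m) (a ∷ zs) ∎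

  -- Once `a` and `b` are replaced by their eliminated rows, the matrix is block triangular: a 2 × 2
  -- block of bordered minors and a block with determinant `N`. Each replacement costs a factor `N`,
  -- and the block contributes one on the other side. One common `N` could be cancelled, but this
  -- ring may have zero divisors.
  desnanot-jacobi : ∀ n a b rs → let N = det (cols n) rs in
    N * (N * det (cols (suc (suc n))) (a ∷ b ∷ rs)) ≈
    N * (det ((λ r → r (suc n)) ∷ cols n) (a ∷ rs) * det (cols (suc n)) (b ∷ rs)
       - det ((λ r → r (suc n)) ∷ cols n) (b ∷ rs) * det (cols (suc n)) (a ∷ rs))
  desnanot-jacobi n a b rs = begin
    N * (N * det C (a ∷ b ∷ rs))         ≈⟨ *-congˡ (*-congˡ (swap [] a b rs)) ⟩
    N * (N * - det C (b ∷ a ∷ rs))       ≈⟨ *-congˡ (-‿distribʳ-* _ _) ⟨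
    N * - (N * det C (b ∷ a ∷ rs))       ≈⟨ *-congˡ (-‿cong (det-eliminate (suc (suc n)) n rs b (a ∷ rs) (∈-rs a))) ⟨
    N * - det C (b′ ∷ a ∷ rs)            ≈⟨ *-congˡ (swap [] a b′ rs) ⟨
    N * det C (a ∷ b′ ∷ rs)              ≈⟨ det-eliminate (suc (suc n)) n rs a (b′ ∷ rs) (∈-rs b′) ⟨
    det C (a′ ∷ b′ ∷ rs)
      ≈⟨ +-cong (*-congˡ (corner b)) (-‿cong (+-cong (*-congˡ (corner a)) (-‿cong (contract-vanish _ zero₂ rs)))) ⟩
    a′ (suc n) * (b′ n * N) - (b′ (suc n) * (a′ n * N) - 0#)
      ≈⟨ +-congˡ (-‿cong (trans (+-congˡ -0#≈0#) (+-identityʳ _))) ⟩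
    a′ (suc n) * (b′ n * N) - b′ (suc n) * (a′ n * N)
      ≈⟨ solve 5 (λ p q r s N → p :* (q :* N) :- r :* (s :* N) := N :* (p :* q :- r :* s)) refl _ _ _ _ _ ⟩
    N * (a′ (suc n) * b′ n - b′ (suc n) * a′ n) ∎
    where
    N = det (cols n) rs
    C = cols (suc (suc n))
    a′ = eliminate n rs a
    b′ = eliminate n rs b
    open Alternating (det-alternating C) using (swap)
    ∈-rs : ∀ x → LAll.All (_∈ᴸ (x ∷ rs)) rs
    ∈-rs x = LAll.map there (LAll.tabulate (λ p → p))
    corner : ∀ x → det (cols (suc n)) (eliminate n rs x ∷ rs) ≈ eliminate n rs x n * N
    corner x = trans (+-congˡ (trans (-‿cong (contract-vanish _ (eliminate-kills n rs x []) rs)) -0#≈0#)) (+-identityʳ _)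
    -- Among the columns of `cols (suc n)` only column `n` is nonzero on `a′` and `b′`, and it can
    -- serve only one of the two rows.
    zero₂ : ∀ ys → det (cols (suc n)) (a′ ∷ b′ ∷ ys) ≈ 0#
    zero₂ ys = begin
      a′ n * det (cols n) (b′ ∷ ys) - (b′ n * det (cols n) (a′ ∷ ys) - contract _ ys (λ zs → det (cols n) (a′ ∷ b′ ∷ zs)))
        ≈⟨ +-cong (*-congˡ (eliminate-kills n rs b [] ys)) (-‿cong (+-cong (*-congˡ (eliminate-kills n rs a [] ys))
             (-‿cong (contract-vanish _ (λ zs → eliminate-kills n rs a [] (b′ ∷ zs)) ys)))) ⟩
      a′ n * 0# - (b′ n * 0# - 0#)
        ≈⟨ solve 3 (λ a b z → a :* z :- (b :* z :- z) := (a :- b :+ con (+ 1)) :* z) refl _ _ 0# ⟩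
      _ * 0#  ≈⟨ zeroʳ _ ⟩
      0# ∎

  -- Derivations of determinants

  record IsDerivation (δ : Carrier → Carrier) : Set where
    field
      δ-cong : ∀ {x y} → x ≈ y → δ x ≈ δ y
      δ-+ : ∀ x y → δ (x + y) ≈ δ x + δ y
      δ-* : ∀ x y → δ (x * y) ≈ δ x * y + x * δ y

    δ-0 : δ 0# ≈ 0#
    δ-0 = begin
      δ 0#          ≈⟨ δ-cong (zeroˡ 0#) ⟨
      δ (0# * 0#)   ≈⟨ δ-* 0# 0# ⟩
      δ 0# * 0# + 0# * δ 0#  ≈⟨ +-cong (zeroʳ _) (zeroˡ _) ⟩
      0# + 0#       ≈⟨ +-identityˡ 0# ⟩
      0# ∎

    δ-neg : ∀ x → δ (- x) ≈ - δ x
    δ-neg x = begin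
      δ (- x)                  ≈⟨ solve 2 (λ a b → a := (a :+ b) :- b) refl (δ (- x)) (δ x) ⟩
      δ (- x) + δ x - δ x      ≈⟨ +-congʳ (δ-+ (- x) x) ⟨
      δ (- x + x) - δ x        ≈⟨ +-congʳ (trans (δ-cong (-‿inverseˡ x)) δ-0) ⟩
      0# - δ x                 ≈⟨ +-identityˡ _ ⟩
      - δ x ∎

    δ-- : ∀ x y → δ (x - y) ≈ δ x - δ y
    δ-- x y = trans (δ-+ x (- y)) (+-congˡ (δ-neg y))

    δ-1 : δ 1# ≈ 0#
    δ-1 = begin
      δ 1#                        ≈⟨ solve 1 (λ a → a := (a :+ a) :- a) refl _ ⟩
      δ 1# + δ 1# - δ 1#          ≈⟨ +-congʳ (+-cong (*-identityʳ _) (*-identityˡ _)) ⟨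
      δ 1# * 1# + 1# * δ 1# - δ 1#  ≈⟨ +-congʳ (δ-* 1# 1#) ⟨
      δ (1# * 1#) - δ 1#          ≈⟨ +-congʳ (δ-cong (*-identityˡ 1#)) ⟩
      δ 1# - δ 1#                 ≈⟨ -‿inverseʳ _ ⟩
      0# ∎

    δ-contract : ∀ {X : Set} (f : X → Carrier) {F G : List X → Carrier} → (∀ ys → δ (F ys) ≈ G ys) → ∀ xs →
      δ (contract f xs F) ≈ contract (λ x → δ (f x)) xs F + contract f xs G
    δ-contract f e [] = trans δ-0 (sym (+-identityˡ 0#))
    δ-contract f {F} {G} e (x ∷ xs) = begin
      δ (f x * F xs - contract f xs _)
        ≈⟨ trans (δ-- _ _) (+-cong (trans (δ-* _ _) (+-congˡ (*-congˡ (e xs)))) (-‿cong (δ-contract f (λ ys → e (x ∷ ys)) xs))) ⟩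
      (δ (f x) * F xs + f x * G xs) - (contract (λ x → δ (f x)) xs _ + contract f xs _)
        ≈⟨ solve 4 (λ a b c d → a :+ b :- (c :+ d) := a :- c :+ (b :- d)) refl _ _ _ _ ⟩
      _ ∎

  module _ {δ : Carrier → Carrier} (isDerivation : IsDerivation δ) where
    open IsDerivation isDerivation

    iterate : ℕ → Carrier → Carrier
    iterate zero x = x
    iterate (suc n) x = δ (iterate n x)

    iterates : ℕ → List (Carrier → Carrier)
    iterates zero = []
    iterates (suc n) = iterate n ∷ iterates n

    -- Differentiating any column but the first produces a column that is already present.
    wronskian-derivative : ∀ n xs → δ (det (iterates (suc n)) xs) ≈ det (iterate (suc n) ∷ iterates n) xs
    wronskian-derivative zero xs = trans (δ-contract (iterate 0) {G = λ _ → 0#} (λ { [] → δ-1 ; (_ ∷ _) → δ-0 }) xs)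
      (trans (+-congˡ (contract-0 _ xs)) (+-identityʳ _))
    wronskian-derivative (suc n) xs = trans (δ-contract (iterate (suc n)) (wronskian-derivative n) xs)
      (trans (+-congˡ (contract-twice _ _ xs)) (+-identityʳ _))

  rowSum : ∀ {X : Set} → (X → X) → (List X → Carrier) → List X → Carrier
  rowSum t F [] = 0#
  rowSum t F (x ∷ xs) = F (t x ∷ xs) + rowSum t (λ ys → F (x ∷ ys)) xs

  module _ {X : Set} (t : X → X) where
    rowSum-cong : ∀ {F G : List X → Carrier} → (∀ ys → F ys ≈ G ys) → ∀ xs → rowSum t F xs ≈ rowSum t G xs
    rowSum-cong e [] = refl
    rowSum-cong e (x ∷ xs) = +-cong (e _) (rowSum-cong (λ ys → e (x ∷ ys)) xs)

    rowSum-- : ∀ F G xs → rowSum t (λ ys → F ys - G ys) xs ≈ rowSum t F xs - rowSum t G xs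
    rowSum-- F G [] = sym (-‿inverseʳ 0#)
    rowSum-- F G (x ∷ xs) = trans (+-congˡ (rowSum-- _ _ xs))
      (solve 4 (λ a b c d → a :- b :+ (c :- d) := a :+ c :- (b :+ d)) refl _ _ _ _)

    rowSum-* : ∀ k F xs → rowSum t (λ ys → k * F ys) xs ≈ k * rowSum t F xs
    rowSum-* k F [] = sym (zeroʳ k)
    rowSum-* k F (x ∷ xs) = trans (+-congˡ (rowSum-* k _ xs)) (sym (distribˡ k _ _))

    rowSum-contract : ∀ f F xs →
      contract (λ x → f (t x)) xs F + contract f xs (rowSum t F) ≈ rowSum t (λ ys → contract f ys F) xs
    rowSum-contract f F [] = +-identityˡ 0#
    rowSum-contract f F (x ∷ xs) = begin
      f (t x) * F xs - contract (λ x → f (t x)) xs Fx + (f x * rowSum t F xs - contract f xs (λ ys → F (t x ∷ ys) + rowSum t Fx ys))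
        ≈⟨ +-congˡ (+-congˡ (-‿cong (contract-+ʳ f _ _ xs))) ⟩
      f (t x) * F xs - contract (λ x → f (t x)) xs Fx + (f x * rowSum t F xs - (contract f xs (λ ys → F (t x ∷ ys)) + contract f xs (rowSum t Fx)))
        ≈⟨ solve 5 (λ a b c d e → a :- b :+ (c :- (d :+ e)) := a :- d :+ (c :- (b :+ e))) refl _ _ _ _ _ ⟩
      f (t x) * F xs - contract f xs (λ ys → F (t x ∷ ys)) + (f x * rowSum t F xs - (contract (λ x → f (t x)) xs Fx + contract f xs (rowSum t Fx)))
        ≈⟨ +-congˡ (+-cong (sym (rowSum-* (f x) F xs)) (-‿cong (rowSum-contract f Fx xs))) ⟩
      f (t x) * F xs - contract f xs (λ ys → F (t x ∷ ys)) + (rowSum t (λ ys → f x * F ys) xs - rowSum t (λ ys → contract f ys Fx) xs)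
        ≈⟨ +-congˡ (rowSum-- _ _ xs) ⟨
      _ ∎
      where Fx = λ ys → F (x ∷ ys)

  det-row-derivative : ∀ {δ} → IsDerivation δ → ∀ fs → LAll.All (λ f → ∀ x → δ (f x) ≈ f (δ x)) fs → ∀ xs →
    δ (det fs xs) ≈ rowSum δ (det fs) xs
  det-row-derivative {δ} d [] [] xs = trans (δ-det[] xs) (sym (zeros xs))
    where
    open IsDerivation d
    δ-det[] : ∀ xs → δ (det [] xs) ≈ 0#
    δ-det[] [] = δ-1
    δ-det[] (_ ∷ _) = δ-0
    zeros′ : ∀ x xs → rowSum δ (λ ys → det [] (x ∷ ys)) xs ≈ 0#
    zeros′ x [] = refl
    zeros′ x (y ∷ xs) = trans (+-identityˡ _) (zeros′ x xs)
    zeros : ∀ xs → rowSum δ (det []) xs ≈ 0#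
    zeros [] = refl
    zeros (x ∷ xs) = trans (+-identityˡ _) (zeros′ x xs)
  det-row-derivative {δ} d (f ∷ fs) (e ∷ es) xs = begin
    δ (contract f xs (det fs))  ≈⟨ IsDerivation.δ-contract d f (det-row-derivative d fs es) xs ⟩
    contract (λ x → δ (f x)) xs (det fs) + contract f xs (rowSum δ (det fs))  ≈⟨ +-congʳ (contract-cong e (λ _ → refl) xs) ⟩
    contract (λ x → f (δ x)) xs (det fs) + contract f xs (rowSum δ (det fs))  ≈⟨ rowSum-contract δ f (det fs) xs ⟩
    rowSum δ (λ ys → contract f ys (det fs)) xs ∎

  -- Double Wronskians: the derivations δ and δ′ act on the columns and on the rows.
  module DoubleWronskian {δ δ′ : Carrier → Carrier} (D : IsDerivation δ) (D′ : IsDerivation δ′)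
    (commute : ∀ x → δ′ (δ x) ≈ δ (δ′ x)) (θ A : Carrier) (δ′θ≈0 : δ′ θ ≈ 0#) where
    open IsDerivation
    private
      δ^ = iterate D
      δ′^ = iterate D′

    rows : ℕ → List Carrier
    rows zero = θ ∷ []
    rows (suc l) = δ′^ l A ∷ rows l

    doubleWronskian : ℕ → Carrier
    doubleWronskian m = det (iterates D (suc m)) (rows m)

    δ^-0 : ∀ n → δ^ n 0# ≈ 0#
    δ^-0 zero = refl
    δ^-0 (suc n) = trans (δ-cong D (δ^-0 n)) (δ-0 D)

    δ^-cong : ∀ n {x y} → x ≈ y → δ^ n x ≈ δ^ n y
    δ^-cong zero e = e
    δ^-cong (suc n) e = δ-cong D (δ^-cong n e)

    δ^-commute : ∀ n x → δ′ (δ^ n x) ≈ δ^ n (δ′ x)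
    δ^-commute zero x = refl
    δ^-commute (suc n) x = trans (commute (δ^ n x)) (δ-cong D (δ^-commute n x))

    iterates-All : ∀ n {P : (Carrier → Carrier) → Set} → (∀ j → P (δ^ j)) → LAll.All P (iterates D n)
    iterates-All zero h = []
    iterates-All (suc n) h = h n ∷ iterates-All n h

    iterates-commute : ∀ n → LAll.All (λ f → ∀ x → δ′ (f x) ≈ f (δ′ x)) (iterates D n)
    iterates-commute n = iterates-All n δ^-commute

    iterates-kill : ∀ n → LAll.All (λ f → f (δ′ θ) ≈ 0#) (iterates D n)
    iterates-kill n = iterates-All n λ j → trans (δ^-cong j δ′θ≈0) (δ^-0 j)

    -- Each row `δ′^ j A` below the top turns into the row just above it, and `θ` is killed by `δ′`.
    -- Hence only the top row contributes to the `δ′`-derivative of the double Wronskian.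
    rowSum-rows : ∀ {F} → Alternating F → Kills (δ′ θ) F → ∀ l → rowSum δ′ (λ ys → F (δ′^ l A ∷ ys)) (rows l) ≈ 0#
    rowSum-rows alt kill zero = trans (+-identityʳ _) (kill (_ ∷ []) [])
    rowSum-rows alt kill (suc l) = trans
      (+-cong (Alternating.same alt [] (δ′^ (suc l) A) (rows l))
        (rowSum-rows (Alternating-∷ (δ′^ (suc l) A) alt) (λ pre zs → kill (δ′^ (suc l) A ∷ pre) zs) l))
      (+-identityˡ 0#)

    δ′-det-rows : ∀ fs → LAll.All (λ f → ∀ x → δ′ (f x) ≈ f (δ′ x)) fs → LAll.All (λ f → f (δ′ θ) ≈ 0#) fs →
      ∀ l → δ′ (det fs (rows (suc l))) ≈ det fs (δ′^ (suc l) A ∷ rows l)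
    δ′-det-rows fs comm kill l = trans (det-row-derivative D′ fs comm (rows (suc l)))
      (trans (+-congˡ (rowSum-rows (det-alternating fs) (det-kills fs kill) l)) (+-identityʳ _))

    private
      row : Carrier → Row
      row y j = δ^ j y

    map-cols : ∀ n → map (_∘ row) (cols n) ≡ iterates D n
    map-cols zero = ≡.refl
    map-cols (suc n) = ≡.cong (δ^ n ∷_) (map-cols n)

    det-cols : ∀ n ys → det (cols n) (map row ys) ≈ det (iterates D n) ys
    det-cols n ys = trans (det-map row (cols n) ys) (reflexive (≡.cong (λ fs → det fs ys) (map-cols n)))

    det-cols′ : ∀ n ys → det ((λ r → r (suc n)) ∷ cols n) (map row ys) ≈ det (δ^ (suc n) ∷ iterates D n) ys
    det-cols′ n ys = trans (det-map row ((λ r → r (suc n)) ∷ cols n) ys)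
      (reflexive (≡.cong (λ fs → det (δ^ (suc n) ∷ fs) ys) (map-cols n)))

    -- `desnanot-jacobi` with the two top rows singled out: the four bordered minors are `W (suc k)`
    -- and its derivatives under `δ`, `δ′` and both.
    toda : ∀ k → let W = doubleWronskian in
      W k * (W k * W (suc (suc k))) ≈
      W k * (W (suc k) * δ (δ′ (W (suc k))) - δ (W (suc k)) * δ′ (W (suc k)))
    toda k = begin
      W k * (W k * W (suc (suc k)))
        ≈⟨ *-cong (det-cols (suc k) rs) (*-cong (det-cols (suc k) rs) (det-cols (suc (suc (suc k))) (a ∷ b ∷ rs))) ⟨
      N * (N * det (cols (suc (suc (suc k)))) (map row (a ∷ b ∷ rs)))
        ≈⟨ desnanot-jacobi (suc k) (row a) (row b) (map row rs) ⟩
      N * (det ((λ r → r (suc (suc k))) ∷ cols (suc k)) (map row (a ∷ rs)) * det (cols (suc (suc k))) (map row (b ∷ rs))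
         - det ((λ r → r (suc (suc k))) ∷ cols (suc k)) (map row (b ∷ rs)) * det (cols (suc (suc k))) (map row (a ∷ rs)))
        ≈⟨ *-cong (det-cols (suc k) rs) (+-cong
             (*-cong (trans (det-cols′ (suc k) (a ∷ rs)) (sym δδ′W)) (det-cols (suc (suc k)) (b ∷ rs)))
             (-‿cong (*-cong (trans (det-cols′ (suc k) (b ∷ rs)) (sym δW)) (trans (det-cols (suc (suc k)) (a ∷ rs)) (sym δ′W))))) ⟩
      W k * (δ (δ′ (W (suc k))) * W (suc k) - δ (W (suc k)) * δ′ (W (suc k)))
        ≈⟨ *-congˡ (+-congʳ (*-comm _ _)) ⟩
      _ ∎
      where
      W = doubleWronskian
      a = δ′^ (suc k) A
      b = δ′^ k A
      rs = rows k
      N = det (cols (suc k)) (map row rs)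
      δW : δ (W (suc k)) ≈ det (δ^ (suc (suc k)) ∷ iterates D (suc k)) (b ∷ rs)
      δW = wronskian-derivative D (suc k) (b ∷ rs)
      δ′W : δ′ (W (suc k)) ≈ det (iterates D (suc (suc k))) (a ∷ rs)
      δ′W = δ′-det-rows (iterates D (suc (suc k))) (iterates-commute (suc (suc k))) (iterates-kill (suc (suc k))) k
      δδ′W : δ (δ′ (W (suc k))) ≈ det (δ^ (suc (suc k)) ∷ iterates D (suc k)) (a ∷ rs)
      δδ′W = trans (δ-cong D δ′W) (wronskian-derivative D (suc k) (a ∷ rs))

  -- Vandermonde determinants

  infixr 8 _^_
  _^_ : Carrier → ℕ → Carrier
  x ^ zero = 1#
  x ^ suc n = x ^ n * x

  product : ∀ {X : Set} → (X → Carrier) → List X → Carrier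
  product h = List.foldr (λ x r → h x * r) 1#

  module Vandermonde {X : Set} (g : X → Carrier) where
    powers : ℕ → List (X → Carrier)
    powers zero = []
    powers (suc n) = (λ x → g x ^ n) ∷ powers n

    difference-product : List X → Carrier
    difference-product [] = 1#
    difference-product (x ∷ xs) = product (λ y → g x - g y) xs * difference-product xs

    private
      shifted : Carrier → ℕ → List (X → Carrier)
      shifted c n = map (λ f x → f x * (g x - c)) (powers n)

      sign : ℕ → Carrier
      sign zero = 1#
      sign (suc n) = - sign n

    -- A column operation: from each power the `c`-fold of the next lower one is subtracted.
    powers-shift : ∀ c n xs → det (powers (suc n)) xs ≈ det (shifted c n ++ (λ _ → 1#) ∷ []) xs
    powers-shift c zero xs = refl
    powers-shift c (suc n) xs = begin
      contract (λ x → g x ^ n * g x) xs F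
        ≈⟨ contract-cong (λ x → solve 3 (λ p x c → p :* x := p :* (x :- c) :+ c :* p) refl (g x ^ n) (g x) c) (λ _ → refl) xs ⟩
      contract (λ x → g x ^ n * (g x - c) + c * g x ^ n) xs F
        ≈⟨ trans (contract-+ˡ _ _ F xs) (+-congˡ (trans (contract-*ˡ c _ F xs) (*-congˡ (contract-twice (λ x → g x ^ n) (det (powers n)) xs)))) ⟩
      contract (λ x → g x ^ n * (g x - c)) xs F + c * 0#
        ≈⟨ trans (+-congˡ (zeroʳ c)) (+-identityʳ _) ⟩
      contract (λ x → g x ^ n * (g x - c)) xs F
        ≈⟨ contract-congʳ _ (powers-shift c n) xs ⟩
      _ ∎
      where F = det (powers (suc n))

    -- Every column but the last vanishes at `x`, so the last column has to take the row `x`; the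
    -- sign comes from passing the other columns.
    det-last-1 : ∀ (fs : List (X → Carrier)) x xs → LAll.All (λ f → f x ≈ 0#) fs →
      det (fs ++ (λ _ → 1#) ∷ []) (x ∷ xs) ≈ sign (length fs) * det fs xs
    det-last-1 [] x xs [] = +-congˡ (trans (-‿cong (contract-0 _ xs)) -0#≈0#) ⟨ trans ⟩ +-identityʳ _
    det-last-1 (f ∷ fs) x xs (e ∷ es) = begin
      f x * _ - contract f xs (λ ys → det (fs ++ (λ _ → 1#) ∷ []) (x ∷ ys))
        ≈⟨ +-cong (trans (*-congʳ e) (zeroˡ _)) (-‿cong (trans (contract-congʳ f (λ ys → det-last-1 fs x ys es) xs) (contract-*ʳ f _ _ xs))) ⟩
      0# - sign (length fs) * contract f xs (det fs)  ≈⟨ +-identityˡ _ ⟩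
      - (sign (length fs) * contract f xs (det fs))   ≈⟨ solve 2 (λ a b → :- (a :* b) := (:- a) :* b) refl _ _ ⟩
      _ ∎

    sign-product : ∀ c (xs : List X) → sign (length xs) * product (λ y → g y - c) xs ≈ product (λ y → c - g y) xs
    sign-product c [] = *-identityˡ 1#
    sign-product c (x ∷ xs) = trans
      (solve 4 (λ s x c p → (:- s) :* ((x :- c) :* p) := (c :- x) :* (s :* p)) refl _ _ _ _) (*-congˡ (sign-product c xs))

    shifted-vanish : ∀ x n → LAll.All (λ f → f x ≈ 0#) (shifted (g x) n)
    shifted-vanish x zero = []
    shifted-vanish x (suc n) = trans (*-congˡ (-‿inverseʳ (g x))) (zeroʳ _) ∷ shifted-vanish x n

    length-shifted : ∀ c n → length (shifted c n) ≡ n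
    length-shifted c zero = ≡.refl
    length-shifted c (suc n) = ≡.cong suc (length-shifted c n)

    vandermonde : ∀ xs → det (powers (length xs)) xs ≈ difference-product xs
    vandermonde [] = refl
    vandermonde (x ∷ xs) = begin
      det (powers (suc n)) (x ∷ xs)                        ≈⟨ powers-shift (g x) n (x ∷ xs) ⟩
      det (shifted (g x) n ++ (λ _ → 1#) ∷ []) (x ∷ xs)    ≈⟨ det-last-1 (shifted (g x) n) x xs (shifted-vanish x n) ⟩
      sign (length (shifted (g x) n)) * det (shifted (g x) n) xs
        ≈⟨ *-cong (reflexive (≡.cong sign (length-shifted (g x) n))) (det-factor (λ y → g y - g x) (powers n) xs) ⟩
      sign n * (product (λ y → g y - g x) xs * det (powers n) xs)
        ≈⟨ trans (sym (*-assoc _ _ _)) (*-cong (sign-product (g x) xs) (vandermonde xs)) ⟩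
      _ ∎
      where n = length xs

-- (∏_{i ≤ m} i!)² / m!
leadingCoefficient : ℕ → ℕ
leadingCoefficient zero = 1
leadingCoefficient (suc m) = leadingCoefficient m ℕ.* (suc m ! ℕ.* m !)

-- Together with `exponent-toda` this matches the scalar factors on the two sides of the Toda
-- recursion; the factor `(k + 1)(k + 2)` is the one produced by the addition formula.
leadingCoefficient-toda : ∀ k → leadingCoefficient k ℕ.* leadingCoefficient (suc (suc k)) ≡
  leadingCoefficient (suc k) ℕ.* leadingCoefficient (suc k) ℕ.* (suc k ℕ.* suc (suc k))
leadingCoefficient-toda k = lem (leadingCoefficient k) (k !) k
  where
  lem : ∀ c f k → c ℕ.* (c ℕ.* ((1 ℕ.+ k) ℕ.* f ℕ.* f) ℕ.* ((2 ℕ.+ k) ℕ.* ((1 ℕ.+ k) ℕ.* f) ℕ.* ((1 ℕ.+ k) ℕ.* f))) ≡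
    c ℕ.* ((1 ℕ.+ k) ℕ.* f ℕ.* f) ℕ.* (c ℕ.* ((1 ℕ.+ k) ℕ.* f ℕ.* f)) ℕ.* ((1 ℕ.+ k) ℕ.* (2 ℕ.+ k))
  lem = ℕ-solve

exponent : ℕ → ℕ
exponent m = m ℕ.* suc m

exponent-toda : ∀ k → exponent k ℕ.+ exponent (suc (suc k)) ≡ exponent (suc k) ℕ.+ exponent (suc k) ℕ.+ 2
exponent-toda = lem
  where
  lem : ∀ k → k ℕ.* (1 ℕ.+ k) ℕ.+ (2 ℕ.+ k) ℕ.* (3 ℕ.+ k) ≡ (1 ℕ.+ k) ℕ.* (2 ℕ.+ k) ℕ.+ (1 ℕ.+ k) ℕ.* (2 ℕ.+ k) ℕ.+ 2
  lem = ℕ-solve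

-- The Hirota operator and the induction for the product formula

module TodaInduction (𝓡 : CommutativeRing 0ℓ 0ℓ)
  (μ : ℤ.+-*-rawRing -Raw-AlmostCommutative⟶ fromCommutativeRing 𝓡) where

  open CommutativeRing 𝓡
  open IntegerSolver 𝓡 μ using (solve; _:=_; _:+_; _:*_; :-_; _:-_; con)
  open Determinant 𝓡 μ
  open _-Raw-AlmostCommutative⟶_ μ renaming (⟦_⟧ to ι)
  open import Relation.Binary.Reasoning.Setoid setoid

  Cancellative : Carrier → Set
  Cancellative p = ∀ {x y} → p * x ≈ p * y → x ≈ y

  ^-+ : ∀ p m n → p ^ (m ℕ.+ n) ≈ p ^ m * p ^ n
  ^-+ p m zero = trans (reflexive (≡.cong (p ^_) (ℕ.+-identityʳ m))) (sym (*-identityʳ _))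
  ^-+ p m (suc n) = trans (reflexive (≡.cong (p ^_) (ℕ.+-suc m n))) (trans (*-congʳ (^-+ p m n)) (*-assoc _ _ _))

  module _ {δ δ′ : Carrier → Carrier} (D : IsDerivation δ) (D′ : IsDerivation δ′) where
    open IsDerivation

    H : Carrier → Carrier
    H f = δ (δ′ f) * f + f * δ (δ′ f) + - (δ f * δ′ f + δ′ f * δ f)

    H-cong : ∀ {f g} → f ≈ g → H f ≈ H g
    H-cong e = +-cong (+-cong (*-cong dd e) (*-cong e dd)) (-‿cong (+-cong (*-cong d d′) (*-cong d′ d)))
      where
      d = δ-cong D e
      d′ = δ-cong D′ e
      dd = δ-cong D d′

    -- `H f / f²` is twice the mixed logarithmic derivative of `f`, hence additive on products; the
    -- formula is this with denominators cleared.
    H-* : ∀ a b → H (a * b) ≈ H a * (b * b) + (a * a) * H b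
    H-* a b = begin
      δ (δ′ (a * b)) * (a * b) + a * b * δ (δ′ (a * b)) + - (δ (a * b) * δ′ (a * b) + δ′ (a * b) * δ (a * b))
        ≈⟨ +-cong (+-cong (*-congʳ dd) (*-congˡ dd)) (-‿cong (+-cong (*-cong d d′) (*-cong d′ d))) ⟩
      _ ≈⟨ solve 8 (λ a b x y x′ y′ z w →
             (z :* b :+ x′ :* y :+ (x :* y′ :+ a :* w)) :* (a :* b) :+ a :* b :* (z :* b :+ x′ :* y :+ (x :* y′ :+ a :* w))
               :+ :- ((x :* b :+ a :* y) :* (x′ :* b :+ a :* y′) :+ (x′ :* b :+ a :* y′) :* (x :* b :+ a :* y)) :=
             (z :* a :+ a :* z :+ :- (x :* x′ :+ x′ :* x)) :* (b :* b) :+ (a :* a) :* (w :* b :+ b :* w :+ :- (y :* y′ :+ y′ :* y)))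
           refl a b (δ a) (δ b) (δ′ a) (δ′ b) (δ (δ′ a)) (δ (δ′ b)) ⟩
      _ ∎
      where
      d = δ-* D a b
      d′ = δ-* D′ a b
      dd : δ (δ′ (a * b)) ≈ δ (δ′ a) * b + δ′ a * δ b + (δ a * δ′ b + a * δ (δ′ b))
      dd = trans (δ-cong D d′) (trans (δ-+ D _ _) (+-cong (δ-* D (δ′ a) b) (δ-* D a (δ′ b))))

    H-constant : ∀ {k} → δ k ≈ 0# → δ′ k ≈ 0# → H k ≈ 0#
    H-constant {k} e e′ = begin
      δ (δ′ k) * k + k * δ (δ′ k) + - (δ k * δ′ k + δ′ k * δ k)
        ≈⟨ +-cong (+-cong (*-congʳ dd) (*-congˡ dd)) (-‿cong (+-cong (*-congʳ e) (*-congʳ e′))) ⟩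
      0# * k + k * 0# + - (0# * δ′ k + 0# * δ k)
        ≈⟨ solve 4 (λ z k a b → z :* k :+ k :* z :+ :- (z :* a :+ z :* b) := z :* (k :+ k :- a :- b)) refl 0# k (δ′ k) (δ k) ⟩
      0# * _ ≈⟨ zeroˡ _ ⟩
      0# ∎
      where
      dd = trans (δ-cong D e′) (δ-0 D)

    H-scale : ∀ {k} → δ k ≈ 0# → δ′ k ≈ 0# → ∀ f → H (k * f) ≈ (k * k) * H f
    H-scale {k} e e′ f = trans (H-* k f) (trans (+-congʳ (trans (*-congʳ (H-constant e e′)) (zeroˡ _))) (+-identityˡ _))

    -- The logarithmic derivative of `p ^ n` is `n` times that of `p`. The factor `p * p` on the
    -- left stands for a division on the right.
    H-power : ∀ p n → H (p ^ n) * (p * p) ≈ ι (+ n) * ((p ^ n * p ^ n) * H p)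
    H-power p zero = trans (*-congʳ (H-constant (δ-1 D) (δ-1 D′))) (trans (zeroˡ _) (sym (trans (*-congʳ 0-homo) (zeroˡ _))))
    H-power p (suc n) = begin
      H (p ^ n * p) * (p * p)     ≈⟨ *-congʳ (H-* (p ^ n) p) ⟩
      (H (p ^ n) * (p * p) + (p ^ n * p ^ n) * H p) * (p * p)   ≈⟨ *-congʳ (+-congʳ (H-power p n)) ⟩
      (ι (+ n) * ((p ^ n * p ^ n) * H p) + (p ^ n * p ^ n) * H p) * (p * p)
        ≈⟨ solve 4 (λ i q h p → (i :* ((q :* q) :* h) :+ (q :* q) :* h) :* (p :* p) := (con (+ 1) :+ i) :* ((q :* p) :* (q :* p) :* h))
             refl (ι (+ n)) (p ^ n) (H p) p ⟩
      (ι (+ 1) + ι (+ n)) * ((p ^ n * p) * (p ^ n * p) * H p)   ≈⟨ *-congʳ (+-homo (+ 1) (+ n)) ⟨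
      ι (+ suc n) * ((p ^ suc n * p ^ suc n) * H p) ∎

    ^-constant : ∀ {δ} (D : IsDerivation δ) {p} → δ p ≈ 0# → ∀ n → δ (p ^ n) ≈ 0#
    ^-constant D e zero = δ-1 D
    ^-constant D {p} e (suc n) = trans (δ-* D _ _) (trans (+-cong (trans (*-congʳ (^-constant D e n)) (zeroˡ _)) (trans (*-congˡ e) (zeroʳ _))) (+-identityˡ 0#))

    *-constant : ∀ {δ} (D : IsDerivation δ) {p q} → δ p ≈ 0# → δ q ≈ 0# → δ (p * q) ≈ 0#
    *-constant D e f = trans (δ-* D _ _) (trans (+-cong (trans (*-congʳ e) (zeroˡ _)) (trans (*-congˡ f) (zeroʳ _))) (+-identityˡ 0#))

    cancellative-* : ∀ {p q} → Cancellative p → Cancellative q → Cancellative (p * q)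
    cancellative-* {p} {q} rp rq e = rq (rp (trans (sym (*-assoc p q _)) (trans e (*-assoc p q _))))

    cancellative-^ : ∀ {p} → Cancellative p → ∀ n → Cancellative (p ^ n)
    cancellative-^ r zero e = trans (sym (*-identityˡ _)) (trans e (*-identityˡ _))
    cancellative-^ r (suc n) = cancellative-* (cancellative-^ r n) r

    cancellative-factor : ∀ {p q r} → p * q ≈ r → Cancellative r → Cancellative p
    cancellative-factor {p} {q} {r} e c {x} {y} h = c (trans (lem x) (trans (*-congˡ h) (sym (lem y))))
      where
      lem : ∀ x → r * x ≈ q * (p * x)
      lem x = trans (*-congʳ (sym e)) (trans (*-congʳ (*-comm p q)) (*-assoc q p x))

    module _ (commute : ∀ x → δ′ (δ x) ≈ δ (δ′ x)) (θ A : Carrier) (δ′θ≈0 : δ′ θ ≈ 0#)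
      (ψ J : Carrier) (T : ℕ → Carrier)
      (θ≈T₀ : θ ≈ T 0)
      (first : (ψ * ψ) * (δ A * θ + - (A * δ θ)) ≈ (J * J) * T 1)
      (addition : ∀ m →
        H (T (suc m)) * (ψ * ψ) + - (ι (+ exponent (suc m)) * ((T (suc m) * T (suc m)) * H ψ)) ≈ ι (+ 2 ℤ.* + exponent (suc m)) * ((J * J) * (T (suc (suc m)) * T m)))
      (δJ : δ J ≈ 0#) (δ′J : δ′ J ≈ 0#) (δι : ∀ n → δ (ι n) ≈ 0#) (δ′ι : ∀ n → δ′ (ι n) ≈ 0#)
      (T-cancel : ∀ m → Cancellative (T m)) (J-cancel : Cancellative J) (ι-cancel : ∀ n .{{_ : ℤ.NonZero n}} → Cancellative (ι n)) where

      open DoubleWronskian D D′ commute θ A δ′θ≈0 renaming (doubleWronskian to W)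
      private
        c : ℕ → ℤ
        c m = + leadingCoefficient m

        C : ℕ → Carrier
        C m = ι (c m) * J ^ exponent m

      ProductFormula : ℕ → Set
      ProductFormula m = W m * ψ ^ exponent m ≈ C m * T m

      formula₀ : ProductFormula 0
      formula₀ = begin
        (θ * 1# - 0#) * 1#     ≈⟨ trans (*-identityʳ _) (trans (+-congˡ -0#≈0#) (trans (+-identityʳ _) (*-identityʳ θ))) ⟩
        θ                      ≈⟨ θ≈T₀ ⟩
        T 0                    ≈⟨ trans (*-congʳ (trans (*-identityʳ _) 1-homo)) (*-identityˡ _) ⟨
        ι (+ 1) * 1# * T 0 ∎
        where open import Algebra.Properties.Ring ring using (-0#≈0#)

      formula₁ : ProductFormula 1
      formula₁ = begin
        (δ A * (θ * 1# - 0#) - (δ θ * (A * 1# - 0#) - 0#)) * (1# * ψ * ψ)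
          ≈⟨ *-cong (+-cong (*-congˡ (simp θ)) (-‿cong (trans (+-congˡ -0#≈0#) (trans (+-identityʳ _) (*-congˡ (simp A)))))) (*-congʳ (*-identityˡ ψ)) ⟩
        (δ A * θ - δ θ * A) * (ψ * ψ)
          ≈⟨ solve 5 (λ a t b u p → (a :* t :- b :* u) :* p := p :* (a :* t :+ :- (u :* b))) refl (δ A) θ (δ θ) A (ψ * ψ) ⟩
        (ψ * ψ) * (δ A * θ + - (A * δ θ))    ≈⟨ first ⟩
        (J * J) * T 1      ≈⟨ *-congʳ (trans (*-congʳ 1-homo) (trans (*-identityˡ _) (*-congʳ (*-identityˡ J)))) ⟨
        ι (+ 1) * (1# * J * J) * T 1 ∎
        where
        open import Algebra.Properties.Ring ring using (-0#≈0#)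
        simp : ∀ x → x * 1# - 0# ≈ x
        simp x = trans (+-congˡ -0#≈0#) (trans (+-identityʳ _) (*-identityʳ x))

      c-nonZero : ∀ m → ℕ.NonZero (leadingCoefficient m)
      c-nonZero zero = _
      c-nonZero (suc m) = ℕ.m*n≢0 _ _ {{c-nonZero m}} {{ℕ.m*n≢0 _ _ {{(suc m) ℕ.!≢0}} {{m ℕ.!≢0}}}}

      C-cancel : ∀ m → Cancellative (C m)
      C-cancel m = cancellative-* (ι-cancel (c m) {{c-nonZero m}}) (cancellative-^ J-cancel (exponent m))

      -- The claim is proved after multiplication by `ι (+ 2) * (C k * T k)`, because the Toda
      -- relation gives the product `W k * W₂` and not `W₂` itself.
      formula-step : ∀ k → ProductFormula k → ProductFormula (suc k) → ProductFormula (suc (suc k))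
      formula-step k f₀ f₁ = cancellative-* (ι-cancel (+ 2)) (cancellative-* (C-cancel k) (T-cancel k)) (begin
        ι (+ 2) * (C k * T k) * (W₂ * ψ ^ exponent (suc (suc k)))
          ≈⟨ *-congʳ (*-congˡ f₀) ⟨
        ι (+ 2) * (W k * ψ ^ exponent k) * (W₂ * ψ ^ exponent (suc (suc k)))
          ≈⟨ solve 5 (λ i w p v q → i :* (w :* p) :* (v :* q) := i :* (w :* v) :* (p :* q)) refl _ _ _ _ _ ⟩
        ι (+ 2) * (W k * W₂) * (ψ ^ exponent k * ψ ^ exponent (suc (suc k)))
          ≈⟨ *-cong two-toda (trans (exponents ψ) (*-congˡ (*-congʳ (*-identityˡ ψ)))) ⟩
        H X * (G * G * (ψ * ψ))
          -- The term `X * X * H G` is added and subtracted, so that `H-*` applies to `X * G`, for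
          -- which the product formula is already known.
          ≈⟨ solve 4 (λ h g p y → h :* (g :* g :* (p :* p)) := (h :* (g :* g) :+ y) :* (p :* p) :- y :* (p :* p)) refl (H X) G ψ (X * X * H G) ⟩
        (H X * (G * G) + X * X * H G) * (ψ * ψ) - X * X * H G * (ψ * ψ)
          ≈⟨ +-cong (*-congʳ (sym (H-* X G))) (-‿cong (trans (*-assoc (X * X) (H G) (ψ * ψ)) (*-congˡ (H-power ψ E)))) ⟩
        H (X * G) * (ψ * ψ) - X * X * (ι (+ E) * (G * G * H ψ))
          ≈⟨ +-cong (*-congʳ (trans (H-cong f₁) (H-scale δC δ′C T₁))) (-‿cong (solve 4 (λ x i g h → x :* x :* (i :* (g :* g :* h)) := i :* ((x :* g) :* (x :* g) :* h)) refl X (ι (+ E)) G (H ψ))) ⟩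
        (C₁ * C₁) * H T₁ * (ψ * ψ) - ι (+ E) * ((X * G) * (X * G) * H ψ)
          ≈⟨ +-congˡ (-‿cong (*-congˡ (*-congʳ (*-cong f₁ f₁)))) ⟩
        (C₁ * C₁) * H T₁ * (ψ * ψ) - ι (+ E) * ((C₁ * T₁) * (C₁ * T₁) * H ψ)
          ≈⟨ solve 6 (λ c h p i t h′ → (c :* c) :* h :* p :- i :* ((c :* t) :* (c :* t) :* h′) := (c :* c) :* (h :* p :+ :- (i :* ((t :* t) :* h′))))
               refl C₁ (H T₁) (ψ * ψ) (ι (+ E)) T₁ (H ψ) ⟩
        (C₁ * C₁) * (H T₁ * (ψ * ψ) + - (ι (+ E) * ((T₁ * T₁) * H ψ)))
          ≈⟨ *-congˡ (addition k) ⟩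
        (C₁ * C₁) * (ι (+ 2 ℤ.* + E) * ((J * J) * (T₂ * T k)))
          ≈⟨ *-congˡ (*-congʳ (*-homo (+ 2) (+ E))) ⟩
        (C₁ * C₁) * (ι (+ 2) * ι (+ E) * ((J * J) * (T₂ * T k)))
          ≈⟨ solve 7 (λ i j two e z t t₂ → (i :* j) :* (i :* j) :* (two :* e :* (z :* (t₂ :* t))) := two :* t :* t₂ :* ((i :* i :* e) :* (j :* j :* z)))
               refl (ι (c (suc k))) (J ^ E) (ι (+ 2)) (ι (+ E)) (J * J) (T k) T₂ ⟩
        ι (+ 2) * T k * T₂ * ((ι (c (suc k)) * ι (c (suc k)) * ι (+ E)) * (J ^ E * J ^ E * (J * J)))
          ≈⟨ *-congˡ (*-cong constants (trans (*-congˡ (*-congʳ (sym (*-identityˡ J)))) (sym (exponents J)))) ⟩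
        ι (+ 2) * T k * T₂ * ((ι (c k) * ι (c (suc (suc k)))) * (J ^ exponent k * J ^ exponent (suc (suc k))))
          ≈⟨ solve 7 (λ two t t₂ i i₂ j j₂ → two :* t :* t₂ :* ((i :* i₂) :* (j :* j₂)) := two :* (i :* j :* t) :* (i₂ :* j₂ :* t₂)) refl _ _ _ _ _ _ _ ⟩
        ι (+ 2) * (C k * T k) * (C (suc (suc k)) * T₂) ∎)
        where
        W₂ = W (suc (suc k))
        X = W (suc k)
        E = exponent (suc k)
        G = ψ ^ E
        C₁ = C (suc k)
        T₁ = T (suc k)
        T₂ = T (suc (suc k))
        δC : δ C₁ ≈ 0#
        δC = *-constant D (δι (c (suc k))) (^-constant D δJ E)
        δ′C : δ′ C₁ ≈ 0#
        δ′C = *-constant D′ (δ′ι (c (suc k))) (^-constant D′ δ′J E)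
        exponents : ∀ p → p ^ exponent k * p ^ exponent (suc (suc k)) ≈ p ^ E * p ^ E * (1# * p * p)
        exponents p = trans (sym (^-+ p (exponent k) (exponent (suc (suc k))))) (trans (reflexive (≡.cong (p ^_) (exponent-toda k)))
          (trans (^-+ p (E ℕ.+ E) 2) (*-congʳ (^-+ p E E))))
        constants : ι (c (suc k)) * ι (c (suc k)) * ι (+ E) ≈ ι (c k) * ι (c (suc (suc k)))
        constants = trans (*-congʳ (sym (*-homo (c (suc k)) (c (suc k))))) (trans (sym (*-homo (c (suc k) ℤ.* c (suc k)) (+ E)))
          (trans (reflexive (≡.cong ι (≡.trans (≡.cong (ℤ._* + E) (≡.sym (ℤ.pos-* (leadingCoefficient (suc k)) (leadingCoefficient (suc k)))))
            (≡.trans (≡.sym (ℤ.pos-* (leadingCoefficient (suc k) ℕ.* leadingCoefficient (suc k)) E)) (≡.trans (≡.cong +_ (≡.sym (leadingCoefficient-toda k))) (ℤ.pos-* (leadingCoefficient k) (leadingCoefficient (suc (suc k)))))))))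
          (*-homo (c k) (c (suc (suc k))))))
        -- By the product formula for `k`, `W k` divides the cancellable element `C k * T k`.
        W-cancel : Cancellative (W k)
        W-cancel = cancellative-factor f₀ (cancellative-* (C-cancel k) (T-cancel k))
        two-toda : ι (+ 2) * (W k * W₂) ≈ H X
        two-toda = trans (*-congˡ (W-cancel (toda k)))
          (solve 4 (λ x dd d d′ → con (+ 2) :* (x :* dd :- d :* d′) := dd :* x :+ x :* dd :+ :- (d :* d′ :+ d′ :* d)) refl X (δ (δ′ X)) (δ X) (δ′ X))

      formulas : ∀ m → ProductFormula m × ProductFormula (suc m)
      formulas zero = formula₀ , formula₁
      formulas (suc m) = let (f₀ , f₁) = formulas m in f₁ , formula-step m f₀ f₁

      product-formula : ∀ m → ProductFormula m
      product-formula m = proj₁ (formulas m)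

open import Data.Integer using (_+_; _*_; -_; _-_; ∣_∣; 0ℤ; 1ℤ; _≟_)
open import Relation.Binary.PropositionalEquality hiding (J)

cong₃ : ∀ {A B C D : Set} (f : A → B → C → D) {a a′ b b′ c c′} → a ≡ a′ → b ≡ b′ → c ≡ c′ → f a b c ≡ f a′ b′ c′
cong₃ f refl refl refl = refl

-- Finite sums over lists and boxes

∑ : {A : Set} → List A → (A → ℤ) → ℤ
∑ [] f = 0ℤ
∑ (x ∷ xs) f = f x + ∑ xs f

module _ {A : Set} where
  ∑-cong : (xs : List A) {f g : A → ℤ} → (∀ x → f x ≡ g x) → ∑ xs f ≡ ∑ xs g
  ∑-cong [] e = refl
  ∑-cong (x ∷ xs) e = cong₂ _+_ (e x) (∑-cong xs e)

  ∑-0 : (xs : List A) → ∑ xs (λ _ → 0ℤ) ≡ 0ℤ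
  ∑-0 [] = refl
  ∑-0 (x ∷ xs) = trans (ℤ.+-identityˡ _) (∑-0 xs)

  ∑-+ : (xs : List A) (f g : A → ℤ) → ∑ xs (λ x → f x + g x) ≡ ∑ xs f + ∑ xs g
  ∑-+ [] f g = refl
  ∑-+ (x ∷ xs) f g rewrite ∑-+ xs f g = interchange (f x) (g x) (∑ xs f) (∑ xs g)
    where
    interchange : ∀ a b c d → (a + b) + (c + d) ≡ (a + c) + (b + d)
    interchange = solve-∀

  ∑-*ˡ : (xs : List A) (c : ℤ) (f : A → ℤ) → ∑ xs (λ x → c * f x) ≡ c * ∑ xs f
  ∑-*ˡ [] c f = sym (ℤ.*-zeroʳ c)
  ∑-*ˡ (x ∷ xs) c f rewrite ∑-*ˡ xs c f = sym (ℤ.*-distribˡ-+ c (f x) (∑ xs f))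

  ∑-*ʳ : (xs : List A) (c : ℤ) (f : A → ℤ) → ∑ xs (λ x → f x * c) ≡ ∑ xs f * c
  ∑-*ʳ xs c f = trans (∑-cong xs λ x → ℤ.*-comm (f x) c) (trans (∑-*ˡ xs c f) (ℤ.*-comm c _))

  ∑-neg : (xs : List A) (f : A → ℤ) → ∑ xs (λ x → - f x) ≡ - ∑ xs f
  ∑-neg [] f = refl
  ∑-neg (x ∷ xs) f rewrite ∑-neg xs f = sym (ℤ.neg-distrib-+ (f x) (∑ xs f))

  ∑-++ : (xs ys : List A) (f : A → ℤ) → ∑ (xs ++ ys) f ≡ ∑ xs f + ∑ ys f
  ∑-++ [] ys f = sym (ℤ.+-identityˡ _)
  ∑-++ (x ∷ xs) ys f rewrite ∑-++ xs ys f = sym (ℤ.+-assoc (f x) _ _)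

module _ {A B : Set} where
  ∑-map : (h : A → B) (xs : List A) (f : B → ℤ) → ∑ (map h xs) f ≡ ∑ xs (f ∘ h)
  ∑-map h [] f = refl
  ∑-map h (x ∷ xs) f = cong (λ z → f (h x) + z) (∑-map h xs f)

  ∑-concatMap : (h : A → List B) (xs : List A) (f : B → ℤ) → ∑ (concatMap h xs) f ≡ ∑ xs (λ x → ∑ (h x) f)
  ∑-concatMap h [] f = refl
  ∑-concatMap h (x ∷ xs) f = trans (∑-++ (h x) (concatMap h xs) f) (cong (λ z → ∑ (h x) f + z) (∑-concatMap h xs f))

  ∑-comm : (xs : List A) (ys : List B) (f : A → B → ℤ) →
    ∑ xs (λ x → ∑ ys (f x)) ≡ ∑ ys (λ y → ∑ xs (λ x → f x y))
  ∑-comm [] ys f = sym (∑-0 ys)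
  ∑-comm (x ∷ xs) ys f = trans (cong (λ z → ∑ ys (f x) + z) (∑-comm xs ys f)) (sym (∑-+ ys (f x) _))

-- Opaque, so that unification does not unfold sums over it.
opaque
  range : ℕ → List ℤ
  range L = intRange L

  range≡intRange : ∀ L → range L ≡ intRange L
  range≡intRange L = refl

S : ℕ → (n : ℕ) → (Vec ℤ n → ℤ) → ℤ
S L zero f = f []
S L (suc n) f = ∑ (range L) λ x → S L n λ v → f (x ∷ v)

∑-box : ∀ L n (f : Vec ℤ n → ℤ) → ∑ (box L n) f ≡ S L n f
∑-box L zero f = ℤ.+-identityʳ _
∑-box L (suc n) f = trans (∑-concatMap (λ x → map (x ∷_) (box L n)) (intRange L) f)
  (subst (λ r → ∑ r (λ x → ∑ (map (x ∷_) (box L n)) f) ≡ S L (suc n) f) (range≡intRange L)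
  (∑-cong (range L) λ x → trans (∑-map (x ∷_) (box L n) f) (∑-box L n _)))

S-cong : ∀ L n {f g : Vec ℤ n → ℤ} → (∀ v → f v ≡ g v) → S L n f ≡ S L n g
S-cong L zero e = e []
S-cong L (suc n) e = ∑-cong (range L) λ x → S-cong L n λ v → e (x ∷ v)

S-0 : ∀ L n → S L n (λ _ → 0ℤ) ≡ 0ℤ
S-0 L zero = refl
S-0 L (suc n) = trans (∑-cong (range L) λ _ → S-0 L n) (∑-0 (range L))

S-+ : ∀ L n (f g : Vec ℤ n → ℤ) → S L n (λ v → f v + g v) ≡ S L n f + S L n g
S-+ L zero f g = refl
S-+ L (suc n) f g = trans (∑-cong (range L) λ x → S-+ L n _ _) (∑-+ (range L) _ _)

S-*ˡ : ∀ L n c (f : Vec ℤ n → ℤ) → S L n (λ v → c * f v) ≡ c * S L n f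
S-*ˡ L zero c f = refl
S-*ˡ L (suc n) c f = trans (∑-cong (range L) λ x → S-*ˡ L n c _) (∑-*ˡ (range L) c _)

S-neg : ∀ L n (f : Vec ℤ n → ℤ) → S L n (λ v → - f v) ≡ - S L n f
S-neg L zero f = refl
S-neg L (suc n) f = trans (∑-cong (range L) λ x → S-neg L n _) (∑-neg (range L) _)

S-∑-comm : ∀ L n {A : Set} (xs : List A) (f : Vec ℤ n → A → ℤ) →
  S L n (λ v → ∑ xs (f v)) ≡ ∑ xs (λ a → S L n (λ v → f v a))
S-∑-comm L zero xs f = refl
S-∑-comm L (suc n) xs f = trans (∑-cong (range L) λ x → S-∑-comm L n xs _) (∑-comm (range L) xs _)

S-comm : ∀ L n L′ n′ (f : Vec ℤ n → Vec ℤ n′ → ℤ) →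
  S L n (λ v → S L′ n′ (f v)) ≡ S L′ n′ (λ w → S L n (λ v → f v w))
S-comm L n L′ zero f = refl
S-comm L n L′ (suc n′) f = trans (S-∑-comm L n (range L′) _)
  (∑-cong (range L′) λ x → S-comm L n L′ n′ _)

InBox : ∀ {n} → ℕ → Vec ℤ n → Set
InBox L = All (λ z → ∣ z ∣ ≤ L)

-- Kronecker deltas and changes of summation variables

δ : ℤ → ℤ → ℤ
δ x y = if does (x ≟ y) then 1ℤ else 0ℤ

δ-refl : ∀ x → δ x x ≡ 1ℤ
δ-refl x with x ≟ x
... | yes _ = refl
... | no x≢x = ⊥-elim (x≢x refl)

δ-≢ : ∀ {x y} → x ≢ y → δ x y ≡ 0ℤ
δ-≢ {x} {y} x≢y with x ≟ y
... | yes x≡y = ⊥-elim (x≢y x≡y)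
... | no _ = refl

∑-δ-∉ : ∀ x (xs : List ℤ) (f : ℤ → ℤ) → LAll.All (x ≢_) xs → ∑ xs (λ y → δ x y * f y) ≡ 0ℤ
∑-δ-∉ x [] f _ = refl
∑-δ-∉ x (y ∷ ys) f (x≢y LAll.∷ ps) rewrite δ-≢ x≢y | ∑-δ-∉ x ys f ps = refl

∑-δ-∈ : ∀ x (xs : List ℤ) (f : ℤ → ℤ) → Unique xs → x ∈ᴸ xs → ∑ xs (λ y → δ x y * f y) ≡ f x
∑-δ-∈ x (.x ∷ ys) f (p AP.∷ u) (here refl)
  rewrite δ-refl x | ∑-δ-∉ x ys f p | ℤ.*-identityˡ (f x) = ℤ.+-identityʳ _
∑-δ-∈ x (y ∷ ys) f (p AP.∷ u) (there m)
  rewrite δ-≢ {x} {y} (λ { refl → LAll.lookup p m refl }) | ∑-δ-∈ x ys f u m = ℤ.+-identityˡ _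

range-unique : ∀ L → Unique (range L)
range-unique L = subst Unique (sym (range≡intRange L)) (Uniq.map⁺ (λ {i} {j} e → ℤ.+-injective (+-cancelʳ (- + L) (+ i) (+ j) e)) (Uniq.upTo⁺ _))

0≤i+L : ∀ {L} x → ∣ x ∣ ≤ L → 0ℤ ℤ.≤ x + + L
0≤i+L (+ n) b = ℤ.+≤+ z≤n
0≤i+L -[1+ n ] b = subst (0ℤ ℤ.≤_) (sym (ℤ.⊖-≥ b)) (ℤ.+≤+ z≤n)

∈-range : ∀ {L x} → ∣ x ∣ ≤ L → x ∈ᴸ range L
∈-range {L} {x} b = subst₂ _∈ᴸ_ e (sym (range≡intRange L)) (∈-map⁺ (λ i → + i - + L) (∈-upTo⁺ (s≤s bound)))
  where
  bound : ∣ x + + L ∣ ≤ 2 ℕ.* L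
  bound = ℕ.≤-trans (ℤ.∣i+j∣≤∣i∣+∣j∣ x (+ L)) (ℕ.+-mono-≤ b (ℕ.≤-reflexive (sym (ℕ.+-identityʳ L))))
  e : + ∣ x + + L ∣ - + L ≡ x
  e rewrite ℤ.0≤i⇒+∣i∣≡i (0≤i+L x b) = c x (+ L)
    where
    c : ∀ a b → a + b - b ≡ a
    c = solve-∀

∑-δ : ∀ {L x} (f : ℤ → ℤ) → ∣ x ∣ ≤ L → ∑ (range L) (λ y → δ x y * f y) ≡ f x
∑-δ {L} {x} f b = ∑-δ-∈ x (range L) f (range-unique L) (∈-range b)

δᵛ : ∀ {n} → Vec ℤ n → Vec ℤ n → ℤ
δᵛ [] [] = 1ℤ
δᵛ (x ∷ v) (y ∷ w) = δ x y * δᵛ v w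

δᵛ-refl : ∀ {n} (v : Vec ℤ n) → δᵛ v v ≡ 1ℤ
δᵛ-refl [] = refl
δᵛ-refl (x ∷ v) rewrite δ-refl x | δᵛ-refl v = refl

δᵛ-≢ : ∀ {n} {v w : Vec ℤ n} → v ≢ w → δᵛ v w ≡ 0ℤ
δᵛ-≢ {v = []} {[]} p = ⊥-elim (p refl)
δᵛ-≢ {v = x ∷ v} {y ∷ w} p with x ≟ y
... | no _ = ℤ.*-zeroˡ (δᵛ v w)
... | yes refl rewrite δᵛ-≢ {v = v} {w} (λ { refl → p refl }) = refl

S-δ : ∀ {L n} {v : Vec ℤ n} (c : ℤ) → InBox L v → S L n (λ w → δᵛ v w * c) ≡ c
S-δ {v = []} c [] = ℤ.*-identityˡ c
S-δ {L} {suc n} {x ∷ v} c (b ∷ bs) =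
  trans (∑-cong (range L) λ y →
    trans (S-cong L n λ w → ℤ.*-assoc (δ x y) (δᵛ v w) c)
    (trans (S-*ˡ L n (δ x y) _) (cong (δ x y *_) (S-δ c bs))))
  (∑-δ {x = x} (λ _ → c) b)

_≟ᵛ_ : ∀ {n} (v w : Vec ℤ n) → Dec (v ≡ w)
_≟ᵛ_ = Vec.≡-dec _≟_

-- Only where f and g do not vanish must σ and τ be inverse to each other: this also covers sums restricted
-- by indicator functions.
reindex : ∀ {L L′ n n′} (f : Vec ℤ n → ℤ) (g : Vec ℤ n′ → ℤ) (σ : Vec ℤ n → Vec ℤ n′) (τ : Vec ℤ n′ → Vec ℤ n) →
  (∀ v → f v ≢ 0ℤ → InBox L′ (σ v) × τ (σ v) ≡ v × g (σ v) ≡ f v) →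
  (∀ w → g w ≢ 0ℤ → InBox L (τ w) × σ (τ w) ≡ w × f (τ w) ≡ g w) →
  S L n f ≡ S L′ n′ g
reindex {L} {L′} {n} {n′} f g σ τ hf hg = begin
  S L n f                                                ≡⟨ S-cong L n expandˡ ⟩
  -- Both sides are written as sums over the pairs with `w = σ v`, which on the supports is the same
  -- condition as `v = τ w`.
  S L n (λ v → S L′ n′ λ w → δᵛ (σ v) w * f v)           ≡⟨ S-cong L n (λ v → S-cong L′ n′ λ w → match v w) ⟩
  S L n (λ v → S L′ n′ λ w → δᵛ (τ w) v * g w)           ≡⟨ S-comm L n L′ n′ _ ⟩
  S L′ n′ (λ w → S L n λ v → δᵛ (τ w) v * g w)           ≡⟨ S-cong L′ n′ expandʳ ⟨
  S L′ n′ g ∎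
  where
  open ≡-Reasoning
  expandˡ : ∀ v → f v ≡ S L′ n′ λ w → δᵛ (σ v) w * f v
  expandˡ v with f v ≟ 0ℤ
  ... | no p = sym (S-δ (f v) (proj₁ (hf v p)))
  ... | yes p rewrite p = sym (trans (S-cong L′ n′ λ w → ℤ.*-zeroʳ (δᵛ (σ v) w)) (S-0 L′ n′))
  expandʳ : ∀ w → g w ≡ S L n λ v → δᵛ (τ w) v * g w
  expandʳ w with g w ≟ 0ℤ
  ... | no p = sym (S-δ (g w) (proj₁ (hg w p)))
  ... | yes p rewrite p = sym (trans (S-cong L n λ v → ℤ.*-zeroʳ (δᵛ (τ w) v)) (S-0 L n))
  match : ∀ v w → δᵛ (σ v) w * f v ≡ δᵛ (τ w) v * g w
  match v w with f v ≟ 0ℤ | g w ≟ 0ℤ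
  ... | yes p | yes q rewrite p | q = trans (ℤ.*-zeroʳ (δᵛ (σ v) w)) (sym (ℤ.*-zeroʳ (δᵛ (τ w) v)))
  ... | yes p | no q
    rewrite δᵛ-≢ {v = τ w} {v} (λ { refl → q (trans (sym (proj₂ (proj₂ (hg w q)))) p) }) | p =
    ℤ.*-zeroʳ (δᵛ (σ v) w)
  ... | no p | yes q
    rewrite δᵛ-≢ {v = σ v} {w} (λ { refl → p (trans (sym (proj₂ (proj₂ (hf v p)))) q) }) | q =
    sym (ℤ.*-zeroʳ (δᵛ (τ w) v))
  ... | no p | no q with σ v ≟ᵛ w
  ...   | yes refl rewrite proj₁ (proj₂ (hf v p)) | δᵛ-refl v | δᵛ-refl (σ v) =
    cong (1ℤ *_) (sym (proj₂ (proj₂ (hf v p))))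
  ...   | no r rewrite δᵛ-≢ r | δᵛ-≢ {v = τ w} {v} (λ { refl → r (proj₁ (proj₂ (hg w q))) }) = refl

-- When `σ` and `τ` are inverse everywhere, `g` is `f` transported, so a support condition on `f`
-- alone suffices.
reindex-iso : ∀ {L L′ n n′} (f : Vec ℤ n → ℤ) (g : Vec ℤ n′ → ℤ) (σ : Vec ℤ n → Vec ℤ n′) (τ : Vec ℤ n′ → Vec ℤ n) →
  (∀ v → τ (σ v) ≡ v) → (∀ w → σ (τ w) ≡ w) → (∀ v → g (σ v) ≡ f v) →
  (∀ v → f v ≢ 0ℤ → InBox L v × InBox L′ (σ v)) →
  S L n f ≡ S L′ n′ g
reindex-iso {L} f g σ τ τσ στ gσ supp = reindex f g σ τ
  (λ v p → proj₂ (supp v p) , τσ v , gσ v)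
  (λ w p → proj₁ (supp (τ w) (λ q → p (trans (sym (fτ w)) q))) , στ w , fτ w)
  where
  fτ : ∀ w → f (τ w) ≡ g w
  fτ w = trans (sym (gσ (τ w))) (cong g (στ w))

≡-neg⇒0 : ∀ {x} → x ≡ - x → x ≡ 0ℤ
≡-neg⇒0 {+ zero} e = refl
≡-neg⇒0 {+ suc n} ()
≡-neg⇒0 { -[1+ n ]} ()

S-antisym : ∀ {L n} (f : Vec ℤ n → ℤ) (σ : Vec ℤ n → Vec ℤ n) → (∀ v → σ (σ v) ≡ v) →
  (∀ v → f (σ v) ≡ - f v) → (∀ v → f v ≢ 0ℤ → InBox L v × InBox L (σ v)) → S L n f ≡ 0ℤ
S-antisym {L} {n} f σ σσ fσ supp = ≡-neg⇒0 (trans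
  (reindex-iso f (λ v → - f v) σ σ σσ σσ (λ v → trans (cong -_ (fσ v)) (ℤ.neg-involutive (f v))) supp)
  (S-neg L n f))

-- Parity and the rotation of double sums

half : ℤ → ℤ
half z = z /ℕ 2

data Parity (z : ℤ) : Set where
  even : z ≡ + 2 * half z → Parity z
  odd  : z ≡ + 2 * half z + 1ℤ → Parity z

parity : ∀ z → Parity z
parity z with z %ℕ 2 | n%ℕd<d z 2 | a≡a%ℕn+[a/ℕn]*n z 2
... | 0 | _ | e = even (trans e (lem (half z)))
  where
  lem : ∀ h → 0ℤ + h * + 2 ≡ + 2 * h
  lem = solve-∀
... | 1 | _ | e = odd (trans e (lem (half z)))
  where
  lem : ∀ h → 1ℤ + h * + 2 ≡ + 2 * h + 1ℤ
  lem = solve-∀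
... | suc (suc _) | s≤s (s≤s ()) | _

2a≢2b+1 : ∀ a b → + 2 * a ≢ + 2 * b + 1ℤ
2a≢2b+1 a b e = absurd {∣ a - b ∣} (trans (sym (ℤ.abs-* (+ 2) (a - b))) (cong ∣_∣ (trans (lem a b) (trans (cong (_- + 2 * b) e) (lem′ b)))))
  where
  lem : ∀ a b → + 2 * (a - b) ≡ + 2 * a - + 2 * b
  lem = solve-∀
  lem′ : ∀ b → + 2 * b + 1ℤ - + 2 * b ≡ 1ℤ
  lem′ = solve-∀
  absurd : ∀ {n} → 2 ℕ.* n ≢ 1
  absurd {suc n} p with trans (sym (ℕ.+-suc n (n ℕ.+ 0))) (ℕ.suc-injective p)
  ... | ()

2a≡2b⇒a≡b : ∀ {a b} → + 2 * a ≡ + 2 * b → a ≡ b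
2a≡2b⇒a≡b {a} {b} = ℤ.*-cancelˡ-≡ (+ 2) a b

half-2* : ∀ a → half (+ 2 * a) ≡ a
half-2* a with parity (+ 2 * a)
... | even e = sym (2a≡2b⇒a≡b e)
... | odd e = ⊥-elim (2a≢2b+1 a (half (+ 2 * a)) e)

half-2*+1 : ∀ a → half (+ 2 * a + 1ℤ) ≡ a
half-2*+1 a with parity (+ 2 * a + 1ℤ)
... | even e = ⊥-elim (2a≢2b+1 (half (+ 2 * a + 1ℤ)) a (sym e))
... | odd e = sym (2a≡2b⇒a≡b (+-cancelʳ 1ℤ _ _ e))

ifEven ifOdd : ℤ → ℤ → ℤ
ifEven z x with parity z
... | even _ = x
... | odd _ = 0ℤ
ifOdd z x with parity z
... | even _ = 0ℤ
... | odd _ = x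

ifEven+ifOdd : ∀ z x → x ≡ ifEven z x + ifOdd z x
ifEven+ifOdd z x with parity z
... | even _ = sym (ℤ.+-identityʳ x)
... | odd _ = sym (ℤ.+-identityˡ x)

ifEven-≢ : ∀ z {x} → ifEven z x ≢ 0ℤ → z ≡ + 2 * half z × ifEven z x ≡ x
ifEven-≢ z p with parity z
... | even e = e , refl
... | odd _ = ⊥-elim (p refl)

ifOdd-≢ : ∀ z {x} → ifOdd z x ≢ 0ℤ → z ≡ + 2 * half z + 1ℤ × ifOdd z x ≡ x
ifOdd-≢ z p with parity z
... | odd e = e , refl
... | even _ = ⊥-elim (p refl)

ifEven-2* : ∀ {z} a {x} → z ≡ + 2 * a → ifEven z x ≡ x
ifEven-2* {z} a refl with parity z
... | even _ = refl
... | odd e = ⊥-elim (2a≢2b+1 a (half (+ 2 * a)) e)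

ifOdd-2*+1 : ∀ {z} a {x} → z ≡ + 2 * a + 1ℤ → ifOdd z x ≡ x
ifOdd-2*+1 {z} a refl with parity z
... | even e = ⊥-elim (2a≢2b+1 (half (+ 2 * a + 1ℤ)) a (sym e))
... | odd _ = refl

∣+∣ : ∀ {a b m n} → ∣ a ∣ ≤ m → ∣ b ∣ ≤ n → ∣ a + b ∣ ≤ m ℕ.+ n
∣+∣ {a} {b} p q = ℕ.≤-trans (ℤ.∣i+j∣≤∣i∣+∣j∣ a b) (ℕ.+-mono-≤ p q)

∣-∣ : ∀ {a b m n} → ∣ a ∣ ≤ m → ∣ b ∣ ≤ n → ∣ a - b ∣ ≤ m ℕ.+ n
∣-∣ {a} {b} p q = ℕ.≤-trans (ℤ.∣i-j∣≤∣i∣+∣j∣ a b) (ℕ.+-mono-≤ p q)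

∣i∣≤∣2i∣ : ∀ a → ∣ a ∣ ≤ ∣ + 2 * a ∣
∣i∣≤∣2i∣ a = ℕ.≤-trans (ℕ.m≤m+n ∣ a ∣ _) (ℕ.≤-reflexive (sym (ℤ.abs-* (+ 2) a)))

∣i∣≤∣2i+1∣ : ∀ a → ∣ a ∣ ≤ ∣ + 2 * a + 1ℤ ∣
∣i∣≤∣2i+1∣ (+ n) = ℕ.≤-trans (ℕ.≤-trans (ℕ.m≤m+n n _) (ℕ.m≤m+n (2 ℕ.* n) 1)) (ℕ.≤-reflexive (cong (λ z → ∣ z + 1ℤ ∣) (ℤ.pos-* 2 n)))
∣i∣≤∣2i+1∣ -[1+ n ] rewrite ℕ.+-suc n (n ℕ.+ 0) = s≤s (ℕ.m≤m+n n _)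

∣half∣ : ∀ z → ∣ half z ∣ ≤ ∣ z ∣
∣half∣ z with parity z
... | even e = ℕ.≤-trans (∣i∣≤∣2i∣ (half z)) (ℕ.≤-reflexive (cong ∣_∣ (sym e)))
... | odd e = ℕ.≤-trans (∣i∣≤∣2i+1∣ (half z)) (ℕ.≤-reflexive (cong ∣_∣ (sym e)))

parity-split : ∀ {L N} (f : ℤ → ℤ) → N ≤ L → (∀ a → f a ≢ 0ℤ → ∣ a ∣ ≤ N) →
  ∑ (range L) f ≡ ∑ (range L) (λ k → f (+ 2 * k)) + ∑ (range L) (λ k → f (+ 2 * k + 1ℤ))
parity-split {L} {N} f N≤L supp =
  trans (∑-cong (range L) λ a → ifEven+ifOdd a (f a))
  (trans (∑-+ (range L) _ _) (cong₂ _+_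
    (reindex {L} {L} {1} {1} (λ { (a ∷ []) → ifEven a (f a) }) (λ { (k ∷ []) → f (+ 2 * k) })
       (λ { (a ∷ []) → half a ∷ [] }) (λ { (k ∷ []) → + 2 * k ∷ [] })
       (λ { (a ∷ []) p → let (e , q) = ifEven-≢ a p in
            (ℕ.≤-trans (∣half∣ a) (ℕ.≤-trans (supp a (λ z → p (trans q z))) N≤L) ∷ []) ,
            cong (_∷ []) (sym e) , trans (cong f (sym e)) (sym q) })
       (λ { (k ∷ []) p → (ℕ.≤-trans (supp _ p) N≤L ∷ []) , cong (_∷ []) (half-2* k) , ifEven-2* k refl }))
    (reindex {L} {L} {1} {1} (λ { (a ∷ []) → ifOdd a (f a) }) (λ { (k ∷ []) → f (+ 2 * k + 1ℤ) })
       (λ { (a ∷ []) → half a ∷ [] }) (λ { (k ∷ []) → + 2 * k + 1ℤ ∷ [] })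
       (λ { (a ∷ []) p → let (e , q) = ifOdd-≢ a p in
            (ℕ.≤-trans (∣half∣ a) (ℕ.≤-trans (supp a (λ z → p (trans q z))) N≤L) ∷ []) ,
            cong (_∷ []) (sym e) , trans (cong f (sym e)) (sym q) })
       (λ { (k ∷ []) p → (ℕ.≤-trans (supp _ p) N≤L ∷ []) , cong (_∷ []) (half-2*+1 k) , ifOdd-2*+1 k refl }))))

-- The pairs are sorted by the parity of `a + b`; the new variables are `s = ⌊(a + b) / 2⌋` and
-- `d = a − s`, or `a − s − 1` in the odd case. As `s` can reach `2N`, `d` can reach `3N + 1`, and
-- the box has to contain it.
rotate : ∀ {L N} (f : ℤ → ℤ → ℤ) → suc (3 ℕ.* N) ≤ L → (∀ a b → f a b ≢ 0ℤ → ∣ a ∣ ≤ N × ∣ b ∣ ≤ N) →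
  ∑ (range L) (λ a → ∑ (range L) (f a)) ≡
  ∑ (range L) (λ s → ∑ (range L) (λ d → f (s + d) (s - d))) +
  ∑ (range L) (λ s → ∑ (range L) (λ d → f (s + d + 1ℤ) (s - d)))
rotate {L} {N} f 3N<L supp =
  trans (∑-cong (range L) λ a → ∑-cong (range L) λ b → ifEven+ifOdd (a + b) (f a b))
  (trans (trans (∑-cong (range L) λ a → ∑-+ (range L) _ _) (∑-+ (range L) _ _)) (cong₂ _+_
    (reindex {L} {L} {2} {2} (λ { (a ∷ b ∷ []) → ifEven (a + b) (f a b) }) (λ { (s ∷ d ∷ []) → f (s + d) (s - d) })
       (λ { (a ∷ b ∷ []) → half (a + b) ∷ a - half (a + b) ∷ [] }) (λ { (s ∷ d ∷ []) → s + d ∷ s - d ∷ [] })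
       (λ { (a ∷ b ∷ []) p → let (e , q) = ifEven-≢ (a + b) p
                                 (ba , bb) = supp a b (λ z → p (trans q z))
                                 ea = l₁ a (half (a + b)); eb = trans (l₂ a (half (a + b))) (trans (cong (_- a) (sym e)) (l₃ a b)) in
            (bs a b ba bb ∷ bd a b ba bb ∷ []) ,
            cong₂ (λ x y → x ∷ y ∷ []) ea eb ,
            trans (cong₂ f ea eb) (sym q) })
       (λ { (s ∷ d ∷ []) p → let (ba , bb) = supp _ _ p in
            (ℕ.≤-trans ba N≤L ∷ ℕ.≤-trans bb N≤L ∷ []) ,
            (let h = trans (cong half (l₄ s d)) (half-2* s) in
             cong₂ (λ x y → x ∷ y ∷ []) h (trans (cong (λ z → s + d - z) h) (l₅ s d))) ,
            ifEven-2* s (l₄ s d) }))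
    (reindex {L} {L} {2} {2} (λ { (a ∷ b ∷ []) → ifOdd (a + b) (f a b) }) (λ { (s ∷ d ∷ []) → f (s + d + 1ℤ) (s - d) })
       (λ { (a ∷ b ∷ []) → half (a + b) ∷ a - half (a + b) - 1ℤ ∷ [] }) (λ { (s ∷ d ∷ []) → s + d + 1ℤ ∷ s - d ∷ [] })
       (λ { (a ∷ b ∷ []) p → let (e , q) = ifOdd-≢ (a + b) p
                                 (ba , bb) = supp a b (λ z → p (trans q z))
                                 ea = m₁ a (half (a + b)); eb = trans (m₂ a (half (a + b))) (trans (cong (_- a) (sym e)) (l₃ a b)) in
            (bs a b ba bb ∷ bd′ a b ba bb ∷ []) ,
            cong₂ (λ x y → x ∷ y ∷ []) ea eb ,
            trans (cong₂ f ea eb) (sym q) })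
       (λ { (s ∷ d ∷ []) p → let (ba , bb) = supp _ _ p in
            (ℕ.≤-trans ba N≤L ∷ ℕ.≤-trans bb N≤L ∷ []) ,
            (let h = trans (cong half (m₄ s d)) (half-2*+1 s) in
             cong₂ (λ x y → x ∷ y ∷ []) h (trans (cong (λ z → s + d + 1ℤ - z - 1ℤ) h) (m₅ s d))) ,
            ifOdd-2*+1 s (m₄ s d) }))))
  where
  l₁ : ∀ a h → h + (a - h) ≡ a
  l₁ = solve-∀
  l₂ : ∀ a h → h - (a - h) ≡ + 2 * h - a
  l₂ = solve-∀
  l₃ : ∀ a b → a + b - a ≡ b
  l₃ = solve-∀
  l₄ : ∀ s d → s + d + (s - d) ≡ + 2 * s
  l₄ = solve-∀
  l₅ : ∀ s d → s + d - s ≡ d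
  l₅ = solve-∀
  m₁ : ∀ a h → h + (a - h - 1ℤ) + 1ℤ ≡ a
  m₁ = solve-∀
  m₂ : ∀ a h → h - (a - h - 1ℤ) ≡ + 2 * h + 1ℤ - a
  m₂ = solve-∀
  m₄ : ∀ s d → s + d + 1ℤ + (s - d) ≡ + 2 * s + 1ℤ
  m₄ = solve-∀
  m₅ : ∀ s d → s + d + 1ℤ - s - 1ℤ ≡ d
  m₅ = solve-∀
  3N≡ : N ℕ.+ (N ℕ.+ N) ≡ 3 ℕ.* N
  3N≡ = cong (λ z → N ℕ.+ (N ℕ.+ z)) (sym (ℕ.+-identityʳ N))
  3N≤L : N ℕ.+ (N ℕ.+ N) ≤ L
  3N≤L = ℕ.≤-trans (ℕ.≤-reflexive 3N≡) (ℕ.≤-trans (ℕ.n≤1+n _) 3N<L)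
  N≤L : N ≤ L
  N≤L = ℕ.≤-trans (ℕ.m≤m+n N _) 3N≤L
  bh : ∀ a b → ∣ a ∣ ≤ N → ∣ b ∣ ≤ N → ∣ half (a + b) ∣ ≤ N ℕ.+ N
  bh a b p q = ℕ.≤-trans (∣half∣ (a + b)) (∣+∣ {a} {b} p q)
  bs : ∀ a b → ∣ a ∣ ≤ N → ∣ b ∣ ≤ N → ∣ half (a + b) ∣ ≤ L
  bs a b p q = ℕ.≤-trans (bh a b p q) (ℕ.≤-trans (ℕ.m≤n+m _ N) 3N≤L)
  bd : ∀ a b → ∣ a ∣ ≤ N → ∣ b ∣ ≤ N → ∣ a - half (a + b) ∣ ≤ L
  bd a b p q = ℕ.≤-trans (∣-∣ {a} p (bh a b p q)) 3N≤L
  bd′ : ∀ a b → ∣ a ∣ ≤ N → ∣ b ∣ ≤ N → ∣ a - half (a + b) - 1ℤ ∣ ≤ L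
  bd′ a b p q = ℕ.≤-trans (∣-∣ {a - half (a + b)} {1ℤ} (∣-∣ {a} p (bh a b p q)) (s≤s z≤n))
    (ℕ.≤-trans (ℕ.≤-reflexive (trans (ℕ.+-comm _ 1) (cong suc 3N≡))) 3N<L)

-- The ring of series in Q over Laurent polynomials in u and v

record Term : Set where
  constructor term
  field
    coef : ℤ
    deg : ℕ
    udeg vdeg : ℤ
open Term

-- A test is a linear functional given by its values on monomials. Its degree argument is an
-- integer, not a natural number, so that tests can also be shifted by the inverse of a monomial, as
-- `cancel-leading` requires.
Test : Set
Test = ℤ → ℤ → ℤ → ℤ

_·ᵀ_ : Term → Term → Term
term x a b c ·ᵀ term y a′ b′ c′ = term (x * y) (a ℕ.+ a′) (b + b′) (c + c′)

shift : ℤ → ℤ → ℤ → Test → Test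
shift a b c φ a′ b′ c′ = φ (a + a′) (b + b′) (c + c′)

_⊗_ : List Term → List Term → List Term
p ⊗ q = concatMap (λ s → map (s ·ᵀ_) q) p

scale : (ℤ → ℤ → ℤ) → List Term → List Term
scale w = map λ t → term (coef t * w (udeg t) (vdeg t)) (deg t) (udeg t) (vdeg t)

opaque
  ⟪_,_⟫ : List Term → Test → ℤ
  ⟪ p , φ ⟫ = ∑ p λ t → coef t * φ (+ deg t) (udeg t) (vdeg t)

  ⟪⟫-∑ : ∀ p φ → ⟪ p , φ ⟫ ≡ ∑ p λ t → coef t * φ (+ deg t) (udeg t) (vdeg t)
  ⟪⟫-∑ p φ = refl

  ⟪⟫-cong : ∀ p {φ ψ : Test} → (∀ a b c → φ a b c ≡ ψ a b c) → ⟪ p , φ ⟫ ≡ ⟪ p , ψ ⟫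
  ⟪⟫-cong p e = ∑-cong p λ t → cong (coef t *_) (e _ _ _)

  ⟪⟫-⊗ : ∀ p q φ → ⟪ p ⊗ q , φ ⟫ ≡ ⟪ p , (λ a b c → ⟪ q , shift a b c φ ⟫) ⟫
  ⟪⟫-⊗ p q φ = trans (∑-concatMap (λ s → map (s ·ᵀ_) q) p _) (∑-cong p λ s →
    trans (∑-map (s ·ᵀ_) q _) (trans (∑-cong q λ t → ℤ.*-assoc (coef s) (coef t) _) (∑-*ˡ q (coef s) _)))

  ⟪⟫-++ : ∀ p q φ → ⟪ p ++ q , φ ⟫ ≡ ⟪ p , φ ⟫ + ⟪ q , φ ⟫
  ⟪⟫-++ p q φ = ∑-++ p q _

  ⟪⟫-scale : ∀ w p φ → ⟪ scale w p , φ ⟫ ≡ ⟪ p , (λ a b c → w b c * φ a b c) ⟫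
  ⟪⟫-scale w p φ = trans (∑-map _ p _) (∑-cong p λ t → ℤ.*-assoc (coef t) _ _)

  ⟪⟫-+ : ∀ p φ ψ → ⟪ p , (λ a b c → φ a b c + ψ a b c) ⟫ ≡ ⟪ p , φ ⟫ + ⟪ p , ψ ⟫
  ⟪⟫-+ p φ ψ = trans (∑-cong p λ t → ℤ.*-distribˡ-+ (coef t) _ _) (∑-+ p _ _)

  ⟪⟫-*ˡ : ∀ p k φ → ⟪ p , (λ a b c → k * φ a b c) ⟫ ≡ k * ⟪ p , φ ⟫
  ⟪⟫-*ˡ p k φ = trans (∑-cong p λ t → lem (coef t) k _) (∑-*ˡ p k _)
    where
    lem : ∀ x k y → x * (k * y) ≡ k * (x * y)
    lem = solve-∀

  ⟪⟫-0 : ∀ p {φ : Test} → (∀ a b c → φ (+ a) b c ≡ 0ℤ) → ⟪ p , φ ⟫ ≡ 0ℤ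
  ⟪⟫-0 p e = trans (∑-cong p λ t → trans (cong (coef t *_) (e _ _ _)) (ℤ.*-zeroʳ (coef t))) (∑-0 p)

  ⟪⟫-comm : ∀ p q (F : ℤ → ℤ → ℤ → Test) →
    ⟪ p , (λ a b c → ⟪ q , F a b c ⟫) ⟫ ≡ ⟪ q , (λ a b c → ⟪ p , (λ a′ b′ c′ → F a′ b′ c′ a b c) ⟫) ⟫
  ⟪⟫-comm p q F = trans (∑-cong p λ s → sym (∑-*ˡ q (coef s) _)) (trans (∑-comm p q _)
    (∑-cong q λ t → trans (∑-cong p λ s → lem (coef s) (coef t) _) (∑-*ˡ p (coef t) _)))
    where
    lem : ∀ x y z → x * (y * z) ≡ y * (x * z)
    lem = solve-∀

  ⟪⟫-cong-deg : ∀ p {φ ψ : Test} → (∀ a b c → φ (+ a) b c ≡ ψ (+ a) b c) → ⟪ p , φ ⟫ ≡ ⟪ p , ψ ⟫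
  ⟪⟫-cong-deg p e = ∑-cong p λ t → cong (coef t *_) (e _ _ _)

  ⟪⟫-[] : ∀ φ → ⟪ [] , φ ⟫ ≡ 0ℤ
  ⟪⟫-[] φ = refl

  ⟪⟫-single : ∀ t φ → ⟪ t ∷ [] , φ ⟫ ≡ coef t * φ (+ deg t) (udeg t) (vdeg t)
  ⟪⟫-single t φ = ℤ.+-identityʳ _

  ⟪⟫-map : ∀ {A : Set} (g : A → Term) xs φ →
    ⟪ map g xs , φ ⟫ ≡ ∑ xs (λ x → coef (g x) * φ (+ deg (g x)) (udeg (g x)) (vdeg (g x)))
  ⟪⟫-map g xs φ = ∑-map g xs _

  ⟪⟫-pow : ∀ k l n p φ → ⟪ map (λ t → term (coef t) (k ℕ.* deg t) (l * udeg t) (n * vdeg t)) p , φ ⟫ ≡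
    ⟪ p , (λ a b c → φ (+ k * a) (l * b) (n * c)) ⟫
  ⟪⟫-pow k l n p φ = trans (∑-map _ p _)
    (∑-cong p λ t → cong (λ z → coef t * φ z (l * udeg t) (n * vdeg t)) (ℤ.pos-* k (deg t)))

  ⟪⟫-All0 : ∀ {P : Term → Set} p φ → LAll.All P p → (∀ t → P t → coef t * φ (+ deg t) (udeg t) (vdeg t) ≡ 0ℤ) →
    ⟪ p , φ ⟫ ≡ 0ℤ
  ⟪⟫-All0 [] φ [] h = refl
  ⟪⟫-All0 (t ∷ p) φ (x ∷ xs) h = trans (cong₂ _+_ (h t x) (⟪⟫-All0 p φ xs h)) refl

-- An element is a family of finite sums indexed by the size of the summation box; two elements are
-- identified when their coefficients below each degree M agree for all large boxes.
R : Set
R = ℕ → List Term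

Cut : ℕ → Test → Set
Cut M φ = ∀ a b c → + M ℤ.≤ a → φ a b c ≡ 0ℤ

Cut-shift : ∀ {M φ} d b c → Cut M φ → Cut M (shift (+ d) b c φ)
Cut-shift d b c cut a b′ c′ M≤a = cut (+ d + a) _ _ (ℤ.≤-trans M≤a (ℤ.i≤j+i a (+ d)))

Cut-weaken : ∀ {M M′ φ} → M ≤ M′ → Cut M φ → Cut M′ φ
Cut-weaken M≤M′ cut a b c q = cut a b c (ℤ.≤-trans (ℤ.+≤+ M≤M′) q)

infix 4 _≈[_]_ _≈_

record _≈[_]_ (p : R) (M : ℕ) (q : R) : Set where
  constructor mk
  field
    bound : ℕ
    agree : ∀ B → bound ≤ B → ∀ φ → Cut M φ → ⟪ p B , φ ⟫ ≡ ⟪ q B , φ ⟫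
open _≈[_]_

record _≈_ (p q : R) : Set where
  constructor mk
  field
    at : ∀ M → p ≈[ M ] q
open _≈_

exactly : ∀ {p q} → (∀ B φ → ⟪ p B , φ ⟫ ≡ ⟪ q B , φ ⟫) → p ≈ q
exactly e = mk λ M → mk 0 λ B _ φ _ → e B φ

≈[]-sym : ∀ {M p q} → p ≈[ M ] q → q ≈[ M ] p
≈[]-sym e = mk (bound e) λ B b φ c → sym (agree e B b φ c)

≈[]-trans : ∀ {M p q r} → p ≈[ M ] q → q ≈[ M ] r → p ≈[ M ] r
≈[]-trans e f = mk (bound e ℕ.⊔ bound f) λ B b φ c →
  trans (agree e B (ℕ.m⊔n≤o⇒m≤o _ _ b) φ c) (agree f B (ℕ.m⊔n≤o⇒n≤o (bound e) _ b) φ c)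

≈[]-weaken : ∀ {M M′ p q} → M ≤ M′ → p ≈[ M′ ] q → p ≈[ M ] q
≈[]-weaken M≤M′ e = mk (bound e) λ B b φ c → agree e B b φ (Cut-weaken M≤M′ c)

infixl 6 _⊕_
infixl 7 _⊙_
infix 8 ⊖_

_⊕_ _⊙_ : R → R → R
(p ⊕ q) B = p B ++ q B
(p ⊙ q) B = p B ⊗ q B

∂ : (ℤ → ℤ → ℤ) → R → R
∂ w p B = scale w (p B)

⊖_ : R → R
⊖ p = ∂ (λ _ _ → - 1ℤ) p

ι : ℤ → R
ι x B = term x 0 0ℤ 0ℤ ∷ []

𝟘 𝟙 : R
𝟘 _ = []
𝟙 = ι 1ℤ

⟪⟫-⊖ : ∀ p B φ → ⟪ (⊖ p) B , φ ⟫ ≡ - ⟪ p B , φ ⟫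
⟪⟫-⊖ p B φ = trans (⟪⟫-scale (λ _ _ → - 1ℤ) (p B) φ) (trans (⟪⟫-*ˡ (p B) (- 1ℤ) φ) (ℤ.-1*i≡-i ⟪ p B , φ ⟫))

⟪⟫-ι : ∀ x B φ → ⟪ ι x B , φ ⟫ ≡ x * φ 0ℤ 0ℤ 0ℤ
⟪⟫-ι x B φ = ⟪⟫-single (term x 0 0ℤ 0ℤ) φ

⟪⟫-ι⊙ : ∀ x p B φ → ⟪ (ι x ⊙ p) B , φ ⟫ ≡ x * ⟪ p B , φ ⟫
⟪⟫-ι⊙ x p B φ = trans (⟪⟫-⊗ (ι x B) (p B) φ) (trans (⟪⟫-ι x B _)
  (cong (x *_) (⟪⟫-cong (p B) λ a b c → cong₃ φ (ℤ.+-identityˡ a) (ℤ.+-identityˡ b) (ℤ.+-identityˡ c))))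

⊕-cong : ∀ {p p′ q q′} → p ≈ p′ → q ≈ q′ → p ⊕ q ≈ p′ ⊕ q′
⊕-cong {p} {p′} {q} {q′} e f = mk λ M → mk (bound (at e M) ℕ.⊔ bound (at f M)) λ B b φ c →
  trans (⟪⟫-++ (p B) (q B) φ) (trans
  (cong₂ _+_ (agree (at e M) B (ℕ.m⊔n≤o⇒m≤o _ _ b) φ c) (agree (at f M) B (ℕ.m⊔n≤o⇒n≤o (bound (at e M)) _ b) φ c))
  (sym (⟪⟫-++ (p′ B) (q′ B) φ)))

∂-cong : ∀ w {p q} → p ≈ q → ∂ w p ≈ ∂ w q
∂-cong w {p} {q} e = mk λ M → mk (bound (at e M)) λ B b φ c →
  trans (⟪⟫-scale w (p B) φ) (trans
  (agree (at e M) B b _ (λ x y z l → trans (cong (w y z *_) (c x y z l)) (ℤ.*-zeroʳ (w y z))))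
  (sym (⟪⟫-scale w (q B) φ)))

⊙-comm : ∀ p q → p ⊙ q ≈ q ⊙ p
⊙-comm p q = exactly λ B φ → trans (⟪⟫-⊗ (p B) (q B) φ) (trans (⟪⟫-comm (p B) (q B) _)
  (trans (⟪⟫-cong (q B) λ a b c → ⟪⟫-cong (p B) λ a′ b′ c′ → comm₃ φ a a′ b b′ c c′) (sym (⟪⟫-⊗ (q B) (p B) φ))))
  where
  comm₃ : ∀ (φ : Test) a a′ b b′ c c′ → φ (a′ + a) (b′ + b) (c′ + c) ≡ φ (a + a′) (b + b′) (c + c′)
  comm₃ φ a a′ b b′ c c′ rewrite ℤ.+-comm a′ a | ℤ.+-comm b′ b | ℤ.+-comm c′ c = refl

-- Degrees are natural numbers, so multiplication by a term of `p` never lowers a degree and the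
-- precision `M` survives.
⊙-congʳ[] : ∀ {M} p {q q′} → q ≈[ M ] q′ → p ⊙ q ≈[ M ] p ⊙ q′
⊙-congʳ[] {M} p {q} {q′} e = mk (bound e) λ B b φ c → trans (⟪⟫-⊗ (p B) (q B) φ) (trans
  (⟪⟫-cong-deg (p B) λ x y z → agree e B b (shift (+ x) y z φ) (Cut-shift {φ = φ} x y z c))
  (sym (⟪⟫-⊗ (p B) (q′ B) φ)))

⊙-congʳ : ∀ p {q q′} → q ≈ q′ → p ⊙ q ≈ p ⊙ q′
⊙-congʳ p e = mk λ M → ⊙-congʳ[] p (at e M)

≈-refl : ∀ {p} → p ≈ p
≈-refl = exactly λ _ _ → refl

≈-sym : ∀ {p q} → p ≈ q → q ≈ p
≈-sym e = mk λ M → ≈[]-sym (at e M)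

≈-trans : ∀ {p q r} → p ≈ q → q ≈ r → p ≈ r
≈-trans e f = mk λ M → ≈[]-trans (at e M) (at f M)

⊙-cong : ∀ {p p′ q q′} → p ≈ p′ → q ≈ q′ → p ⊙ q ≈ p′ ⊙ q′
⊙-cong {p} {p′} {q} {q′} e f = ≈-trans (⊙-congʳ p f)
  (≈-trans (⊙-comm p q′) (≈-trans (⊙-congʳ q′ e) (⊙-comm q′ p′)))

⊙-assoc : ∀ p q r → (p ⊙ q) ⊙ r ≈ p ⊙ (q ⊙ r)
⊙-assoc p q r = exactly λ B φ → trans (⟪⟫-⊗ (p B ⊗ q B) (r B) φ) (trans (⟪⟫-⊗ (p B) (q B) _)
  (trans (⟪⟫-cong (p B) λ a b c → trans
     (⟪⟫-cong (q B) λ a′ b′ c′ → ⟪⟫-cong (r B) λ a″ b″ c″ → assoc₃ φ a a′ a″ b b′ b″ c c′ c″)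
     (sym (⟪⟫-⊗ (q B) (r B) (shift a b c φ))))
  (sym (⟪⟫-⊗ (p B) (q B ⊗ r B) φ))))
  where
  assoc₃ : ∀ (φ : Test) a a′ a″ b b′ b″ c c′ c″ →
    φ (a + a′ + a″) (b + b′ + b″) (c + c′ + c″) ≡ φ (a + (a′ + a″)) (b + (b′ + b″)) (c + (c′ + c″))
  assoc₃ φ a a′ a″ b b′ b″ c c′ c″ rewrite ℤ.+-assoc a a′ a″ | ℤ.+-assoc b b′ b″ | ℤ.+-assoc c c′ c″ = refl

⊙-identityˡ : ∀ p → 𝟙 ⊙ p ≈ p
⊙-identityˡ p = exactly λ B φ → trans (⟪⟫-ι⊙ 1ℤ p B φ) (ℤ.*-identityˡ _)

⊙-distribˡ : ∀ p q r → p ⊙ (q ⊕ r) ≈ p ⊙ q ⊕ p ⊙ r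
⊙-distribˡ p q r = exactly λ B φ → trans (⟪⟫-⊗ (p B) (q B ++ r B) φ) (trans
  (⟪⟫-cong (p B) λ a b c → ⟪⟫-++ (q B) (r B) _) (trans (⟪⟫-+ (p B) _ _)
  (trans (sym (cong₂ _+_ (⟪⟫-⊗ (p B) (q B) φ) (⟪⟫-⊗ (p B) (r B) φ))) (sym (⟪⟫-++ (p B ⊗ q B) (p B ⊗ r B) φ)))))

ring : CommutativeRing 0ℓ 0ℓ
ring = record
  { Carrier = R ; _≈_ = _≈_ ; _+_ = _⊕_ ; _*_ = _⊙_ ; -_ = ⊖_ ; 0# = 𝟘 ; 1# = 𝟙
  ; isCommutativeRing = record
    { isRing = record
      { +-isAbelianGroup = record
        { isGroup = record
          { isMonoid = record
            { isSemigroup = record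
              { isMagma = record
                { isEquivalence = record { refl = ≈-refl ; sym = ≈-sym ; trans = ≈-trans }
                ; ∙-cong = ⊕-cong }
              ; assoc = λ p q r → exactly λ B φ →
                  trans (⟪⟫-++ (p B ++ q B) (r B) φ) (trans (cong₂ _+_ (⟪⟫-++ (p B) (q B) φ) refl)
                  (trans (ℤ.+-assoc ⟪ p B , φ ⟫ ⟪ q B , φ ⟫ ⟪ r B , φ ⟫)
                  (trans (cong₂ _+_ {x = ⟪ p B , φ ⟫} refl (sym (⟪⟫-++ (q B) (r B) φ))) (sym (⟪⟫-++ (p B) (q B ++ r B) φ))))) }
            ; identity = (λ p → ≈-refl) , (λ p → exactly λ B φ → trans (⟪⟫-++ (p B) [] φ) (trans (cong (λ z → ⟪ p B , φ ⟫ + z) (⟪⟫-[] φ)) (ℤ.+-identityʳ ⟪ p B , φ ⟫))) }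
          ; inverse = (λ p → exactly λ B φ → trans (⟪⟫-++ ((⊖ p) B) (p B) φ)
                        (trans (cong₂ _+_ (⟪⟫-⊖ p B φ) refl) (trans (ℤ.+-inverseˡ ⟪ p B , φ ⟫) (sym (⟪⟫-[] φ)))))
                    , (λ p → exactly λ B φ → trans (⟪⟫-++ (p B) ((⊖ p) B) φ)
                        (trans (cong₂ _+_ {x = ⟪ p B , φ ⟫} refl (⟪⟫-⊖ p B φ)) (trans (ℤ.+-inverseʳ ⟪ p B , φ ⟫) (sym (⟪⟫-[] φ)))))
          ; ⁻¹-cong = ∂-cong (λ _ _ → - 1ℤ) }
        ; comm = λ p q → exactly λ B φ → trans (⟪⟫-++ (p B) (q B) φ)
            (trans (ℤ.+-comm ⟪ p B , φ ⟫ ⟪ q B , φ ⟫) (sym (⟪⟫-++ (q B) (p B) φ))) }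
      ; *-cong = ⊙-cong
      ; *-assoc = ⊙-assoc
      ; *-identity = ⊙-identityˡ , (λ p → ≈-trans (⊙-comm p 𝟙) (⊙-identityˡ p))
      ; distrib = ⊙-distribˡ , (λ p q r → ≈-trans (⊙-comm (q ⊕ r) p)
          (≈-trans (⊙-distribˡ p q r) (⊕-cong (⊙-comm p q) (⊙-comm p r)))) }
    ; *-comm = ⊙-comm } }

ι-+ : ∀ x y → ι (x + y) ≈ ι x ⊕ ι y
ι-+ x y = exactly λ B φ → trans (⟪⟫-ι (x + y) B φ) (trans (ℤ.*-distribʳ-+ (φ 0ℤ 0ℤ 0ℤ) x y)
  (sym (trans (⟪⟫-++ (ι x B) (ι y B) φ) (cong₂ _+_ (⟪⟫-ι x B φ) (⟪⟫-ι y B φ)))))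

ι-* : ∀ x y → ι (x * y) ≈ ι x ⊙ ι y
ι-* x y = exactly λ B φ → refl

ι-neg : ∀ x → ι (- x) ≈ ⊖ ι x
ι-neg x = exactly λ B φ → trans (⟪⟫-ι (- x) B φ) (trans (sym (ℤ.neg-distribˡ-* x _))
  (sym (trans (⟪⟫-⊖ (ι x) B φ) (cong -_ (⟪⟫-ι x B φ)))))

ι-0 : ι 0ℤ ≈ 𝟘
ι-0 = exactly λ B φ → trans (⟪⟫-ι 0ℤ B φ) (sym (⟪⟫-[] φ))

-- Derivations that act diagonally on monomials

Additive : (ℤ → ℤ → ℤ) → Set
Additive w = ∀ b c b′ c′ → w (b + b′) (c + c′) ≡ w b c + w b′ c′

∂-⊕ : ∀ w p q → ∂ w (p ⊕ q) ≈ ∂ w p ⊕ ∂ w q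
∂-⊕ w p q = exactly λ B φ → trans (⟪⟫-scale w (p B ++ q B) φ) (trans (⟪⟫-++ (p B) (q B) _)
  (sym (trans (⟪⟫-++ (scale w (p B)) (scale w (q B)) φ) (cong₂ _+_ (⟪⟫-scale w (p B) φ) (⟪⟫-scale w (q B) φ)))))

∂-⊙ : ∀ w → Additive w → ∀ p q → ∂ w (p ⊙ q) ≈ ∂ w p ⊙ q ⊕ p ⊙ ∂ w q
∂-⊙ w add p q = exactly λ B φ → trans (⟪⟫-scale w (p B ⊗ q B) φ) (trans (⟪⟫-⊗ (p B) (q B) _)
  (trans (⟪⟫-cong (p B) λ a b c → trans
    (⟪⟫-cong (q B) λ a′ b′ c′ → trans (cong (_* φ (a + a′) (b + b′) (c + c′)) (add b c b′ c′)) (ℤ.*-distribʳ-+ _ (w b c) (w b′ c′)))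
    (trans (⟪⟫-+ (q B) _ _) (cong₂ _+_ (⟪⟫-*ˡ (q B) (w b c) _) (sym (⟪⟫-scale w (q B) (shift a b c φ))))))
  (trans (⟪⟫-+ (p B) _ _)
  (sym (trans (⟪⟫-++ (scale w (p B) ⊗ q B) (p B ⊗ scale w (q B)) φ) (cong₂ _+_
    (trans (⟪⟫-⊗ (scale w (p B)) (q B) φ) (⟪⟫-scale w (p B) _))
    (⟪⟫-⊗ (p B) (scale w (q B)) φ)))))))

∂-comm : ∀ w w′ p → ∂ w (∂ w′ p) ≈ ∂ w′ (∂ w p)
∂-comm w w′ p = exactly λ B φ → trans (⟪⟫-scale w (scale w′ (p B)) φ) (trans (⟪⟫-scale w′ (p B) _)
  (sym (trans (⟪⟫-scale w′ (scale w (p B)) φ) (trans (⟪⟫-scale w (p B) _) (⟪⟫-cong (p B) λ a b c → lem (w b c) (w′ b c) _)))))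
  where
  lem : ∀ x y z → x * (y * z) ≡ y * (x * z)
  lem = solve-∀

-- Substitutions Q ↦ Q ^ k, u ↦ u ^ l, v ↦ v ^ n

pow : ℕ → ℤ → ℤ → R → R
pow k l n p B = map (λ t → term (coef t) (k ℕ.* deg t) (l * udeg t) (n * vdeg t)) (p B)

Cut-pow : ∀ {M φ} k l n → Cut M φ → Cut M (λ a b c → φ (+ suc k * a) (l * b) (n * c))
Cut-pow {M} k l n cut a b c q = cut _ _ _ (ℤ.≤-trans q (lem a (ℤ.≤-trans (ℤ.+≤+ z≤n) q)))
  where
  lem : ∀ a → 0ℤ ℤ.≤ a → a ℤ.≤ + suc k * a
  lem (+ a) _ = subst (+ a ℤ.≤_) (ℤ.pos-* (suc k) a) (ℤ.+≤+ (ℕ.m≤m+n a (k ℕ.* a)))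

pow-cong : ∀ k l n {p q} → p ≈ q → pow (suc k) l n p ≈ pow (suc k) l n q
pow-cong k l n {p} {q} e = mk λ M → mk (bound (at e M)) λ B b φ c →
  trans (⟪⟫-pow (suc k) l n (p B) φ) (trans (agree (at e M) B b _ (Cut-pow {φ = φ} k l n c)) (sym (⟪⟫-pow (suc k) l n (q B) φ)))

pow-⊕ : ∀ k l n p q → pow k l n (p ⊕ q) ≈ pow k l n p ⊕ pow k l n q
pow-⊕ k l n p q = exactly λ B φ → trans (⟪⟫-pow k l n (p B ++ q B) φ) (trans (⟪⟫-++ (p B) (q B) _)
  (sym (trans (⟪⟫-++ (pow k l n p B) (pow k l n q B) φ) (cong₂ _+_ (⟪⟫-pow k l n (p B) φ) (⟪⟫-pow k l n (q B) φ)))))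

pow-⊙ : ∀ k l n p q → pow k l n (p ⊙ q) ≈ pow k l n p ⊙ pow k l n q
pow-⊙ k l n p q = exactly λ B φ → trans (⟪⟫-pow k l n (p B ⊗ q B) φ) (trans (⟪⟫-⊗ (p B) (q B) _)
  (trans (⟪⟫-cong (p B) λ a b c → trans (⟪⟫-cong (q B) λ a′ b′ c′ → lem φ (+ k) l n a a′ b b′ c c′)
     (sym (⟪⟫-pow k l n (q B) (shift (+ k * a) (l * b) (n * c) φ))))
  (sym (trans (⟪⟫-⊗ (pow k l n p B) (pow k l n q B) φ) (⟪⟫-pow k l n (p B) _)))))
  where
  lem : ∀ (φ : Test) k l n a a′ b b′ c c′ → φ (k * (a + a′)) (l * (b + b′)) (n * (c + c′)) ≡
    φ (k * a + k * a′) (l * b + l * b′) (n * c + n * c′)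
  lem φ k l n a a′ b b′ c c′ rewrite ℤ.*-distribˡ-+ k a a′ | ℤ.*-distribˡ-+ l b b′ | ℤ.*-distribˡ-+ n c c′ = refl

-- The absolute value only serves to make the degree a natural number; `⟪⟫-fam` removes it when `d`
-- is nonnegative wherever the weight `w` does not vanish.
fam : (n : ℕ) (w d b c : Vec ℤ n → ℤ) → R
fam n w d b c B = map (λ x → term (w x) ∣ d x ∣ (b x) (c x)) (box B n)

⟪⟫-fam : ∀ {n} {w d b c : Vec ℤ n → ℤ} → (∀ x → w x ≢ 0ℤ → 0ℤ ℤ.≤ d x) →
  ∀ B φ → ⟪ fam n w d b c B , φ ⟫ ≡ S B n (λ x → w x * φ (d x) (b x) (c x))
⟪⟫-fam {n} {w} {d} {b} {c} nn B φ = trans (⟪⟫-map _ (box B n) φ) (trans (∑-box B n _) (S-cong B n eq))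
  where
  eq : ∀ x → w x * φ (+ ∣ d x ∣) (b x) (c x) ≡ w x * φ (d x) (b x) (c x)
  eq x with w x ≟ 0ℤ
  ... | yes p rewrite p = refl
  ... | no p rewrite ℤ.0≤i⇒+∣i∣≡i (nn x p) = refl

-- Cancellation by means of a leading monomial

Regular : R → Set
Regular p = ∀ {x y} → p ⊙ x ≈ p ⊙ y → x ≈ y

Regular-⊙ : ∀ {p q} → Regular p → Regular q → Regular (p ⊙ q)
Regular-⊙ {p} {q} rp rq {x} {y} e = rq (rp (≈-trans (≈-sym (⊙-assoc p q x)) (≈-trans e (⊙-assoc p q y))))

Regular-ι : ∀ n .{{_ : ℤ.NonZero n}} → Regular (ι n)
Regular-ι n {x} {y} e = mk λ M → mk (bound (at e M)) λ B b φ c →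
  ℤ.*-cancelˡ-≡ n ⟪ x B , φ ⟫ ⟪ y B , φ ⟫ (trans (sym (⟪⟫-ι⊙ n x B φ)) (trans (agree (at e M) B b φ c) (⟪⟫-ι⊙ n y B φ)))

record Leading (p : R) (d : ℕ) (b c : ℤ) : Set where
  field
    from : ℕ
    rest : R
    higher : ∀ B → from ≤ B → LAll.All (λ t → coef t ≡ 0ℤ ⊎ d ℕ.< deg t) (rest B)
    split : ∀ B → from ≤ B → ∀ φ → ⟪ p B , φ ⟫ ≡ φ (+ d) b c + ⟪ rest B , φ ⟫

-- Induction on the precision: if `z` vanishes below degree `M`, then `rest ⊙ z` vanishes up to and
-- including degree `d + M`. Hence so does the leading monomial times `z`, which settles the part of
-- `z` in degree `M`.
cancel-leading : ∀ {p d b c} → Leading p d b c → ∀ M {z} → p ⊙ z ≈[ d ℕ.+ M ] 𝟘 → z ≈[ M ] 𝟘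
cancel-leading {p} {d} {b} {c} l zero {z} e = mk 0 λ B _ φ cut → trans (⟪⟫-0 (z B) λ x y w → cut (+ x) y w (ℤ.+≤+ z≤n)) (sym (⟪⟫-[] φ))
cancel-leading {p} {d} {b} {c} l (suc M) {z} e = mk (bound ih ℕ.⊔ (bound e ℕ.⊔ from)) λ B q φ cut →
  let
    B₁ = ℕ.m⊔n≤o⇒m≤o (bound ih) _ q
    B₂₃ = ℕ.m⊔n≤o⇒n≤o (bound ih) _ q
    B₂ = ℕ.m⊔n≤o⇒m≤o (bound e) _ B₂₃
    B₃ = ℕ.m⊔n≤o⇒n≤o (bound e) _ B₂₃
    -- Undoes the leading monomial: the value of `ψ` on this monomial times `z` is the value of `φ`
    -- on `z`.
    ψ = shift (- + d) (- b) (- c) φ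
    cutψ : Cut (d ℕ.+ suc M) ψ
    cutψ = λ x y w h → cut _ _ _ (subst (ℤ._≤ - + d + x) (unshift (+ d) (+ suc M)) (ℤ.+-monoʳ-≤ (- + d) h))
    head : ⟪ z B , shift (+ d) b c ψ ⟫ ≡ ⟪ z B , φ ⟫
    head = ⟪⟫-cong (z B) λ x y w → cong₃ φ (unshift (+ d) x) (unshift b y) (unshift c w)
    tail : ⟪ rest B , (λ x y w → ⟪ z B , shift x y w ψ ⟫) ⟫ ≡ 0ℤ
    tail = ⟪⟫-All0 (rest B) _ (higher B B₃) λ
      { t (inj₁ t≡0) → trans (cong (_* ⟪ z B , shift (+ deg t) (udeg t) (vdeg t) ψ ⟫) t≡0) refl
      ; t (inj₂ d<t) → trans (cong (coef t *_) (trans (agree ih B B₁ _ λ x y w M≤x →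
          cutψ _ _ _ (deg-bound d<t x M≤x)) (⟪⟫-[] _))) (ℤ.*-zeroʳ (coef t)) }
  in trans (sym (trans (cong₂ _+_ head tail) (ℤ.+-identityʳ _)))
     (trans (sym (split B B₃ (λ x y w → ⟪ z B , shift x y w ψ ⟫)))
     (trans (sym (⟪⟫-⊗ (p B) (z B) ψ)) (trans (agree e B B₂ ψ cutψ) (trans (⟪⟫-[] ψ) (sym (⟪⟫-[] φ))))))
  where
  open Leading l
  ih = cancel-leading l M {z} (≈[]-weaken (ℕ.+-monoʳ-≤ d (ℕ.n≤1+n M)) e)
  unshift : ∀ d x → - d + (d + x) ≡ x
  unshift = solve-∀
  deg-bound : ∀ {t} → d ℕ.< t → ∀ x → + M ℤ.≤ x → + (d ℕ.+ suc M) ℤ.≤ + t + x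
  deg-bound {t} d<t x q = ℤ.≤-trans (ℤ.≤-reflexive (cong +_ (ℕ.+-suc d M))) (ℤ.+-mono-≤ (ℤ.+≤+ d<t) q)

⊕-⊖⇒≈[] : ∀ {M x y} → x ⊕ ⊖ y ≈[ M ] 𝟘 → x ≈[ M ] y
⊕-⊖⇒≈[] {M} {x} {y} e = mk (bound e) λ B b φ c → ℤ.i-j≡0⇒i≡j ⟪ x B , φ ⟫ ⟪ y B , φ ⟫
  (trans (cong₂ _+_ {x = ⟪ x B , φ ⟫} refl (sym (⟪⟫-⊖ y B φ))) (trans (sym (⟪⟫-++ (x B) ((⊖ y) B) φ)) (trans (agree e B b φ c) (⟪⟫-[] φ))))

≈[]⇒⊕-⊖ : ∀ {M x y} → x ≈[ M ] y → x ⊕ ⊖ y ≈[ M ] 𝟘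
≈[]⇒⊕-⊖ {M} {x} {y} e = mk (bound e) λ B b φ c → trans (⟪⟫-++ (x B) ((⊖ y) B) φ)
  (trans (cong₂ _+_ (agree e B b φ c) (⟪⟫-⊖ y B φ)) (trans (ℤ.+-inverseʳ ⟪ y B , φ ⟫) (sym (⟪⟫-[] φ))))

Regular-leading : ∀ {p d b c} → Leading p d b c → Regular p
Regular-leading {p} {d} l {x} {y} e = mk λ M → ⊕-⊖⇒≈[] (cancel-leading l M
  (≈[]-trans (at (distrib-⊖ p x y) (d ℕ.+ M)) (≈[]⇒⊕-⊖ (at e (d ℕ.+ M)))))
  where
  open import Algebra.Properties.Ring (CommutativeRing.ring ring) using (-‿distribʳ-*)
  distrib-⊖ : ∀ p x y → p ⊙ (x ⊕ ⊖ y) ≈ p ⊙ x ⊕ ⊖ (p ⊙ y)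
  distrib-⊖ p x y = ≈-trans (⊙-distribˡ p x (⊖ y)) (⊕-cong (≈-refl {p ⊙ x}) (≈-sym (-‿distribʳ-* p y)))

fam-leading : ∀ {w d b c : Vec ℤ 1 → ℤ} (k₀ : Vec ℤ 1) → w k₀ ≡ 1ℤ →
  (∀ k → k ≢ k₀ → ∣ d k₀ ∣ ℕ.< ∣ d k ∣) → Leading (fam 1 w d b c) ∣ d k₀ ∣ (b k₀) (c k₀)
fam-leading {w} {d} {b} {c} k₀@(z ∷ []) w₀ min = record
  -- From this size on the box contains the leading index.
  { from = ∣ z ∣
  ; rest = fam 1 (λ k → (1ℤ - δᵛ k₀ k) * w k) d b c
  ; higher = λ B _ → LAll.map⁺ (LAll.universal high (box B 1))
  ; split = λ B q φ → let
      F = λ k → w k * φ (+ ∣ d k ∣) (b k) (c k)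
      eF : ∀ (w : Vec ℤ 1 → ℤ) → ⟪ fam 1 w d b c B , φ ⟫ ≡ S B 1 (λ k → w k * φ (+ ∣ d k ∣) (b k) (c k))
      eF w = trans (⟪⟫-map _ (box B 1) φ) (∑-box B 1 λ k → w k * φ (+ ∣ d k ∣) (b k) (c k))
    in trans (eF w) (trans (S-cong B 1 λ k → lem (δᵛ k₀ k) (w k) (φ (+ ∣ d k ∣) (b k) (c k)))
       (trans (S-+ B 1 (λ k → δᵛ k₀ k * F k) (λ k → (1ℤ - δᵛ k₀ k) * w k * φ (+ ∣ d k ∣) (b k) (c k))) (cong₂ _+_
         (trans (S-cong B 1 (at-k₀ F)) (trans (S-δ {v = k₀} (F k₀) (q ∷ []))
           (trans (cong (_* φ (+ ∣ d k₀ ∣) (b k₀) (c k₀)) w₀) (ℤ.*-identityˡ _))))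
         (sym (eF λ k → (1ℤ - δᵛ k₀ k) * w k)))))
  }
  where
  lem : ∀ e w x → w * x ≡ e * (w * x) + (1ℤ - e) * w * x
  lem = solve-∀
  at-k₀ : ∀ F k → δᵛ k₀ k * F k ≡ δᵛ k₀ k * F k₀
  at-k₀ F k with k₀ ≟ᵛ k
  ... | yes refl = refl
  ... | no p rewrite δᵛ-≢ p = trans (ℤ.*-zeroˡ (F k)) (sym (ℤ.*-zeroˡ (F k₀)))
  high : ∀ k → (1ℤ - δᵛ k₀ k) * w k ≡ 0ℤ ⊎ ∣ d k₀ ∣ ℕ.< ∣ d k ∣
  high k with k₀ ≟ᵛ k
  ... | yes refl rewrite δᵛ-refl k₀ = inj₁ refl
  ... | no p = inj₂ (min k (λ e → p (sym e)))

-- The factor suc N lets a bound absorb additive constants.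
record Bounded (N k : ℕ) (z : ℤ) : Set where
  constructor bounded
  field
    size : ∣ z ∣ ≤ k ℕ.* suc N
open Bounded

module _ {N : ℕ} where
  B+ : ∀ {k l a b} → Bounded N k a → Bounded N l b → Bounded N (k ℕ.+ l) (a + b)
  B+ {k} {l} {a} {b} (bounded p) (bounded q) = bounded (ℕ.≤-trans (∣+∣ {a} {b} p q) (ℕ.≤-reflexive (sym (ℕ.*-distribʳ-+ (suc N) k l))))

  B- : ∀ {k l a b} → Bounded N k a → Bounded N l b → Bounded N (k ℕ.+ l) (a - b)
  B- {k} {l} {a} {b} (bounded p) (bounded q) = bounded (ℕ.≤-trans (∣-∣ {a} {b} p q) (ℕ.≤-reflexive (sym (ℕ.*-distribʳ-+ (suc N) k l))))

  B1 : Bounded N 1 1ℤ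
  B1 = bounded (s≤s z≤n)

  B≡ : ∀ {k a b} → a ≡ b → Bounded N k a → Bounded N k b
  B≡ refl p = p

  Bhalf : ∀ {k a} → Bounded N k (+ 2 * a) → Bounded N k a
  Bhalf {k} {a} (bounded p) = bounded (ℕ.≤-trans (∣i∣≤∣2i∣ a) p)

  Bhalf1 : ∀ {k a} → Bounded N k (+ 2 * a + 1ℤ) → Bounded N k a
  Bhalf1 {k} {a} (bounded p) = bounded (ℕ.≤-trans (∣i∣≤∣2i+1∣ a) p)

  -- The comparison of the numerals `k` and `K` is evaluated during type checking, so a bound is
  -- applied by naming its multiplier and that of the box.
  Bk : ∀ {L z} k K {k≤K : True (k ℕ.≤? K)} → K ℕ.* suc N ≤ L → Bounded N k z → ∣ z ∣ ≤ L
  Bk k K {w} KN≤L (bounded p) = ℕ.≤-trans p (ℕ.≤-trans (ℕ.*-monoˡ-≤ (suc N) (toWitness w)) KN≤L)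

-- Double sums with bounded support

∑∑ : ℕ → (ℤ → ℤ → ℤ) → ℤ
∑∑ L f = ∑ (range L) λ a → ∑ (range L) (f a)

∑∑-cong : ∀ L {f g : ℤ → ℤ → ℤ} → (∀ a b → f a b ≡ g a b) → ∑∑ L f ≡ ∑∑ L g
∑∑-cong L e = ∑-cong (range L) λ a → ∑-cong (range L) (e a)

∑∑-+ : ∀ L (f g : ℤ → ℤ → ℤ) → ∑∑ L (λ a b → f a b + g a b) ≡ ∑∑ L f + ∑∑ L g
∑∑-+ L f g = trans (∑-cong (range L) λ a → ∑-+ (range L) (f a) (g a)) (∑-+ (range L) _ _)

∑∑-*ˡ : ∀ L c (f : ℤ → ℤ → ℤ) → ∑∑ L (λ a b → c * f a b) ≡ c * ∑∑ L f
∑∑-*ˡ L c f = trans (∑-cong (range L) λ a → ∑-*ˡ (range L) c (f a)) (∑-*ˡ (range L) c _)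

∑∑-neg : ∀ L (f : ℤ → ℤ → ℤ) → ∑∑ L (λ a b → - f a b) ≡ - ∑∑ L f
∑∑-neg L f = trans (∑-cong (range L) λ a → ∑-neg (range L) (f a)) (∑-neg (range L) _)

∑∑-0 : ∀ L {f : ℤ → ℤ → ℤ} → (∀ a b → f a b ≡ 0ℤ) → ∑∑ L f ≡ 0ℤ
∑∑-0 L e = trans (∑-cong (range L) λ a → trans (∑-cong (range L) (e a)) (∑-0 (range L))) (∑-0 (range L))

∑∑-swap : ∀ L (f : ℤ → ℤ → ℤ) → ∑∑ L f ≡ ∑∑ L (λ a b → f b a)
∑∑-swap L f = ∑-comm (range L) (range L) f

∑∑-antisym : ∀ L (f : ℤ → ℤ → ℤ) → (∀ a b → f a b ≡ - f b a) → ∑∑ L f ≡ 0ℤ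
∑∑-antisym L f e = ≡-neg⇒0 (trans (∑∑-cong L e) (trans (∑∑-neg L _) (cong -_ (sym (∑∑-swap L f)))))

∑∑-comm : ∀ L (f : ℤ → ℤ → ℤ → ℤ → ℤ) →
  ∑∑ L (λ a b → ∑∑ L (f a b)) ≡ ∑∑ L (λ c d → ∑∑ L (λ a b → f a b c d))
∑∑-comm L f = S-comm L 2 L 2 (λ { (a ∷ b ∷ []) (c ∷ d ∷ []) → f a b c d })

reflect : ∀ {L} c (f : ℤ → ℤ) → (∀ k → f k ≢ 0ℤ → ∣ k ∣ ≤ L × ∣ c - k ∣ ≤ L) →
  ∑ (range L) f ≡ ∑ (range L) (λ k → f (c - k))
reflect {L} c f supp = reindex-iso {L} {L} {1} {1} (λ { (k ∷ []) → f k }) (λ { (k ∷ []) → f (c - k) })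
  (λ { (k ∷ []) → c - k ∷ [] }) (λ { (k ∷ []) → c - k ∷ [] })
  (λ { (k ∷ []) → cong (_∷ []) (lem c k) }) (λ { (k ∷ []) → cong (_∷ []) (lem c k) })
  (λ { (k ∷ []) → cong f (lem c k) })
  (λ { (k ∷ []) p → let (x , y) = supp k p in (x ∷ []) , (y ∷ []) })
  where
  lem : ∀ c k → c - (c - k) ≡ k
  lem = solve-∀

translate : ∀ {L} c (f : ℤ → ℤ) → (∀ k → f k ≢ 0ℤ → ∣ k ∣ ≤ L × ∣ k - c ∣ ≤ L) →
  ∑ (range L) f ≡ ∑ (range L) (λ k → f (k + c))
translate {L} c f supp = reindex-iso {L} {L} {1} {1} (λ { (k ∷ []) → f k }) (λ { (k ∷ []) → f (k + c) })
  (λ { (k ∷ []) → k - c ∷ [] }) (λ { (k ∷ []) → k + c ∷ [] })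
  (λ { (k ∷ []) → cong (_∷ []) (lem c k) }) (λ { (k ∷ []) → cong (_∷ []) (lem′ c k) })
  (λ { (k ∷ []) → cong f (lem c k) })
  (λ { (k ∷ []) p → let (x , y) = supp k p in (x ∷ []) , (y ∷ []) })
  where
  lem : ∀ c k → k - c + c ≡ k
  lem = solve-∀
  lem′ : ∀ c k → k + c - c ≡ k
  lem′ = solve-∀

reflect-antisym : ∀ {L} c (f : ℤ → ℤ) → (∀ k → f (c - k) ≡ - f k) → (∀ k → f k ≢ 0ℤ → ∣ k ∣ ≤ L × ∣ c - k ∣ ≤ L) →
  ∑ (range L) f ≡ 0ℤ
reflect-antisym {L} c f e supp = ≡-neg⇒0 (trans (reflect c f supp) (trans (∑-cong (range L) e) (∑-neg (range L) f)))

-- For variables bounded by `k` units of size `suc N`, the demand `3N + 1` of `rotate` becomes the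
-- multiplier `3 k + 1`.
rotateB : ∀ {L N} k K {k≤K : True (suc (3 ℕ.* k) ℕ.≤? K)} → K ℕ.* suc N ≤ L → (f : ℤ → ℤ → ℤ) →
  (∀ a b → f a b ≢ 0ℤ → Bounded N k a × Bounded N k b) →
  ∑∑ L f ≡ ∑∑ L (λ s d → f (s + d) (s - d)) + ∑∑ L (λ s d → f (s + d + 1ℤ) (s - d))
rotateB {L} {N} k K {w} KN≤L f supp = rotate {L} {k ℕ.* suc N} f
  (ℕ.≤-trans (ℕ.≤-trans (ℕ.+-mono-≤ (s≤s (z≤n {N})) (ℕ.≤-reflexive (sym (ℕ.*-assoc 3 k (suc N))))) (ℕ.*-monoˡ-≤ (suc N) (toWitness w))) KN≤L)
  (λ a b p → let (x , y) = supp a b p in size x , size y)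

*-≢0ʳ : ∀ a {b} → a * b ≢ 0ℤ → b ≢ 0ℤ
*-≢0ʳ a p refl = p (ℤ.*-zeroʳ a)

*-≢0ˡ : ∀ a {b} → a * b ≢ 0ℤ → a ≢ 0ℤ
*-≢0ˡ a {b} p refl = p (ℤ.*-zeroˡ b)

*-neg-cong : ∀ {a a′ b b′} → a ≡ - a′ → b ≡ b′ → a * b ≡ - (a′ * b′)
*-neg-cong {a′ = a′} {b} refl refl = sym (ℤ.neg-distribˡ-* a′ b)

-- Rotating by 45° turns the square of J into a sum over all pairs (e , f), each term of J² occurring twice.
J-square : ∀ {L N} → 40 ℕ.* suc N ≤ L → (Ψ : ℤ → ℤ) →
  (∀ e f → Ψ (+ 2 * (f * f) + + 2 * f + + 2 * (e * e)) ≢ 0ℤ → Bounded N 4 e × Bounded N 4 f) →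
  ∑∑ L (λ e f → ((+ 2 * f + 1ℤ) * (+ 2 * f + 1ℤ) - + 4 * (e * e)) * Ψ (+ 2 * (f * f) + + 2 * f + + 2 * (e * e))) ≡
  + 2 * ∑∑ L (λ i j → ((+ 4 * i + 1ℤ) * (+ 4 * j + 1ℤ)) * Ψ (+ 2 * (i * (+ 2 * i + 1ℤ)) + + 2 * (j * (+ 2 * j + 1ℤ))))
J-square {L} {N} big Ψ supp = begin
  ∑∑ L g
    ≡⟨ ∑-cong (range L) double ⟩
  ∑ (range L) (λ e → + 2 * ∑ (range L) (λ s → g e (+ 2 * s)))
    ≡⟨ ∑-*ˡ (range L) (+ 2) _ ⟩
  + 2 * ∑ (range L) (λ e → ∑ (range L) (λ s → g e (+ 2 * s)))
    ≡⟨ cong (+ 2 *_) (trans (∑-comm (range L) (range L) _) (trans (∑-cong (range L) λ s →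
         parity-split {L} {4 ℕ.* suc N} (λ e → g e (+ 2 * s)) (ℕ.≤-trans (ℕ.*-monoˡ-≤ (suc N) 4≤40) big) (λ e p → size (proj₁ (suppg e (+ 2 * s) p)))) (∑-+ (range L) _ _))) ⟩
  + 2 * (∑∑ L (λ s d → g (+ 2 * d) (+ 2 * s)) + ∑∑ L (λ s d → g (+ 2 * d + 1ℤ) (+ 2 * s)))
    -- For odd `e` the even `f` are exchanged for the odd ones, so that `e` and `f` have equal
    -- parity, as `i − j` and `i + j` always do.
    ≡⟨ cong (λ z → + 2 * (∑∑ L (λ s d → g (+ 2 * d) (+ 2 * s)) + z)) (trans (∑∑-swap L _) (trans (∑-cong (range L) λ d → odd-even (+ 2 * d + 1ℤ)) (∑∑-swap L _))) ⟩
  + 2 * (∑∑ L (λ s d → g (+ 2 * d) (+ 2 * s)) + ∑∑ L (λ s d → g (+ 2 * d + 1ℤ) (+ 2 * s + 1ℤ)))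
    ≡⟨ cong (+ 2 *_) (cong₂ _+_ (∑∑-cong L even-part) (∑∑-cong L odd-part)) ⟨
  + 2 * (∑∑ L (λ s d → h (s + d) (s - d)) + ∑∑ L (λ s d → h (s + d + 1ℤ) (s - d)))
    ≡⟨ cong (+ 2 *_) (rotateB 8 40 big h supph) ⟨
  + 2 * ∑∑ L h ∎
  where
  open ≡-Reasoning
  g h : ℤ → ℤ → ℤ
  g e f = ((+ 2 * f + 1ℤ) * (+ 2 * f + 1ℤ) - + 4 * (e * e)) * Ψ (+ 2 * (f * f) + + 2 * f + + 2 * (e * e))
  h i j = ((+ 4 * i + 1ℤ) * (+ 4 * j + 1ℤ)) * Ψ (+ 2 * (i * (+ 2 * i + 1ℤ)) + + 2 * (j * (+ 2 * j + 1ℤ)))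
  4≤40 : 4 ≤ 40
  4≤40 = s≤s (s≤s (s≤s (s≤s z≤n)))
  suppg : ∀ e f → g e f ≢ 0ℤ → Bounded N 4 e × Bounded N 4 f
  suppg e f p = supp e f (*-≢0ʳ ((+ 2 * f + 1ℤ) * (+ 2 * f + 1ℤ) - + 4 * (e * e)) p)
  -- `f ↦ −1 − f` preserves the weight and the exponent and exchanges even and odd `f`.
  g-reflect : ∀ e s → g e (+ 2 * (- 1ℤ - s) + 1ℤ) ≡ g e (+ 2 * s)
  g-reflect e s = cong₂ (λ x y → x * Ψ y) (l₁ e s) (l₂ e s)
    where
    l₁ : ∀ e s → (+ 2 * (+ 2 * (- 1ℤ - s) + 1ℤ) + 1ℤ) * (+ 2 * (+ 2 * (- 1ℤ - s) + 1ℤ) + 1ℤ) - + 4 * (e * e) ≡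
      (+ 2 * (+ 2 * s) + 1ℤ) * (+ 2 * (+ 2 * s) + 1ℤ) - + 4 * (e * e)
    l₁ = solve-∀
    l₂ : ∀ e s → + 2 * ((+ 2 * (- 1ℤ - s) + 1ℤ) * (+ 2 * (- 1ℤ - s) + 1ℤ)) + + 2 * (+ 2 * (- 1ℤ - s) + 1ℤ) + + 2 * (e * e) ≡
      + 2 * ((+ 2 * s) * (+ 2 * s)) + + 2 * (+ 2 * s) + + 2 * (e * e)
    l₂ = solve-∀
  odd-even : ∀ e → ∑ (range L) (λ s → g e (+ 2 * s)) ≡ ∑ (range L) (λ s → g e (+ 2 * s + 1ℤ))
  odd-even e = sym (trans (reflect (- 1ℤ) (λ s → g e (+ 2 * s + 1ℤ)) λ s p →
    let b = Bhalf1 {a = s} (proj₂ (suppg e (+ 2 * s + 1ℤ) p)) in Bk 4 40 big b , Bk 5 40 big (B- {k = 1} {a = - 1ℤ} {b = s} (bounded (s≤s z≤n)) b))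
    (∑-cong (range L) (g-reflect e)))
  double : ∀ e → ∑ (range L) (g e) ≡ + 2 * ∑ (range L) (λ s → g e (+ 2 * s))
  double e = trans (parity-split {L} {4 ℕ.* suc N} (g e) (ℕ.≤-trans (ℕ.*-monoˡ-≤ (suc N) 4≤40) big) (λ f p → size (proj₂ (suppg e f p))))
    (trans (cong (λ z → ∑ (range L) (λ s → g e (+ 2 * s)) + z) (sym (odd-even e))) (l _))
    where
    l : ∀ x → x + x ≡ + 2 * x
    l = solve-∀
  supph : ∀ i j → h i j ≢ 0ℤ → Bounded N 8 i × Bounded N 8 j
  supph i j p = Bhalf (B≡ (l₁ i j) (B+ be bf)) , Bhalf (B≡ (l₂ i j) (B- bf be))
    where
    l₀ : ∀ i j → + 2 * (i * (+ 2 * i + 1ℤ)) + + 2 * (j * (+ 2 * j + 1ℤ)) ≡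
      + 2 * ((i + j) * (i + j)) + + 2 * (i + j) + + 2 * ((i - j) * (i - j))
    l₀ = solve-∀
    l₁ : ∀ i j → (i - j) + (i + j) ≡ + 2 * i
    l₁ = solve-∀
    l₂ : ∀ i j → (i + j) - (i - j) ≡ + 2 * j
    l₂ = solve-∀
    bs = supp (i - j) (i + j) (λ q → *-≢0ʳ ((+ 4 * i + 1ℤ) * (+ 4 * j + 1ℤ)) p (trans (cong Ψ (l₀ i j)) q))
    be = proj₁ bs
    bf = proj₂ bs
  even-part : ∀ s d → h (s + d) (s - d) ≡ g (+ 2 * d) (+ 2 * s)
  even-part s d = cong₂ (λ x y → x * Ψ y) (l₁ s d) (l₂ s d)
    where
    l₁ : ∀ s d → (+ 4 * (s + d) + 1ℤ) * (+ 4 * (s - d) + 1ℤ) ≡ (+ 2 * (+ 2 * s) + 1ℤ) * (+ 2 * (+ 2 * s) + 1ℤ) - + 4 * (+ 2 * d * (+ 2 * d))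
    l₁ = solve-∀
    l₂ : ∀ s d → + 2 * ((s + d) * (+ 2 * (s + d) + 1ℤ)) + + 2 * ((s - d) * (+ 2 * (s - d) + 1ℤ)) ≡
      + 2 * (+ 2 * s * (+ 2 * s)) + + 2 * (+ 2 * s) + + 2 * (+ 2 * d * (+ 2 * d))
    l₂ = solve-∀
  odd-part : ∀ s d → h (s + d + 1ℤ) (s - d) ≡ g (+ 2 * d + 1ℤ) (+ 2 * s + 1ℤ)
  odd-part s d = cong₂ (λ x y → x * Ψ y) (l₁ s d) (l₂ s d)
    where
    l₁ : ∀ s d → (+ 4 * (s + d + 1ℤ) + 1ℤ) * (+ 4 * (s - d) + 1ℤ) ≡
      (+ 2 * (+ 2 * s + 1ℤ) + 1ℤ) * (+ 2 * (+ 2 * s + 1ℤ) + 1ℤ) - + 4 * ((+ 2 * d + 1ℤ) * (+ 2 * d + 1ℤ))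
    l₁ = solve-∀
    l₂ : ∀ s d → + 2 * ((s + d + 1ℤ) * (+ 2 * (s + d + 1ℤ) + 1ℤ)) + + 2 * ((s - d) * (+ 2 * (s - d) + 1ℤ)) ≡
      + 2 * ((+ 2 * s + 1ℤ) * (+ 2 * s + 1ℤ)) + + 2 * (+ 2 * s + 1ℤ) + + 2 * ((+ 2 * d + 1ℤ) * (+ 2 * d + 1ℤ))
    l₂ = solve-∀

-- Signs and the addition formula for theta functions

sg : ℤ → ℤ
sg k with parity k
... | even _ = 1ℤ
... | odd _ = - 1ℤ

sg-even : ∀ {k} a → k ≡ + 2 * a → sg k ≡ 1ℤ
sg-even {k} a refl with parity k
... | even _ = refl
... | odd e = ⊥-elim (2a≢2b+1 a (half (+ 2 * a)) e)

sg-odd : ∀ {k} a → k ≡ + 2 * a + 1ℤ → sg k ≡ - 1ℤ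
sg-odd {k} a refl with parity k
... | even e = ⊥-elim (2a≢2b+1 (half (+ 2 * a + 1ℤ)) a (sym e))
... | odd _ = refl

sg-+ : ∀ a b → sg (a + b) ≡ sg a * sg b
sg-+ a b with parity a | parity b
... | even p | even q = sg-even (half a + half b) (trans (cong₂ _+_ p q) (l (half a) (half b)))
  where
  l : ∀ x y → + 2 * x + + 2 * y ≡ + 2 * (x + y)
  l = solve-∀
... | even p | odd q = sg-odd (half a + half b) (trans (cong₂ _+_ p q) (l (half a) (half b)))
  where
  l : ∀ x y → + 2 * x + (+ 2 * y + 1ℤ) ≡ + 2 * (x + y) + 1ℤ
  l = solve-∀
... | odd p | even q = sg-odd (half a + half b) (trans (cong₂ _+_ p q) (l (half a) (half b)))
  where
  l : ∀ x y → + 2 * x + 1ℤ + + 2 * y ≡ + 2 * (x + y) + 1ℤ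
  l = solve-∀
... | odd p | odd q = sg-even (half a + half b + 1ℤ) (trans (cong₂ _+_ p q) (l (half a) (half b)))
  where
  l : ∀ x y → + 2 * x + 1ℤ + (+ 2 * y + 1ℤ) ≡ + 2 * (x + y + 1ℤ)
  l = solve-∀

∑∑-regroup : ∀ L (f : ℤ → ℤ → ℤ → ℤ → ℤ) →
  ∑∑ L (λ s e → ∑∑ L (f s e)) ≡ ∑∑ L (λ s u → ∑∑ L (λ e v → f s e u v))
∑∑-regroup L f = ∑-cong (range L) λ s → ∑-comm (range L) (range L) _

module _ {L N : ℕ} (big : 40 ℕ.* suc N ≤ L) (Φ : ℤ → ℤ → ℤ → ℤ)
  (supp : ∀ a b c d → Φ (a * a + b * b + c * c + d * d) (a + b) (c + d) ≢ 0ℤ →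
    (Bounded N 1 a × Bounded N 1 b) × (Bounded N 1 c × Bounded N 1 d)) where
  open ≡-Reasoning
  private
    F : ℤ → ℤ → ℤ → ℤ → ℤ
    F a b c d = ((a - b) * (a - b) - (c - d) * (c - d)) * (sg (c + d) * Φ (a * a + b * b + c * c + d * d) (a + b) (c + d))

    suppF : ∀ a b c d → F a b c d ≢ 0ℤ → (Bounded N 1 a × Bounded N 1 b) × (Bounded N 1 c × Bounded N 1 d)
    suppF a b c d p = supp a b c d (*-≢0ʳ (sg (c + d)) (*-≢0ʳ ((a - b) * (a - b) - (c - d) * (c - d)) p))

    κ : ℤ → ℤ → ℤ
    κ i j = + 2 * (i * (+ 2 * i + 1ℤ)) + + 2 * (j * (+ 2 * j + 1ℤ))

    -- `EO` belongs to the quadruples with `a + b = 2s` and `c + d = 2u + 1`, `OE` to those with the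
    -- parities exchanged. The argument `z` is the part of the exponent that depends on the
    -- differences `a − b` and `c − d`.
    EO OE : ℤ → ℤ → ℤ → ℤ
    EO s u z = Φ (+ 2 * (s * s) + (+ 2 * (u * u) + + 2 * u + 1ℤ) + z) (+ 2 * s) (+ 2 * u + 1ℤ)
    OE s u z = Φ (+ 2 * (s * s) + + 2 * s + 1ℤ + + 2 * (u * u) + z) (+ 2 * s + 1ℤ) (+ 2 * u)

    G : ℤ → ℤ → ℤ → ℤ → ℤ
    G i j x y = ((+ 4 * i + 1ℤ) * (+ 4 * j + 1ℤ)) * Φ (κ i j + (x * x + y * y - (x - y - 1ℤ))) (x + y) (x - y - 1ℤ)

    Φ-cong : ∀ {e e′ s s′ t t′} → e ≡ e′ → s ≡ s′ → t ≡ t′ → Φ e s t ≡ Φ e′ s′ t′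
    Φ-cong refl refl refl = refl

    z₃ : ℤ → ℤ → ℤ
    z₃ e f = + 2 * (f * f) + + 2 * f + + 2 * (e * e)

    EO-abcd : ∀ s u e f → EO s u (z₃ e f) ≡
      Φ ((s + e) * (s + e) + (s - e) * (s - e) + (u + f + 1ℤ) * (u + f + 1ℤ) + (u - f) * (u - f)) ((s + e) + (s - e)) ((u + f + 1ℤ) + (u - f))
    EO-abcd s u e f = Φ-cong (l₁ s u e f) (l₂ s e) (l₃ u f)
      where
      l₁ : ∀ s u e f → + 2 * (s * s) + (+ 2 * (u * u) + + 2 * u + 1ℤ) + (+ 2 * (f * f) + + 2 * f + + 2 * (e * e)) ≡
        (s + e) * (s + e) + (s - e) * (s - e) + (u + f + 1ℤ) * (u + f + 1ℤ) + (u - f) * (u - f)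
      l₁ = solve-∀
      l₂ : ∀ s e → + 2 * s ≡ (s + e) + (s - e)
      l₂ = solve-∀
      l₃ : ∀ u f → + 2 * u + 1ℤ ≡ (u + f + 1ℤ) + (u - f)
      l₃ = solve-∀

    OE-abcd : ∀ s u e f → OE s u (z₃ e f) ≡
      Φ ((s + f + 1ℤ) * (s + f + 1ℤ) + (s - f) * (s - f) + (u + e) * (u + e) + (u - e) * (u - e)) ((s + f + 1ℤ) + (s - f)) ((u + e) + (u - e))
    OE-abcd s u e f = Φ-cong (l₁ s u e f) (l₃ s f) (l₂ u e)
      where
      l₁ : ∀ s u e f → + 2 * (s * s) + + 2 * s + 1ℤ + + 2 * (u * u) + (+ 2 * (f * f) + + 2 * f + + 2 * (e * e)) ≡
        (s + f + 1ℤ) * (s + f + 1ℤ) + (s - f) * (s - f) + (u + e) * (u + e) + (u - e) * (u - e)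
      l₁ = solve-∀
      l₂ : ∀ s e → + 2 * s ≡ (s + e) + (s - e)
      l₂ = solve-∀
      l₃ : ∀ u f → + 2 * u + 1ℤ ≡ (u + f + 1ℤ) + (u - f)
      l₃ = solve-∀

    Bdiff : ∀ s e {k l} → Bounded N k (s + e) → Bounded N l (s - e) → Bounded N (k ℕ.+ l) e
    Bdiff s e p q = Bhalf (B≡ (l s e) (B- p q))
      where
      l : ∀ s e → (s + e) - (s - e) ≡ + 2 * e
      l = solve-∀

    Bsum : ∀ s e {k l} → Bounded N k (s + e) → Bounded N l (s - e) → Bounded N (k ℕ.+ l) s
    Bsum s e p q = Bhalf (B≡ (l s e) (B+ p q))
      where
      l : ∀ s e → (s + e) + (s - e) ≡ + 2 * s
      l = solve-∀

    Bdiff1 : ∀ s e {k l} → Bounded N k (s + e + 1ℤ) → Bounded N l (s - e) → Bounded N (k ℕ.+ l) e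
    Bdiff1 s e p q = Bhalf1 (B≡ (l s e) (B- p q))
      where
      l : ∀ s e → (s + e + 1ℤ) - (s - e) ≡ + 2 * e + 1ℤ
      l = solve-∀

    Bsum1 : ∀ s e {k l} → Bounded N k (s + e + 1ℤ) → Bounded N l (s - e) → Bounded N (k ℕ.+ l) s
    Bsum1 s e p q = Bhalf1 (B≡ (l s e) (B+ p q))
      where
      l : ∀ s e → (s + e + 1ℤ) + (s - e) ≡ + 2 * s + 1ℤ
      l = solve-∀

    suppEO : ∀ s u e f → EO s u (z₃ e f) ≢ 0ℤ → (Bounded N 2 s × Bounded N 2 u) × (Bounded N 4 e × Bounded N 4 f)
    suppEO s u e f p =
      let ((ba , bb) , (bc , bd)) = supp (s + e) (s - e) (u + f + 1ℤ) (u - f) (λ q → p (trans (EO-abcd s u e f) q))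
      in (Bsum s e ba bb , Bsum1 u f bc bd) , (bounded (ℕ.≤-trans (size (Bdiff s e ba bb)) up) , bounded (ℕ.≤-trans (size (Bdiff1 u f bc bd)) up))
      where
      up : 2 ℕ.* suc N ≤ 4 ℕ.* suc N
      up = ℕ.*-monoˡ-≤ (suc N) (s≤s (s≤s (z≤n {2})))

    suppOE : ∀ s u e f → OE s u (z₃ e f) ≢ 0ℤ → (Bounded N 2 s × Bounded N 2 u) × (Bounded N 4 e × Bounded N 4 f)
    suppOE s u e f p =
      let ((ba , bb) , (bc , bd)) = supp (s + f + 1ℤ) (s - f) (u + e) (u - e) (λ q → p (trans (OE-abcd s u e f) q))
      in (Bsum1 s f ba bb , Bsum u e bc bd) , (bounded (ℕ.≤-trans (size (Bdiff u e bc bd)) up) , bounded (ℕ.≤-trans (size (Bdiff1 s f ba bb)) up))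
      where
      up : 2 ℕ.* suc N ≤ 4 ℕ.* suc N
      up = ℕ.*-monoˡ-≤ (suc N) (s≤s (s≤s (z≤n {2})))

    κ-z₃ : ∀ i j → κ i j ≡ z₃ (i - j) (i + j)
    κ-z₃ = l
      where
      l : ∀ i j → + 2 * (i * (+ 2 * i + 1ℤ)) + + 2 * (j * (+ 2 * j + 1ℤ)) ≡
        + 2 * ((i + j) * (i + j)) + + 2 * (i + j) + + 2 * ((i - j) * (i - j))
      l = solve-∀

    H : (ℤ → ℤ → ℤ → ℤ) → ℤ → ℤ → ℤ → ℤ → ℤ
    H E i j s u = ((+ 4 * i + 1ℤ) * (+ 4 * j + 1ℤ)) * E s u (κ i j)

    -- Rotation by `u + 1` instead of `u` makes `x − y − 1` equal to `2u + 1`, as in `EO`; the odd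
    -- class fits `OE` as it stands.
    G-even : ∀ i j s u → G i j (s + (u + 1ℤ)) (s - (u + 1ℤ)) ≡ H EO i j s u
    G-even i j s u = cong (((+ 4 * i + 1ℤ) * (+ 4 * j + 1ℤ)) *_) (Φ-cong (l₁ (κ i j) s u) (l₂ s u) (l₃ s u))
      where
      l₁ : ∀ k s u → k + ((s + (u + 1ℤ)) * (s + (u + 1ℤ)) + (s - (u + 1ℤ)) * (s - (u + 1ℤ)) - ((s + (u + 1ℤ)) - (s - (u + 1ℤ)) - 1ℤ)) ≡
        + 2 * (s * s) + (+ 2 * (u * u) + + 2 * u + 1ℤ) + k
      l₁ = solve-∀
      l₂ : ∀ s u → (s + (u + 1ℤ)) + (s - (u + 1ℤ)) ≡ + 2 * s
      l₂ = solve-∀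
      l₃ : ∀ s u → (s + (u + 1ℤ)) - (s - (u + 1ℤ)) - 1ℤ ≡ + 2 * u + 1ℤ
      l₃ = solve-∀

    G-odd : ∀ i j s u → G i j (s + u + 1ℤ) (s - u) ≡ H OE i j s u
    G-odd i j s u = cong (((+ 4 * i + 1ℤ) * (+ 4 * j + 1ℤ)) *_) (Φ-cong (l₁ (κ i j) s u) (l₂ s u) (l₃ s u))
      where
      l₁ : ∀ k s u → k + ((s + u + 1ℤ) * (s + u + 1ℤ) + (s - u) * (s - u) - ((s + u + 1ℤ) - (s - u) - 1ℤ)) ≡
        + 2 * (s * s) + + 2 * s + 1ℤ + + 2 * (u * u) + k
      l₁ = solve-∀
      l₂ : ∀ s u → (s + u + 1ℤ) + (s - u) ≡ + 2 * s + 1ℤ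
      l₂ = solve-∀
      l₃ : ∀ s u → (s + u + 1ℤ) - (s - u) - 1ℤ ≡ + 2 * u
      l₃ = solve-∀

    suppHEO : ∀ i j s u → H EO i j s u ≢ 0ℤ → Bounded N 2 s × Bounded N 2 u
    suppHEO i j s u p = proj₁ (suppEO s u (i - j) (i + j) (λ q → *-≢0ʳ ((+ 4 * i + 1ℤ) * (+ 4 * j + 1ℤ)) p (trans (cong (EO s u) (κ-z₃ i j)) q)))

    suppHOE : ∀ i j s u → H OE i j s u ≢ 0ℤ → Bounded N 2 s × Bounded N 2 u
    suppHOE i j s u p = proj₁ (suppOE s u (i - j) (i + j) (λ q → *-≢0ʳ ((+ 4 * i + 1ℤ) * (+ 4 * j + 1ℤ)) p (trans (cong (OE s u) (κ-z₃ i j)) q)))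

    suppG : ∀ i j x y → G i j x y ≢ 0ℤ → Bounded N 5 x × Bounded N 5 y
    suppG i j x y p with parity (x + y)
    ... | even e =
      let h = half (x + y); u = x - h - 1ℤ
          ex = l₁ x h; ey = trans (l₂ x h) (trans (cong (_- x) (sym e)) (l₃ x y))
          (bs , bu) = suppHEO i j h u (λ q → p (trans (sym (cong₂ (G i j) ex ey)) (trans (G-even i j h u) q)))
      in B≡ ex (B+ bs (B+ bu B1)) , B≡ ey (B- bs (B+ bu B1))
      where
      l₁ : ∀ x h → h + (x - h - 1ℤ + 1ℤ) ≡ x
      l₁ = solve-∀
      l₂ : ∀ x h → h - (x - h - 1ℤ + 1ℤ) ≡ + 2 * h - x
      l₂ = solve-∀
      l₃ : ∀ x y → x + y - x ≡ y
      l₃ = solve-∀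
    ... | odd e =
      let h = half (x + y); u = x - h - 1ℤ
          ex = l₁ x h; ey = trans (l₂ x h) (trans (cong (_- x) (sym e)) (l₃ x y))
          (bs , bu) = suppHOE i j h u (λ q → p (trans (sym (cong₂ (G i j) ex ey)) (trans (G-odd i j h u) q)))
      in B≡ ex (B+ (B+ bs bu) B1) , bounded (ℕ.≤-trans (size (B≡ ey (B- bs bu))) (ℕ.*-monoˡ-≤ (suc N) (s≤s (s≤s (s≤s (s≤s (z≤n {1})))))))
      where
      l₁ : ∀ x h → h + (x - h - 1ℤ) + 1ℤ ≡ x
      l₁ = solve-∀
      l₂ : ∀ x h → h - (x - h - 1ℤ) ≡ + 2 * h + 1ℤ - x
      l₂ = solve-∀
      l₃ : ∀ x y → x + y - x ≡ y
      l₃ = solve-∀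

    ∑∑G : ∀ i j → ∑∑ L (G i j) ≡ ∑∑ L (H EO i j) + ∑∑ L (H OE i j)
    ∑∑G i j = trans (rotateB 5 40 big (G i j) (suppG i j)) (cong₂ _+_
      (∑-cong (range L) λ s → trans (translate 1ℤ (λ d → G i j (s + d) (s - d)) λ d p →
          let (bx , by) = suppG i j (s + d) (s - d) p in Bk 10 40 big (Bdiff s d bx by) , Bk 11 40 big (B- (Bdiff s d bx by) B1))
        (∑-cong (range L) (G-even i j s)))
      (∑∑-cong L (G-odd i j)))

    -- With `a − b = 2e` and `c − d = 2f`, exchanging `e` and `f` negates the weight and fixes the
    -- sign and the exponents. `OO-zero` uses the same exchange with `2e + 1` and `2f + 1`.
    EE-zero : ∑∑ L (λ s e → ∑∑ L (λ u f → F (s + e) (s - e) (u + f) (u - f))) ≡ 0ℤ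
    EE-zero = trans (∑∑-regroup L _) (∑∑-0 L λ s u → ∑∑-antisym L _ λ e f →
      *-neg-cong (l₁ s u e f) (cong₂ _*_ (cong sg (l₂ u e f)) (Φ-cong (l₃ s u e f) (l₂ s f e) (l₂ u e f))))
      where
      l₁ : ∀ s u e f → ((s + e) - (s - e)) * ((s + e) - (s - e)) - ((u + f) - (u - f)) * ((u + f) - (u - f)) ≡
        - (((s + f) - (s - f)) * ((s + f) - (s - f)) - ((u + e) - (u - e)) * ((u + e) - (u - e)))
      l₁ = solve-∀
      l₂ : ∀ u e f → (u + f) + (u - f) ≡ (u + e) + (u - e)
      l₂ = solve-∀
      l₃ : ∀ s u e f → (s + e) * (s + e) + (s - e) * (s - e) + (u + f) * (u + f) + (u - f) * (u - f) ≡
        (s + f) * (s + f) + (s - f) * (s - f) + (u + e) * (u + e) + (u - e) * (u - e)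
      l₃ = solve-∀

    OO-zero : ∑∑ L (λ s e → ∑∑ L (λ u f → F (s + e + 1ℤ) (s - e) (u + f + 1ℤ) (u - f))) ≡ 0ℤ
    OO-zero = trans (∑∑-regroup L _) (∑∑-0 L λ s u → ∑∑-antisym L _ λ e f →
      *-neg-cong (l₁ s u e f) (cong₂ _*_ (cong sg (l₂ u e f)) (Φ-cong (l₃ s u e f) (l₂ s f e) (l₂ u e f))))
      where
      l₁ : ∀ s u e f → ((s + e + 1ℤ) - (s - e)) * ((s + e + 1ℤ) - (s - e)) - ((u + f + 1ℤ) - (u - f)) * ((u + f + 1ℤ) - (u - f)) ≡
        - (((s + f + 1ℤ) - (s - f)) * ((s + f + 1ℤ) - (s - f)) - ((u + e + 1ℤ) - (u - e)) * ((u + e + 1ℤ) - (u - e)))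
      l₁ = solve-∀
      l₂ : ∀ u e f → (u + f + 1ℤ) + (u - f) ≡ (u + e + 1ℤ) + (u - e)
      l₂ = solve-∀
      l₃ : ∀ s u e f → (s + e + 1ℤ) * (s + e + 1ℤ) + (s - e) * (s - e) + (u + f + 1ℤ) * (u + f + 1ℤ) + (u - f) * (u - f) ≡
        (s + f + 1ℤ) * (s + f + 1ℤ) + (s - f) * (s - f) + (u + e + 1ℤ) * (u + e + 1ℤ) + (u - e) * (u - e)
      l₃ = solve-∀

    odd-sum : ∀ u f → (u + f + 1ℤ) + (u - f) ≡ + 2 * u + 1ℤ
    odd-sum = solve-∀

    even-sum : ∀ u f → (u + f) + (u - f) ≡ + 2 * u
    even-sum = solve-∀

    F-EO : ∀ s u e f → F (s + e) (s - e) (u + f + 1ℤ) (u - f) ≡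
      ((+ 2 * f + 1ℤ) * (+ 2 * f + 1ℤ) - + 4 * (e * e)) * EO s u (z₃ e f)
    F-EO s u e f = trans (cong₂ (λ x y → (((s + e) - (s - e)) * ((s + e) - (s - e)) - ((u + f + 1ℤ) - (u - f)) * ((u + f + 1ℤ) - (u - f))) * (x * y)) (sg-odd {(u + f + 1ℤ) + (u - f)} u (odd-sum u f)) (sym (EO-abcd s u e f))) (l₁ s u e f (EO s u (z₃ e f)))
      where
      l₁ : ∀ s u e f x → (((s + e) - (s - e)) * ((s + e) - (s - e)) - ((u + f + 1ℤ) - (u - f)) * ((u + f + 1ℤ) - (u - f))) * (- 1ℤ * x) ≡
        ((+ 2 * f + 1ℤ) * (+ 2 * f + 1ℤ) - + 4 * (e * e)) * x
      l₁ = solve-∀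

    F-OE : ∀ s u e f → F (s + f + 1ℤ) (s - f) (u + e) (u - e) ≡
      ((+ 2 * f + 1ℤ) * (+ 2 * f + 1ℤ) - + 4 * (e * e)) * OE s u (z₃ e f)
    F-OE s u e f = trans (cong₂ (λ x y → (((s + f + 1ℤ) - (s - f)) * ((s + f + 1ℤ) - (s - f)) - ((u + e) - (u - e)) * ((u + e) - (u - e))) * (x * y)) (sg-even {(u + e) + (u - e)} u (even-sum u e)) (sym (OE-abcd s u e f))) (l₁ s u e f (OE s u (z₃ e f)))
      where
      l₁ : ∀ s u e f x → (((s + f + 1ℤ) - (s - f)) * ((s + f + 1ℤ) - (s - f)) - ((u + e) - (u - e)) * ((u + e) - (u - e))) * (1ℤ * x) ≡
        ((+ 2 * f + 1ℤ) * (+ 2 * f + 1ℤ) - + 4 * (e * e)) * x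
      l₁ = solve-∀

    -- For fixed `s` and `u` there remains the sum over `e` and `f` that `J-square` evaluates; the
    -- sign of the odd number `c + d` turns the weight into `(2f + 1)² − 4e²`.
    EO-part : ∑∑ L (λ s e → ∑∑ L (λ u f → F (s + e) (s - e) (u + f + 1ℤ) (u - f))) ≡
      + 2 * ∑∑ L (λ i j → ∑∑ L (H EO i j))
    EO-part = trans (∑∑-regroup L _) (trans (∑∑-cong L λ s u →
      trans (∑∑-cong L λ e f → F-EO s u e f) (J-square big (EO s u) (λ e f p → proj₂ (suppEO s u e f p))))
      (trans (∑∑-*ˡ L (+ 2) _) (cong (+ 2 *_) (∑∑-comm L _))))

    OE-part : ∑∑ L (λ s e → ∑∑ L (λ u f → F (s + e + 1ℤ) (s - e) (u + f) (u - f))) ≡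
      + 2 * ∑∑ L (λ i j → ∑∑ L (H OE i j))
    OE-part = trans (∑∑-regroup L _) (trans (∑∑-cong L λ s u → trans (∑∑-swap L _)
      (trans (∑∑-cong L λ e f → F-OE s u e f) (J-square big (OE s u) (λ e f p → proj₂ (suppOE s u e f p)))))
      (trans (∑∑-*ˡ L (+ 2) _) (cong (+ 2 *_) (∑∑-comm L _))))

    rotate-cd : ∀ a b → ∑∑ L (F a b) ≡
      ∑∑ L (λ u f → F a b (u + f) (u - f)) + ∑∑ L (λ u f → F a b (u + f + 1ℤ) (u - f))
    rotate-cd a b = rotateB 1 40 big (F a b) (λ c d p → proj₂ (suppF a b c d p))

  -- The coefficient form of H(θ)(W) ψ(v)² − θ(W)² H(ψ)(v) = J² θ(WV) θ(W/V) / V with H(f) = f f″ − f′² and V = v/q.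
  addition-formula :
    ∑∑ L (λ a b → ∑∑ L (λ c d → ((a - b) * (a - b) - (c - d) * (c - d)) *
      (sg (c + d) * Φ (a * a + b * b + c * c + d * d) (a + b) (c + d)))) ≡
    + 2 * ∑∑ L (λ i j → ∑∑ L (λ x y → ((+ 4 * i + 1ℤ) * (+ 4 * j + 1ℤ)) *
      Φ (+ 2 * (i * (+ 2 * i + 1ℤ)) + + 2 * (j * (+ 2 * j + 1ℤ)) + (x * x + y * y - (x - y - 1ℤ))) (x + y) (x - y - 1ℤ)))
  addition-formula = begin
    ∑∑ L (λ a b → ∑∑ L (F a b))
      ≡⟨ trans (∑∑-comm L F) (∑∑-cong L λ c d → rotateB 1 40 big (λ a b → F a b c d) (λ a b p → proj₁ (suppF a b c d p))) ⟩
    ∑∑ L (λ c d → ∑∑ L (λ s e → F (s + e) (s - e) c d) + ∑∑ L (λ s e → F (s + e + 1ℤ) (s - e) c d))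
      ≡⟨ trans (∑∑-+ L _ _) (cong₂ _+_ (∑∑-comm L _) (∑∑-comm L _)) ⟩
    ∑∑ L (λ s e → ∑∑ L (F (s + e) (s - e))) + ∑∑ L (λ s e → ∑∑ L (F (s + e + 1ℤ) (s - e)))
      ≡⟨ cong₂ _+_ (trans (∑∑-cong L λ s e → rotate-cd (s + e) (s - e)) (∑∑-+ L ee eo))
           (trans (∑∑-cong L λ s e → rotate-cd (s + e + 1ℤ) (s - e)) (∑∑-+ L oe oo)) ⟩
    ∑∑ L ee + ∑∑ L eo + (∑∑ L oe + ∑∑ L oo)
      ≡⟨ cong₂ _+_ (cong₂ _+_ EE-zero EO-part) (cong₂ _+_ OE-part OO-zero) ⟩
    0ℤ + + 2 * ∑∑ L (λ i j → ∑∑ L (H EO i j)) + (+ 2 * ∑∑ L (λ i j → ∑∑ L (H OE i j)) + 0ℤ)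
      ≡⟨ l (∑∑ L λ i j → ∑∑ L (H EO i j)) (∑∑ L λ i j → ∑∑ L (H OE i j)) ⟩
    + 2 * (∑∑ L (λ i j → ∑∑ L (H EO i j)) + ∑∑ L (λ i j → ∑∑ L (H OE i j)))
      ≡⟨ cong (+ 2 *_) (trans (sym (∑∑-+ L _ _)) (∑∑-cong L λ i j → sym (∑∑G i j))) ⟩
    + 2 * ∑∑ L (λ i j → ∑∑ L (G i j)) ∎
    where
    l : ∀ x y → 0ℤ + + 2 * x + (+ 2 * y + 0ℤ) ≡ + 2 * (x + y)
    l = solve-∀
    ee eo oe oo : ℤ → ℤ → ℤ
    ee s e = ∑∑ L (λ u f → F (s + e) (s - e) (u + f) (u - f))
    eo s e = ∑∑ L (λ u f → F (s + e) (s - e) (u + f + 1ℤ) (u - f))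
    oe s e = ∑∑ L (λ u f → F (s + e + 1ℤ) (s - e) (u + f) (u - f))
    oo s e = ∑∑ L (λ u f → F (s + e + 1ℤ) (s - e) (u + f + 1ℤ) (u - f))

-- Inequalities for quadratic exponents

*-nonneg : ∀ {a b} → 0ℤ ℤ.≤ a → 0ℤ ℤ.≤ b → 0ℤ ℤ.≤ a * b
*-nonneg {+ m} {+ n} _ _ = subst (0ℤ ℤ.≤_) (ℤ.pos-* m n) (ℤ.+≤+ z≤n)

+-nonneg : ∀ {a b} → 0ℤ ℤ.≤ a → 0ℤ ℤ.≤ b → 0ℤ ℤ.≤ a + b
+-nonneg = ℤ.+-mono-≤

0≤+ : ∀ {n} → 0ℤ ℤ.≤ + n
0≤+ = ℤ.+≤+ z≤n

nonneg : ∀ {a b} → a ≡ b → 0ℤ ℤ.≤ b → 0ℤ ℤ.≤ a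
nonneg refl p = p

∣x∣≤x*x : ∀ x → + ∣ x ∣ ℤ.≤ x * x
∣x∣≤x*x (+ zero) = 0≤+
∣x∣≤x*x (+ suc n) = ℤ.+≤+ (ℕ.m≤m*n (suc n) (suc n))
∣x∣≤x*x -[1+ n ] = ℤ.+≤+ (ℕ.m≤m*n (suc n) (suc n))

square-nonneg : ∀ x → 0ℤ ℤ.≤ x * x
square-nonneg x = ℤ.≤-trans 0≤+ (∣x∣≤x*x x)

pronic-nonneg : ∀ x → 0ℤ ℤ.≤ x * x + x
pronic-nonneg (+ n) = +-nonneg (square-nonneg (+ n)) 0≤+
pronic-nonneg -[1+ n ] = nonneg (l (+ n)) (*-nonneg {+ n} {+ suc n} 0≤+ 0≤+)
  where
  l : ∀ n → (- (1ℤ + n)) * (- (1ℤ + n)) + - (1ℤ + n) ≡ n * (1ℤ + n)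
  l = solve-∀

∣x∣≤x[2x+1] : ∀ x → + ∣ x ∣ ℤ.≤ x * (+ 2 * x + 1ℤ)
∣x∣≤x[2x+1] x = ℤ.≤-trans (∣x∣≤x*x x) (subst (x * x ℤ.≤_) (l x) (ℤ.≤-trans (ℤ.≤-reflexive (sym (ℤ.+-identityʳ _))) (ℤ.+-monoʳ-≤ (x * x) (pronic-nonneg x))))
  where
  l : ∀ x → x * x + (x * x + x) ≡ x * (+ 2 * x + 1ℤ)
  l = solve-∀

hexagonal-nonneg : ∀ x → 0ℤ ℤ.≤ x * (+ 2 * x + 1ℤ)
hexagonal-nonneg x = ℤ.≤-trans 0≤+ (∣x∣≤x[2x+1] x)

-- The standard way to bound an index `x`: the degree `e` is a part `p` that dominates `∣ x ∣` plus
-- a nonnegative remainder `r`.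
≤-dominated : ∀ {x N p e} r → + ∣ x ∣ ℤ.≤ p → p + r ≡ e → 0ℤ ℤ.≤ r → e ℤ.≤ + N → Bounded N 1 x
≤-dominated {x} {N} {p} r xp refl 0≤r e≤N = bounded (ℕ.≤-trans (ℤ.drop‿+≤+ (ℤ.≤-trans xp
  (ℤ.≤-trans (subst (ℤ._≤ p + r) (ℤ.+-identityʳ p) (ℤ.+-monoʳ-≤ p 0≤r)) e≤N))) (ℕ.≤-trans (ℕ.n≤1+n N) (ℕ.≤-reflexive (sym (ℕ.+-identityʳ (suc N))))))

Bweaken : ∀ {N k l z} {k≤l : True (k ℕ.≤? l)} → Bounded N k z → Bounded N l z
Bweaken {N} {k≤l = w} (bounded p) = bounded (ℕ.≤-trans p (ℕ.*-monoˡ-≤ (suc N) (toWitness w)))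

i≤∣i∣ : ∀ x → x ℤ.≤ + ∣ x ∣
i≤∣i∣ (+ n) = ℤ.≤-refl
i≤∣i∣ -[1+ n ] = ℤ.-≤+

+∣i∣≡±i : ∀ i → + ∣ i ∣ ≡ i ⊎ + ∣ i ∣ ≡ - i
+∣i∣≡±i (+ n) = inj₁ refl
+∣i∣≡±i -[1+ n ] = inj₂ refl

-- If `∣ x ∣` exceeded `∣ a ∣ + n`, then `x² ≥ (1 + ∣ a ∣) ∣ x ∣ > n + ∣ a ∣ ∣ x ∣`.
quadratic-bound : ∀ x a n → x * x + a * x ℤ.≤ + n → ∣ x ∣ ≤ ∣ a ∣ ℕ.+ n
quadratic-bound x a n h with ∣ x ∣ ℕ.≤? ∣ a ∣ ℕ.+ n
... | yes p = p
... | no p = ⊥-elim (ℕ.<-irrefl refl (ℕ.<-≤-trans strict upper))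
  where
  X = ∣ x ∣
  A = ∣ a ∣
  x² : x * x ≡ + (X ℕ.* X)
  x² = trans (sym (ℤ.0≤i⇒+∣i∣≡i (square-nonneg x))) (cong +_ (ℤ.abs-* x x))
  ax : - (a * x) ℤ.≤ + (A ℕ.* X)
  ax = ℤ.≤-trans (i≤∣i∣ (- (a * x))) (ℤ.≤-reflexive (cong +_ (trans (ℤ.∣-i∣≡∣i∣ (a * x)) (ℤ.abs-* a x))))
  upper : X ℕ.* X ≤ n ℕ.+ A ℕ.* X
  upper = ℤ.drop‿+≤+ (subst₂ ℤ._≤_ (trans (l (x * x) (a * x)) x²) refl (ℤ.+-mono-≤ h ax))
    where
    l : ∀ s t → s + t + - t ≡ s
    l = solve-∀
  strict : n ℕ.+ A ℕ.* X ℕ.< X ℕ.* X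
  strict = ℕ.<-≤-trans (ℕ.+-monoˡ-< (A ℕ.* X) (ℕ.<-≤-trans (ℕ.≤-<-trans (ℕ.m≤n+m n A) (ℕ.≰⇒> p)) (ℕ.≤-reflexive (sym (ℕ.*-identityˡ X)))))
    (ℕ.≤-trans (ℕ.≤-reflexive (sym (ℕ.*-distribʳ-+ X 1 A))) (ℕ.*-monoˡ-≤ X (ℕ.≤-trans (s≤s (ℕ.m≤m+n A n)) (ℕ.≰⇒> p))))

-- Indicators and sign patterns

ind : ℤ → ℤ → ℤ
ind a b = if does (a ℤ.≤? b) then 1ℤ else 0ℤ

ind-≤ : ∀ {a b} → a ℤ.≤ b → ind a b ≡ 1ℤ
ind-≤ {a} {b} p with a ℤ.≤? b
... | yes _ = refl
... | no q = ⊥-elim (q p)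

ind-≰ : ∀ {a b} → ¬ a ℤ.≤ b → ind a b ≡ 0ℤ
ind-≰ {a} {b} p with a ℤ.≤? b
... | yes q = ⊥-elim (p q)
... | no _ = refl

ind-shift : ∀ a b x → ind (a + x) (b + x) ≡ ind a b
ind-shift a b x with a ℤ.≤? b
... | yes p = ind-≤ {a + x} {b + x} (ℤ.+-monoˡ-≤ x p)
... | no p = ind-≰ {a + x} {b + x} λ q → p (subst₂ ℤ._≤_ (l a x) (l b x) (ℤ.+-monoˡ-≤ (- x) q))
  where
  l : ∀ a x → a + x + - x ≡ a
  l = solve-∀

≤∧≢⇒suc≤ : ∀ {a b} → a ℤ.≤ b → a ≢ b → a + 1ℤ ℤ.≤ b
≤∧≢⇒suc≤ {a} p q = subst (ℤ._≤ _) (ℤ.+-comm 1ℤ a) (ℤ.i<j⇒suc[i]≤j (ℤ.≤∧≢⇒< p q))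

≰⇒suc≤ : ∀ {a b} → ¬ a ℤ.≤ b → b + 1ℤ ℤ.≤ a
≰⇒suc≤ {a} {b} p = subst (ℤ._≤ _) (ℤ.+-comm 1ℤ b) (ℤ.i<j⇒suc[i]≤j (ℤ.≰⇒> p))

suc≰ : ∀ a → ¬ a + 1ℤ ℤ.≤ a
suc≰ a p = ℤ.<-irrefl refl (ℤ.suc[i]≤j⇒i<j (subst (ℤ._≤ a) (ℤ.+-comm a 1ℤ) p))

ind-step : ∀ c d → ind c d ≡ ind (c + 1ℤ) d + δ c d
ind-step c d with c ≟ d
... | yes refl = trans (ind-≤ (ℤ.≤-refl {c})) (cong (_+ 1ℤ) (sym (ind-≰ (suc≰ c))))
... | no c≢d with c ℤ.≤? d
...   | yes p = cong (_+ 0ℤ) (sym (ind-≤ (≤∧≢⇒suc≤ p c≢d)))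
...   | no p = cong (_+ 0ℤ) (sym (ind-≰ λ q → p (ℤ.≤-trans (ℤ.≤-trans (ℤ.i≤i+j c 1ℤ) ℤ.≤-refl) q)))

-- The sign pattern of the pairs (k , r) lying in a common ℤ_J.
ε : ℤ → ℤ → ℤ
ε k r = ind 1ℤ r - ind k 0ℤ

ε-cases : ∀ k r → ε k r ≢ 0ℤ → (1ℤ ℤ.≤ k × 1ℤ ℤ.≤ r) ⊎ (k ℤ.≤ 0ℤ × r ℤ.≤ 0ℤ)
ε-cases k r p with 1ℤ ℤ.≤? r | k ℤ.≤? 0ℤ
... | yes q | yes s = ⊥-elim (p refl)
... | yes q | no s = inj₁ (≰⇒suc≤ s , q)
... | no q | yes s = inj₂ (s , r≤0)
  where
  r≤0 : r ℤ.≤ 0ℤ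
  r≤0 = subst₂ ℤ._≤_ (l r) refl (ℤ.+-monoˡ-≤ (- 1ℤ) (≰⇒suc≤ q))
    where
    l : ∀ r → r + 1ℤ + - 1ℤ ≡ r
    l = solve-∀
... | no q | no s = ⊥-elim (p refl)

-- Where `f x = 0` the point `x` may lie outside the range.
∑-δ′ : ∀ {L} x (f : ℤ → ℤ) → (f x ≢ 0ℤ → ∣ x ∣ ≤ L) → ∑ (range L) (λ y → δ x y * f y) ≡ f x
∑-δ′ {L} x f supp with f x ≟ 0ℤ
... | no p = ∑-δ {L} {x} f (supp p)
... | yes p = trans (∑-cong (range L) zero′) (trans (∑-0 (range L)) (sym p))
  where
  zero′ : ∀ y → δ x y * f y ≡ 0ℤ
  zero′ y with x ≟ y
  ... | yes refl = trans (ℤ.*-identityˡ (f x)) p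
  ... | no _ = ℤ.*-zeroˡ (f y)

-- The signed indicator of an interval: `−1` for `0 ≤ d ≤ c`, `+1` for `c < d < 0`, and 0 otherwise;
-- it vanishes identically for `c = −1`. It arises as `ε′ d (d - c)`.
η : ℤ → ℤ → ℤ
η d c = ind (c + 1ℤ) d - ind 0ℤ d

η-step : ∀ d c → η (d + 1ℤ) c ≡ η d c + (δ c d - δ (- 1ℤ) d)
η-step d c = trans (cong₂ _-_ (trans (ind-shift c d 1ℤ) (ind-step c d)) (trans (ind-shift (- 1ℤ) d 1ℤ) (ind-step (- 1ℤ) d)))
  (l (ind (c + 1ℤ) d) (δ c d) (ind 0ℤ d) (δ (- 1ℤ) d))
  where
  l : ∀ a b c d → a + b - (c + d) ≡ a - c + (b - d)
  l = solve-∀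

η-cases : ∀ d c → η d c ≢ 0ℤ → (0ℤ ℤ.≤ d × d ℤ.≤ c) ⊎ (d + 1ℤ ℤ.≤ 0ℤ × c + 1ℤ ℤ.≤ d)
η-cases d c p with (c + 1ℤ) ℤ.≤? d | 0ℤ ℤ.≤? d
... | yes q | yes s = ⊥-elim (p refl)
... | yes q | no s = inj₂ (≰⇒suc≤ s , q)
... | no q | yes s = inj₁ (s , subst₂ ℤ._≤_ (l d) (l c) (ℤ.+-monoˡ-≤ (- 1ℤ) (≰⇒suc≤ q)))
  where
  l : ∀ r → r + 1ℤ + - 1ℤ ≡ r
  l = solve-∀
... | no q | no s = ⊥-elim (p refl)

∣d∣≤∣c∣ : ∀ d c → η d c ≢ 0ℤ → ∣ d ∣ ≤ ∣ c ∣
∣d∣≤∣c∣ d c p with η-cases d c p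
... | inj₁ (0≤d , d≤c) = ℤ.drop‿+≤+ (subst₂ ℤ._≤_ (sym (ℤ.0≤i⇒+∣i∣≡i 0≤d)) (sym (ℤ.0≤i⇒+∣i∣≡i (ℤ.≤-trans 0≤d d≤c))) d≤c)
... | inj₂ (d<0 , c<d) = subst₂ _≤_ (ℤ.∣-i∣≡∣i∣ d) (ℤ.∣-i∣≡∣i∣ c)
  (ℤ.drop‿+≤+ (subst₂ ℤ._≤_ (sym (ℤ.0≤i⇒+∣i∣≡i 0≤-d)) (sym (ℤ.0≤i⇒+∣i∣≡i (ℤ.≤-trans 0≤-d -d≤-c))) -d≤-c))
  where
  0≤-d : 0ℤ ℤ.≤ - d
  0≤-d = ℤ.neg-mono-≤ (ℤ.≤-trans (ℤ.i≤i+j d 1ℤ) d<0)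
  -d≤-c : - d ℤ.≤ - c
  -d≤-c = ℤ.neg-mono-≤ (ℤ.≤-trans (ℤ.i≤i+j c 1ℤ) c<d)

-- The sum is 0 at `c = −1` and drops by 1 whenever `c` grows by 1; the two inductions go up and
-- down from there.
∑-η : ∀ L c → ∣ c ∣ ≤ L → ∑ (range L) (λ d → η d c) ≡ - (c + 1ℤ)
∑-η L = λ { (+ n) p → up n p ; -[1+ n ] p → down n p }
  where
  Σ = λ c → ∑ (range L) (λ d → η d c)
  start : Σ (- 1ℤ) ≡ 0ℤ
  start = trans (∑-cong (range L) λ d → ℤ.+-inverseʳ (ind 0ℤ d)) (∑-0 (range L))
  step : ∀ c → ∣ c ∣ ≤ L → Σ (c - 1ℤ) ≡ Σ c + 1ℤ
  step c p = trans (∑-cong (range L) λ d → trans (cong (λ z → ind z d - ind 0ℤ d) (l c)) (trans (cong (_- ind 0ℤ d) (ind-step c d)) (l′ (ind (c + 1ℤ) d) (δ c d) (ind 0ℤ d))))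
    (trans (∑-+ (range L) _ _) (cong (λ z → Σ c + z) (trans (∑-cong (range L) λ d → sym (ℤ.*-identityʳ (δ c d))) (∑-δ {L} {c} (λ _ → 1ℤ) p))))
    where
    l : ∀ c → c - 1ℤ + 1ℤ ≡ c
    l = solve-∀
    l′ : ∀ a b c → a + b - c ≡ a - c + b
    l′ = solve-∀
  up : ∀ n → n ≤ L → Σ (+ n) ≡ - (+ n + 1ℤ)
  up zero p = l (Σ 0ℤ) (trans (sym (step 0ℤ p)) start)
    where
    l : ∀ x → x + 1ℤ ≡ 0ℤ → x ≡ - 1ℤ
    l x e = trans (l′ x) (cong (_- 1ℤ) e)
      where
      l′ : ∀ x → x ≡ x + 1ℤ - 1ℤ
      l′ = solve-∀
  up (suc n) p = trans (l (Σ (+ suc n))) (trans (cong (_- 1ℤ) (trans (sym (step (+ suc n) p)) (up n (ℕ.≤-trans (ℕ.n≤1+n n) p)))) (l″ (+ n)))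
    where
    l : ∀ x → x ≡ x + 1ℤ - 1ℤ
    l = solve-∀
    l″ : ∀ x → - (x + 1ℤ) - 1ℤ ≡ - (1ℤ + x + 1ℤ)
    l″ = solve-∀
  down : ∀ n → suc n ≤ L → Σ -[1+ n ] ≡ - (-[1+ n ] + 1ℤ)
  down zero p = start
  down (suc n) p = trans (cong Σ (l (+ n))) (trans (step -[1+ n ] (ℕ.≤-trans (ℕ.n≤1+n (suc n)) p)) (trans (cong (_+ 1ℤ) (down n (ℕ.≤-trans (ℕ.n≤1+n (suc n)) p))) (l″ (+ n))))
    where
    l : ∀ x → - (1ℤ + (1ℤ + x)) ≡ - (1ℤ + x) - 1ℤ
    l = solve-∀
    l″ : ∀ x → - (- (1ℤ + x) + 1ℤ) + 1ℤ ≡ - (- (1ℤ + (1ℤ + x)) + 1ℤ)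
    l″ = solve-∀

sg-neg : ∀ k → sg (- k) ≡ sg k
sg-neg k with parity k
... | even e = sg-even (- half k) (trans (cong -_ e) (ℤ.neg-distribʳ-* (+ 2) (half k)))
... | odd e = sg-odd (- half k - 1ℤ) (trans (cong -_ e) (l (half k)))
  where
  l : ∀ x → - (+ 2 * x + 1ℤ) ≡ + 2 * (- x - 1ℤ) + 1ℤ
  l = solve-∀

sg-flip : ∀ {a} b c → a ≡ b + (+ 2 * c + 1ℤ) → sg a ≡ - sg b
sg-flip b c refl = trans (sg-+ b _) (trans (cong (sg b *_) (sg-odd c refl)) (trans (ℤ.*-comm (sg b) (- 1ℤ)) (ℤ.-1*i≡-i (sg b))))

-- Telescoping in d shows that the sum with offset K agrees with the one with offset K + 2e; for e ≠ 0 it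
-- therefore vanishes.
module Telescope {L N′ E : ℕ} (big : 2 ℕ.* (E ℕ.+ N′) ℕ.+ 4 ≤ L) (Ψ : ℤ → ℤ) (cut : ∀ z → Ψ z ≢ 0ℤ → z ℤ.≤ + N′)
  (e : ℤ) (e≤E : ∣ e ∣ ℕ.+ ∣ e ∣ ≤ E) where

  summand : ℤ → ℤ → ℤ → ℤ
  summand K c d = sg c * (η d c * Ψ (c * c + c + + 2 * (e * d) + K))

  Z : ℤ → ℤ
  Z K = ∑∑ L (summand K)

  private
    2ed : ∀ c d → ∣ d ∣ ≤ ∣ c ∣ → c * c + c + + 2 * (e * d) ℤ.≤ + N′ → ∣ c ∣ ≤ suc E ℕ.+ N′
    2ed c d p h = ℕ.≤-trans (quadratic-bound (+ ∣ c ∣) (- + suc E) N′ (ℤ.≤-trans lower h))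
      (ℕ.≤-reflexive refl)
      where
      C² : + ∣ c ∣ * + ∣ c ∣ ≡ c * c
      C² = trans (sym (ℤ.pos-* ∣ c ∣ ∣ c ∣)) (trans (cong +_ (sym (ℤ.abs-* c c))) (ℤ.0≤i⇒+∣i∣≡i (square-nonneg c)))
      rest : - (+ suc E * + ∣ c ∣) ℤ.≤ c + + 2 * (e * d)
      rest = subst₂ ℤ._≤_ refl (ℤ.neg-involutive _) (ℤ.neg-mono-≤ (ℤ.≤-trans (i≤∣i∣ _) (ℤ.≤-trans (ℤ.+≤+ abs) (ℤ.≤-reflexive (ℤ.pos-* (suc E) ∣ c ∣)))))
        where
        abs : ∣ - (c + + 2 * (e * d)) ∣ ≤ suc E ℕ.* ∣ c ∣
        abs = ℕ.≤-trans (ℕ.≤-reflexive (ℤ.∣-i∣≡∣i∣ (c + + 2 * (e * d)))) (ℕ.≤-trans (ℤ.∣i+j∣≤∣i∣+∣j∣ c (+ 2 * (e * d)))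
          (ℕ.+-monoʳ-≤ ∣ c ∣ (ℕ.≤-trans (ℕ.≤-reflexive (trans (ℤ.abs-* (+ 2) (e * d)) (cong (2 ℕ.*_) (ℤ.abs-* e d))))
            (ℕ.≤-trans (ℕ.*-monoʳ-≤ 2 (ℕ.*-monoʳ-≤ ∣ e ∣ p))
            (ℕ.≤-trans (ℕ.≤-reflexive (trans (sym (ℕ.*-assoc 2 ∣ e ∣ ∣ c ∣)) (cong (λ z → (∣ e ∣ ℕ.+ z) ℕ.* ∣ c ∣) (ℕ.+-identityʳ ∣ e ∣)))) (ℕ.*-monoˡ-≤ ∣ c ∣ e≤E))))))
      lower : + ∣ c ∣ * + ∣ c ∣ + - + suc E * + ∣ c ∣ ℤ.≤ c * c + c + + 2 * (e * d)
      lower = subst₂ ℤ._≤_ (cong₂ _+_ (sym C²) (ℤ.neg-distribˡ-* (+ suc E) (+ ∣ c ∣))) (sym (ℤ.+-assoc (c * c) c _)) (ℤ.+-monoʳ-≤ (c * c) rest)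

    drop-K : ∀ {K x} → 0ℤ ℤ.≤ K → x + K ℤ.≤ + N′ → x ℤ.≤ + N′
    drop-K {K} {x} 0≤K h = ℤ.≤-trans (subst (ℤ._≤ x + K) (ℤ.+-identityʳ x) (ℤ.+-monoʳ-≤ x 0≤K)) h

    support : ∀ {K} → 0ℤ ℤ.≤ K → ∀ c d → summand K c d ≢ 0ℤ → ∣ d ∣ ≤ ∣ c ∣ × ∣ c ∣ ≤ suc E ℕ.+ N′
    support 0≤K c d p = dc , 2ed c d dc (drop-K 0≤K (cut _ (*-≢0ʳ (η d c) (*-≢0ʳ (sg c) p))))
      where dc = ∣d∣≤∣c∣ d c (*-≢0ˡ (η d c) (*-≢0ʳ (sg c) p))

    to-L : ∀ {n} → n ≤ suc (E ℕ.+ N′) → suc n ≤ L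
    to-L {n} p = ℕ.≤-trans (s≤s p) (ℕ.≤-trans (ℕ.≤-trans (ℕ.≤-reflexive (ℕ.+-comm 2 (E ℕ.+ N′)))
      (ℕ.+-mono-≤ (ℕ.m≤m+n (E ℕ.+ N′) _) (s≤s (s≤s (z≤n {2}))))) big)

    double-L : ∀ {n} → n ≤ suc (E ℕ.+ N′ ℕ.+ (E ℕ.+ N′)) → suc n ≤ L
    double-L p = ℕ.≤-trans (s≤s p) (ℕ.≤-trans (ℕ.≤-trans (ℕ.≤-reflexive (ℕ.+-comm 2 (E ℕ.+ N′ ℕ.+ (E ℕ.+ N′))))
      (ℕ.+-mono-≤ (ℕ.≤-reflexive (cong (λ z → E ℕ.+ N′ ℕ.+ z) (sym (ℕ.+-identityʳ (E ℕ.+ N′))))) (s≤s (s≤s (z≤n {2}))))) big)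

  -- Shifting `d` by 1 raises the offset by `2e` and changes `η` only at `d = c` and `d = −1`. The
  -- boundary sums over `c` vanish, being odd under `c ↦ −(2e + 1) − c` and `c ↦ −1 − c`.
  step : ∀ K → 0ℤ ℤ.≤ K → 0ℤ ℤ.≤ K + + 2 * e → Z K ≡ Z (K + + 2 * e)
  step K 0≤K 0≤K+2e = begin
    Z K
      ≡⟨ ∑-cong (range L) (λ c → translate 1ℤ (summand K c) λ d p → let (dc , cb) = support 0≤K c d p in
           ℕ.≤-trans (ℕ.≤-trans dc (ℕ.≤-trans cb (ℕ.n≤1+n _))) (to-L (ℕ.≤-refl)) ,
           ℕ.≤-trans (∣-∣ {d} {1ℤ} (ℕ.≤-trans dc cb) (ℕ.≤-refl {1})) (ℕ.≤-trans (ℕ.≤-reflexive (ℕ.+-comm _ 1)) (to-L ℕ.≤-refl))) ⟩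
    ∑∑ L (λ c d → summand K c (d + 1ℤ))
      ≡⟨ ∑∑-cong L split ⟩
    ∑∑ L (λ c d → summand (K + + 2 * e) c d + (δ c d * x c d - δ (- 1ℤ) d * x c d))
      ≡⟨ trans (∑∑-+ L _ _) (cong (λ z → Z (K + + 2 * e) + z) (trans (∑-cong (range L) λ c →
           trans (∑-+ (range L) _ _) (cong₂ _+_
             (∑-δ′ c (x c) λ p → ℕ.≤-trans (ℕ.n≤1+n _) (double-L (xcc-bound c p)))
             (trans (∑-neg (range L) _) (cong -_ (∑-δ′ (- 1ℤ) (x c) λ _ → ℕ.≤-trans (s≤s z≤n) (to-L z≤n))))))
           (trans (∑-+ (range L) _ _) (cong₂ _+_ diagonal (trans (∑-neg (range L) _) (cong -_ last)))))) ⟩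
    Z (K + + 2 * e) + (0ℤ + - 0ℤ)
      ≡⟨ ℤ.+-identityʳ _ ⟩
    Z (K + + 2 * e) ∎
    where
    open ≡-Reasoning
    x : ℤ → ℤ → ℤ
    x c d = sg c * Ψ (c * c + c + + 2 * (e * d) + (K + + 2 * e))
    split : ∀ c d → summand K c (d + 1ℤ) ≡ summand (K + + 2 * e) c d + (δ c d * x c d - δ (- 1ℤ) d * x c d)
    split c d = trans (cong₂ (λ y z → sg c * (y * Ψ z)) (η-step d c) (l c d e K)) (l′ (sg c) (η d c) (δ c d) (δ (- 1ℤ) d) (Ψ _))
      where
      l : ∀ c d e K → c * c + c + + 2 * (e * (d + 1ℤ)) + K ≡ c * c + c + + 2 * (e * d) + (K + + 2 * e)
      l = solve-∀
      l′ : ∀ s h a b y → s * ((h + (a - b)) * y) ≡ s * (h * y) + (a * (s * y) - b * (s * y))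
      l′ = solve-∀
    ∣2e+1∣ : ∣ + 2 * e + 1ℤ ∣ ≤ suc E
    ∣2e+1∣ = ℕ.≤-trans (∣+∣ {+ 2 * e} {1ℤ} (ℕ.≤-trans (ℕ.≤-reflexive (trans (ℤ.abs-* (+ 2) e) (cong (∣ e ∣ ℕ.+_) (ℕ.+-identityʳ ∣ e ∣)))) e≤E) (ℕ.≤-refl {1})) (ℕ.≤-reflexive (ℕ.+-comm E 1))
    xcc-bound : ∀ c → x c c ≢ 0ℤ → ∣ c ∣ ≤ suc (E ℕ.+ N′ ℕ.+ (E ℕ.+ N′))
    xcc-bound c p = ℕ.≤-trans (quadratic-bound c (+ 2 * e + 1ℤ) N′ (ℤ.≤-trans (ℤ.≤-reflexive (l c e)) (drop-K 0≤K+2e (cut _ (*-≢0ʳ (sg c) p)))))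
      (ℕ.≤-trans (ℕ.+-monoˡ-≤ N′ ∣2e+1∣) (s≤s (ℕ.m≤m+n (E ℕ.+ N′) _)))
      where
      l : ∀ c e → c * c + (+ 2 * e + 1ℤ) * c ≡ c * c + c + + 2 * (e * c)
      l = solve-∀
    diagonal : ∑ (range L) (λ c → x c c) ≡ 0ℤ
    diagonal = reflect-antisym (- (+ 2 * e + 1ℤ)) (λ c → x c c)
      (λ c → trans (cong₂ _*_ (trans (sg-flip c (- e - c - 1ℤ) (l c e)) (refl {x = - sg c})) (cong Ψ (l′ c e K))) (sym (ℤ.neg-distribˡ-* (sg c) _)))
      (λ c p → let b = quadratic-bound c (+ 2 * e + 1ℤ) N′ (ℤ.≤-trans (ℤ.≤-reflexive (l″ c e)) (drop-K 0≤K+2e (cut _ (*-≢0ʳ (sg c) p)))) in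
        ℕ.≤-trans (ℕ.n≤1+n _) (double-L (xcc-bound c p)) ,
        ℕ.≤-trans (∣-∣ { - (+ 2 * e + 1ℤ)} {c} (ℕ.≤-trans (ℕ.≤-reflexive (ℤ.∣-i∣≡∣i∣ (+ 2 * e + 1ℤ))) ∣2e+1∣) (ℕ.≤-trans b (ℕ.+-monoˡ-≤ N′ ∣2e+1∣)))
          (ℕ.≤-trans (ℕ.+-monoˡ-≤ (suc E ℕ.+ N′) (s≤s (ℕ.m≤m+n E N′))) (ℕ.≤-trans (ℕ.≤-reflexive (cong suc (ℕ.+-suc (E ℕ.+ N′) (E ℕ.+ N′)))) (double-L ℕ.≤-refl))))
      where
      l : ∀ c e → - (+ 2 * e + 1ℤ) - c ≡ c + (+ 2 * (- e - c - 1ℤ) + 1ℤ)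
      l = solve-∀
      l′ : ∀ c e K → (- (+ 2 * e + 1ℤ) - c) * (- (+ 2 * e + 1ℤ) - c) + (- (+ 2 * e + 1ℤ) - c) + + 2 * (e * (- (+ 2 * e + 1ℤ) - c)) + (K + + 2 * e) ≡
        c * c + c + + 2 * (e * c) + (K + + 2 * e)
      l′ = solve-∀
      l″ : ∀ c e → c * c + (+ 2 * e + 1ℤ) * c ≡ c * c + c + + 2 * (e * c)
      l″ = solve-∀
    last : ∑ (range L) (λ c → x c (- 1ℤ)) ≡ 0ℤ
    last = reflect-antisym (- 1ℤ) (λ c → x c (- 1ℤ))
      (λ c → trans (cong₂ _*_ (sg-flip c (- c - 1ℤ) (l c)) (cong Ψ (l′ c e K))) (sym (ℤ.neg-distribˡ-* (sg c) _)))
      (λ c p → let b = quadratic-bound c 1ℤ N′ (ℤ.≤-trans (ℤ.≤-reflexive (l″ c)) (drop-K 0≤K (ℤ.≤-trans (ℤ.≤-reflexive (l‴ c e K)) (cut _ (*-≢0ʳ (sg c) p))))) in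
        ℕ.≤-trans (ℕ.n≤1+n _) (to-L (ℕ.≤-trans b (s≤s (ℕ.m≤n+m N′ E)))) ,
        ℕ.≤-trans (∣-∣ { - 1ℤ} {c} (ℕ.≤-refl {1}) b) (to-L (s≤s (ℕ.m≤n+m N′ E))))
      where
      l : ∀ c → - 1ℤ - c ≡ c + (+ 2 * (- c - 1ℤ) + 1ℤ)
      l = solve-∀
      l′ : ∀ c e K → (- 1ℤ - c) * (- 1ℤ - c) + (- 1ℤ - c) + + 2 * (e * - 1ℤ) + (K + + 2 * e) ≡ c * c + c + + 2 * (e * - 1ℤ) + (K + + 2 * e)
      l′ = solve-∀
      l″ : ∀ c → c * c + 1ℤ * c ≡ c * c + c
      l″ = solve-∀
      l‴ : ∀ c e K → c * c + c + K ≡ c * c + c + + 2 * (e * - 1ℤ) + (K + + 2 * e)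
      l‴ = solve-∀

  -- The support bounds make the rest of the exponent bounded below, so a large offset pushes every
  -- term beyond the cut.
  far : ∀ K → + (N′ ℕ.+ suc E ℕ.* (suc E ℕ.+ N′) ℕ.+ 1) ℤ.≤ K → Z K ≡ 0ℤ
  far K h = ∑∑-0 L zero′
    where
    0≤K : 0ℤ ℤ.≤ K
    0≤K = ℤ.≤-trans 0≤+ h
    zero′ : ∀ c d → summand K c d ≡ 0ℤ
    zero′ c d with summand K c d ≟ 0ℤ
    ... | yes p = p
    ... | no p = ⊥-elim (ℤ.<-irrefl refl (ℤ.<-≤-trans (ℤ.≤-<-trans low (ℤ.suc[i]≤j⇒i<j (subst (ℤ._≤ K) (ℤ.+-comm (+ (N′ ℕ.+ suc E ℕ.* (suc E ℕ.+ N′))) 1ℤ) h))) ℤ.≤-refl))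
      where
      dc = proj₁ (support 0≤K c d p)
      cb = proj₂ (support 0≤K c d p)
      hcut : c * c + c + + 2 * (e * d) + K ℤ.≤ + N′
      hcut = cut _ (*-≢0ʳ (η d c) (*-≢0ʳ (sg c) p))
      abs : ∣ - (c + + 2 * (e * d)) ∣ ≤ suc E ℕ.* (suc E ℕ.+ N′)
      abs = ℕ.≤-trans (ℕ.≤-reflexive (ℤ.∣-i∣≡∣i∣ (c + + 2 * (e * d)))) (ℕ.≤-trans (ℤ.∣i+j∣≤∣i∣+∣j∣ c (+ 2 * (e * d)))
          (ℕ.+-mono-≤ cb (ℕ.≤-trans (ℕ.≤-reflexive (trans (ℤ.abs-* (+ 2) (e * d)) (cong (2 ℕ.*_) (ℤ.abs-* e d))))
            (ℕ.≤-trans (ℕ.≤-reflexive (trans (sym (ℕ.*-assoc 2 ∣ e ∣ ∣ d ∣)) (cong (λ z → (∣ e ∣ ℕ.+ z) ℕ.* ∣ d ∣) (ℕ.+-identityʳ ∣ e ∣)))) (ℕ.*-mono-≤ e≤E (ℕ.≤-trans dc cb))))))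
      low : K ℤ.≤ + (N′ ℕ.+ suc E ℕ.* (suc E ℕ.+ N′))
      low = subst₂ ℤ._≤_ (l (c * c) (c + + 2 * (e * d)) K) refl (ℤ.+-mono-≤
        (ℤ.≤-trans (subst₂ ℤ._≤_ (ℤ.+-identityˡ (c + + 2 * (e * d) + K)) (l₂ (c * c) c (+ 2 * (e * d)) K) (ℤ.+-monoˡ-≤ (c + + 2 * (e * d) + K) (square-nonneg c))) hcut)
        (ℤ.≤-trans (i≤∣i∣ (- (c + + 2 * (e * d)))) (ℤ.+≤+ abs)))
        where
        l : ∀ s w K → w + K + - w ≡ K
        l = solve-∀
        l₂ : ∀ s c w K → s + (c + w + K) ≡ s + c + w + K
        l₂ = solve-∀

  vanish : e ≢ 0ℤ → ∀ K → 0ℤ ℤ.≤ K → Z K ≡ 0ℤ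
  vanish e≢0 K 0≤K = climb (N′ ℕ.+ suc E ℕ.* (suc E ℕ.+ N′) ℕ.+ 1) K 0≤K
    (subst (ℤ._≤ K + limit) (ℤ.+-identityˡ limit) (ℤ.+-monoˡ-≤ limit 0≤K))
    where
    limit : ℤ
    limit = + (N′ ℕ.+ suc E ℕ.* (suc E ℕ.+ N′) ℕ.+ 1)
    -- `step` can be used in either direction; the sign of `e` decides which one raises the offset,
    -- always by `∣ 2e ∣`.
    up : ∀ K → 0ℤ ℤ.≤ K → Z K ≡ Z (K + + suc ∣ + 2 * e ∣ - 1ℤ)
    up K 0≤K with +∣i∣≡±i (+ 2 * e)
    ... | inj₁ q = trans (step K 0≤K (+-nonneg 0≤K (subst (0ℤ ℤ.≤_) q 0≤+))) (cong Z (trans (cong (λ z → K + z) (sym q)) (l K _)))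
      where
      l : ∀ K x → K + x ≡ K + (1ℤ + x) - 1ℤ
      l = solve-∀
    ... | inj₂ q = sym (trans (cong Z (trans (l K _) (cong (λ z → K + z) q)))
        (trans (step (K + - (+ 2 * e)) (+-nonneg 0≤K (subst (0ℤ ℤ.≤_) q 0≤+)) (subst (0ℤ ℤ.≤_) (l′ K (+ 2 * e)) 0≤K)) (cong Z (sym (l′ K (+ 2 * e))))))
      where
      l : ∀ K x → K + (1ℤ + x) - 1ℤ ≡ K + x
      l = solve-∀
      l′ : ∀ K x → K ≡ K + - x + x
      l′ = solve-∀
    -- `n` is fuel: every move raises `K` by at least 1, because `e` is nonzero.
    climb : ∀ n K → 0ℤ ℤ.≤ K → limit ℤ.≤ K + + n → Z K ≡ 0ℤ
    climb zero K 0≤K h = far K (subst (limit ℤ.≤_) (ℤ.+-identityʳ K) h)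
    climb (suc n) K 0≤K h = trans (up K 0≤K) (climb n _ 0≤K′ (ℤ.≤-trans h (subst₂ ℤ._≤_ (l₁ K (+ n)) (l₂ K (+ n) (+ m)) (ℤ.+-monoʳ-≤ (K + + n) 1≤m))))
      where
      m = ∣ + 2 * e ∣
      m≢0 : m ≢ 0
      m≢0 q = e≢0 (2a≡2b⇒a≡b (trans (ℤ.∣i∣≡0⇒i≡0 q) refl))
      1≤m : 1ℤ ℤ.≤ + m
      1≤m = ℤ.+≤+ (ℕ.n≢0⇒n>0 m≢0)
      0≤K′ : 0ℤ ℤ.≤ K + + suc m - 1ℤ
      0≤K′ = subst (0ℤ ℤ.≤_) (l K (+ m)) (+-nonneg 0≤K (0≤+ {m}))
        where
        l : ∀ K x → K + x ≡ K + (1ℤ + x) - 1ℤ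
        l = solve-∀
      l₁ : ∀ K n → K + n + 1ℤ ≡ K + (1ℤ + n)
      l₁ = solve-∀
      l₂ : ∀ K n m → K + n + m ≡ K + (1ℤ + m) - 1ℤ + n
      l₂ = solve-∀

-- Two sums that evaluate to the series J

half≤ : ∀ {x N} → + 2 * x ℤ.≤ + N → x ℤ.≤ + N
half≤ {+ m} {N} p = ℤ.+≤+ (ℕ.≤-trans (ℕ.m≤m+n m _) (ℤ.drop‿+≤+ (subst (ℤ._≤ + N) (sym (ℤ.pos-* 2 m)) p)))
half≤ { -[1+ _ ]} p = ℤ.-≤+

≤-drop : ∀ {a b c N} → a + b ≡ c → 0ℤ ℤ.≤ b → c ℤ.≤ + N → a ℤ.≤ + N
≤-drop {a} {b} refl 0≤b h = ℤ.≤-trans (subst (ℤ._≤ a + b) (ℤ.+-identityʳ a) (ℤ.+-monoʳ-≤ a 0≤b)) h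

-- With `n = p − 2k` this is the sum of `(2n + 1) Ψ(n (n + 1))` over one residue class modulo 2. The
-- even class `n = 2i` gives the weights `4i + 1`; `n ↦ −1 − n` exchanges the classes and negates
-- the weight, whence the sign.
J-odd-class : ∀ {L N} → 20 ℕ.* suc N ≤ L → ∀ p (Ψ : ℤ → ℤ) →
  (∀ k → Ψ ((p - + 2 * k) * (p - + 2 * k + 1ℤ)) ≢ 0ℤ → Bounded N 6 k × Bounded N 9 p) →
  ∑ (range L) (λ k → (+ 2 * (p - + 2 * k) + 1ℤ) * Ψ ((p - + 2 * k) * (p - + 2 * k + 1ℤ))) ≡
  sg p * ∑ (range L) (λ i → (+ 4 * i + 1ℤ) * Ψ (+ 2 * (i * (+ 2 * i + 1ℤ))))
J-odd-class {L} {N} big p Ψ supp with parity p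
... | even e = trans (reflect (half p) f λ k q → let (bk , bp) = supp k (*-≢0ʳ (+ 2 * (p - + 2 * k) + 1ℤ) q) in
      Bk 6 20 big bk , Bk 15 20 big (B- (Bhalf {a = half p} (B≡ e bp)) bk))
    (trans (∑-cong (range L) λ i → cong₂ (λ x y → x * Ψ y)
      (trans (cong (λ q → + 2 * (q - + 2 * (half p - i)) + 1ℤ) e) (l₁ (half p) i))
      (trans (cong (λ q → (q - + 2 * (half p - i)) * (q - + 2 * (half p - i) + 1ℤ)) e) (l₂ (half p) i)))
    (sym (ℤ.*-identityˡ _)))
  where
  f = λ k → (+ 2 * (p - + 2 * k) + 1ℤ) * Ψ ((p - + 2 * k) * (p - + 2 * k + 1ℤ))
  l₁ : ∀ h i → + 2 * (+ 2 * h - + 2 * (h - i)) + 1ℤ ≡ + 4 * i + 1ℤ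
  l₁ = solve-∀
  l₂ : ∀ h i → (+ 2 * h - + 2 * (h - i)) * (+ 2 * h - + 2 * (h - i) + 1ℤ) ≡ + 2 * (i * (+ 2 * i + 1ℤ))
  l₂ = solve-∀
... | odd e = trans (translate (half p + 1ℤ) f λ k q → let (bk , bp) = supp k (*-≢0ʳ (+ 2 * (p - + 2 * k) + 1ℤ) q) in
      Bk 6 20 big bk , Bk 16 20 big (B- {a = k} {b = half p + 1ℤ} bk (B+ (Bhalf1 {a = half p} (B≡ e bp)) B1)))
    (trans (∑-cong (range L) λ i → trans (cong₂ (λ x y → x * Ψ y)
      (trans (cong (λ q → + 2 * (q - + 2 * (i + (half p + 1ℤ))) + 1ℤ) e) (l₁ (half p) i))
      (trans (cong (λ q → (q - + 2 * (i + (half p + 1ℤ))) * (q - + 2 * (i + (half p + 1ℤ)) + 1ℤ)) e) (l₂ (half p) i)))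
      (sym (l₃ (+ 4 * i + 1ℤ) (Ψ (+ 2 * (i * (+ 2 * i + 1ℤ)))))))
    (∑-*ˡ (range L) (- 1ℤ) _))
  where
  f = λ k → (+ 2 * (p - + 2 * k) + 1ℤ) * Ψ ((p - + 2 * k) * (p - + 2 * k + 1ℤ))
  l₁ : ∀ h i → + 2 * (+ 2 * h + 1ℤ - + 2 * (i + (h + 1ℤ))) + 1ℤ ≡ - (+ 4 * i + 1ℤ)
  l₁ = solve-∀
  l₂ : ∀ h i → (+ 2 * h + 1ℤ - + 2 * (i + (h + 1ℤ))) * (+ 2 * h + 1ℤ - + 2 * (i + (h + 1ℤ)) + 1ℤ) ≡ + 2 * (i * (+ 2 * i + 1ℤ))
  l₂ = solve-∀
  l₃ : ∀ x y → - 1ℤ * (x * y) ≡ - x * y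
  l₃ = solve-∀

-- `c = 2j` and `c = −1 − 2j` share an exponent, and their signed weights `2j + 1` and `2j` add up
-- to `4j + 1`.
J-alternating : ∀ {L N} → 20 ℕ.* suc N ≤ L → (Ψ : ℤ → ℤ) →
  (∀ c → Ψ (c * (c + 1ℤ)) ≢ 0ℤ → Bounded N 6 c) →
  ∑ (range L) (λ c → sg c * ((c + 1ℤ) * Ψ (c * (c + 1ℤ)))) ≡
  ∑ (range L) (λ j → (+ 4 * j + 1ℤ) * Ψ (+ 2 * (j * (+ 2 * j + 1ℤ))))
J-alternating {L} {N} big Ψ supp = trans
  (parity-split {L} {6 ℕ.* suc N} f (ℕ.≤-trans (ℕ.*-monoˡ-≤ (suc N) {6} {20} (s≤s (s≤s (s≤s (s≤s (s≤s (s≤s z≤n))))))) big)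
    (λ c p → size (suppf c p)))
  (trans (cong₂ _+_ (∑-cong (range L) even-terms) (trans (reflect (- 1ℤ) (λ j → f (+ 2 * j + 1ℤ)) λ j p →
      let b = Bhalf1 {a = j} (suppf (+ 2 * j + 1ℤ) p) in Bk 6 20 big b , Bk 7 20 big (B- {k = 1} {a = - 1ℤ} {b = j} (bounded (s≤s z≤n)) b))
    (∑-cong (range L) odd-terms)))
  (trans (sym (∑-+ (range L) (λ j → (+ 2 * j + 1ℤ) * Ψ (+ 2 * (j * (+ 2 * j + 1ℤ)))) (λ j → (+ 2 * j) * Ψ (+ 2 * (j * (+ 2 * j + 1ℤ))))))
    (∑-cong (range L) λ j → l j _)))
  where
  f = λ c → sg c * ((c + 1ℤ) * Ψ (c * (c + 1ℤ)))
  suppf : ∀ c → f c ≢ 0ℤ → Bounded N 6 c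
  suppf c p = supp c (*-≢0ʳ (c + 1ℤ) (*-≢0ʳ (sg c) p))
  even-terms : ∀ j → f (+ 2 * j) ≡ (+ 2 * j + 1ℤ) * Ψ (+ 2 * (j * (+ 2 * j + 1ℤ)))
  even-terms j = trans (cong₂ (λ s z → s * ((+ 2 * j + 1ℤ) * Ψ z)) (sg-even {+ 2 * j} j refl) (l₁ j)) (ℤ.*-identityˡ _)
    where
    l₁ : ∀ j → + 2 * j * (+ 2 * j + 1ℤ) ≡ + 2 * (j * (+ 2 * j + 1ℤ))
    l₁ = solve-∀
  odd-terms : ∀ j → f (+ 2 * (- 1ℤ - j) + 1ℤ) ≡ (+ 2 * j) * Ψ (+ 2 * (j * (+ 2 * j + 1ℤ)))
  odd-terms j = trans (cong₂ (λ s z → s * ((+ 2 * (- 1ℤ - j) + 1ℤ + 1ℤ) * Ψ z)) (sg-odd {+ 2 * (- 1ℤ - j) + 1ℤ} (- 1ℤ - j) refl) (l₁ j)) (l₂ j _)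
    where
    l₁ : ∀ j → (+ 2 * (- 1ℤ - j) + 1ℤ) * (+ 2 * (- 1ℤ - j) + 1ℤ + 1ℤ) ≡ + 2 * (j * (+ 2 * j + 1ℤ))
    l₁ = solve-∀
    l₂ : ∀ j x → - 1ℤ * ((+ 2 * (- 1ℤ - j) + 1ℤ + 1ℤ) * x) ≡ (+ 2 * j) * x
    l₂ = solve-∀
  l : ∀ j x → (+ 2 * j + 1ℤ) * x + (+ 2 * j) * x ≡ (+ 4 * j + 1ℤ) * x
  l = solve-∀

-- The double Wronskian of size two

ε′ : ℤ → ℤ → ℤ
ε′ d r = ind 1ℤ r - ind 0ℤ d

ε′-nonneg : ∀ d r → ε′ d r ≢ 0ℤ → 0ℤ ℤ.≤ - (+ 2 * d + 1ℤ) * r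
ε′-nonneg d r p with 1ℤ ℤ.≤? r | 0ℤ ℤ.≤? d
... | yes q | yes s = ⊥-elim (p refl)
... | no q | no s = ⊥-elim (p refl)
... | yes q | no s = *-nonneg (nonneg (l d) (+-nonneg (*-nonneg (0≤+ {2}) (ℤ.neg-mono-≤ (≰⇒suc≤ s))) (0≤+ {1}))) (ℤ.≤-trans (0≤+ {1}) q)
  where
  l : ∀ d → - (+ 2 * d + 1ℤ) ≡ + 2 * (- (d + 1ℤ)) + 1ℤ
  l = solve-∀
... | no q | yes s = nonneg (l d r) (*-nonneg (+-nonneg (*-nonneg (0≤+ {2}) s) (0≤+ {1})) (ℤ.neg-mono-≤ r≤0))
  where
  l : ∀ d r → - (+ 2 * d + 1ℤ) * r ≡ (+ 2 * d + 1ℤ) * (- r)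
  l = solve-∀
  l′ : ∀ r → r + 1ℤ + - 1ℤ ≡ r
  l′ = solve-∀
  r≤0 : r ℤ.≤ 0ℤ
  r≤0 = subst (ℤ._≤ 0ℤ) (l′ r) (ℤ.+-monoˡ-≤ (- 1ℤ) (≰⇒suc≤ q))

degA : ℤ → ℤ → ℤ
degA k r = + 2 * (k * k + (+ 2 * k - 1ℤ) * r) + k

-- Where `ε` does not vanish, `2k − 1` and `r` never have opposite signs. This is the source of
-- convergence of `A`, whose exponent is an indefinite form.
degA-bounds : ∀ k r → ε k r ≢ 0ℤ → (0ℤ ℤ.≤ + 2 * ((+ 2 * k - 1ℤ) * r)) × (+ ∣ r ∣ ℤ.≤ degA k r)
degA-bounds k r p with ε-cases k r p
... | inj₁ (1≤k , 1≤r) = *-nonneg (0≤+ {2}) (*-nonneg (nonneg (l₁ k) (+-nonneg (*-nonneg (0≤+ {2}) 0≤k-1) (0≤+ {1}))) 0≤r) ,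
    ℤ.≤-trans (ℤ.≤-reflexive (ℤ.0≤i⇒+∣i∣≡i 0≤r)) (subst₂ ℤ._≤_ (ℤ.+-identityʳ r) (l₂ k r) (ℤ.+-monoʳ-≤ r
      (+-nonneg (hexagonal-nonneg k) (*-nonneg (+-nonneg (*-nonneg (0≤+ {4}) 0≤k-1) (0≤+ {1})) 0≤r))))
  where
  0≤k-1 : 0ℤ ℤ.≤ k - 1ℤ
  0≤k-1 = ℤ.i≤j⇒0≤j-i 1≤k
  0≤r : 0ℤ ℤ.≤ r
  0≤r = ℤ.≤-trans (0≤+ {1}) 1≤r
  l₁ : ∀ k → + 2 * k - 1ℤ ≡ + 2 * (k - 1ℤ) + 1ℤ
  l₁ = solve-∀
  l₂ : ∀ k r → r + (k * (+ 2 * k + 1ℤ) + (+ 4 * (k - 1ℤ) + 1ℤ) * r) ≡ + 2 * (k * k + (+ 2 * k - 1ℤ) * r) + k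
  l₂ = solve-∀
... | inj₂ (k≤0 , r≤0) = nonneg (l₁ k r) (*-nonneg (0≤+ {2}) (*-nonneg (+-nonneg (*-nonneg (0≤+ {2}) 0≤-k) (0≤+ {1})) 0≤-r)) ,
    ℤ.≤-trans (ℤ.≤-reflexive (trans (cong +_ (sym (ℤ.∣-i∣≡∣i∣ r))) (ℤ.0≤i⇒+∣i∣≡i 0≤-r))) (subst₂ ℤ._≤_ (ℤ.+-identityʳ (- r)) (l₂ k r) (ℤ.+-monoʳ-≤ (- r)
      (+-nonneg (hexagonal-nonneg k) (*-nonneg (+-nonneg (*-nonneg (0≤+ {4}) 0≤-k) (0≤+ {1})) 0≤-r))))
  where
  0≤-k : 0ℤ ℤ.≤ - k
  0≤-k = ℤ.neg-mono-≤ k≤0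
  0≤-r : 0ℤ ℤ.≤ - r
  0≤-r = ℤ.neg-mono-≤ r≤0
  l₁ : ∀ k r → + 2 * ((+ 2 * k - 1ℤ) * r) ≡ + 2 * ((+ 2 * (- k) + 1ℤ) * (- r))
  l₁ = solve-∀
  l₂ : ∀ k r → - r + (k * (+ 2 * k + 1ℤ) + (+ 4 * (- k) + 1ℤ) * (- r)) ≡ + 2 * (k * k + (+ 2 * k - 1ℤ) * r) + k
  l₂ = solve-∀

-- Both exponents are fixed by s = k + l and t = c + d′ + r; in the coordinates (d , r , k , s , t) with d = r + c − k the
-- sign pattern ε may be exchanged for ε′, because the full alternating sum over r vanishes.
module FirstWronskian {L N : ℕ} (big : 200 ℕ.* suc N ≤ L) (Φ : ℤ → ℤ → ℤ → ℤ)
  (cut : ∀ e s t → Φ e s t ≢ 0ℤ → + 2 * e + s ℤ.≤ + N) where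

  private
    Φ-cong : ∀ {e e′ s s′ t t′} → e ≡ e′ → s ≡ s′ → t ≡ t′ → Φ e s t ≡ Φ e′ s′ t′
    Φ-cong refl refl refl = refl

    X : ℤ → ℤ → ℤ → ℤ → ℤ → ℤ
    X c d k r l = Φ (c * c + d * d + (k * k + (+ 2 * k - 1ℤ) * r) + l * l) (k + l) (c + d + r)

    F F₁ : ℤ → ℤ → ℤ → ℤ → ℤ → ℤ
    F c d k r l = sg (c + d) * (ε k r * ((k + r - l) * X c d k r l))
    F₁ c d k r l = sg (c + d) * (ε k r * ((k + r + c - l - d) * X c d k r l))

    record Small₅ (c d k r l : ℤ) : Set where
      constructor small₅
      field
        bc : Bounded N 1 c
        bd : Bounded N 1 d
        bk : Bounded N 1 k
        br : Bounded N 1 r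
        bl : Bounded N 1 l

    suppX : ∀ c d k r l → ε k r ≢ 0ℤ → X c d k r l ≢ 0ℤ → Small₅ c d k r l
    suppX c d k r l pε p = small₅
      (≤-dominated _ (∣x∣≤x*x c) (l₁ c d k r l) (+-nonneg (+-nonneg (square-nonneg c) (+-nonneg (square-nonneg d) (square-nonneg d))) (+-nonneg A≥0 (hexagonal-nonneg l))) e≤N)
      (≤-dominated _ (∣x∣≤x*x d) (l₂ c d k r l) (+-nonneg (+-nonneg (square-nonneg d) (+-nonneg (square-nonneg c) (square-nonneg c))) (+-nonneg A≥0 (hexagonal-nonneg l))) e≤N)
      (≤-dominated _ (∣x∣≤x[2x+1] k) (l₃ c d k r l) (+-nonneg (+-nonneg cc≥0 (proj₁ (degA-bounds k r pε))) (hexagonal-nonneg l)) e≤N)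
      (≤-dominated _ (proj₂ (degA-bounds k r pε)) (l₄ c d k r l) (+-nonneg cc≥0 (hexagonal-nonneg l)) e≤N)
      (≤-dominated _ (∣x∣≤x[2x+1] l) (l₅ c d k r l) (+-nonneg cc≥0 A≥0) e≤N)
      where
      e≤N = cut _ _ _ p
      A≥0 : 0ℤ ℤ.≤ degA k r
      A≥0 = ℤ.≤-trans 0≤+ (proj₂ (degA-bounds k r pε))
      cc≥0 : 0ℤ ℤ.≤ + 2 * (c * c) + + 2 * (d * d)
      cc≥0 = +-nonneg (*-nonneg (0≤+ {2}) (square-nonneg c)) (*-nonneg (0≤+ {2}) (square-nonneg d))
      l₁ : ∀ c d k r l → c * c + (c * c + (d * d + d * d) + (+ 2 * (k * k + (+ 2 * k - 1ℤ) * r) + k + l * (+ 2 * l + 1ℤ))) ≡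
        + 2 * (c * c + d * d + (k * k + (+ 2 * k - 1ℤ) * r) + l * l) + (k + l)
      l₁ = solve-∀
      l₂ : ∀ c d k r l → d * d + (d * d + (c * c + c * c) + (+ 2 * (k * k + (+ 2 * k - 1ℤ) * r) + k + l * (+ 2 * l + 1ℤ))) ≡
        + 2 * (c * c + d * d + (k * k + (+ 2 * k - 1ℤ) * r) + l * l) + (k + l)
      l₂ = solve-∀
      l₃ : ∀ c d k r l → k * (+ 2 * k + 1ℤ) + (+ 2 * (c * c) + + 2 * (d * d) + + 2 * ((+ 2 * k - 1ℤ) * r) + l * (+ 2 * l + 1ℤ)) ≡
        + 2 * (c * c + d * d + (k * k + (+ 2 * k - 1ℤ) * r) + l * l) + (k + l)
      l₃ = solve-∀
      l₄ : ∀ c d k r l → (+ 2 * (k * k + (+ 2 * k - 1ℤ) * r) + k) + (+ 2 * (c * c) + + 2 * (d * d) + l * (+ 2 * l + 1ℤ)) ≡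
        + 2 * (c * c + d * d + (k * k + (+ 2 * k - 1ℤ) * r) + l * l) + (k + l)
      l₄ = solve-∀
      l₅ : ∀ c d k r l → l * (+ 2 * l + 1ℤ) + (+ 2 * (c * c) + + 2 * (d * d) + (+ 2 * (k * k + (+ 2 * k - 1ℤ) * r) + k)) ≡
        + 2 * (c * c + d * d + (k * k + (+ 2 * k - 1ℤ) * r) + l * l) + (k + l)
      l₅ = solve-∀

    -- The added weight `c − d` is antisymmetric in `c` and `d`. Afterwards the weight is
    -- `4k + 2d − s − t` in the coordinates of `F₂`, free of `r`, as the reflection of `r` in
    -- `difference-zero` requires.
    symmetrize : ∑∑ L (λ c d → ∑∑ L (λ k r → ∑ (range L) (F c d k r))) ≡ ∑∑ L (λ c d → ∑∑ L (λ k r → ∑ (range L) (F₁ c d k r)))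
    symmetrize = sym (trans (∑∑-cong L λ c d → trans (∑∑-cong L λ k r → trans (∑-cong (range L) (split c d k r)) (∑-+ (range L) (F c d k r) (D′ c d k r))) (∑∑-+ L (λ k r → ∑ (range L) (F c d k r)) (λ k r → ∑ (range L) (D′ c d k r))))
      (trans (∑∑-+ L (λ c d → ∑∑ L (λ k r → ∑ (range L) (F c d k r))) D) (trans (cong (λ z → ∑∑ L (λ c d → ∑∑ L (λ k r → ∑ (range L) (F c d k r))) + z) (∑∑-antisym L D anti)) (ℤ.+-identityʳ _))))
      where
      D′ : ℤ → ℤ → ℤ → ℤ → ℤ → ℤ
      D′ c d k r l = (c - d) * (sg (c + d) * (ε k r * X c d k r l))
      D : ℤ → ℤ → ℤ
      D c d = ∑∑ L (λ k r → ∑ (range L) (D′ c d k r))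
      split : ∀ c d k r l → F₁ c d k r l ≡ F c d k r l + (c - d) * (sg (c + d) * (ε k r * X c d k r l))
      split c d k r l = lem (sg (c + d)) (ε k r) (X c d k r l) c d k r l
        where
        lem : ∀ s e x c d k r l → s * (e * ((k + r + c - l - d) * x)) ≡ s * (e * ((k + r - l) * x)) + (c - d) * (s * (e * x))
        lem = solve-∀
      anti : ∀ c d → D c d ≡ - D d c
      anti c d = trans (∑∑-cong L λ k r → trans (∑-cong (range L) λ l → *-neg-cong (l₁ c d)
        (cong₂ (λ s x → s * (ε k r * x)) (cong sg (ℤ.+-comm c d)) (Φ-cong (l₂ c d _ _) refl (cong (_+ r) (ℤ.+-comm c d))))) (∑-neg (range L) _)) (∑∑-neg L _)
        where
        l₁ : ∀ c d → c - d ≡ - (d - c)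
        l₁ = solve-∀
        l₂ : ∀ c d a b → c * c + d * d + a + b ≡ d * d + c * c + a + b
        l₂ = solve-∀

    e₅ : ℤ → ℤ → ℤ → ℤ → ℤ → ℤ
    e₅ d r k s t = (k + d - r) * (k + d - r) + (t - k - d) * (t - k - d) + (k * k + (+ 2 * k - 1ℤ) * r) + (s - k) * (s - k)

    w : ℤ → ℤ → ℤ → ℤ → ℤ
    w d k s t = + 4 * k + + 2 * d - s - t

    F₂ F₃ : ℤ → ℤ → ℤ → ℤ → ℤ → ℤ
    F₂ d r k s t = sg (t - r) * (ε k r * (w d k s t * Φ (e₅ d r k s t) s t))
    F₃ d r k s t = sg (t - r) * (ε′ d r * (w d k s t * Φ (e₅ d r k s t) s t))

    S5 : (ℤ → ℤ → ℤ → ℤ → ℤ → ℤ) → ℤ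
    S5 f = ∑∑ L (λ a b → ∑ (range L) λ c → ∑∑ L (f a b c))

    reindexed : ∑∑ L (λ c d → ∑∑ L (λ k r → ∑ (range L) (F₁ c d k r))) ≡ S5 F₂
    reindexed = reindex-iso {L} {L} {5} {5}
      (λ { (c ∷ d ∷ k ∷ r ∷ l ∷ []) → F₁ c d k r l }) (λ { (d ∷ r ∷ k ∷ s ∷ t ∷ []) → F₂ d r k s t })
      (λ { (c ∷ d ∷ k ∷ r ∷ l ∷ []) → r + c - k ∷ r ∷ k ∷ k + l ∷ c + d + r ∷ [] })
      (λ { (d ∷ r ∷ k ∷ s ∷ t ∷ []) → k + d - r ∷ t - k - d ∷ k ∷ r ∷ s - k ∷ [] })
      (λ { (c ∷ d ∷ k ∷ r ∷ l ∷ []) → cong₃ (λ x y z → x ∷ y ∷ k ∷ r ∷ z ∷ []) (m₁ c k r) (m₂ c d k r) (m₃ k l) })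
      (λ { (d ∷ r ∷ k ∷ s ∷ t ∷ []) → cong₃ (λ x y z → x ∷ r ∷ k ∷ y ∷ z ∷ []) (n₁ d r k) (n₂ s k) (n₃ d r k t) })
      (λ { (c ∷ d ∷ k ∷ r ∷ l ∷ []) → value c d k r l })
      (λ { (c ∷ d ∷ k ∷ r ∷ l ∷ []) p →
        let small₅ bc bd bk br bl = suppX c d k r l (*-≢0ˡ (ε k r) (*-≢0ʳ (sg (c + d)) p)) (*-≢0ʳ (k + r + c - l - d) (*-≢0ʳ (ε k r) (*-≢0ʳ (sg (c + d)) p))) in
        (Bk 1 200 big bc ∷ Bk 1 200 big bd ∷ Bk 1 200 big bk ∷ Bk 1 200 big br ∷ Bk 1 200 big bl ∷ []) ,
        (Bk 3 200 big (B- (B+ br bc) bk) ∷ Bk 1 200 big br ∷ Bk 1 200 big bk ∷ Bk 2 200 big (B+ bk bl) ∷ Bk 3 200 big (B+ (B+ bc bd) br) ∷ []) })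
      where
      m₁ : ∀ c k r → k + (r + c - k) - r ≡ c
      m₁ = solve-∀
      m₂ : ∀ c d k r → c + d + r - k - (r + c - k) ≡ d
      m₂ = solve-∀
      m₃ : ∀ k l → k + l - k ≡ l
      m₃ = solve-∀
      n₁ : ∀ d r k → r + (k + d - r) - k ≡ d
      n₁ = solve-∀
      n₂ : ∀ s k → k + (s - k) ≡ s
      n₂ = solve-∀
      n₃ : ∀ d r k t → (k + d - r) + (t - k - d) + r ≡ t
      n₃ = solve-∀
      value : ∀ c d k r l → F₂ (r + c - k) r k (k + l) (c + d + r) ≡ F₁ c d k r l
      value c d k r l = cong₂ (λ s x → s * (ε k r * x)) (cong sg (v₁ c d r)) (cong₂ _*_ (v₂ c d k r l) (Φ-cong (v₃ c d k r l) refl refl))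
        where
        v₁ : ∀ c d r → c + d + r - r ≡ c + d
        v₁ = solve-∀
        v₂ : ∀ c d k r l → + 4 * k + + 2 * (r + c - k) - (k + l) - (c + d + r) ≡ k + r + c - l - d
        v₂ = solve-∀
        v₃ : ∀ c d k r l → (k + (r + c - k) - r) * (k + (r + c - k) - r) + (c + d + r - k - (r + c - k)) * (c + d + r - k - (r + c - k)) +
          (k * k + (+ 2 * k - 1ℤ) * r) + (k + l - k) * (k + l - k) ≡ c * c + d * d + (k * k + (+ 2 * k - 1ℤ) * r) + l * l
        v₃ = solve-∀

    record Small (d k s t : ℤ) : Set where
      constructor small
      field
        bd : Bounded N 3 d
        bk : Bounded N 3 k
        bs : Bounded N 3 s
        bt : Bounded N 3 t

    supp₂ : ∀ d r k s t → F₂ d r k s t ≢ 0ℤ → Small d k s t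
    supp₂ d r k s t p =
      let small₅ bc bd bk br bl = suppX (k + d - r) (t - k - d) k r (s - k) pε (λ q → *-≢0ʳ (w d k s t) pw (trans (Φ-cong refl (sym (n₂ s k)) (sym (n₃ d r k t))) q))
      in small (B≡ (n₁ d r k) (B- (B+ br bc) bk)) (Bweaken bk) (Bweaken (B≡ (n₂ s k) (B+ bk bl))) (B≡ (n₃ d r k t) (B+ (B+ bc bd) br))
      where
      pε = *-≢0ˡ (ε k r) (*-≢0ʳ (sg (t - r)) p)
      pw = *-≢0ʳ (ε k r) (*-≢0ʳ (sg (t - r)) p)
      n₁ : ∀ d r k → r + (k + d - r) - k ≡ d
      n₁ = solve-∀
      n₂ : ∀ s k → k + (s - k) ≡ s
      n₂ = solve-∀
      n₃ : ∀ d r k t → (k + d - r) + (t - k - d) + r ≡ t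
      n₃ = solve-∀

    squares≥0 : ∀ d k s t → 0ℤ ℤ.≤ + 2 * ((k + d) * (k + d)) + + 2 * ((t - k - d) * (t - k - d)) + (s - k) * (+ 2 * (s - k) + 1ℤ) + k * (+ 2 * k + 1ℤ)
    squares≥0 d k s t = +-nonneg (+-nonneg (+-nonneg (*-nonneg (0≤+ {2}) (square-nonneg (k + d))) (*-nonneg (0≤+ {2}) (square-nonneg (t - k - d))))
      (hexagonal-nonneg (s - k))) (hexagonal-nonneg k)

    -- Isolates `r² − (2d + 1) r`, the only part of the degree that can be negative; the other terms
    -- are those of `squares≥0`.
    e₅-squares : ∀ d r k s t → + 2 * (r * r + - (+ 2 * d + 1ℤ) * r) +
      (+ 2 * ((k + d) * (k + d)) + + 2 * ((t - k - d) * (t - k - d)) + (s - k) * (+ 2 * (s - k) + 1ℤ) + k * (+ 2 * k + 1ℤ)) ≡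
      + 2 * e₅ d r k s t + s
    e₅-squares = lem
      where
      lem : ∀ d r k s t → + 2 * (r * r + - (+ 2 * d + 1ℤ) * r) +
        (+ 2 * ((k + d) * (k + d)) + + 2 * ((t - k - d) * (t - k - d)) + (s - k) * (+ 2 * (s - k) + 1ℤ) + k * (+ 2 * k + 1ℤ)) ≡
        + 2 * ((k + d - r) * (k + d - r) + (t - k - d) * (t - k - d) + (k * k + (+ 2 * k - 1ℤ) * r) + (s - k) * (s - k)) + s
      lem = solve-∀

    supp₃ : ∀ d r k s t → F₃ d r k s t ≢ 0ℤ → Small d k s t × Bounded N 3 r
    supp₃ d r k s t p = small (Bweaken (B≡ (n₁ d k) (B- bkd bk))) (Bweaken bk) (Bweaken (B≡ (n₂ s k) (B+ bsk bk))) (Bweaken (B≡ (n₃ d k t) (B+ btkd bkd))) , Bweaken br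
      where
      0≤r = ε′-nonneg d r (*-≢0ˡ (ε′ d r) (*-≢0ʳ (sg (t - r)) p))
      e≤N = ℤ.≤-trans (ℤ.≤-reflexive (e₅-squares d r k s t)) (cut _ _ _ (*-≢0ʳ (w d k s t) (*-≢0ʳ (ε′ d r) (*-≢0ʳ (sg (t - r)) p))))
      rr = r * r + - (+ 2 * d + 1ℤ) * r
      rr≥0 : 0ℤ ℤ.≤ rr
      rr≥0 = +-nonneg (square-nonneg r) 0≤r
      A = (k + d) * (k + d)
      B = (t - k - d) * (t - k - d)
      C = (s - k) * (+ 2 * (s - k) + 1ℤ)
      D = k * (+ 2 * k + 1ℤ)
      a≥0 = square-nonneg (k + d)
      b≥0 = square-nonneg (t - k - d)
      c≥0 = hexagonal-nonneg (s - k)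
      d≥0 = hexagonal-nonneg k
      2rr≥0 = *-nonneg (0≤+ {2}) rr≥0
      bkd : Bounded N 1 (k + d)
      bkd = ≤-dominated _ (∣x∣≤x*x (k + d)) (lem (+ 2 * rr) A B C D) (+-nonneg (+-nonneg (+-nonneg 2rr≥0 a≥0) (*-nonneg (0≤+ {2}) b≥0)) (+-nonneg c≥0 d≥0)) e≤N
        where
        lem : ∀ r a b c d → a + (r + a + + 2 * b + (c + d)) ≡ r + (+ 2 * a + + 2 * b + c + d)
        lem = solve-∀
      btkd : Bounded N 1 (t - k - d)
      btkd = ≤-dominated _ (∣x∣≤x*x (t - k - d)) (lem (+ 2 * rr) A B C D) (+-nonneg (+-nonneg (+-nonneg 2rr≥0 b≥0) (*-nonneg (0≤+ {2}) a≥0)) (+-nonneg c≥0 d≥0)) e≤N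
        where
        lem : ∀ r a b c d → b + (r + b + + 2 * a + (c + d)) ≡ r + (+ 2 * a + + 2 * b + c + d)
        lem = solve-∀
      bsk : Bounded N 1 (s - k)
      bsk = ≤-dominated _ (∣x∣≤x[2x+1] (s - k)) (lem (+ 2 * rr) A B C D) (+-nonneg (+-nonneg 2rr≥0 (+-nonneg (*-nonneg (0≤+ {2}) a≥0) (*-nonneg (0≤+ {2}) b≥0))) d≥0) e≤N
        where
        lem : ∀ r a b c d → c + (r + (+ 2 * a + + 2 * b) + d) ≡ r + (+ 2 * a + + 2 * b + c + d)
        lem = solve-∀
      bk : Bounded N 1 k
      bk = ≤-dominated _ (∣x∣≤x[2x+1] k) (lem (+ 2 * rr) A B C D) (+-nonneg (+-nonneg 2rr≥0 (+-nonneg (*-nonneg (0≤+ {2}) a≥0) (*-nonneg (0≤+ {2}) b≥0))) c≥0) e≤N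
        where
        lem : ∀ r a b c d → d + (r + (+ 2 * a + + 2 * b) + c) ≡ r + (+ 2 * a + + 2 * b + c + d)
        lem = solve-∀
      br : Bounded N 1 r
      br = ≤-dominated _ (∣x∣≤x*x r) (lem (r * r) (- (+ 2 * d + 1ℤ) * r) _) (+-nonneg (+-nonneg (square-nonneg r) (*-nonneg (0≤+ {2}) 0≤r)) (squares≥0 d k s t)) e≤N
        where
        lem : ∀ r a b → r + (r + + 2 * a + b) ≡ + 2 * (r + a) + b
        lem = solve-∀
      n₁ : ∀ d k → k + d - k ≡ d
      n₁ = solve-∀
      n₂ : ∀ s k → s - k + k ≡ s
      n₂ = solve-∀
      n₃ : ∀ d k t → (t - k - d) + (k + d) ≡ t
      n₃ = solve-∀

    χ : ℤ → ℤ
    χ z with ∣ z ∣ ℕ.≤? 3 ℕ.* suc N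
    ... | yes _ = 1ℤ
    ... | no _ = 0ℤ

    χ-in : ∀ {z} → Bounded N 3 z → χ z ≡ 1ℤ
    χ-in {z} (bounded p) with ∣ z ∣ ℕ.≤? 3 ℕ.* suc N
    ... | yes _ = refl
    ... | no q = ⊥-elim (q p)

    χ-≢ : ∀ {z} → χ z ≢ 0ℤ → Bounded N 3 z
    χ-≢ {z} p with ∣ z ∣ ℕ.≤? 3 ℕ.* suc N
    ... | yes q = bounded q
    ... | no _ = ⊥-elim (p refl)

    -- Cuts `d`, `k`, `s` and `t` off at a bound valid on the supports of both `F₂` and `F₃`. Their
    -- difference need not have finite support by itself: its indicators no longer restrict `r`, and
    -- the exponent is indefinite.
    mask : ℤ → ℤ → ℤ → ℤ → ℤ
    mask d k s t = χ d * (χ k * (χ s * χ t))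

    masked : ∀ {x} d k s t → (x ≢ 0ℤ → Small d k s t) → x ≡ mask d k s t * x
    masked {x} d k s t h with x ≟ 0ℤ
    ... | yes refl = sym (ℤ.*-zeroʳ (mask d k s t))
    ... | no p = let small bd bk bs bt = h p in
      sym (trans (cong₂ (λ a b → a * b * x) (χ-in bd) (cong₂ _*_ (χ-in bk) (cong₂ _*_ (χ-in bs) (χ-in bt)))) (ℤ.*-identityˡ x))

    difference : ℤ → ℤ → ℤ → ℤ → ℤ → ℤ
    difference d r k s t = mask d k s t * ((ind 0ℤ d - ind k 0ℤ) * (w d k s t * (sg (t - r) * Φ (e₅ d r k s t) s t)))

    -- `r ↦ 2d + 1 − r` preserves `e₅` and reverses the parity of `t − r`, while the indicators and
    -- the weight are free of `r`.
    difference-zero : S5 difference ≡ 0ℤ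
    difference-zero = S-antisym {L} {5} (λ { (d ∷ r ∷ k ∷ s ∷ t ∷ []) → difference d r k s t })
      (λ { (d ∷ r ∷ k ∷ s ∷ t ∷ []) → d ∷ + 2 * d + 1ℤ - r ∷ k ∷ s ∷ t ∷ [] })
      (λ { (d ∷ r ∷ k ∷ s ∷ t ∷ []) → cong (λ z → d ∷ z ∷ k ∷ s ∷ t ∷ []) (inv d r) })
      (λ { (d ∷ r ∷ k ∷ s ∷ t ∷ []) → trans
        (cong (λ z → mask d k s t * ((ind 0ℤ d - ind k 0ℤ) * (w d k s t * z)))
          (*-neg-cong (sg-flip (t - r) (r - d - 1ℤ) (v₁ d r t)) (Φ-cong (v₂ d r k s t) refl refl)))
        (pull (mask d k s t) (ind 0ℤ d - ind k 0ℤ) (w d k s t) _) })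
      (λ { (d ∷ r ∷ k ∷ s ∷ t ∷ []) p →
        let pm = *-≢0ˡ (mask d k s t) p
            bd = χ-≢ (*-≢0ˡ (χ d) pm)
            bk = χ-≢ (*-≢0ˡ (χ k) (*-≢0ʳ (χ d) pm))
            bs = χ-≢ (*-≢0ˡ (χ s) (*-≢0ʳ (χ k) (*-≢0ʳ (χ d) pm)))
            bt = χ-≢ (*-≢0ʳ (χ s) (*-≢0ʳ (χ k) (*-≢0ʳ (χ d) pm)))
            b2 : Bounded N 7 (+ 2 * d + 1ℤ)
            b2 = B+ (B≡ (dbl d) (B+ bd bd)) B1
            br = r-bound d r k s t b2 (*-≢0ʳ (sg (t - r)) (*-≢0ʳ (w d k s t) (*-≢0ʳ (ind 0ℤ d - ind k 0ℤ) (*-≢0ʳ (mask d k s t) p))))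
        in (Bk 3 200 big bd ∷ Bk 8 200 big br ∷ Bk 3 200 big bk ∷ Bk 3 200 big bs ∷ Bk 3 200 big bt ∷ []) ,
           (Bk 3 200 big bd ∷ Bk 15 200 big (B- b2 br) ∷ Bk 3 200 big bk ∷ Bk 3 200 big bs ∷ Bk 3 200 big bt ∷ []) })
      where
      inv : ∀ d r → + 2 * d + 1ℤ - (+ 2 * d + 1ℤ - r) ≡ r
      inv = solve-∀
      dbl : ∀ d → d + d ≡ + 2 * d
      dbl = solve-∀
      v₁ : ∀ d r t → t - (+ 2 * d + 1ℤ - r) ≡ t - r + (+ 2 * (r - d - 1ℤ) + 1ℤ)
      v₁ = solve-∀
      v₂ : ∀ d r k s t → (k + d - (+ 2 * d + 1ℤ - r)) * (k + d - (+ 2 * d + 1ℤ - r)) + (t - k - d) * (t - k - d) +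
        (k * k + (+ 2 * k - 1ℤ) * (+ 2 * d + 1ℤ - r)) + (s - k) * (s - k) ≡
        (k + d - r) * (k + d - r) + (t - k - d) * (t - k - d) + (k * k + (+ 2 * k - 1ℤ) * r) + (s - k) * (s - k)
      v₂ = solve-∀
      pull : ∀ a b c x → a * (b * (c * - x)) ≡ - (a * (b * (c * x)))
      pull = solve-∀
      r-bound : ∀ d r k s t → Bounded N 7 (+ 2 * d + 1ℤ) → Φ (e₅ d r k s t) s t ≢ 0ℤ → Bounded N 8 r
      r-bound d r k s t (bounded b) p = bounded (ℕ.≤-trans
        (quadratic-bound r (- (+ 2 * d + 1ℤ)) N (half≤ (≤-drop {b = + 2 * ((k + d) * (k + d)) + + 2 * ((t - k - d) * (t - k - d)) + (s - k) * (+ 2 * (s - k) + 1ℤ) + k * (+ 2 * k + 1ℤ)}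
          (e₅-squares d r k s t) (squares≥0 d k s t) (cut _ _ _ p))))
        (ℕ.≤-trans (ℕ.+-mono-≤ (ℕ.≤-trans (ℕ.≤-reflexive (ℤ.∣-i∣≡∣i∣ (+ 2 * d + 1ℤ))) b) (ℕ.n≤1+n N)) (ℕ.≤-reflexive (ℕ.+-comm (7 ℕ.* suc N) (suc N)))))

    S5-cong : ∀ {f g : ℤ → ℤ → ℤ → ℤ → ℤ → ℤ} → (∀ a b c d e → f a b c d e ≡ g a b c d e) → S5 f ≡ S5 g
    S5-cong h = ∑∑-cong L λ a b → ∑-cong (range L) λ c → ∑∑-cong L (h a b c)

    S5-+ : ∀ (f g : ℤ → ℤ → ℤ → ℤ → ℤ → ℤ) → S5 (λ a b c d e → f a b c d e + g a b c d e) ≡ S5 f + S5 g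
    S5-+ f g = trans (∑∑-cong L λ a b → trans (∑-cong (range L) λ c → ∑∑-+ L (f a b c) (g a b c)) (∑-+ (range L) _ _)) (∑∑-+ L _ _)

    exchange : S5 F₂ ≡ S5 F₃
    exchange = trans (S5-cong λ d r k s t → trans (masked d k s t (supp₂ d r k s t)) (trans (split d r k s t)
        (cong (_+ difference d r k s t) (sym (masked d k s t (λ p → proj₁ (supp₃ d r k s t p)))))))
      (trans (S5-+ F₃ difference) (trans (cong (λ z → S5 F₃ + z) difference-zero) (ℤ.+-identityʳ (S5 F₃))))
      where
      split : ∀ d r k s t → mask d k s t * F₂ d r k s t ≡ mask d k s t * F₃ d r k s t + difference d r k s t
      split d r k s t = lem (mask d k s t) (sg (t - r)) (ind 1ℤ r) (ind k 0ℤ) (ind 0ℤ d) (w d k s t) _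
        where
        lem : ∀ m s a b c w x → m * (s * ((a - b) * (w * x))) ≡ m * (s * ((a - c) * (w * x))) + m * ((c - b) * (w * (s * x)))
        lem = solve-∀

    -- For `s = h + e` and `t = h − e` the reflection `k ↦ h − d − k` preserves the exponent and
    -- negates the weight.
    even-zero : ∑∑ L (λ d r → ∑ (range L) λ k → ∑∑ L λ h e → F₃ d r k (h + e) (h - e)) ≡ 0ℤ
    even-zero = ∑∑-0 L λ d r → trans (S-comm L 1 L 2 (λ { (k ∷ []) (h ∷ e ∷ []) → F₃ d r k (h + e) (h - e) }))
      (∑∑-0 L λ h e → reflect-antisym (h - d) (λ k → F₃ d r k (h + e) (h - e))
        (λ k → trans (cong (λ z → sg (h - e - r) * (ε′ d r * z)) (*-neg-cong (v₁ d k h e) (Φ-cong (v₂ d r k h e) refl refl)))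
          (pull (sg (h - e - r)) (ε′ d r) _))
        (λ k p → let (small bd bk bs bt , _) = supp₃ d r k (h + e) (h - e) p
                     bh : Bounded N 6 h
                     bh = Bhalf (B≡ (v₃ h e) (B+ bs bt))
                 in Bk 3 200 big bk , Bk 12 200 big (B- (B- bh bd) bk)))
      where
      v₁ : ∀ d k h e → + 4 * (h - d - k) + + 2 * d - (h + e) - (h - e) ≡ - (+ 4 * k + + 2 * d - (h + e) - (h - e))
      v₁ = solve-∀
      v₂ : ∀ d r k h e → (h - d - k + d - r) * (h - d - k + d - r) + (h - e - (h - d - k) - d) * (h - e - (h - d - k) - d) +
        ((h - d - k) * (h - d - k) + (+ 2 * (h - d - k) - 1ℤ) * r) + (h + e - (h - d - k)) * (h + e - (h - d - k)) ≡
        (k + d - r) * (k + d - r) + (h - e - k - d) * (h - e - k - d) + (k * k + (+ 2 * k - 1ℤ) * r) + (h + e - k) * (h + e - k)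
      v₂ = solve-∀
      v₃ : ∀ h e → h + e + (h - e) ≡ + 2 * h
      v₃ = solve-∀
      pull : ∀ a b x → a * (b * - x) ≡ - (a * (b * x))
      pull = solve-∀

    C : ℤ → ℤ → ℤ → ℤ → ℤ
    C h e d c = h * h + h + (+ 2 * (e * e) + + 2 * e + 1ℤ) + (c * c + c + + 2 * (e * d))

    J-sum : ℤ → ℤ → ℤ → ℤ
    J-sum z s t = ∑ (range L) λ i → (+ 4 * i + 1ℤ) * Φ (z + + 2 * (i * (+ 2 * i + 1ℤ))) s t

    -- For `n = h − d − 2k` the weight is `−(2n + 1)` and `k` enters the exponent only through
    -- `n (n + 1)`, so the sum over `k` is an instance of `J-odd-class`.
    odd-k-sum : ∀ d r h e → ∑ (range L) (λ k → F₃ d r k (h + e + 1ℤ) (h - e)) ≡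
      - (sg (h - e - r) * (sg (h - d) * (ε′ d r * J-sum (C h e d (d - r)) (h + e + 1ℤ) (h - e))))
    -- The case `ε′ d r = 0` is separated because the support bounds that `J-odd-class` asks for are
    -- available only when `ε′ d r` is nonzero.
    odd-k-sum d r h e with ε′ d r ≟ 0ℤ
    ... | yes q = trans (trans (∑-cong (range L) λ k → trans (cong (λ z → sg (h - e - r) * (z * (w d k (h + e + 1ℤ) (h - e) * Φ (e₅ d r k (h + e + 1ℤ) (h - e)) (h + e + 1ℤ) (h - e)))) q) (ℤ.*-zeroʳ (sg (h - e - r)))) (∑-0 (range L)))
      (sym (trans (cong (λ z → - (sg (h - e - r) * (sg (h - d) * (z * J-sum (C h e d (d - r)) (h + e + 1ℤ) (h - e))))) q)
        (trans (cong (λ z → - (sg (h - e - r) * z)) (ℤ.*-zeroʳ (sg (h - d)))) (cong -_ (ℤ.*-zeroʳ (sg (h - e - r)))))))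
    ... | no q = trans (∑-cong (range L) λ k → trans
          (cong (λ z → sg (h - e - r) * (ε′ d r * z)) (cong₂ _*_ (v₁ d k h e) (Φ-cong (v₂ d r k h e) refl refl)))
          (pull (sg (h - e - r)) (ε′ d r) (+ 2 * (h - d - + 2 * k) + 1ℤ) _))
        (trans (∑-neg (range L) _) (cong -_ (trans (∑-*ˡ (range L) (sg (h - e - r) * ε′ d r) (λ k → (+ 2 * (h - d - + 2 * k) + 1ℤ) * Ψ ((h - d - + 2 * k) * (h - d - + 2 * k + 1ℤ))))
          (trans (cong (sg (h - e - r) * ε′ d r *_) (J-odd-class {L} {N} (ℕ.≤-trans (ℕ.*-monoˡ-≤ (suc N) 20≤200) big) (h - d) Ψ suppΨ))
            (assoc (sg (h - e - r)) (ε′ d r) (sg (h - d)) (J-sum (C h e d (d - r)) (h + e + 1ℤ) (h - e)))))))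
      where
      20≤200 : 20 ≤ 200
      20≤200 = ℕ.≤ᵇ⇒≤ 20 200 _
      Ψ : ℤ → ℤ
      Ψ z = Φ (C h e d (d - r) + z) (h + e + 1ℤ) (h - e)
      v₁ : ∀ d k h e → + 4 * k + + 2 * d - (h + e + 1ℤ) - (h - e) ≡ - (+ 2 * (h - d - + 2 * k) + 1ℤ)
      v₁ = solve-∀
      v₂ : ∀ d r k h e → (k + d - r) * (k + d - r) + (h - e - k - d) * (h - e - k - d) + (k * k + (+ 2 * k - 1ℤ) * r) + (h + e + 1ℤ - k) * (h + e + 1ℤ - k) ≡
        h * h + h + (+ 2 * (e * e) + + 2 * e + 1ℤ) + ((d - r) * (d - r) + (d - r) + + 2 * (e * d)) + (h - d - + 2 * k) * (h - d - + 2 * k + 1ℤ)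
      v₂ = solve-∀
      v₃ : ∀ h e → (h + e + 1ℤ) + (h - e) ≡ + 2 * h + 1ℤ
      v₃ = solve-∀
      pull : ∀ a b x y → a * (b * (- x * y)) ≡ - (a * b * (x * y))
      pull = solve-∀
      assoc : ∀ a b c x → a * b * (c * x) ≡ a * (c * (b * x))
      assoc = solve-∀
      -- The weight of F₃ is odd, hence nonzero.
      suppΨ : ∀ k → Ψ ((h - d - + 2 * k) * (h - d - + 2 * k + 1ℤ)) ≢ 0ℤ → Bounded N 6 k × Bounded N 9 (h - d)
      suppΨ k p = Bweaken bk , B- (Bhalf1 {a = h} (B≡ (v₃ h e) (B+ bs bt))) bd
        where
        Y = Φ (e₅ d r k (h + e + 1ℤ) (h - e)) (h + e + 1ℤ) (h - e)
        sg≢0 : ∀ z → sg z ≢ 0ℤ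
        sg≢0 z with parity z
        ... | even _ = λ ()
        ... | odd _ = λ ()
        w≢0 : w d k (h + e + 1ℤ) (h - e) ≢ 0ℤ
        w≢0 z = 2a≢2b+1 0ℤ (h - d - + 2 * k) (trans (sym (ℤ.neg-involutive 0ℤ)) (trans (cong -_ (trans (sym z) (v₁ d k h e))) (ℤ.neg-involutive _)))
        f≢0 : F₃ d r k (h + e + 1ℤ) (h - e) ≢ 0ℤ
        f≢0 z with ℤ.i*j≡0⇒i≡0∨j≡0 (sg (h - e - r)) z
        ... | inj₁ y = sg≢0 (h - e - r) y
        ... | inj₂ y with ℤ.i*j≡0⇒i≡0∨j≡0 (ε′ d r) y
        ...   | inj₁ x = q x
        ...   | inj₂ x with ℤ.i*j≡0⇒i≡0∨j≡0 (w d k (h + e + 1ℤ) (h - e)) x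
        ...     | inj₁ u = w≢0 u
        ...     | inj₂ u = p (trans (Φ-cong (sym (v₂ d r k h e)) refl refl) u)
        open Small (proj₁ (supp₃ d r k (h + e + 1ℤ) (h - e) f≢0))

    degree-nonneg : ∀ x → 0ℤ ℤ.≤ (+ 2 * x + 1ℤ) * (x + 1ℤ)
    degree-nonneg x = nonneg (l x) (hexagonal-nonneg (- (x + 1ℤ)))
      where
      l : ∀ x → (+ 2 * x + 1ℤ) * (x + 1ℤ) ≡ - (x + 1ℤ) * (+ 2 * (- (x + 1ℤ)) + 1ℤ)
      l = solve-∀

    ∣x+1∣≤degree : ∀ x → + ∣ x + 1ℤ ∣ ℤ.≤ (+ 2 * x + 1ℤ) * (x + 1ℤ)
    ∣x+1∣≤degree x = subst₂ ℤ._≤_ (cong +_ (ℤ.∣-i∣≡∣i∣ (x + 1ℤ))) (l x) (∣x∣≤x[2x+1] (- (x + 1ℤ)))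
      where
      l : ∀ x → - (x + 1ℤ) * (+ 2 * (- (x + 1ℤ)) + 1ℤ) ≡ (+ 2 * x + 1ℤ) * (x + 1ℤ)
      l = solve-∀

    -- The product is `(c² + c) − (d² + d)`. With it `supp₄` rewrites `c² + c + 2ed`, combined with
    -- `e² + e`, as a sum of nonnegative terms.
    pronic-mono : ∀ d c → η d c ≢ 0ℤ → 0ℤ ℤ.≤ (c - d) * (c + d + 1ℤ)
    pronic-mono d c p with η-cases d c p
    ... | inj₁ (0≤d , d≤c) = *-nonneg (ℤ.i≤j⇒0≤j-i d≤c) (+-nonneg (+-nonneg (ℤ.≤-trans 0≤d d≤c) 0≤d) (0≤+ {1}))
    ... | inj₂ (d<0 , c<d) = nonneg (l c d) (*-nonneg (+-nonneg (ℤ.i≤j⇒0≤j-i c<d) (0≤+ {1})) (+-nonneg (ℤ.neg-mono-≤ (ℤ.≤-trans c<d (ℤ.≤-trans (ℤ.i≤i+j d 1ℤ) d<0))) (ℤ.neg-mono-≤ (ℤ.≤-trans (ℤ.i≤i+j d 1ℤ) d<0)) ))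
      where
      l : ∀ c d → (c - d) * (c + d + 1ℤ) ≡ (d - (c + 1ℤ) + 1ℤ) * (- (c + 1ℤ) + - d)
      l = solve-∀

    record Small₄ (h e c i : ℤ) : Set where
      constructor small₄
      field
        bh : Bounded N 2 h
        be : Bounded N 2 e
        bi : Bounded N 1 i

    supp₄ : ∀ h e d c i → η d c ≢ 0ℤ → Φ (C h e d c + + 2 * (i * (+ 2 * i + 1ℤ))) (h + e + 1ℤ) (h - e) ≢ 0ℤ → Small₄ h e c i
    supp₄ h e d c i pη p = small₄
      (B≡ (drop1 h) (B- {a = h + 1ℤ} (≤-dominated _ (∣x+1∣≤degree h) (l₁ h e d c i) (+-nonneg (+-nonneg rest≥0 (*-nonneg (0≤+ {4}) (hexagonal-nonneg i))) (degree-nonneg e)) e≤N) B1))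
      (B≡ (drop1 e) (B- {a = e + 1ℤ} (≤-dominated _ (∣x+1∣≤degree e) (l₂ h e d c i) (+-nonneg (+-nonneg rest≥0 (*-nonneg (0≤+ {4}) (hexagonal-nonneg i))) (degree-nonneg h)) e≤N) B1))
      (≤-dominated _ (∣x∣≤x[2x+1] i) (l₃ h e d c i) (+-nonneg (+-nonneg (+-nonneg rest≥0 (*-nonneg (0≤+ {3}) (hexagonal-nonneg i))) (degree-nonneg h)) (degree-nonneg e)) e≤N)
      where
      e≤N = cut _ _ _ p
      rest≥0 : 0ℤ ℤ.≤ + 2 * ((c - d) * (c + d + 1ℤ)) + + 2 * ((d + e) * (d + e) + (d + e)) + 1ℤ
      rest≥0 = +-nonneg (+-nonneg (*-nonneg (0≤+ {2}) (pronic-mono d c pη)) (*-nonneg (0≤+ {2}) (pronic-nonneg (d + e)))) (0≤+ {1})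
      drop1 : ∀ x → x + 1ℤ - 1ℤ ≡ x
      drop1 = solve-∀
      l₁ : ∀ h e d c i → (+ 2 * h + 1ℤ) * (h + 1ℤ) + (+ 2 * ((c - d) * (c + d + 1ℤ)) + + 2 * ((d + e) * (d + e) + (d + e)) + 1ℤ + + 4 * (i * (+ 2 * i + 1ℤ)) + (+ 2 * e + 1ℤ) * (e + 1ℤ)) ≡
        + 2 * (h * h + h + (+ 2 * (e * e) + + 2 * e + 1ℤ) + (c * c + c + + 2 * (e * d)) + + 2 * (i * (+ 2 * i + 1ℤ))) + (h + e + 1ℤ)
      l₁ = solve-∀
      l₂ : ∀ h e d c i → (+ 2 * e + 1ℤ) * (e + 1ℤ) + (+ 2 * ((c - d) * (c + d + 1ℤ)) + + 2 * ((d + e) * (d + e) + (d + e)) + 1ℤ + + 4 * (i * (+ 2 * i + 1ℤ)) + (+ 2 * h + 1ℤ) * (h + 1ℤ)) ≡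
        + 2 * (h * h + h + (+ 2 * (e * e) + + 2 * e + 1ℤ) + (c * c + c + + 2 * (e * d)) + + 2 * (i * (+ 2 * i + 1ℤ))) + (h + e + 1ℤ)
      l₂ = solve-∀
      l₃ : ∀ h e d c i → i * (+ 2 * i + 1ℤ) + (+ 2 * ((c - d) * (c + d + 1ℤ)) + + 2 * ((d + e) * (d + e) + (d + e)) + 1ℤ + + 3 * (i * (+ 2 * i + 1ℤ)) + (+ 2 * h + 1ℤ) * (h + 1ℤ) + (+ 2 * e + 1ℤ) * (e + 1ℤ)) ≡
        + 2 * (h * h + h + (+ 2 * (e * e) + + 2 * e + 1ℤ) + (c * c + c + + 2 * (e * d)) + + 2 * (i * (+ 2 * i + 1ℤ))) + (h + e + 1ℤ)
      l₃ = solve-∀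

    inner : ℤ → ℤ → ℤ → ℤ
    inner h e i = ∑∑ L (λ c d → sg c * (η d c * Φ (C h e d c + + 2 * (i * (+ 2 * i + 1ℤ))) (h + e + 1ℤ) (h - e)))

    signs : ∀ h e d c → sg (h - e - (d - c)) * sg (h - d) ≡ sg e * sg c
    signs h e d c = trans (sym (sg-+ (h - e - (d - c)) (h - d))) (trans (cong sg (l h e d c)) (trans (sg-+ (e + c) (+ 2 * (h - d - e)))
      (trans (cong (sg (e + c) *_) (sg-even {+ 2 * (h - d - e)} (h - d - e) refl)) (trans (ℤ.*-identityʳ (sg (e + c))) (sg-+ e c)))))
      where
      l : ∀ h e d c → (h - e - (d - c)) + (h - d) ≡ (e + c) + + 2 * (h - d - e)
      l = solve-∀

    -- The substitution `r = d − c` turns `ε′ d r` into `η d c` and brings the exponent into the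
    -- form `c² + c + 2ed` of `Telescope`.
    odd-part : ∑∑ L (λ d r → ∑ (range L) λ k → ∑∑ L λ h e → F₃ d r k (h + e + 1ℤ) (h - e)) ≡
      ∑∑ L (λ h e → ∑ (range L) λ i → - (sg e * ((+ 4 * i + 1ℤ) * inner h e i)))
    odd-part = trans (∑∑-cong L λ d r → S-comm L 1 L 2 (λ { (k ∷ []) (h ∷ e ∷ []) → F₃ d r k (h + e + 1ℤ) (h - e) }))
      (trans (∑∑-comm L (λ d r h e → ∑ (range L) λ k → F₃ d r k (h + e + 1ℤ) (h - e)))
      (∑∑-cong L λ h e → trans (∑∑-cong L λ d r → odd-k-sum d r h e)
        (trans (∑-cong (range L) λ d → trans (reflect d (λ r → G h e d r) (suppG h e d)) (∑-cong (range L) (rewritten h e d)))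
        (trans (S-comm L 2 L 1 (λ { (d ∷ c ∷ []) (i ∷ []) → - (sg e * ((+ 4 * i + 1ℤ) * Y h e i c d)) }))
        (∑-cong (range L) λ i → trans (∑∑-neg L _) (cong -_ (trans (∑∑-*ˡ L (sg e) _) (cong (sg e *_) (trans (∑∑-*ˡ L (+ 4 * i + 1ℤ) _) (cong ((+ 4 * i + 1ℤ) *_) (∑∑-swap L _)))))))))))
      where
      Y : ℤ → ℤ → ℤ → ℤ → ℤ → ℤ
      Y h e i c d = sg c * (η d c * Φ (C h e d c + + 2 * (i * (+ 2 * i + 1ℤ))) (h + e + 1ℤ) (h - e))
      G : ℤ → ℤ → ℤ → ℤ → ℤ
      G h e d r = - (sg (h - e - r) * (sg (h - d) * (ε′ d r * J-sum (C h e d (d - r)) (h + e + 1ℤ) (h - e))))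
      rewritten : ∀ h e d c → G h e d (d - c) ≡ ∑ (range L) λ i → - (sg e * ((+ 4 * i + 1ℤ) * Y h e i c d))
      rewritten h e d c = trans (cong -_ (trans (sym (ℤ.*-assoc (sg (h - e - (d - c))) (sg (h - d)) _))
          (cong₂ _*_ (signs h e d c) (cong₂ _*_ (cong (_- ind 0ℤ d) (sym (trans (cong (ind (c + 1ℤ)) (l₁ d c)) (trans (cong (λ z → ind z (d - c + c)) (ℤ.+-comm c 1ℤ)) (ind-shift 1ℤ (d - c) c)))))
            (cong (λ z → J-sum (C h e d z) (h + e + 1ℤ) (h - e)) (l₂ d c))))))
        (trans (cong (λ z → - (sg e * sg c * z)) (sym (∑-*ˡ (range L) (η d c) _)))
        (trans (cong -_ (sym (∑-*ˡ (range L) (sg e * sg c) _))) (trans (sym (∑-neg (range L) _))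
        (∑-cong (range L) λ i → cong -_ (l₃ (sg e) (sg c) (η d c) (+ 4 * i + 1ℤ) _)))))
        where
        l₁ : ∀ d c → d ≡ d - c + c
        l₁ = solve-∀
        l₂ : ∀ d c → d - (d - c) ≡ c
        l₂ = solve-∀
        l₃ : ∀ a b x y z → a * b * (x * (y * z)) ≡ a * (y * (b * (x * z)))
        l₃ = solve-∀
      -- By `odd-k-sum`, `G` is a sum of values of `F₃` over `k`, so it vanishes outside their
      -- support.
      suppG : ∀ h e d r → G h e d r ≢ 0ℤ → ∣ r ∣ ≤ L × ∣ d - r ∣ ≤ L
      suppG h e d r p with ∣ r ∣ ℕ.≤? 3 ℕ.* suc N | ∣ d ∣ ℕ.≤? 3 ℕ.* suc N
      ... | yes x | yes y = Bk 3 200 big (bounded {z = r} x) , Bk 6 200 big (B- {k = 3} {l = 3} {a = d} {b = r} (bounded y) (bounded x))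
      ... | no x | _ = ⊥-elim (p (trans (sym (odd-k-sum d r h e)) (trans (∑-cong (range L) λ k → zero-outside k λ q → x (size (proj₂ (supp₃ d r k (h + e + 1ℤ) (h - e) q)))) (∑-0 (range L)))))
        where
        zero-outside : ∀ k → ¬ (F₃ d r k (h + e + 1ℤ) (h - e) ≢ 0ℤ) → F₃ d r k (h + e + 1ℤ) (h - e) ≡ 0ℤ
        zero-outside k q with F₃ d r k (h + e + 1ℤ) (h - e) ≟ 0ℤ
        ... | yes z = z
        ... | no z = ⊥-elim (q z)
      ... | _ | no x = ⊥-elim (p (trans (sym (odd-k-sum d r h e)) (trans (∑-cong (range L) λ k → zero-outside k λ q → x (size (Small.bd (proj₁ (supp₃ d r k (h + e + 1ℤ) (h - e) q))))) (∑-0 (range L)))))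
        where
        zero-outside : ∀ k → ¬ (F₃ d r k (h + e + 1ℤ) (h - e) ≢ 0ℤ) → F₃ d r k (h + e + 1ℤ) (h - e) ≡ 0ℤ
        zero-outside k q with F₃ d r k (h + e + 1ℤ) (h - e) ≟ 0ℤ
        ... | yes z = z
        ... | no z = ⊥-elim (q z)

    Φ-at : ℤ → ℤ → ℤ → ℤ → ℤ
    Φ-at h e i z = Φ (z + (h * h + h + (+ 2 * (e * e) + + 2 * e + 1ℤ) + + 2 * (i * (+ 2 * i + 1ℤ)))) (h + e + 1ℤ) (h - e)

    cut-at : ∀ h e i z → Φ-at h e i z ≢ 0ℤ → z ℤ.≤ + N
    cut-at h e i z p = half≤ (≤-drop (l h e i z) (+-nonneg (+-nonneg (+-nonneg (degree-nonneg h) (hexagonal-nonneg e))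
        (*-nonneg (0≤+ {2}) (square-nonneg (e + 1ℤ)))) (*-nonneg (0≤+ {4}) (hexagonal-nonneg i))) (cut _ _ _ p))
      where
      l : ∀ h e i z → + 2 * z + ((+ 2 * h + 1ℤ) * (h + 1ℤ) + e * (+ 2 * e + 1ℤ) + + 2 * ((e + 1ℤ) * (e + 1ℤ)) + + 4 * (i * (+ 2 * i + 1ℤ))) ≡
        + 2 * (z + (h * h + h + (+ 2 * (e * e) + + 2 * e + 1ℤ) + + 2 * (i * (+ 2 * i + 1ℤ)))) + (h + e + 1ℤ)
      l = solve-∀

    inner-zero : ∀ h e i → e ≢ 0ℤ → inner h e i ≡ 0ℤ
    inner-zero h e i e≢0 with ∣ e ∣ ℕ.≤? 2 ℕ.* suc N
    ... | no q = ∑∑-0 L λ c d → zero-term c d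
      where
      zero-term : ∀ c d → sg c * (η d c * Φ (C h e d c + + 2 * (i * (+ 2 * i + 1ℤ))) (h + e + 1ℤ) (h - e)) ≡ 0ℤ
      zero-term c d with sg c * (η d c * Φ (C h e d c + + 2 * (i * (+ 2 * i + 1ℤ))) (h + e + 1ℤ) (h - e)) ≟ 0ℤ
      ... | yes z = z
      ... | no p = ⊥-elim (q (size (Small₄.be (supp₄ h e d c i (*-≢0ˡ (η d c) (*-≢0ʳ (sg c) p)) (*-≢0ʳ (η d c) (*-≢0ʳ (sg c) p))))))
    ... | yes q = trans (∑∑-cong L λ c d → cong (λ z → sg c * (η d c * z)) (Φ-cong (l h e d c i) refl refl)) (Telescope.vanish {L} {N} {4 ℕ.* suc N} fits (Φ-at h e i) (cut-at h e i) e
          (ℕ.≤-trans (ℕ.+-mono-≤ q q) (ℕ.≤-reflexive (sym (ℕ.*-distribʳ-+ (suc N) 2 2)))) e≢0 0ℤ ℤ.≤-refl)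
      where
      l : ∀ h e d c i → h * h + h + (+ 2 * (e * e) + + 2 * e + 1ℤ) + (c * c + c + + 2 * (e * d)) + + 2 * (i * (+ 2 * i + 1ℤ)) ≡
        c * c + c + + 2 * (e * d) + 0ℤ + (h * h + h + (+ 2 * (e * e) + + 2 * e + 1ℤ) + + 2 * (i * (+ 2 * i + 1ℤ)))
      l = solve-∀
      fits : 2 ℕ.* (4 ℕ.* suc N ℕ.+ N) ℕ.+ 4 ≤ L
      fits = ℕ.≤-trans (ℕ.+-mono-≤ (ℕ.*-monoʳ-≤ 2 (ℕ.+-monoʳ-≤ (4 ℕ.* suc N) (ℕ.n≤1+n N))) (ℕ.m≤m*n 4 (suc N)))
        (ℕ.≤-trans (ℕ.≤-reflexive (trans (cong (λ z → 2 ℕ.* z ℕ.+ 4 ℕ.* suc N) (ℕ.+-comm (4 ℕ.* suc N) (suc N)))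
           (trans (cong (ℕ._+ 4 ℕ.* suc N) (sym (ℕ.*-assoc 2 5 (suc N)))) (sym (ℕ.*-distribʳ-+ (suc N) 10 4)))))
          (ℕ.≤-trans (ℕ.*-monoˡ-≤ (suc N) (ℕ.≤ᵇ⇒≤ 14 200 _)) big))

    -- At `e = 0` the exponent is free of `d`: `∑-η` carries out the sum over `d`, and
    -- `J-alternating` the one over `c`, which supplies the second factor `J`.
    inner-0 : ∀ h i → inner h 0ℤ i ≡ - ∑ (range L) (λ j → (+ 4 * j + 1ℤ) * Φ-at h 0ℤ i (+ 2 * (j * (+ 2 * j + 1ℤ))))
    inner-0 h i = trans (∑-cong (range L) per-c) (trans (∑-neg (range L) _) (cong -_
      (J-alternating {L} {N} (ℕ.≤-trans (ℕ.*-monoˡ-≤ (suc N) (ℕ.≤ᵇ⇒≤ 20 200 _)) big) (Φ-at h 0ℤ i) λ c p → Bweaken (bound-c c p))))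
      where
      bound-c : ∀ c → Φ-at h 0ℤ i (c * (c + 1ℤ)) ≢ 0ℤ → Bounded N 2 c
      bound-c c p = bounded (ℕ.≤-trans (quadratic-bound c 1ℤ N (ℤ.≤-trans (ℤ.≤-reflexive (l c)) (cut-at h 0ℤ i _ p))) (ℕ.m≤m+n (suc N) _))
        where
        l : ∀ c → c * c + 1ℤ * c ≡ c * (c + 1ℤ)
        l = solve-∀
      l₁ : ∀ h d c i → h * h + h + (+ 2 * (0ℤ * 0ℤ) + + 2 * 0ℤ + 1ℤ) + (c * c + c + + 2 * (0ℤ * d)) + + 2 * (i * (+ 2 * i + 1ℤ)) ≡
        c * (c + 1ℤ) + (h * h + h + (+ 2 * (0ℤ * 0ℤ) + + 2 * 0ℤ + 1ℤ) + + 2 * (i * (+ 2 * i + 1ℤ)))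
      l₁ = solve-∀
      l₂ : ∀ s x y → s * (- y * x) ≡ - (s * (y * x))
      l₂ = solve-∀
      per-c : ∀ c → ∑ (range L) (λ d → sg c * (η d c * Φ (C h 0ℤ d c + + 2 * (i * (+ 2 * i + 1ℤ))) (h + 0ℤ + 1ℤ) (h - 0ℤ))) ≡
        - (sg c * ((c + 1ℤ) * Φ-at h 0ℤ i (c * (c + 1ℤ))))
      per-c c = trans (∑-cong (range L) λ d → cong (λ z → sg c * (η d c * z)) (Φ-cong (l₁ h d c i) refl refl))
        (trans (∑-*ˡ (range L) (sg c) _) (trans (cong (sg c *_) (∑-*ʳ (range L) _ (λ d → η d c))) total))
        where
        total : sg c * (∑ (range L) (λ d → η d c) * Φ-at h 0ℤ i (c * (c + 1ℤ))) ≡ - (sg c * ((c + 1ℤ) * Φ-at h 0ℤ i (c * (c + 1ℤ))))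
        total with Φ-at h 0ℤ i (c * (c + 1ℤ)) ≟ 0ℤ
        ... | no p = trans (cong (λ z → sg c * (z * Φ-at h 0ℤ i (c * (c + 1ℤ)))) (∑-η L c (Bk 2 200 big (bound-c c p)))) (l₂ (sg c) _ (c + 1ℤ))
        ... | yes p = trans (cong (λ z → sg c * (∑ (range L) (λ d → η d c) * z)) p) (trans (cong (sg c *_) (ℤ.*-zeroʳ (∑ (range L) (λ d → η d c))))
          (trans (ℤ.*-zeroʳ (sg c)) (sym (trans (cong (λ z → - (sg c * ((c + 1ℤ) * z))) p) (cong -_ (trans (cong (sg c *_) (ℤ.*-zeroʳ (c + 1ℤ))) (ℤ.*-zeroʳ (sg c))))))))

    T : ℤ → ℤ → ℤ → ℤ
    T i j x = ((+ 4 * i + 1ℤ) * (+ 4 * j + 1ℤ)) * Φ (+ 2 * (i * (+ 2 * i + 1ℤ)) + + 2 * (j * (+ 2 * j + 1ℤ)) + (x * x - x + 1ℤ)) x (x - 1ℤ)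

    at-0 : ∀ h → ∑ (range L) (λ e → ∑ (range L) λ i → - (sg e * ((+ 4 * i + 1ℤ) * inner h e i))) ≡
      ∑∑ L (λ i j → T i j (h + 1ℤ))
    at-0 h = trans (∑-cong (range L) pick) (trans (∑-δ {L} {0ℤ} g z≤n) (∑-cong (range L) λ i →
      trans (cong (λ z → - (1ℤ * ((+ 4 * i + 1ℤ) * z))) (inner-0 h i)) (trans (l₁ (+ 4 * i + 1ℤ) _)
      (trans (sym (∑-*ˡ (range L) (+ 4 * i + 1ℤ) _)) (∑-cong (range L) λ j → trans (sym (ℤ.*-assoc (+ 4 * i + 1ℤ) (+ 4 * j + 1ℤ) _))
        (cong ((+ 4 * i + 1ℤ) * (+ 4 * j + 1ℤ) *_) (Φ-cong (l₂ h i j) (l₃ h) (l₄ h))))))))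
      where
      g : ℤ → ℤ
      g e = ∑ (range L) λ i → - (sg e * ((+ 4 * i + 1ℤ) * inner h e i))
      pick : ∀ e → g e ≡ δ 0ℤ e * g e
      pick e with 0ℤ ≟ e
      ... | yes _ = sym (ℤ.*-identityˡ (g e))
      ... | no p = trans (trans (∑-cong (range L) λ i → trans (cong (λ z → - (sg e * ((+ 4 * i + 1ℤ) * z))) (inner-zero h e i (λ q → p (sym q))))
        (trans (cong (λ z → - (sg e * z)) (ℤ.*-zeroʳ (+ 4 * i + 1ℤ))) (cong -_ (ℤ.*-zeroʳ (sg e))))) (∑-0 (range L))) (sym (ℤ.*-zeroˡ (g e)))
      l₁ : ∀ x y → - (1ℤ * (x * - y)) ≡ x * y
      l₁ = solve-∀
      l₂ : ∀ h i j → + 2 * (j * (+ 2 * j + 1ℤ)) + (h * h + h + (+ 2 * (0ℤ * 0ℤ) + + 2 * 0ℤ + 1ℤ) + + 2 * (i * (+ 2 * i + 1ℤ))) ≡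
        + 2 * (i * (+ 2 * i + 1ℤ)) + + 2 * (j * (+ 2 * j + 1ℤ)) + ((h + 1ℤ) * (h + 1ℤ) - (h + 1ℤ) + 1ℤ)
      l₂ = solve-∀
      l₃ : ∀ h → h + 0ℤ + 1ℤ ≡ h + 1ℤ
      l₃ = solve-∀
      l₄ : ∀ h → h - 0ℤ ≡ h + 1ℤ - 1ℤ
      l₄ = solve-∀

    suppT : ∀ i j x → T i j x ≢ 0ℤ → Bounded N 2 x
    suppT i j x p = Bweaken (B≡ (ℤ.neg-involutive x) (Bneg (≤-dominated _ (∣x∣≤x[2x+1] (- x)) (l i j x)
        (+-nonneg (+-nonneg (*-nonneg (0≤+ {4}) (hexagonal-nonneg i)) (*-nonneg (0≤+ {4}) (hexagonal-nonneg j))) (0≤+ {2}))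
        (cut _ _ _ (*-≢0ʳ ((+ 4 * i + 1ℤ) * (+ 4 * j + 1ℤ)) p)))))
      where
      Bneg : ∀ {k z} → Bounded N k z → Bounded N k (- z)
      Bneg {z = z} (bounded q) = bounded (ℕ.≤-trans (ℕ.≤-reflexive (ℤ.∣-i∣≡∣i∣ z)) q)
      l : ∀ i j x → - x * (+ 2 * (- x) + 1ℤ) + (+ 4 * (i * (+ 2 * i + 1ℤ)) + + 4 * (j * (+ 2 * j + 1ℤ)) + + 2) ≡
        + 2 * (+ 2 * (i * (+ 2 * i + 1ℤ)) + + 2 * (j * (+ 2 * j + 1ℤ)) + (x * x - x + 1ℤ)) + x
      l = solve-∀

  first-wronskian : ∑∑ L (λ c d → ∑∑ L (λ k r → ∑ (range L) λ l →
      sg (c + d) * (ε k r * ((k + r - l) * Φ (c * c + d * d + (k * k + (+ 2 * k - 1ℤ) * r) + l * l) (k + l) (c + d + r))))) ≡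
    ∑∑ L (λ i j → ∑ (range L) λ x → ((+ 4 * i + 1ℤ) * (+ 4 * j + 1ℤ)) *
      Φ (+ 2 * (i * (+ 2 * i + 1ℤ)) + + 2 * (j * (+ 2 * j + 1ℤ)) + (x * x - x + 1ℤ)) x (x - 1ℤ))
  first-wronskian = begin
    ∑∑ L (λ c d → ∑∑ L (λ k r → ∑ (range L) (F c d k r)))   ≡⟨ trans symmetrize (trans reindexed exchange) ⟩
    S5 F₃
      ≡⟨ ∑∑-cong L (λ d r → trans (∑-cong (range L) λ k → rotateB 3 200 big (F₃ d r k) λ s t p →
           let small _ _ bs bt = proj₁ (supp₃ d r k s t p) in bs , bt) (∑-+ (range L) _ _)) ⟩
    ∑∑ L (λ d r → ∑ (range L) (λ k → ∑∑ L λ h e → F₃ d r k (h + e) (h - e)) + ∑ (range L) (λ k → ∑∑ L λ h e → F₃ d r k (h + e + 1ℤ) (h - e)))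
      ≡⟨ trans (∑∑-+ L _ _) (trans (cong₂ _+_ even-zero odd-part) (ℤ.+-identityˡ _)) ⟩
    ∑∑ L (λ h e → ∑ (range L) λ i → - (sg e * ((+ 4 * i + 1ℤ) * inner h e i)))
      ≡⟨ ∑-cong (range L) at-0 ⟩
    ∑ (range L) (λ h → ∑∑ L (λ i j → T i j (h + 1ℤ)))
      ≡⟨ S-comm L 1 L 2 (λ { (h ∷ []) (i ∷ j ∷ []) → T i j (h + 1ℤ) }) ⟩
    ∑∑ L (λ i j → ∑ (range L) λ h → T i j (h + 1ℤ))
      ≡⟨ ∑∑-cong L (λ i j → sym (translate 1ℤ (T i j) λ x p → let b = suppT i j x p in Bk 2 200 big b , Bk 3 200 big (B- b B1))) ⟩
    ∑∑ L (λ i j → ∑ (range L) (T i j)) ∎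
    where open ≡-Reasoning

-- Elements given by a multiple sum of monomials

record Summation : Set₁ where
  field
    Index : Set
    sum : ℕ → (Index → ℤ) → ℤ
    sum-cong : ∀ B {f g} → (∀ i → f i ≡ g i) → sum B f ≡ sum B g
    sum-+ : ∀ B f g → sum B (λ i → f i + g i) ≡ sum B f + sum B g
    sum-*ˡ : ∀ B k f → sum B (λ i → k * f i) ≡ k * sum B f
open Summation

Over : ℕ → Summation
Over n = record
  { Index = Vec ℤ n ; sum = λ B → S B n
  ; sum-cong = λ B → S-cong B n ; sum-+ = λ B → S-+ B n ; sum-*ˡ = λ B → S-*ˡ B n }

_⊠_ : Summation → Summation → Summation
Σ ⊠ Σ′ = record
  { Index = Index Σ × Index Σ′
  ; sum = λ B f → sum Σ B λ i → sum Σ′ B λ j → f (i , j)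
  ; sum-cong = λ B e → sum-cong Σ B λ i → sum-cong Σ′ B λ j → e (i , j)
  ; sum-+ = λ B f g → trans (sum-cong Σ B λ i → sum-+ Σ′ B _ _) (sum-+ Σ B _ _)
  ; sum-*ˡ = λ B k f → trans (sum-cong Σ B λ i → sum-*ˡ Σ′ B k _) (sum-*ˡ Σ B k _) }

-- Turns identities in `R` into identities of multiple sums: products multiply the index sets, while
-- derivations and substitutions only change weights and exponents.
record Represents (Σ : Summation) (p : R) (w d b c : Index Σ → ℤ) : Set where
  constructor represents
  field
    pairing : ∀ B φ → ⟪ p B , φ ⟫ ≡ sum Σ B (λ i → w i * φ (d i) (b i) (c i))
open Represents

rep-fam : ∀ {n} {w d b c : Vec ℤ n → ℤ} → (∀ x → w x ≢ 0ℤ → 0ℤ ℤ.≤ d x) → Represents (Over n) (fam n w d b c) w d b c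
rep-fam nn = represents (⟪⟫-fam nn)

module _ {Σ Σ′ : Summation} {p q : R} {w d b c : Index Σ → ℤ} {w′ d′ b′ c′ : Index Σ′ → ℤ} where
  rep-⊙ : Represents Σ p w d b c → Represents Σ′ q w′ d′ b′ c′ →
    Represents (Σ ⊠ Σ′) (p ⊙ q) (λ (i , j) → w i * w′ j) (λ (i , j) → d i + d′ j) (λ (i , j) → b i + b′ j) (λ (i , j) → c i + c′ j)
  rep-⊙ P Q = represents λ B φ → trans (⟪⟫-⊗ (p B) (q B) φ) (trans (⟪⟫-cong (p B) λ x y z → pairing Q B (shift x y z φ))
    (trans (pairing P B _) (sum-cong Σ B λ i → trans (sym (sum-*ˡ Σ′ B (w i) _)) (sum-cong Σ′ B λ j → sym (ℤ.*-assoc (w i) (w′ j) _)))))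

module _ {Σ : Summation} {p : R} {w d b c : Index Σ → ℤ} where
  rep-∂ : ∀ ω → Represents Σ p w d b c → Represents Σ (∂ ω p) (λ i → w i * ω (b i) (c i)) d b c
  rep-∂ ω P = represents λ B φ → trans (⟪⟫-scale ω (p B) φ) (trans (pairing P B _) (sum-cong Σ B λ i → sym (ℤ.*-assoc (w i) _ _)))

  rep-⊕ : ∀ {q w′} → Represents Σ p w d b c → Represents Σ q w′ d b c → Represents Σ (p ⊕ q) (λ i → w i + w′ i) d b c
  rep-⊕ {q} {w′} P Q = represents λ B φ → trans (⟪⟫-++ (p B) (q B) φ) (trans (cong₂ _+_ (pairing P B φ) (pairing Q B φ))
    (trans (sym (sum-+ Σ B _ _)) (sum-cong Σ B λ i → sym (ℤ.*-distribʳ-+ (φ (d i) (b i) (c i)) (w i) (w′ i)))))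

  rep-⊖ : Represents Σ p w d b c → Represents Σ (⊖ p) (λ i → - w i) d b c
  rep-⊖ P = represents λ B φ → trans (⟪⟫-⊖ p B φ) (trans (cong -_ (pairing P B φ)) (trans (sym (ℤ.-1*i≡-i _))
    (trans (sym (sum-*ˡ Σ B (- 1ℤ) _)) (sum-cong Σ B λ i → trans (sym (ℤ.*-assoc (- 1ℤ) (w i) _)) (cong (_* φ (d i) (b i) (c i)) (ℤ.-1*i≡-i (w i)))))))

  rep-ι : ∀ k → Represents Σ p w d b c → Represents Σ (ι k ⊙ p) (λ i → k * w i) d b c
  rep-ι k P = represents λ B φ → trans (⟪⟫-ι⊙ k p B φ) (trans (cong (k *_) (pairing P B φ))
    (trans (sym (sum-*ˡ Σ B k _)) (sum-cong Σ B λ i → sym (ℤ.*-assoc k (w i) _))))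

  rep-≡ : ∀ {w′ d′ b′ c′} → (∀ i → w i ≡ w′ i) → (∀ i → d i ≡ d′ i) → (∀ i → b i ≡ b′ i) → (∀ i → c i ≡ c′ i) →
    Represents Σ p w d b c → Represents Σ p w′ d′ b′ c′
  rep-≡ {w′} {d′} {b′} {c′} ew ed eb ec P = represents λ B φ → trans (pairing P B φ) (sum-cong Σ B λ i → lem φ (ew i) (ed i) (eb i) (ec i))
    where
    lem : ∀ φ {w w′ d d′ b b′ c c′ : ℤ} → w ≡ w′ → d ≡ d′ → b ≡ b′ → c ≡ c′ → w * φ d b c ≡ w′ * φ d′ b′ c′
    lem φ refl refl refl refl = refl

  rep-pow : ∀ k l n → Represents Σ p w d b c → Represents Σ (pow k l n p) w (λ i → + k * d i) (λ i → l * b i) (λ i → n * c i)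
  rep-pow k l n P = represents λ B φ → trans (⟪⟫-pow k l n (p B) φ) (pairing P B _)

-- The theta series and the bilinear identity for T

fam₁ : (w d b c : ℤ → ℤ) → R
fam₁ w d b c = fam 1 (λ v → w (head v)) (λ v → d (head v)) (λ v → b (head v)) (λ v → c (head v))

on₂ : (ℤ → ℤ → ℤ) → Vec ℤ 2 → ℤ
on₂ f (k ∷ r ∷ []) = f k r

∂x ∂y : R → R
∂x = ∂ _+_
∂y = ∂ (λ _ c → c)

-- The bilinear operator 2 (f f_xy − f_x f_y).
hirota : R → R
hirota f = ∂x (∂y f) ⊙ f ⊕ f ⊙ ∂x (∂y f) ⊕ ⊖ (∂x f ⊙ ∂y f ⊕ ∂y f ⊙ ∂x f)

-- Over ordered pairs of monomials the four terms of the operator combine into a product of two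
-- differences, the shape in which `addition-formula` is stated.
rep-hirota : ∀ {Σ p w d b c} → Represents Σ p w d b c → Represents (Σ ⊠ Σ) (hirota p)
  (λ (i , j) → (w i * w j) * (((b i + c i) - (b j + c j)) * (c i - c j)))
  (λ (i , j) → d i + d j) (λ (i , j) → b i + b j) (λ (i , j) → c i + c j)
rep-hirota {w = w} {b = b} {c} P = rep-≡ (λ (i , j) → lem (w i) (w j) (b i) (b j) (c i) (c j)) (λ _ → refl) (λ _ → refl) (λ _ → refl)
  (rep-⊕ (rep-⊕ (rep-⊙ xy P) (rep-⊙ P xy)) (rep-⊖ (rep-⊕ (rep-⊙ x y) (rep-⊙ y x))))
  where
  x = rep-∂ _+_ P
  y = rep-∂ (λ _ c → c) P
  xy = rep-∂ _+_ y
  lem : ∀ w w′ b b′ c c′ → w * c * (b + c) * w′ + w * (w′ * c′ * (b′ + c′)) + - (w * (b + c) * (w′ * c′) + w * c * (w′ * (b′ + c′))) ≡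
    (w * w′) * (((b + c) - (b′ + c′)) * (c - c′))
  lem = solve-∀

-- `△` is entered as the bilateral sum of `q^(j (2j + 1))`, which is easier to rotate;
-- `triangular-count` identifies it with the sum over triangular numbers.
θ ψ J △ A : R
θ = fam₁ (λ _ → 1ℤ) (λ k → k * (+ 2 * k + 1ℤ)) (λ k → k) (λ _ → 0ℤ)
ψ = fam₁ sg (λ k → + 2 * (k * k)) (λ _ → 0ℤ) (λ k → k)
J = fam₁ (λ i → + 4 * i + 1ℤ) (λ i → + 4 * (i * (+ 2 * i + 1ℤ))) (λ _ → 0ℤ) (λ _ → 0ℤ)
△ = fam₁ (λ _ → 1ℤ) (λ j → + 2 * (j * (+ 2 * j + 1ℤ))) (λ _ → 0ℤ) (λ _ → 0ℤ)
A = fam 2 (on₂ ε) (on₂ degA) (on₂ λ k r → k) (on₂ λ k r → r)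

tri : ℕ → ℤ
tri zero = 0ℤ
tri (suc m) = tri m + + suc m

degT : ℤ → ℤ → ℤ
degT m k = + 2 * (k * k - k * m) + k + m * (m + 1ℤ)

T : ℕ → R
T m = fam₁ (λ _ → 1ℤ) (degT (+ m)) (λ k → k) (λ k → k * + m - tri m)

degT-nonneg : ∀ m k → 0ℤ ℤ.≤ degT (+ m) k
degT-nonneg m k = nonneg (l (+ m) k) (+-nonneg (+-nonneg (square-nonneg (k - + m)) (pronic-nonneg k)) (0≤+ {m}))
  where
  l : ∀ m k → + 2 * (k * k - k * m) + k + m * (m + 1ℤ) ≡ (k - m) * (k - m) + (k * k + k) + m
  l = solve-∀

rep-θ : Represents (Over 1) θ (λ v → 1ℤ) (λ v → head v * (+ 2 * head v + 1ℤ)) head (λ _ → 0ℤ)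
rep-θ = rep-fam λ v _ → hexagonal-nonneg (head v)

rep-ψ : Represents (Over 1) ψ (λ v → sg (head v)) (λ v → + 2 * (head v * head v)) (λ _ → 0ℤ) head
rep-ψ = rep-fam λ v _ → *-nonneg (0≤+ {2}) (square-nonneg (head v))

rep-J : Represents (Over 1) J (λ v → + 4 * head v + 1ℤ) (λ v → + 4 * (head v * (+ 2 * head v + 1ℤ))) (λ _ → 0ℤ) (λ _ → 0ℤ)
rep-J = rep-fam λ v _ → *-nonneg (0≤+ {4}) (hexagonal-nonneg (head v))

rep-△ : Represents (Over 1) △ (λ v → 1ℤ) (λ v → + 2 * (head v * (+ 2 * head v + 1ℤ))) (λ _ → 0ℤ) (λ _ → 0ℤ)
rep-△ = rep-fam λ v _ → *-nonneg (0≤+ {2}) (hexagonal-nonneg (head v))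

rep-T : ∀ m → Represents (Over 1) (T m) (λ _ → 1ℤ) (λ v → degT (+ m) (head v)) head (λ v → head v * + m - tri m)
rep-T m = rep-fam λ v _ → degT-nonneg m (head v)

rep-A : Represents (Over 2) A (on₂ ε) (on₂ degA) (on₂ λ k r → k) (on₂ λ k r → r)
rep-A = rep-fam λ { (k ∷ r ∷ []) p → ℤ.≤-trans 0≤+ (proj₂ (degA-bounds k r p)) }

cut⇒≤ : ∀ {M φ} → Cut M φ → ∀ a b c → φ a b c ≢ 0ℤ → a ℤ.≤ + M
cut⇒≤ {M} cut a b c p with a ℤ.≤? + M
... | yes q = q
... | no q = ⊥-elim (p (cut a b c (ℤ.<⇒≤ (ℤ.≰⇒> q))))

-- In `T (suc m)` the x-degree and the y-degree are `k (M₁ + 1)` and `k M₁` up to constants, so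
-- `hirota` produces the factor `P = M₁ (M₁ + 1)`, common to both terms on the left. What remains is
-- `addition-formula`.
two-T : ∀ m → let μ = + m ; P = (1ℤ + μ) * (1ℤ + μ + 1ℤ) in
  hirota (T (suc m)) ⊙ (ψ ⊙ ψ) ⊕ ⊖ (ι P ⊙ ((T (suc m) ⊙ T (suc m)) ⊙ hirota ψ)) ≈
  ι (+ 2 * P) ⊙ ((J ⊙ J) ⊙ (T (suc (suc m)) ⊙ T m))
-- The degree bounds `a − M₁` and `b − M₁` rather than `a` and `b`, hence the additional `suc m`.
two-T m = mk λ M → mk (40 ℕ.* suc (M ℕ.+ suc m)) λ B big φ cut → let
    -- Up to a monomial, `T m` is `θ` with `u` replaced by `u q^(−m) v^m`. On the exponents this
    -- substitution is linear in `s`, so it can be moved into the test.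
    Φ : ℤ → ℤ → ℤ → ℤ
    Φ e s t = φ (+ 2 * e + s - + 2 * (s * M₁) + + 2 * (M₁ * (M₁ + 1ℤ))) s (s * M₁ - + 2 * τ₁ + t)
  in trans (pairing left B φ) (trans (∑∑-cong B λ a b → trans (∑∑-cong B λ c d → lhs φ a b c d) (∑∑-*ˡ B P _))
     (trans (∑∑-*ˡ B P _) (trans (cong (P *_) (addition-formula big Φ (support M φ cut)))
     (trans (arrange P _) (sym (trans (pairing right B φ) (trans (∑∑-cong B λ i j → trans (∑∑-cong B λ x y → rhs φ i j x y) (∑∑-*ˡ B (+ 2 * P) _))
        (∑∑-*ˡ B (+ 2 * P) _))))))))
  where
  μ = + m
  M₁ = 1ℤ + μ
  P = M₁ * (M₁ + 1ℤ)
  τ₁ = tri m + M₁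
  left = rep-⊕ {Σ = (Over 1 ⊠ Over 1) ⊠ (Over 1 ⊠ Over 1)}
    {d = λ ((a , b) , (c , d)) → degT M₁ (head a) + degT M₁ (head b) + (+ 2 * (head c * head c) + + 2 * (head d * head d))}
    {b = λ ((a , b) , (c , d)) → head a + head b + (0ℤ + 0ℤ)}
    {c = λ ((a , b) , (c , d)) → (head a * M₁ - τ₁) + (head b * M₁ - τ₁) + (head c + head d)}
    (rep-⊙ (rep-hirota (rep-T (suc m))) (rep-⊙ rep-ψ rep-ψ))
    (rep-⊖ (rep-ι P (rep-⊙ (rep-⊙ (rep-T (suc m)) (rep-T (suc m))) (rep-hirota rep-ψ))))
  right = rep-ι (+ 2 * P) (rep-⊙ (rep-⊙ rep-J rep-J) (rep-⊙ (rep-T (suc (suc m))) (rep-T m)))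
  arrange : ∀ p x → p * (+ 2 * x) ≡ + 2 * p * x
  arrange = solve-∀
  w-left : ℤ → ℤ → ℤ → ℤ → ℤ
  w-left a b c d =
    (1ℤ * 1ℤ) * (((a + (a * M₁ - τ₁)) - (b + (b * M₁ - τ₁))) * ((a * M₁ - τ₁) - (b * M₁ - τ₁))) * (sg c * sg d)
    + - (P * (1ℤ * 1ℤ * (sg c * sg d * ((0ℤ + c - (0ℤ + d)) * (c - d)))))
  lhs : ∀ φ a b c d → w-left a b c d *
      φ (degT M₁ a + degT M₁ b + (+ 2 * (c * c) + + 2 * (d * d))) (a + b + (0ℤ + 0ℤ)) ((a * M₁ - τ₁) + (b * M₁ - τ₁) + (c + d)) ≡
    P * (((a - b) * (a - b) - (c - d) * (c - d)) * (sg (c + d) *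
      φ (+ 2 * (a * a + b * b + c * c + d * d) + (a + b) - + 2 * ((a + b) * M₁) + + 2 * (M₁ * (M₁ + 1ℤ))) (a + b) ((a + b) * M₁ - + 2 * τ₁ + (c + d))))
  lhs φ a b c d = trans (cong₂ _*_ (trans (l₁ (sg c) (sg d) M₁ τ₁ a b c d) (cong (M₁ * (M₁ + 1ℤ) * ((a - b) * (a - b) - (c - d) * (c - d)) *_) (sym (sg-+ c d))))
      (cong₃ φ (l₂ M₁ a b c d) (l₃ a b) (l₄ M₁ τ₁ a b c d))) (l₅ P ((a - b) * (a - b) - (c - d) * (c - d)) (sg (c + d)) _)
    where
    l₁ : ∀ s s′ m τ a b c d → (1ℤ * 1ℤ) * (((a + (a * m - τ)) - (b + (b * m - τ))) * ((a * m - τ) - (b * m - τ))) * (s * s′)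
      + - ((m * (m + 1ℤ)) * (1ℤ * 1ℤ * (s * s′ * ((0ℤ + c - (0ℤ + d)) * (c - d))))) ≡
      m * (m + 1ℤ) * ((a - b) * (a - b) - (c - d) * (c - d)) * (s * s′)
    l₁ = solve-∀
    l₂ : ∀ m a b c d → + 2 * (a * a - a * m) + a + m * (m + 1ℤ) + (+ 2 * (b * b - b * m) + b + m * (m + 1ℤ)) + (+ 2 * (c * c) + + 2 * (d * d)) ≡
      + 2 * (a * a + b * b + c * c + d * d) + (a + b) - + 2 * ((a + b) * m) + + 2 * (m * (m + 1ℤ))
    l₂ = solve-∀
    l₃ : ∀ a b → a + b + (0ℤ + 0ℤ) ≡ a + b
    l₃ = solve-∀
    l₄ : ∀ m τ a b c d → (a * m - τ) + (b * m - τ) + (c + d) ≡ (a + b) * m - + 2 * τ + (c + d)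
    l₄ = solve-∀
    l₅ : ∀ p x s y → p * x * s * y ≡ p * (x * (s * y))
    l₅ = solve-∀
  -- `x` is the index of `T (suc (suc m))` and `y` that of `T m`: their v-exponents add up to
  -- `(x + y) M₁ + (x − y)` apart from constants, and `tri (m + 2) + tri m = 2 τ₁ + 1` accounts for
  -- the `−1`.
  rhs : ∀ φ i j x y → + 2 * P * ((+ 4 * i + 1ℤ) * (+ 4 * j + 1ℤ) * (1ℤ * 1ℤ)) *
      φ (+ 4 * (i * (+ 2 * i + 1ℤ)) + + 4 * (j * (+ 2 * j + 1ℤ)) + (degT (1ℤ + M₁) x + degT μ y)) (0ℤ + 0ℤ + (x + y))
        (0ℤ + 0ℤ + ((x * (1ℤ + M₁) - (τ₁ + (1ℤ + M₁))) + (y * μ - tri m))) ≡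
    + 2 * P * (((+ 4 * i + 1ℤ) * (+ 4 * j + 1ℤ)) *
      φ (+ 2 * (+ 2 * (i * (+ 2 * i + 1ℤ)) + + 2 * (j * (+ 2 * j + 1ℤ)) + (x * x + y * y - (x - y - 1ℤ))) + (x + y) - + 2 * ((x + y) * M₁) + + 2 * (M₁ * (M₁ + 1ℤ)))
        (x + y) ((x + y) * M₁ - + 2 * τ₁ + (x - y - 1ℤ)))
  rhs φ i j x y = trans (cong₂ _*_ (l₀ (+ 2 * P) ((+ 4 * i + 1ℤ) * (+ 4 * j + 1ℤ))) (cong₃ φ (l₁ μ i j x y) (l₂ x y) (l₃ μ (tri m) x y))) (ℤ.*-assoc (+ 2 * P) ((+ 4 * i + 1ℤ) * (+ 4 * j + 1ℤ)) _)
    where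
    l₀ : ∀ p x → p * (x * (1ℤ * 1ℤ)) ≡ p * x
    l₀ = solve-∀
    l₁ : ∀ μ i j x y → + 4 * (i * (+ 2 * i + 1ℤ)) + + 4 * (j * (+ 2 * j + 1ℤ)) +
        (+ 2 * (x * x - x * (1ℤ + (1ℤ + μ))) + x + (1ℤ + (1ℤ + μ)) * (1ℤ + (1ℤ + μ) + 1ℤ) + (+ 2 * (y * y - y * μ) + y + μ * (μ + 1ℤ))) ≡
      + 2 * (+ 2 * (i * (+ 2 * i + 1ℤ)) + + 2 * (j * (+ 2 * j + 1ℤ)) + (x * x + y * y - (x - y - 1ℤ))) + (x + y) - + 2 * ((x + y) * (1ℤ + μ)) +
        + 2 * ((1ℤ + μ) * (1ℤ + μ + 1ℤ))
    l₁ = solve-∀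
    l₂ : ∀ x y → 0ℤ + 0ℤ + (x + y) ≡ x + y
    l₂ = solve-∀
    l₃ : ∀ μ τ x y → 0ℤ + 0ℤ + ((x * (1ℤ + (1ℤ + μ)) - (τ + (1ℤ + μ) + (1ℤ + (1ℤ + μ)))) + (y * μ - τ)) ≡
      (x + y) * (1ℤ + μ) - + 2 * (τ + (1ℤ + μ)) + (x - y - 1ℤ)
    l₃ = solve-∀
  support : ∀ M φ → Cut M φ → ∀ a b c d →
    φ (+ 2 * (a * a + b * b + c * c + d * d) + (a + b) - + 2 * ((a + b) * M₁) + + 2 * (M₁ * (M₁ + 1ℤ))) (a + b) ((a + b) * M₁ - + 2 * τ₁ + (c + d)) ≢ 0ℤ →
    (Bounded (M ℕ.+ suc m) 1 a × Bounded (M ℕ.+ suc m) 1 b) × (Bounded (M ℕ.+ suc m) 1 c × Bounded (M ℕ.+ suc m) 1 d)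
  support M φ cut a b c d p =
    (widen {a} (undo a (le {a - M₁} (∣x∣≤x*x (a - M₁)) (l₁ M₁ a b c d) (+-nonneg (+-nonneg (+-nonneg (pronic-nonneg a) 0≤M₁) (+-nonneg (+-nonneg (square-nonneg (b - M₁)) (pronic-nonneg b)) 0≤M₁)) cd≥0))) ,
     widen {b} (undo b (le {b - M₁} (∣x∣≤x*x (b - M₁)) (l₂ M₁ a b c d) (+-nonneg (+-nonneg (+-nonneg (pronic-nonneg b) 0≤M₁) (+-nonneg (+-nonneg (square-nonneg (a - M₁)) (pronic-nonneg a)) 0≤M₁)) cd≥0)))) ,
    (widen {c} (weaken {c} (le {c} (∣x∣≤x*x c) (l₃ M₁ a b c d) (+-nonneg (+-nonneg ab≥0 (square-nonneg c)) (*-nonneg (0≤+ {2}) (square-nonneg d))))) ,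
     widen {d} (weaken {d} (le {d} (∣x∣≤x*x d) (l₄ M₁ a b c d) (+-nonneg (+-nonneg ab≥0 (square-nonneg d)) (*-nonneg (0≤+ {2}) (square-nonneg c))))))
    where
    e≤M = cut⇒≤ {φ = φ} cut _ _ _ p
    0≤M₁ : 0ℤ ℤ.≤ M₁
    0≤M₁ = 0≤+ {suc m}
    deg≥0 : ∀ k → 0ℤ ℤ.≤ degT M₁ k
    deg≥0 = degT-nonneg (suc m)
    ab≥0 : 0ℤ ℤ.≤ degT M₁ a + degT M₁ b
    ab≥0 = +-nonneg (deg≥0 a) (deg≥0 b)
    cd≥0 : 0ℤ ℤ.≤ + 2 * (c * c) + + 2 * (d * d)
    cd≥0 = +-nonneg (*-nonneg (0≤+ {2}) (square-nonneg c)) (*-nonneg (0≤+ {2}) (square-nonneg d))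
    le : ∀ {x y r} → + ∣ x ∣ ℤ.≤ y → y + r ≡ _ → 0ℤ ℤ.≤ r → ∣ x ∣ ≤ M
    le {x} {y} {r} xy e 0≤r = ℤ.drop‿+≤+ (ℤ.≤-trans xy (≤-drop {y} {r} e 0≤r e≤M))
    weaken : ∀ {x} → ∣ x ∣ ≤ M → ∣ x ∣ ≤ M ℕ.+ suc m
    weaken p = ℕ.≤-trans p (ℕ.m≤m+n M (suc m))
    undo : ∀ a → ∣ a - M₁ ∣ ≤ M → ∣ a ∣ ≤ M ℕ.+ suc m
    undo a p = subst (λ z → ∣ z ∣ ≤ M ℕ.+ suc m) (l a M₁) (∣+∣ {a - M₁} {M₁} p ℕ.≤-refl)
      where
      l : ∀ a m → a - m + m ≡ a
      l = solve-∀
    widen : ∀ {x} → ∣ x ∣ ≤ M ℕ.+ suc m → Bounded (M ℕ.+ suc m) 1 x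
    widen p = bounded (ℕ.≤-trans p (ℕ.≤-trans (ℕ.n≤1+n _) (ℕ.≤-reflexive (sym (ℕ.*-identityˡ _)))))
    l₁ : ∀ m a b c d → (a - m) * (a - m) + (a * a + a + m + ((b - m) * (b - m) + (b * b + b) + m) + (+ 2 * (c * c) + + 2 * (d * d))) ≡
      + 2 * (a * a + b * b + c * c + d * d) + (a + b) - + 2 * ((a + b) * m) + + 2 * (m * (m + 1ℤ))
    l₁ = solve-∀
    l₂ : ∀ m a b c d → (b - m) * (b - m) + (b * b + b + m + ((a - m) * (a - m) + (a * a + a) + m) + (+ 2 * (c * c) + + 2 * (d * d))) ≡
      + 2 * (a * a + b * b + c * c + d * d) + (a + b) - + 2 * ((a + b) * m) + + 2 * (m * (m + 1ℤ))
    l₂ = solve-∀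
    l₃ : ∀ m a b c d → c * c + (+ 2 * (a * a - a * m) + a + m * (m + 1ℤ) + (+ 2 * (b * b - b * m) + b + m * (m + 1ℤ)) + c * c + + 2 * (d * d)) ≡
      + 2 * (a * a + b * b + c * c + d * d) + (a + b) - + 2 * ((a + b) * m) + + 2 * (m * (m + 1ℤ))
    l₃ = solve-∀
    l₄ : ∀ m a b c d → d * d + (+ 2 * (a * a - a * m) + a + m * (m + 1ℤ) + (+ 2 * (b * b - b * m) + b + m * (m + 1ℤ)) + d * d + + 2 * (c * c)) ≡
      + 2 * (a * a + b * b + c * c + d * d) + (a + b) - + 2 * ((a + b) * m) + + 2 * (m * (m + 1ℤ))
    l₄ = solve-∀

-- The case m = 1 of the product formula for the double Wronskian.
first-product : (ψ ⊙ ψ) ⊙ (∂x A ⊙ θ ⊕ ⊖ (A ⊙ ∂x θ)) ≈ (J ⊙ J) ⊙ T 1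
first-product = mk λ M → mk (200 ℕ.* suc M) λ B big φ cut → let
    Φ : ℤ → ℤ → ℤ → ℤ
    Φ e s t = φ (+ 2 * e + s) s t
  in trans (pairing left B φ) (trans (∑∑-cong B λ c d → ∑∑-cong B λ k r → ∑-cong (range B) λ l → lhs φ c d k r l)
     (trans (FirstWronskian.first-wronskian big Φ (λ e s t p → cut⇒≤ {φ = φ} cut _ _ _ p))
     (sym (trans (pairing (rep-⊙ (rep-⊙ rep-J rep-J) (rep-T 1)) B φ) (∑∑-cong B λ i j → ∑-cong (range B) λ x → rhs φ i j x)))))
  where
  left = rep-⊙ (rep-⊙ rep-ψ rep-ψ) (rep-⊕ {Σ = Over 2 ⊠ Over 1} (rep-⊙ (rep-∂ _+_ rep-A) rep-θ) (rep-⊖ (rep-⊙ rep-A (rep-∂ _+_ rep-θ))))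
  w-left : ℤ → ℤ → ℤ → ℤ → ℤ → ℤ
  w-left c d k r l = sg c * sg d * (ε k r * (k + r) * 1ℤ + - (ε k r * (1ℤ * (l + 0ℤ))))
  lhs : ∀ φ c d k r l → w-left c d k r l *
      φ (+ 2 * (c * c) + + 2 * (d * d) + (degA k r + l * (+ 2 * l + 1ℤ))) (0ℤ + 0ℤ + (k + l)) (c + d + (r + 0ℤ)) ≡
    sg (c + d) * (ε k r * ((k + r - l) * φ (+ 2 * (c * c + d * d + (k * k + (+ 2 * k - 1ℤ) * r) + l * l) + (k + l)) (k + l) (c + d + r)))
  lhs φ c d k r l = trans (cong₂ _*_ (trans (l₁ (sg c * sg d) (ε k r) k r l) (cong (_* (ε k r * (k + r - l))) (sym (sg-+ c d)))) (cong₃ φ (l₂ c d k r l) (l₃ k l) (l₄ c d r)))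
      (l₅ (sg (c + d)) (ε k r) (k + r - l) _)
    where
    l₁ : ∀ s e k r l → s * (e * (k + r) * 1ℤ + - (e * (1ℤ * (l + 0ℤ)))) ≡ s * (e * (k + r - l))
    l₁ = solve-∀
    l₂ : ∀ c d k r l → + 2 * (c * c) + + 2 * (d * d) + (+ 2 * (k * k + (+ 2 * k - 1ℤ) * r) + k + l * (+ 2 * l + 1ℤ)) ≡
      + 2 * (c * c + d * d + (k * k + (+ 2 * k - 1ℤ) * r) + l * l) + (k + l)
    l₂ = solve-∀
    l₃ : ∀ k l → 0ℤ + 0ℤ + (k + l) ≡ k + l
    l₃ = solve-∀
    l₄ : ∀ c d r → c + d + (r + 0ℤ) ≡ c + d + r
    l₄ = solve-∀
    l₅ : ∀ a b c x → a * (b * c) * x ≡ a * (b * (c * x))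
    l₅ = solve-∀
  rhs : ∀ φ i j x → (+ 4 * i + 1ℤ) * (+ 4 * j + 1ℤ) * 1ℤ *
      φ (+ 4 * (i * (+ 2 * i + 1ℤ)) + + 4 * (j * (+ 2 * j + 1ℤ)) + degT 1ℤ x) (0ℤ + 0ℤ + x) (0ℤ + 0ℤ + (x * 1ℤ - 1ℤ)) ≡
    (+ 4 * i + 1ℤ) * (+ 4 * j + 1ℤ) * φ (+ 2 * (+ 2 * (i * (+ 2 * i + 1ℤ)) + + 2 * (j * (+ 2 * j + 1ℤ)) + (x * x - x + 1ℤ)) + x) x (x - 1ℤ)
  rhs φ i j x = cong₂ _*_ (ℤ.*-identityʳ ((+ 4 * i + 1ℤ) * (+ 4 * j + 1ℤ))) (cong₃ φ (l₁ i j x) (l₂ x) (l₃ x))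
    where
    l₁ : ∀ i j x → + 4 * (i * (+ 2 * i + 1ℤ)) + + 4 * (j * (+ 2 * j + 1ℤ)) + (+ 2 * (x * x - x * 1ℤ) + x + 1ℤ * (1ℤ + 1ℤ)) ≡
      + 2 * (+ 2 * (i * (+ 2 * i + 1ℤ)) + + 2 * (j * (+ 2 * j + 1ℤ)) + (x * x - x + 1ℤ)) + x
    l₁ = solve-∀
    l₂ : ∀ x → 0ℤ + 0ℤ + x ≡ x
    l₂ = solve-∀
    l₃ : ∀ x → 0ℤ + 0ℤ + (x * 1ℤ - 1ℤ) ≡ x - 1ℤ
    l₃ = solve-∀

-- Quadratic transformations and the factorisation of J

module Rotations {L N : ℕ} (big : 40 ℕ.* suc N ≤ L) (Ψ : ℤ → ℤ) (cut : ∀ z → Ψ z ≢ 0ℤ → z ℤ.≤ + N) where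
  private
    hex : ℤ → ℤ
    hex i = i * (+ 2 * i + 1ℤ)

    supp-hex : ∀ i j → Ψ (hex i + hex j) ≢ 0ℤ → Bounded N 1 i × Bounded N 1 j
    supp-hex i j p = ≤-dominated _ (∣x∣≤x[2x+1] i) refl (hexagonal-nonneg j) (cut _ p) ,
      ≤-dominated _ (∣x∣≤x[2x+1] j) (ℤ.+-comm (hex j) (hex i)) (hexagonal-nonneg i) (cut _ p)

    supp-sq : ∀ s n → Ψ (+ 2 * hex s + n * n) ≢ 0ℤ → Bounded N 1 s × Bounded N 1 n
    supp-sq s n p = ≤-dominated _ (∣x∣≤x[2x+1] s) (l (hex s) (n * n)) (+-nonneg (hexagonal-nonneg s) (square-nonneg n)) (cut _ p) ,
      ≤-dominated _ (∣x∣≤x*x n) (ℤ.+-comm (n * n) (+ 2 * hex s)) (*-nonneg (0≤+ {2}) (hexagonal-nonneg s)) (cut _ p)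
      where
      l : ∀ h m → h + (h + m) ≡ + 2 * h + m
      l = solve-∀

    even-exp : ∀ s d → (s + d) * (+ 2 * (s + d) + 1ℤ) + (s - d) * (+ 2 * (s - d) + 1ℤ) ≡ + 2 * (s * (+ 2 * s + 1ℤ)) + (+ 2 * d) * (+ 2 * d)
    even-exp = solve-∀

    odd-exp : ∀ s d → (- 1ℤ - s + d + 1ℤ) * (+ 2 * (- 1ℤ - s + d + 1ℤ) + 1ℤ) + (- 1ℤ - s - d) * (+ 2 * (- 1ℤ - s - d) + 1ℤ) ≡
      + 2 * (s * (+ 2 * s + 1ℤ)) + (+ 2 * d + 1ℤ) * (+ 2 * d + 1ℤ)
    odd-exp = solve-∀

    odd-supp : ∀ s d → Ψ (hex (s + d + 1ℤ) + hex (s - d)) ≢ 0ℤ → Bounded N 2 s × Bounded N 2 d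
    odd-supp s d p = Bhalf1 {a = s} (B≡ (l₁ s d) (B+ (proj₁ b) (proj₂ b))) , Bhalf1 {a = d} (B≡ (l₂ s d) (B- (proj₁ b) (proj₂ b)))
      where
      b = supp-hex (s + d + 1ℤ) (s - d) p
      l₁ : ∀ s d → (s + d + 1ℤ) + (s - d) ≡ + 2 * s + 1ℤ
      l₁ = solve-∀
      l₂ : ∀ s d → (s + d + 1ℤ) - (s - d) ≡ + 2 * d + 1ℤ
      l₂ = solve-∀

    even-supp : ∀ s d → Ψ (hex (s + d) + hex (s - d)) ≢ 0ℤ → Bounded N 2 s × Bounded N 2 d
    even-supp s d p = Bhalf {a = s} (B≡ (l₁ s d) (B+ (proj₁ b) (proj₂ b))) , Bhalf {a = d} (B≡ (l₂ s d) (B- (proj₁ b) (proj₂ b)))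
      where
      b = supp-hex (s + d) (s - d) p
      l₁ : ∀ s d → (s + d) + (s - d) ≡ + 2 * s
      l₁ = solve-∀
      l₂ : ∀ s d → (s + d) - (s - d) ≡ + 2 * d
      l₂ = solve-∀

    reflect-s : (g : ℤ → ℤ → ℤ) → (∀ s d → g s d ≢ 0ℤ → Bounded N 2 s × Bounded N 2 d) → ∑∑ L g ≡ ∑∑ L (λ s d → g (- 1ℤ - s) d)
    reflect-s g supp = trans (∑∑-swap L g) (trans (∑-cong (range L) λ d → reflect (- 1ℤ) (λ s → g s d) λ s p →
      let b = proj₁ (supp s d p) in Bk 2 40 big b , Bk 3 40 big (B- {k = 1} {a = - 1ℤ} {b = s} (bounded (s≤s z≤n)) b)) (∑∑-swap L _))

    join : (g : ℤ → ℤ → ℤ) → (∀ s n → g s n ≢ 0ℤ → Bounded N 1 n) →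
      ∑∑ L (λ s d → g s (+ 2 * d)) + ∑∑ L (λ s d → g s (+ 2 * d + 1ℤ)) ≡ ∑∑ L g
    join g supp = sym (trans (∑-cong (range L) λ s → parity-split {L} {1 ℕ.* suc N} (g s) (ℕ.≤-trans (ℕ.*-monoˡ-≤ (suc N) (s≤s (z≤n {39}))) big) λ n p → size (supp s n p))
      (∑-+ (range L) _ _))

  -- After rotation the exponent is `2 hex s + n²` with `n = i − j`; in the class of odd `n` this
  -- needs the reflection `s ↦ −1 − s`. The two classes of `n` are then joined.
  unweighted : ∑∑ L (λ i j → Ψ (hex i + hex j)) ≡ ∑∑ L (λ s n → Ψ (+ 2 * hex s + n * n))
  unweighted = trans (rotateB 1 40 big _ supp-hex) (trans (cong₂ _+_
      (∑∑-cong L λ s d → cong Ψ (even-exp s d))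
      (trans (reflect-s (λ s d → Ψ (hex (s + d + 1ℤ) + hex (s - d))) odd-supp) (∑∑-cong L λ s d → cong Ψ (odd-exp s d))))
    (join (λ s n → Ψ (+ 2 * hex s + n * n)) (λ s n p → proj₂ (supp-sq s n p))))

  -- The weight `4i + 1` is `(4s + 1) + 4d` or `(4s + 3) + 2 (2d + 1)`; the second summands are odd
  -- under a reflection of `d` and drop out. The reflection of `s` turns `4s + 3` into `−(4s + 1)`,
  -- which is the origin of the sign `sg n`.
  weighted : ∑∑ L (λ i j → (+ 4 * i + 1ℤ) * Ψ (hex i + hex j)) ≡ ∑∑ L (λ s n → (+ 4 * s + 1ℤ) * (sg n * Ψ (+ 2 * hex s + n * n)))
  weighted = trans (rotateB 1 40 big _ (λ i j p → supp-hex i j (*-≢0ʳ (+ 4 * i + 1ℤ) p))) (trans (cong₂ _+_ even-terms odd-terms)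
    (join (λ s n → (+ 4 * s + 1ℤ) * (sg n * Ψ (+ 2 * hex s + n * n))) (λ s n p → proj₂ (supp-sq s n (*-≢0ʳ (sg n) (*-≢0ʳ (+ 4 * s + 1ℤ) p))))))
    where
    E O : ℤ → ℤ → ℤ
    E s d = Ψ (hex (s + d) + hex (s - d))
    O s d = Ψ (hex (s + d + 1ℤ) + hex (s - d))
    even-terms : ∑∑ L (λ s d → (+ 4 * (s + d) + 1ℤ) * E s d) ≡ ∑∑ L (λ s d → (+ 4 * s + 1ℤ) * (sg (+ 2 * d) * Ψ (+ 2 * hex s + (+ 2 * d) * (+ 2 * d))))
    even-terms = trans (∑∑-cong L λ s d → l s d (E s d)) (trans (∑∑-+ L (λ s d → (+ 4 * s + 1ℤ) * E s d) (λ s d → + 4 * d * E s d))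
      (trans (cong₂ _+_ (∑∑-cong L λ s d → cong ((+ 4 * s + 1ℤ) *_) (trans (cong Ψ (even-exp s d)) (sym (trans (cong (_* Ψ (+ 2 * hex s + (+ 2 * d) * (+ 2 * d))) (sg-even {+ 2 * d} d refl)) (ℤ.*-identityˡ _)))))
        (trans (∑-cong (range L) λ s → reflect-antisym 0ℤ (λ d → + 4 * d * E s d) (λ d → *-neg-cong (l′ d) (cong Ψ (l″ s d)))
           (λ d p → let b = proj₂ (even-supp s d (*-≢0ʳ (+ 4 * d) p)) in Bk 2 40 big b , Bk 3 40 big (B- {k = 1} {a = 0ℤ} {b = d} (bounded z≤n) b))) (∑-0 (range L))))
      (ℤ.+-identityʳ _)))
      where
      l : ∀ s d x → (+ 4 * (s + d) + 1ℤ) * x ≡ (+ 4 * s + 1ℤ) * x + + 4 * d * x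
      l = solve-∀
      l′ : ∀ d → + 4 * (0ℤ - d) ≡ - (+ 4 * d)
      l′ = solve-∀
      l″ : ∀ s d → (s + (0ℤ - d)) * (+ 2 * (s + (0ℤ - d)) + 1ℤ) + (s - (0ℤ - d)) * (+ 2 * (s - (0ℤ - d)) + 1ℤ) ≡
        (s + d) * (+ 2 * (s + d) + 1ℤ) + (s - d) * (+ 2 * (s - d) + 1ℤ)
      l″ = solve-∀
    odd-terms : ∑∑ L (λ s d → (+ 4 * (s + d + 1ℤ) + 1ℤ) * O s d) ≡ ∑∑ L (λ s d → (+ 4 * s + 1ℤ) * (sg (+ 2 * d + 1ℤ) * Ψ (+ 2 * hex s + (+ 2 * d + 1ℤ) * (+ 2 * d + 1ℤ))))
    odd-terms = trans (∑∑-cong L λ s d → l s d (O s d)) (trans (∑∑-+ L (λ s d → (+ 4 * s + + 3) * O s d) (λ s d → + 2 * (+ 2 * d + 1ℤ) * O s d))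
      (trans (cong₂ _+_ (trans (reflect-s (λ s d → (+ 4 * s + + 3) * O s d) (λ s d p → odd-supp s d (*-≢0ʳ (+ 4 * s + + 3) p)))
          (∑∑-cong L λ s d → trans (cong₂ _*_ (l₄ s) (cong Ψ (odd-exp s d)))
            (trans (l₅ (+ 4 * s + 1ℤ) _) (cong (λ z → (+ 4 * s + 1ℤ) * (z * Ψ (+ 2 * hex s + (+ 2 * d + 1ℤ) * (+ 2 * d + 1ℤ)))) (sym (sg-odd {+ 2 * d + 1ℤ} d refl))))))
        (trans (∑-cong (range L) λ s → reflect-antisym (- 1ℤ) (λ d → + 2 * (+ 2 * d + 1ℤ) * O s d) (λ d → *-neg-cong (l′ d) (cong Ψ (l″ s d)))
           (λ d p → let b = proj₂ (odd-supp s d (*-≢0ʳ (+ 2 * (+ 2 * d + 1ℤ)) p)) in Bk 2 40 big b , Bk 3 40 big (B- {k = 1} {a = - 1ℤ} {b = d} (bounded (s≤s z≤n)) b))) (∑-0 (range L))))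
      (ℤ.+-identityʳ _)))
      where
      l : ∀ s d x → (+ 4 * (s + d + 1ℤ) + 1ℤ) * x ≡ (+ 4 * s + + 3) * x + + 2 * (+ 2 * d + 1ℤ) * x
      l = solve-∀
      l′ : ∀ d → + 2 * (+ 2 * (- 1ℤ - d) + 1ℤ) ≡ - (+ 2 * (+ 2 * d + 1ℤ))
      l′ = solve-∀
      l″ : ∀ s d → (s + (- 1ℤ - d) + 1ℤ) * (+ 2 * (s + (- 1ℤ - d) + 1ℤ) + 1ℤ) + (s - (- 1ℤ - d)) * (+ 2 * (s - (- 1ℤ - d)) + 1ℤ) ≡
        (s + d + 1ℤ) * (+ 2 * (s + d + 1ℤ) + 1ℤ) + (s - d) * (+ 2 * (s - d) + 1ℤ)
      l″ = solve-∀
      l₄ : ∀ s → + 4 * (- 1ℤ - s) + + 3 ≡ - (+ 4 * s + 1ℤ)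
      l₄ = solve-∀
      l₅ : ∀ x y → - x * y ≡ x * (- 1ℤ * y)
      l₅ = solve-∀

  -- When `a + b` is odd, exchanging `a` and `b` reverses the sign, so only the pairs of equal
  -- parity survive the rotation.
  alternating : ∑∑ L (λ a b → sg b * Ψ (a * a + b * b)) ≡ ∑∑ L (λ s d → (sg s * sg d) * Ψ (+ 2 * (s * s) + + 2 * (d * d)))
  alternating = trans (rotateB 1 40 big _ supp) (trans (cong₂ _+_
      (∑∑-cong L λ s d → cong₂ _*_ (trans (sg-+ s (- d)) (cong (sg s *_) (sg-neg d))) (cong Ψ (l s d)))
      (trans (∑-cong (range L) λ s → reflect-antisym (- 1ℤ) (λ d → sg (s - d) * Ψ ((s + d + 1ℤ) * (s + d + 1ℤ) + (s - d) * (s - d)))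
        (λ d → *-neg-cong (sg-flip (s - d) d (l₁ s d)) (cong Ψ (l₂ s d)))
        (λ d p → let (ba , bb) = supp (s + d + 1ℤ) (s - d) p
                     b : Bounded N 2 d
                     b = Bhalf1 {a = d} (B≡ (l₃ s d) (B- ba bb))
                 in Bk 2 40 big b , Bk 3 40 big (B- {k = 1} {a = - 1ℤ} {b = d} (bounded (s≤s z≤n)) b))) (∑-0 (range L))))
    (ℤ.+-identityʳ _))
    where
    supp : ∀ a b → sg b * Ψ (a * a + b * b) ≢ 0ℤ → Bounded N 1 a × Bounded N 1 b
    supp a b p = ≤-dominated _ (∣x∣≤x*x a) refl (square-nonneg b) (cut _ (*-≢0ʳ (sg b) p)) ,
      ≤-dominated _ (∣x∣≤x*x b) (ℤ.+-comm (b * b) (a * a)) (square-nonneg a) (cut _ (*-≢0ʳ (sg b) p))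
    l : ∀ s d → (s + d) * (s + d) + (s - d) * (s - d) ≡ + 2 * (s * s) + + 2 * (d * d)
    l = solve-∀
    l₁ : ∀ s d → s - (- 1ℤ - d) ≡ s - d + (+ 2 * d + 1ℤ)
    l₁ = solve-∀
    l₂ : ∀ s d → (s + (- 1ℤ - d) + 1ℤ) * (s + (- 1ℤ - d) + 1ℤ) + (s - (- 1ℤ - d)) * (s - (- 1ℤ - d)) ≡ (s + d + 1ℤ) * (s + d + 1ℤ) + (s - d) * (s - d)
    l₂ = solve-∀
    l₃ : ∀ s d → (s + d + 1ℤ) - (s - d) ≡ + 2 * d + 1ℤ
    l₃ = solve-∀

-- Specialisation v = 1, and the substitution q ↦ q².
at-v=1 double : R → R
at-v=1 = pow 1 1ℤ 0ℤ
double = pow 2 1ℤ 1ℤ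

ψ₁ φ₊ : R
ψ₁ = at-v=1 ψ
φ₊ = fam₁ (λ _ → 1ℤ) (λ k → + 2 * (k * k)) (λ _ → 0ℤ) (λ _ → 0ℤ)

private
  rep-φ₊ : Represents (Over 1) φ₊ (λ v → 1ℤ) (λ v → + 2 * (head v * head v)) (λ _ → 0ℤ) (λ _ → 0ℤ)
  rep-φ₊ = rep-fam λ v _ → *-nonneg (0≤+ {2}) (square-nonneg (head v))

  rep-ψ₁ : Represents (Over 1) ψ₁ (λ v → sg (head v)) (λ v → + 2 * (head v * head v)) (λ _ → 0ℤ) (λ _ → 0ℤ)
  rep-ψ₁ = rep-≡ (λ _ → refl) (λ v → ℤ.*-identityˡ _) (λ _ → refl) (λ v → ℤ.*-zeroˡ (head v)) (rep-pow 1 1ℤ 0ℤ rep-ψ)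

  rep-double : ∀ {p w d} → Represents (Over 1) p w d (λ _ → 0ℤ) (λ _ → 0ℤ) → Represents (Over 1) (double p) w (λ i → + 2 * d i) (λ _ → 0ℤ) (λ _ → 0ℤ)
  rep-double P = rep-≡ (λ _ → refl) (λ _ → refl) (λ _ → refl) (λ _ → refl) (rep-pow 2 1ℤ 1ℤ P)

△-square : △ ⊙ △ ≈ double △ ⊙ φ₊
△-square = mk λ M → mk (40 ℕ.* suc M) λ B big φ cut →
  trans (pairing (rep-⊙ rep-△ rep-△) B φ) (trans (∑∑-cong B λ i j → trans (ℤ.*-identityˡ _) (cong₃ φ (l₁ i j) refl refl))
  (trans (Rotations.unweighted big (λ z → φ (+ 2 * z) 0ℤ 0ℤ) (λ z p → half≤ (cut⇒≤ {φ = φ} cut _ _ _ p)))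
  (sym (trans (pairing (rep-⊙ (rep-double rep-△) rep-φ₊) B φ) (∑∑-cong B λ s n → trans (ℤ.*-identityˡ _) (cong₃ φ (l₂ s n) refl refl))))))
  where
  open Represents
  l₁ : ∀ i j → + 2 * (i * (+ 2 * i + 1ℤ)) + + 2 * (j * (+ 2 * j + 1ℤ)) ≡ + 2 * (i * (+ 2 * i + 1ℤ) + j * (+ 2 * j + 1ℤ))
  l₁ = solve-∀
  l₂ : ∀ s n → + 2 * (+ 2 * (s * (+ 2 * s + 1ℤ))) + + 2 * (n * n) ≡ + 2 * (+ 2 * (s * (+ 2 * s + 1ℤ)) + n * n)
  l₂ = solve-∀

φ₊-ψ₁ : φ₊ ⊙ ψ₁ ≈ double ψ₁ ⊙ double ψ₁
φ₊-ψ₁ = mk λ M → mk (40 ℕ.* suc M) λ B big φ cut →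
  trans (pairing (rep-⊙ rep-φ₊ rep-ψ₁) B φ) (trans (∑∑-cong B λ a b → cong₂ _*_ (ℤ.*-identityˡ (sg b)) (cong₃ φ (l₁ a b) refl refl))
  (trans (Rotations.alternating big (λ z → φ (+ 2 * z) 0ℤ 0ℤ) (λ z p → half≤ (cut⇒≤ {φ = φ} cut _ _ _ p)))
  (sym (trans (pairing (rep-⊙ (rep-double rep-ψ₁) (rep-double rep-ψ₁)) B φ) (∑∑-cong B λ s d → cong (sg s * sg d *_) (cong₃ φ (l₂ s d) refl refl))))))
  where
  open Represents
  l₁ : ∀ a b → + 2 * (a * a) + + 2 * (b * b) ≡ + 2 * (a * a + b * b)
  l₁ = solve-∀
  l₂ : ∀ s d → + 2 * (+ 2 * (s * s)) + + 2 * (+ 2 * (d * d)) ≡ + 2 * (+ 2 * (s * s) + + 2 * (d * d))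
  l₂ = solve-∀

J-double : J ⊙ double △ ≈ double J ⊙ double ψ₁
J-double = mk λ M → mk (40 ℕ.* suc M) λ B big φ cut →
  trans (pairing (rep-⊙ rep-J (rep-double rep-△)) B φ) (trans (∑∑-cong B λ i j → cong₂ _*_ (ℤ.*-identityʳ (+ 4 * i + 1ℤ)) (cong₃ φ (l₁ i j) refl refl))
  (trans (Rotations.weighted big (λ z → φ (+ 2 * (+ 2 * z)) 0ℤ 0ℤ) (λ z p → half≤ (half≤ (cut⇒≤ {φ = φ} cut _ _ _ p))))
  (sym (trans (pairing (rep-⊙ (rep-double rep-J) (rep-double rep-ψ₁)) B φ) (∑∑-cong B λ s n → trans (ℤ.*-assoc (+ 4 * s + 1ℤ) (sg n) _)
    (cong (λ z → (+ 4 * s + 1ℤ) * (sg n * z)) (cong₃ φ (l₂ s n) refl refl)))))))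
  where
  open Represents
  l₁ : ∀ i j → + 4 * (i * (+ 2 * i + 1ℤ)) + + 2 * (+ 2 * (j * (+ 2 * j + 1ℤ))) ≡ + 2 * (+ 2 * (i * (+ 2 * i + 1ℤ) + j * (+ 2 * j + 1ℤ)))
  l₁ = solve-∀
  l₂ : ∀ s n → + 2 * (+ 4 * (s * (+ 2 * s + 1ℤ))) + + 2 * (+ 2 * (n * n)) ≡ + 2 * (+ 2 * (+ 2 * (s * (+ 2 * s + 1ℤ)) + n * n))
  l₂ = solve-∀

-- Leading monomials of the theta series

∣⟨⟩∣-mono : ∀ {a b} c → 0ℤ ℤ.≤ a → a + c ≡ b → 1ℤ ℤ.≤ c → ∣ a ∣ ℕ.< ∣ b ∣
∣⟨⟩∣-mono {a} {b} c 0≤a refl 1≤c = ℤ.drop‿+<+ (subst₂ ℤ._<_ (sym (ℤ.0≤i⇒+∣i∣≡i 0≤a)) (sym (ℤ.0≤i⇒+∣i∣≡i (+-nonneg 0≤a (ℤ.≤-trans (0≤+ {1}) 1≤c))))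
  (ℤ.suc[i]≤j⇒i<j (subst (ℤ._≤ a + c) (ℤ.+-comm a 1ℤ) (ℤ.+-monoʳ-≤ a 1≤c))))

1≤hex : ∀ {x} → x ≢ 0ℤ → 1ℤ ℤ.≤ x * (+ 2 * x + 1ℤ)
1≤hex {x} p = ℤ.≤-trans (ℤ.+≤+ (ℕ.n≢0⇒n>0 {∣ x ∣} λ q → p (ℤ.∣i∣≡0⇒i≡0 {x} q))) (∣x∣≤x[2x+1] x)

1≤square : ∀ {x} → x ≢ 0ℤ → 1ℤ ℤ.≤ x * x
1≤square {x} p = ℤ.≤-trans (ℤ.+≤+ (ℕ.n≢0⇒n>0 {∣ x ∣} λ q → p (ℤ.∣i∣≡0⇒i≡0 {x} q))) (∣x∣≤x*x x)

∷-≢ : ∀ {x y : ℤ} → _≢_ {A = Vec ℤ 1} (x ∷ []) (y ∷ []) → x ≢ y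
∷-≢ p refl = p refl

1≤n*x : ∀ n x → 1ℤ ℤ.≤ x → 1ℤ ℤ.≤ + suc n * x
1≤n*x n (+ suc x) _ = ℤ.+≤+ (s≤s z≤n)
1≤n*x n (+ zero) (ℤ.+≤+ ())

fam₁-leading : ∀ (w d b c : ℤ → ℤ) z → w z ≡ 1ℤ → (∀ k → k ≢ z → ∣ d z ∣ ℕ.< ∣ d k ∣) → Leading (fam₁ w d b c) ∣ d z ∣ (b z) (c z)
fam₁-leading w d b c z w₁ min = fam-leading {w = λ v → w (head v)} {λ v → d (head v)} {λ v → b (head v)} {λ v → c (head v)}
  (z ∷ []) w₁ λ { (k ∷ []) p → min k (∷-≢ p) }

leading-ψ : Leading ψ 0 0ℤ 0ℤ
leading-ψ = fam₁-leading sg (λ k → + 2 * (k * k)) (λ _ → 0ℤ) (λ k → k) 0ℤ (sg-even {0ℤ} 0ℤ refl) λ x p →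
  ∣⟨⟩∣-mono {0ℤ} {+ 2 * (x * x)} (+ 2 * (x * x)) ℤ.≤-refl (ℤ.+-identityˡ _) (1≤n*x 1 (x * x) (1≤square p))

leading-J : Leading J 0 0ℤ 0ℤ
leading-J = fam₁-leading (λ i → + 4 * i + 1ℤ) (λ i → + 4 * (i * (+ 2 * i + 1ℤ))) (λ _ → 0ℤ) (λ _ → 0ℤ) 0ℤ refl λ x p →
  ∣⟨⟩∣-mono {0ℤ} {+ 4 * (x * (+ 2 * x + 1ℤ))} (+ 4 * (x * (+ 2 * x + 1ℤ))) ℤ.≤-refl (ℤ.+-identityˡ _) (1≤n*x 3 (x * (+ 2 * x + 1ℤ)) (1≤hex p))

leading-△ : Leading △ 0 0ℤ 0ℤ
leading-△ = fam₁-leading (λ _ → 1ℤ) (λ j → + 2 * (j * (+ 2 * j + 1ℤ))) (λ _ → 0ℤ) (λ _ → 0ℤ) 0ℤ refl λ x p →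
  ∣⟨⟩∣-mono {0ℤ} {+ 2 * (x * (+ 2 * x + 1ℤ))} (+ 2 * (x * (+ 2 * x + 1ℤ))) ℤ.≤-refl (ℤ.+-identityˡ _) (1≤n*x 1 (x * (+ 2 * x + 1ℤ)) (1≤hex p))

-- The degree of T m has a unique minimum because its vertex (2m − 1)/4 is not half an odd integer.
T-regular : ∀ m → Regular (T m)
T-regular m = go (parity (+ m))
  where
  n = half (+ m)
  back : ∀ k n → k ≡ k - n + n
  back = solve-∀
  lead : ∀ (g : ℤ → ℤ) → (∀ k → degT (+ m) n + g k * (+ 2 * g k + 1ℤ) ≡ degT (+ m) k) → (∀ k → g k ≡ 0ℤ → k ≡ n) → Regular (T m)
  lead g e inj = Regular-leading (fam₁-leading (λ _ → 1ℤ) (degT (+ m)) (λ k → k) (λ k → k * + m - tri m) n refl λ k p →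
    ∣⟨⟩∣-mono {degT (+ m) n} {degT (+ m) k} (g k * (+ 2 * g k + 1ℤ)) (degT-nonneg m n) (e k) (1≤hex {g k} λ q → p (inj k q)))
  go : Parity (+ m) → Regular (T m)
  go (even e) = lead (λ k → k - n) (λ k → trans (cong (λ z → degT z n + (k - n) * (+ 2 * (k - n) + 1ℤ)) e) (trans (l n k) (cong (λ z → degT z k) (sym e))))
    (λ k q → trans (back k n) (trans (cong (_+ n) q) (ℤ.+-identityˡ n)))
    where
    l : ∀ n k → + 2 * (n * n - n * (+ 2 * n)) + n + + 2 * n * (+ 2 * n + 1ℤ) + (k - n) * (+ 2 * (k - n) + 1ℤ) ≡
      + 2 * (k * k - k * (+ 2 * n)) + k + + 2 * n * (+ 2 * n + 1ℤ)
    l = solve-∀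
  go (odd e) = lead (λ k → n - k) (λ k → trans (cong (λ z → degT z n + (n - k) * (+ 2 * (n - k) + 1ℤ)) e) (trans (l n k) (cong (λ z → degT z k) (sym e))))
    (λ k q → sym (trans (back n k) (trans (cong (_+ k) q) (ℤ.+-identityˡ k))))
    where
    l : ∀ n k → + 2 * (n * n - n * (+ 2 * n + 1ℤ)) + n + (+ 2 * n + 1ℤ) * (+ 2 * n + 1ℤ + 1ℤ) + (n - k) * (+ 2 * (n - k) + 1ℤ) ≡
      + 2 * (k * k - k * (+ 2 * n + 1ℤ)) + k + (+ 2 * n + 1ℤ) * (+ 2 * n + 1ℤ + 1ℤ)
    l = solve-∀

leading-pow : ∀ {p d b c} k l n → Leading p d b c → Leading (pow (suc k) l n p) (suc k ℕ.* d) (l * b) (n * c)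
leading-pow {p} {d} {b} {c} k l n lead = record
  { from = from
  ; rest = pow (suc k) l n rest
  ; higher = λ B q → LAll.map⁺ (LAll.map (λ { (inj₁ z) → inj₁ z ; (inj₂ h) → inj₂ (ℕ.*-monoʳ-< (suc k) h) }) (higher B q))
  ; split = λ B q φ → trans (⟪⟫-pow (suc k) l n (p B) φ) (trans (split B q _) (cong₂ _+_ (cong (λ z → φ z (l * b) (n * c)) (sym (ℤ.pos-* (suc k) d)))
      (sym (⟪⟫-pow (suc k) l n (rest B) φ))))
  }
  where open Leading lead

leading-≈1 : ∀ {p} → Leading p 0 0ℤ 0ℤ → p ≈[ 1 ] 𝟙
leading-≈1 {p} lead = mk from λ B q φ cut → trans (split B q φ) (trans (cong (λ z → φ 0ℤ 0ℤ 0ℤ + z)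
    (⟪⟫-All0 (rest B) φ (higher B q) λ { t (inj₁ z) → trans (cong (_* φ (+ Term.deg t) (Term.udeg t) (Term.vdeg t)) z) refl
      ; t (inj₂ h) → trans (cong (Term.coef t *_) (cut _ _ _ (ℤ.+≤+ h))) (ℤ.*-zeroʳ (Term.coef t)) }))
    (trans (ℤ.+-identityʳ _) (sym (trans (⟪⟫-ι 1ℤ B φ) (ℤ.*-identityˡ _)))))
  where open Leading lead

≈1-⊙ : ∀ {p q} → p ≈[ 1 ] 𝟙 → q ≈[ 1 ] 𝟙 → p ⊙ q ≈[ 1 ] 𝟙
≈1-⊙ {p} {q} e f = ≈[]-trans (⊙-congʳ[] p f) (≈[]-trans (_≈_.at (≈-trans (⊙-comm p 𝟙) (⊙-identityˡ p)) 1) e)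

double-≈[] : ∀ {M z} → z ≈[ M ] 𝟘 → double z ≈[ 2 ℕ.* M ] 𝟘
double-≈[] {M} {z} e = mk (_≈[_]_.bound e) λ B q φ cut → trans (⟪⟫-pow 2 1ℤ 1ℤ (z B) φ) (trans (_≈[_]_.agree e B q _ λ a b c h →
  cut _ _ _ (ℤ.≤-trans (ℤ.≤-reflexive (ℤ.pos-* 2 M)) (ℤ.*-monoˡ-≤-nonNeg (+ 2) h))) (trans (⟪⟫-[] _) (sym (⟪⟫-[] φ))))

-- J(q) / P(q) is invariant under q ↦ q², where P = △(q)² ψ(1; q), hence constant.
J-product : J ≈ (△ ⊙ △) ⊙ ψ₁
J-product = mk λ M → ⊕-⊖⇒≈[] (≈[]-weaken (n<2^n M) (vanish M))
  where
  open import Algebra.Bundles using (CommutativeRing)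
  module C = CommutativeRing ring
  open import Relation.Binary.Reasoning.Setoid C.setoid
  open import Algebra.Properties.Ring C.ring using (-‿distribˡ-*)
  P = (△ ⊙ △) ⊙ ψ₁
  Z = J ⊕ ⊖ P
  invariant : J ⊙ double P ≈ double J ⊙ P
  invariant = begin
    J ⊙ double P                                  ≈⟨ ⊙-congʳ J (≈-trans (pow-⊙ 2 1ℤ 1ℤ (△ ⊙ △) ψ₁) (⊙-cong (pow-⊙ 2 1ℤ 1ℤ △ △) ≈-refl)) ⟩
    J ⊙ ((double △ ⊙ double △) ⊙ double ψ₁)       ≈⟨ ⊙-congʳ J (⊙-assoc (double △) (double △) (double ψ₁)) ⟩
    J ⊙ (double △ ⊙ (double △ ⊙ double ψ₁))       ≈⟨ ⊙-assoc J (double △) _ ⟨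
    (J ⊙ double △) ⊙ (double △ ⊙ double ψ₁)       ≈⟨ ⊙-cong J-double (⊙-comm (double △) (double ψ₁)) ⟩
    (double J ⊙ double ψ₁) ⊙ (double ψ₁ ⊙ double △)  ≈⟨ ⊙-assoc (double J) (double ψ₁) _ ⟩
    double J ⊙ (double ψ₁ ⊙ (double ψ₁ ⊙ double △))  ≈⟨ ⊙-congʳ (double J) (⊙-assoc (double ψ₁) (double ψ₁) (double △)) ⟨
    double J ⊙ ((double ψ₁ ⊙ double ψ₁) ⊙ double △)  ≈⟨ ⊙-congʳ (double J) (⊙-comm _ (double △)) ⟩
    double J ⊙ (double △ ⊙ (double ψ₁ ⊙ double ψ₁))  ≈⟨ ⊙-congʳ (double J) (⊙-congʳ (double △) φ₊-ψ₁) ⟨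
    double J ⊙ (double △ ⊙ (φ₊ ⊙ ψ₁))             ≈⟨ ⊙-congʳ (double J) (⊙-assoc (double △) φ₊ ψ₁) ⟨
    double J ⊙ ((double △ ⊙ φ₊) ⊙ ψ₁)             ≈⟨ ⊙-congʳ (double J) (⊙-cong △-square ≈-refl) ⟨
    double J ⊙ P ∎
  difference : double P ⊙ Z ≈ P ⊙ double Z
  difference = begin
    double P ⊙ (J ⊕ ⊖ P)                  ≈⟨ ⊙-comm (double P) Z ⟩
    (J ⊕ ⊖ P) ⊙ double P                  ≈⟨ C.distribʳ (double P) J (⊖ P) ⟩
    J ⊙ double P ⊕ (⊖ P) ⊙ double P       ≈⟨ ⊕-cong (≈-trans invariant (⊙-comm (double J) P)) (≈-trans (≈-sym (-‿distribˡ-* P (double P))) (C.-‿cong (≈-refl {P ⊙ double P}))) ⟩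
    P ⊙ double J ⊕ ⊖ (P ⊙ double P)       ≈⟨ ⊕-cong (≈-refl {P ⊙ double J}) (distribʳ-neg P (double P)) ⟩
    P ⊙ double J ⊕ P ⊙ (⊖ double P)       ≈⟨ ⊙-distribˡ P (double J) (⊖ double P) ⟨
    P ⊙ (double J ⊕ ⊖ double P)           ≈⟨ ⊙-congʳ P (⊕-cong (≈-refl {double J}) (exactly λ B φ → double-neg B φ)) ⟩
    P ⊙ (double J ⊕ double (⊖ P))         ≈⟨ ⊙-congʳ P (pow-⊕ 2 1ℤ 1ℤ J (⊖ P)) ⟨
    P ⊙ double Z ∎
    where
    distribʳ-neg : ∀ x y → ⊖ (x ⊙ y) ≈ x ⊙ (⊖ y)
    distribʳ-neg x y = -‿distribʳ-* x y
      where open import Algebra.Properties.Ring C.ring using (-‿distribʳ-*)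
    double-neg : ∀ B φ → ⟪ (⊖ double P) B , φ ⟫ ≡ ⟪ double (⊖ P) B , φ ⟫
    double-neg B φ = trans (⟪⟫-⊖ (double P) B φ) (trans (cong -_ (⟪⟫-pow 2 1ℤ 1ℤ (P B) φ)) (sym (trans (⟪⟫-pow 2 1ℤ 1ℤ ((⊖ P) B) φ) (⟪⟫-⊖ P B _))))
  -- `double P` is removed one factor at a time, each having the leading monomial 1, so that no
  -- precision is lost.
  cancel : ∀ {M z} → double P ⊙ z ≈[ M ] 𝟘 → z ≈[ M ] 𝟘
  cancel {M} {z} e = cancel-leading (leading-pow 1 1ℤ 1ℤ (leading-pow 0 1ℤ 0ℤ leading-ψ)) M (cancel-leading (leading-pow 1 1ℤ 1ℤ leading-△) M
    (cancel-leading (leading-pow 1 1ℤ 1ℤ leading-△) M (≈[]-trans (_≈_.at regroup M) e)))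
    where
    regroup : double △ ⊙ (double △ ⊙ (double ψ₁ ⊙ z)) ≈ double P ⊙ z
    regroup = begin
      double △ ⊙ (double △ ⊙ (double ψ₁ ⊙ z))     ≈⟨ ⊙-assoc (double △) (double △) _ ⟨
      (double △ ⊙ double △) ⊙ (double ψ₁ ⊙ z)     ≈⟨ ⊙-assoc (double △ ⊙ double △) (double ψ₁) z ⟨
      ((double △ ⊙ double △) ⊙ double ψ₁) ⊙ z     ≈⟨ ⊙-cong (≈-trans (pow-⊙ 2 1ℤ 1ℤ (△ ⊙ △) ψ₁) (⊙-cong (pow-⊙ 2 1ℤ 1ℤ △ △) (≈-refl {double ψ₁}))) (≈-refl {z}) ⟨
      double P ⊙ z ∎
  base : Z ≈[ 1 ] 𝟘
  base = ≈[]⇒⊕-⊖ (≈[]-trans (leading-≈1 leading-J) (≈[]-sym (≈1-⊙ (≈1-⊙ (leading-≈1 leading-△) (leading-≈1 leading-△)) (leading-≈1 (leading-pow 0 1ℤ 0ℤ leading-ψ)))))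
  -- If `Z` vanishes below degree `2 ^ n`, then `double Z` vanishes below twice that degree, and
  -- `difference` passes this on to `Z`.
  vanish : ∀ n → Z ≈[ 2 ℕ.^ n ] 𝟘
  vanish zero = base
  vanish (suc n) = cancel (≈[]-trans (_≈_.at difference _) (≈[]-trans (⊙-congʳ[] P (double-≈[] (vanish n))) (_≈_.at (C.zeroʳ P) _)))
  n<2^n : ∀ n → n ≤ 2 ℕ.^ n
  n<2^n zero = z≤n
  n<2^n (suc n) = ℕ.≤-trans (s≤s (n<2^n n)) (ℕ.≤-trans (ℕ.≤-reflexive (ℕ.+-comm 1 _)) (ℕ.+-monoʳ-≤ (2 ℕ.^ n) (ℕ.≤-trans (ℕ.m^n>0 2 n) (ℕ.m≤m+n _ 0))))

-- The product formula for W and its specialisation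

ι-homomorphism : ℤ.+-*-rawRing -Raw-AlmostCommutative⟶ fromCommutativeRing ring
ι-homomorphism = record { ⟦_⟧ = ι ; +-homo = ι-+ ; *-homo = ι-* ; -‿homo = ι-neg ; 0-homo = ι-0 ; 1-homo = ≈-refl }

module RDet = Determinant ring ι-homomorphism
module RToda = TodaInduction ring ι-homomorphism
open RDet using (IsDerivation; iterate; iterates)

∂x-derivation : IsDerivation ∂x
∂x-derivation = record { δ-cong = ∂-cong _+_ ; δ-+ = ∂-⊕ _+_ ; δ-* = ∂-⊙ _+_ l }
  where
  l : ∀ b c b′ c′ → (b + b′) + (c + c′) ≡ (b + c) + (b′ + c′)
  l = solve-∀

∂y-derivation : IsDerivation ∂y
∂y-derivation = record { δ-cong = ∂-cong (λ _ c → c) ; δ-+ = ∂-⊕ (λ _ c → c) ; δ-* = ∂-⊙ (λ _ c → c) λ _ _ _ _ → refl }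

∂y-∂x : ∀ p → ∂y (∂x p) ≈ ∂x (∂y p)
∂y-∂x = ∂-comm (λ _ c → c) _+_

constant : ∀ {Σ p w d b c} ω → Represents Σ p w d b c → (∀ i → ω (b i) (c i) ≡ 0ℤ) → ∂ ω p ≈ 𝟘
constant {Σ} {w = w} {d} {b} {c} ω P e = exactly λ B φ → trans (Represents.pairing (rep-∂ ω P) B φ)
  (trans (Summation.sum-cong Σ B {g = λ i → 0ℤ * 0ℤ} λ i → trans (cong (λ z → w i * z * φ (d i) (b i) (c i)) (e i)) (cong (_* φ (d i) (b i) (c i)) (ℤ.*-zeroʳ (w i))))
  (trans (Summation.sum-*ˡ Σ B 0ℤ (λ _ → 0ℤ)) (sym (⟪⟫-[] φ))))

∂-ι : ∀ ω → ω 0ℤ 0ℤ ≡ 0ℤ → ∀ n → ∂ ω (ι n) ≈ 𝟘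
∂-ι ω e n = exactly λ B φ → trans (⟪⟫-scale ω (ι n B) φ) (trans (⟪⟫-ι n B _) (trans (cong (λ z → n * (z * φ 0ℤ 0ℤ 0ℤ)) e) (trans (ℤ.*-zeroʳ n) (sym (⟪⟫-[] φ)))))

∂yθ≈0 : ∂y θ ≈ 𝟘
∂yθ≈0 = constant (λ _ c → c) rep-θ λ _ → refl

θ≈T0 : θ ≈ T 0
θ≈T0 = exactly λ B φ → trans (Represents.pairing rep-θ B φ) (trans (∑-cong (range B) λ k → cong (1ℤ *_) (cong₃ φ (l₁ k) refl (l₂ k)))
  (sym (Represents.pairing (rep-T 0) B φ)))
  where
  l₁ : ∀ k → k * (+ 2 * k + 1ℤ) ≡ + 2 * (k * k - k * 0ℤ) + k + 0ℤ * (0ℤ + 1ℤ)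
  l₁ = solve-∀
  l₂ : ∀ k → 0ℤ ≡ k * 0ℤ - 0ℤ
  l₂ = solve-∀

addition : ∀ m → let P = + (suc m ℕ.* suc (suc m)) in
  hirota (T (suc m)) ⊙ (ψ ⊙ ψ) ⊕ ⊖ (ι P ⊙ ((T (suc m) ⊙ T (suc m)) ⊙ hirota ψ)) ≈ ι (+ 2 * P) ⊙ ((J ⊙ J) ⊙ (T (suc (suc m)) ⊙ T m))
addition m = subst (λ P → hirota (T (suc m)) ⊙ (ψ ⊙ ψ) ⊕ ⊖ (ι P ⊙ ((T (suc m) ⊙ T (suc m)) ⊙ hirota ψ)) ≈ ι (+ 2 * P) ⊙ ((J ⊙ J) ⊙ (T (suc (suc m)) ⊙ T m)))
  (trans (cong (λ z → + suc m * + z) (ℕ.+-comm (suc m) 1)) (sym (ℤ.pos-* (suc m) (suc (suc m))))) (two-T m)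

module RW = RDet.DoubleWronskian ∂x-derivation ∂y-derivation ∂y-∂x θ A ∂yθ≈0

W : ℕ → R
W = RW.doubleWronskian

open RDet using (_^_)

product-formula : ∀ m → W m ⊙ ψ ^ exponent m ≈ (ι (+ leadingCoefficient m) ⊙ J ^ exponent m) ⊙ T m
product-formula = RToda.product-formula ∂x-derivation ∂y-derivation ∂y-∂x θ A ∂yθ≈0 ψ J T θ≈T0 first-product addition
  (constant _+_ rep-J λ _ → refl) (constant (λ _ c → c) rep-J λ _ → refl) (∂-ι _+_ refl) (∂-ι (λ _ c → c) refl)
  T-regular (Regular-leading leading-J) Regular-ι

at-v=1-^ : ∀ p n → at-v=1 (p ^ n) ≈ at-v=1 p ^ n
at-v=1-^ p zero = ≈-refl
at-v=1-^ p (suc n) = ≈-trans (pow-⊙ 1 1ℤ 0ℤ (p ^ n) p) (⊙-cong (at-v=1-^ p n) ≈-refl)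

^-cong : ∀ {p q} n → p ≈ q → p ^ n ≈ q ^ n
^-cong zero e = ≈-refl
^-cong (suc n) e = ⊙-cong (^-cong n e) e

^-⊙ : ∀ p q n → (p ⊙ q) ^ n ≈ p ^ n ⊙ q ^ n
^-⊙ p q zero = ≈-sym (⊙-identityˡ 𝟙)
^-⊙ p q (suc n) = begin
  (p ⊙ q) ^ n ⊙ (p ⊙ q)        ≈⟨ ⊙-cong (^-⊙ p q n) ≈-refl ⟩
  (p ^ n ⊙ q ^ n) ⊙ (p ⊙ q)    ≈⟨ ⊙-assoc (p ^ n) (q ^ n) (p ⊙ q) ⟩
  p ^ n ⊙ (q ^ n ⊙ (p ⊙ q))    ≈⟨ ⊙-congʳ (p ^ n) (≈-trans (≈-sym (⊙-assoc (q ^ n) p q)) (≈-trans (⊙-cong (⊙-comm (q ^ n) p) ≈-refl) (⊙-assoc p (q ^ n) q))) ⟩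
  p ^ n ⊙ (p ⊙ (q ^ n ⊙ q))    ≈⟨ ⊙-assoc (p ^ n) p (q ^ n ⊙ q) ⟨
  p ^ suc n ⊙ q ^ suc n ∎
  where open import Relation.Binary.Reasoning.Setoid (CommutativeRing.setoid ring)

Regular-^ : ∀ {p} → Regular p → ∀ n → Regular (p ^ n)
Regular-^ r zero {x} {y} e = ≈-trans (≈-sym (⊙-identityˡ x)) (≈-trans e (⊙-identityˡ y))
Regular-^ {p} r (suc n) = Regular-⊙ {p ^ n} {p} (Regular-^ r n) r

at-v=1-J : at-v=1 J ≈ J
at-v=1-J = exactly λ B φ → trans (⟪⟫-pow 1 1ℤ 0ℤ (J B) φ) (trans (Represents.pairing rep-J B _)
  (trans (∑-cong (range B) λ i → cong ((+ 4 * i + 1ℤ) *_) (cong₃ φ (ℤ.*-identityˡ _) refl refl)) (sym (Represents.pairing rep-J B φ))))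

at-v=1-ι : ∀ n → at-v=1 (ι n) ≈ ι n
at-v=1-ι n = exactly λ B φ → trans (⟪⟫-pow 1 1ℤ 0ℤ (ι n B) φ) (trans (⟪⟫-ι n B _) (sym (⟪⟫-ι n B φ)))

-- At `v = 1` the power of `ψ` on the left cancels against the one that `J-product` reveals in
-- `J ^ exponent m`.
specialised : ∀ m → at-v=1 (W m) ≈ ι (+ leadingCoefficient m) ⊙ ((△ ⊙ △) ^ exponent m ⊙ at-v=1 (T m))
specialised m = Regular-^ {ψ₁} (Regular-leading (leading-pow 0 1ℤ 0ℤ leading-ψ)) E (begin
  ψ₁ ^ E ⊙ at-v=1 (W m)                 ≈⟨ ⊙-comm (ψ₁ ^ E) (at-v=1 (W m)) ⟩
  at-v=1 (W m) ⊙ ψ₁ ^ E                 ≈⟨ ⊙-congʳ (at-v=1 (W m)) (at-v=1-^ ψ E) ⟨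
  at-v=1 (W m) ⊙ at-v=1 (ψ ^ E)         ≈⟨ pow-⊙ 1 1ℤ 0ℤ (W m) (ψ ^ E) ⟨
  at-v=1 (W m ⊙ ψ ^ E)                  ≈⟨ pow-cong 0 1ℤ 0ℤ (product-formula m) ⟩
  at-v=1 ((c ⊙ J ^ E) ⊙ T m)            ≈⟨ ≈-trans (pow-⊙ 1 1ℤ 0ℤ (c ⊙ J ^ E) (T m)) (⊙-cong (pow-⊙ 1 1ℤ 0ℤ c (J ^ E)) ≈-refl) ⟩
  (at-v=1 c ⊙ at-v=1 (J ^ E)) ⊙ T₁      ≈⟨ ⊙-cong (⊙-cong (at-v=1-ι (+ leadingCoefficient m)) J-power) ≈-refl ⟩
  (c ⊙ (D ⊙ ψ₁ ^ E)) ⊙ T₁               ≈⟨ ⊙-cong (≈-trans (⊙-congʳ c (⊙-comm D (ψ₁ ^ E))) (≈-trans (≈-sym (⊙-assoc c (ψ₁ ^ E) D)) (≈-trans (⊙-cong (⊙-comm c (ψ₁ ^ E)) ≈-refl) (⊙-assoc (ψ₁ ^ E) c D)))) ≈-refl ⟩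
  (ψ₁ ^ E ⊙ (c ⊙ D)) ⊙ T₁               ≈⟨ ⊙-assoc (ψ₁ ^ E) (c ⊙ D) T₁ ⟩
  ψ₁ ^ E ⊙ ((c ⊙ D) ⊙ T₁)               ≈⟨ ⊙-congʳ (ψ₁ ^ E) (⊙-assoc c D T₁) ⟩
  ψ₁ ^ E ⊙ (c ⊙ (D ⊙ T₁)) ∎)
  where
  open import Relation.Binary.Reasoning.Setoid (CommutativeRing.setoid ring)
  E = exponent m
  c = ι (+ leadingCoefficient m)
  D = (△ ⊙ △) ^ E
  T₁ = at-v=1 (T m)
  J-power : at-v=1 (J ^ E) ≈ D ⊙ ψ₁ ^ E
  J-power = ≈-trans (at-v=1-^ J E) (≈-trans (^-cong E (≈-trans at-v=1-J J-product)) (^-⊙ (△ ⊙ △) ψ₁ E))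

-- Expansion of determinants of series over monomials

id-homomorphism : ℤ.+-*-rawRing -Raw-AlmostCommutative⟶ fromCommutativeRing ℤ.+-*-commutativeRing
id-homomorphism = record { ⟦_⟧ = λ x → x ; +-homo = λ _ _ → refl ; *-homo = λ _ _ → refl ; -‿homo = λ _ → refl ; 0-homo = refl ; 1-homo = refl }

module ℤDet = Determinant ℤ.+-*-commutativeRing id-homomorphism

record Mon : Set where
  constructor mon
  field
    mdeg : ℕ
    mu mv : ℤ
open Mon

monomial : Term → Mon
monomial t = mon (deg t) (udeg t) (vdeg t)

_+ᴹ_ : Mon → Mon → Mon
mon a b c +ᴹ mon a′ b′ c′ = mon (a ℕ.+ a′) (b + b′) (c + c′)

translateᴹ : Mon → Test → Test
translateᴹ m = shift (+ mdeg m) (mu m) (mv m)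

total : Test → List Mon → ℤ
total φ [] = φ 0ℤ 0ℤ 0ℤ
total φ (m ∷ ms) = total (translateᴹ m φ) ms

total-cong : ∀ {φ φ′ : Test} → (∀ a b c → φ a b c ≡ φ′ a b c) → ∀ ms → total φ ms ≡ total φ′ ms
total-cong e [] = e _ _ _
total-cong e (m ∷ ms) = total-cong (λ a b c → e _ _ _) ms

total-swap : ∀ φ pre x y zs → total φ (pre ++ x ∷ y ∷ zs) ≡ total φ (pre ++ y ∷ x ∷ zs)
total-swap φ (p ∷ pre) x y zs = total-swap (translateᴹ p φ) pre x y zs
total-swap φ [] x y zs = total-cong (λ a b c → cong₃ φ (l (+ mdeg x) (+ mdeg y) a) (l (mu x) (mu y) b) (l (mv x) (mv y) c)) zs
  where
  l : ∀ x y a → x + (y + a) ≡ y + (x + a)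
  l = solve-∀

-- Multilinear expansion: one term is chosen from each list, the coefficients are multiplied, and
-- `H` sees the monomials.
Multi : List (List Term) → (List Mon → ℤ) → ℤ
Multi [] H = H []
Multi (p ∷ ps) H = ∑ p λ t → coef t * Multi ps λ ms → H (monomial t ∷ ms)

Multi-cong : ∀ ps {H H′ : List Mon → ℤ} → (∀ ms → H ms ≡ H′ ms) → Multi ps H ≡ Multi ps H′
Multi-cong [] e = e []
Multi-cong (p ∷ ps) e = ∑-cong p λ t → cong (coef t *_) (Multi-cong ps λ ms → e _)

Multi-- : ∀ ps (H H′ : List Mon → ℤ) → Multi ps (λ ms → H ms - H′ ms) ≡ Multi ps H - Multi ps H′
Multi-- [] H H′ = refl
Multi-- (p ∷ ps) H H′ = trans (∑-cong p λ t → trans (cong (coef t *_) (Multi-- ps _ _)) (l (coef t) _ _))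
  (trans (∑-+ p (λ t → coef t * Multi ps (λ ms → H (monomial t ∷ ms))) (λ t → - (coef t * Multi ps (λ ms → H′ (monomial t ∷ ms)))))
  (cong (λ z → Multi (p ∷ ps) H + z) (∑-neg p _)))
  where
  l : ∀ c x y → c * (x - y) ≡ c * x + - (c * y)
  l = solve-∀

Multi-*ˡ : ∀ ps k (H : List Mon → ℤ) → Multi ps (λ ms → k * H ms) ≡ k * Multi ps H
Multi-*ˡ [] k H = refl
Multi-*ˡ (p ∷ ps) k H = trans (∑-cong p λ t → trans (cong (coef t *_) (Multi-*ˡ ps k _)) (l (coef t) k _)) (∑-*ˡ p k _)
  where
  l : ∀ c k x → c * (k * x) ≡ k * (c * x)
  l = solve-∀

Multi-0 : ∀ ps {H : List Mon → ℤ} → (∀ ms → H ms ≡ 0ℤ) → Multi ps H ≡ 0ℤ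
Multi-0 [] e = e []
Multi-0 (p ∷ ps) e = trans (∑-cong p λ t → trans (cong (coef t *_) (Multi-0 ps λ ms → e _)) (ℤ.*-zeroʳ (coef t))) (∑-0 p)

module _ (B : ℕ) where
  ev : List R → List (List Term)
  ev = map (λ p → p B)

  Weighs : (R → R) → (Mon → ℤ) → Set
  Weighs f w = ∀ p φ → ⟪ f p B , φ ⟫ ≡ ∑ (p B) λ t → coef t * (w (monomial t) * φ (+ deg t) (udeg t) (vdeg t))

  -- F is the expansion over all choices of monomials in its arguments; the index list I accounts for rows already chosen.
  Expands : {A : Set} → List A → (A → ℤ) → (A → Mon) → (A → List Mon → ℤ) → (List R → R) → Set
  Expands I κ τ G F = ∀ ys φ → ⟪ F ys B , φ ⟫ ≡ ∑ I λ z → κ z * Multi (ev ys) λ ms → G z ms * total (translateᴹ (τ z) φ) ms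

  -- A column that acts diagonally on monomials becomes a numerical functional, so contracting
  -- series is contracting numbers under the multiple sum.
  contract-expands : ∀ {A : Set} (I : List A) κ τ G F f w → Weighs f w → Expands I κ τ G F →
    Expands I κ τ (λ z ms → ℤDet.contract w ms (G z)) (λ ys → RDet.contract f ys F)
  contract-expands I κ τ G F f w hf hF [] φ = trans (⟪⟫-[] φ) (sym (trans (∑-cong I λ z → ℤ.*-zeroʳ (κ z)) (∑-0 I)))
  contract-expands {A} I κ τ G F f w hf hF (y ∷ ys) φ = begin
    ⟪ (f y ⊙ F ys ⊕ ⊖ rest) B , φ ⟫
      ≡⟨ trans (⟪⟫-++ ((f y ⊙ F ys) B) ((⊖ rest) B) φ) (cong₂ _+_ (⟪⟫-⊗ (f y B) (F ys B) φ) (⟪⟫-⊖ rest B φ)) ⟩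
    ⟪ f y B , (λ a b c → ⟪ F ys B , shift a b c φ ⟫) ⟫ - ⟪ rest B , φ ⟫
      ≡⟨ cong₂ _-_ head-part rest-part ⟩
    ∑ I (λ z → κ z * ∑ (y B) λ t → coef t * (w (monomial t) * M₁ z t)) - ∑ I (λ z → κ z * ∑ (y B) λ t → coef t * M₂ z t)
      ≡⟨ cong (λ x → ∑ I (λ z → κ z * ∑ (y B) λ t → coef t * (w (monomial t) * M₁ z t)) + x) (sym (∑-neg I _)) ⟩
    ∑ I X₁ + ∑ I (λ z → - X₂ z)
      ≡⟨ sym (∑-+ I X₁ (λ z → - X₂ z)) ⟩
    ∑ I (λ z → X₁ z - X₂ z)
      ≡⟨ ∑-cong I combine ⟩
    ∑ I (λ z → κ z * Multi (ev (y ∷ ys)) λ ms → ℤDet.contract w ms (G z) * total (translateᴹ (τ z) φ) ms) ∎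
    where
    open ≡-Reasoning
    rest = RDet.contract f ys (λ zs → F (y ∷ zs))
    M₁ M₂ : A → Term → ℤ
    M₁ z t = Multi (ev ys) λ ms → G z ms * total (translateᴹ (monomial t) (translateᴹ (τ z) φ)) ms
    M₂ z t = Multi (ev ys) λ ms → ℤDet.contract w ms (λ ns → G z (monomial t ∷ ns)) * total (translateᴹ (monomial t) (translateᴹ (τ z) φ)) ms
    X₁ X₂ : A → ℤ
    X₁ z = κ z * ∑ (y B) λ t → coef t * (w (monomial t) * M₁ z t)
    X₂ z = κ z * ∑ (y B) λ t → coef t * M₂ z t
    head-part : ⟪ f y B , (λ a b c → ⟪ F ys B , shift a b c φ ⟫) ⟫ ≡ ∑ I X₁
    head-part = trans (hf y _) (trans (∑-cong (y B) λ t → trans (cong (λ x → coef t * (w (monomial t) * x)) (hF ys (shift (+ deg t) (udeg t) (vdeg t) φ)))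
        (trans (sym (ℤ.*-assoc (coef t) (w (monomial t)) _)) (trans (sym (∑-*ˡ I (coef t * w (monomial t)) _)) (∑-cong I λ z →
          trans (cong (λ x → coef t * w (monomial t) * (κ z * x)) (Multi-cong (ev ys) λ ms → cong (G z ms *_)
            (total-cong (λ a b c → cong₃ φ (l₁ (+ deg t) (+ mdeg (τ z)) a) (l₁ (udeg t) (mu (τ z)) b) (l₁ (vdeg t) (mv (τ z)) c)) ms)))
          (l₂ (coef t) (w (monomial t)) (κ z) (M₁ z t))))))
      (trans (∑-comm (y B) I _) (∑-cong I λ z → ∑-*ˡ (y B) (κ z) _)))
      where
      l₁ : ∀ x y a → x + (y + a) ≡ y + (x + a)
      l₁ = solve-∀
      l₂ : ∀ c w k m → c * w * (k * m) ≡ k * (c * (w * m))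
      l₂ = solve-∀
    -- The term chosen from `y` joins the index list before the induction proceeds to the remaining
    -- rows.
    pairs : List (A × Term)
    pairs = concatMap (λ z → map (z ,_) (y B)) I
    ∑-pairs : ∀ (h : A × Term → ℤ) → ∑ pairs h ≡ ∑ I λ z → ∑ (y B) λ t → h (z , t)
    ∑-pairs h = trans (∑-concatMap (λ z → map (z ,_) (y B)) I h) (∑-cong I λ z → ∑-map (z ,_) (y B) h)
    reassociate : ∀ z t ms → total (translateᴹ (monomial t) (translateᴹ (τ z) φ)) ms ≡ total (translateᴹ (τ z +ᴹ monomial t) φ) ms
    reassociate z t = total-cong λ a b c → cong₃ φ (sym (ℤ.+-assoc (+ mdeg (τ z)) (+ deg t) a)) (sym (ℤ.+-assoc (mu (τ z)) (udeg t) b)) (sym (ℤ.+-assoc (mv (τ z)) (vdeg t) c))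
    rest-part : ⟪ rest B , φ ⟫ ≡ ∑ I X₂
    rest-part = trans (contract-expands pairs (λ (z , t) → κ z * coef t) (λ (z , t) → τ z +ᴹ monomial t) (λ (z , t) ns → G z (monomial t ∷ ns)) (λ zs → F (y ∷ zs)) f w hf hF′ ys φ)
      (trans (∑-pairs _) (∑-cong I λ z → trans (∑-cong (y B) λ t → trans (ℤ.*-assoc (κ z) (coef t) _)
        (cong (λ x → κ z * (coef t * x)) (Multi-cong (ev ys) λ ms → cong (ℤDet.contract w ms (λ ns → G z (monomial t ∷ ns)) *_) (sym (reassociate z t ms)))))
        (∑-*ˡ (y B) (κ z) _)))
      where
      hF′ : Expands pairs (λ (z , t) → κ z * coef t) (λ (z , t) → τ z +ᴹ monomial t) (λ (z , t) ns → G z (monomial t ∷ ns)) (λ zs → F (y ∷ zs))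
      hF′ zs φ′ = trans (hF (y ∷ zs) φ′) (sym (trans (∑-pairs _) (∑-cong I λ z → trans (∑-cong (y B) λ t → trans (ℤ.*-assoc (κ z) (coef t) _)
        (cong (λ x → κ z * (coef t * x)) (Multi-cong (ev zs) λ ms → cong (G z (monomial t ∷ ms) *_)
          (total-cong (λ a b c → cong₃ φ′ (ℤ.+-assoc (+ mdeg (τ z)) (+ deg t) a) (ℤ.+-assoc (mu (τ z)) (udeg t) b) (ℤ.+-assoc (mv (τ z)) (vdeg t) c)) ms))))
        (∑-*ˡ (y B) (κ z) _))))
    combine : ∀ z → X₁ z - X₂ z ≡ κ z * Multi (ev (y ∷ ys)) λ ms → ℤDet.contract w ms (G z) * total (translateᴹ (τ z) φ) ms
    combine z = trans (l (κ z) (∑ (y B) λ t → coef t * (w (monomial t) * M₁ z t)) (∑ (y B) λ t → coef t * M₂ z t))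
      (cong (κ z *_) (trans (cong (λ x → (∑ (y B) λ t → coef t * (w (monomial t) * M₁ z t)) + x) (sym (∑-neg (y B) _)))
        (trans (sym (∑-+ (y B) _ _)) (∑-cong (y B) λ t → trans (l′ (coef t) (w (monomial t) * M₁ z t) (M₂ z t)) (cong (coef t *_)
          (trans (cong (_- M₂ z t) (sym (Multi-*ˡ (ev ys) (w (monomial t)) _))) (trans (sym (Multi-- (ev ys) _ _))
            (Multi-cong (ev ys) λ ms → l″ (w (monomial t)) (G z ms) _ _))))))))
      where
      l : ∀ k a b → k * a - k * b ≡ k * (a - b)
      l = solve-∀
      l′ : ∀ c a b → c * a + - (c * b) ≡ c * (a - b)
      l′ = solve-∀
      l″ : ∀ w g t k → w * (g * t) - k * t ≡ (w * g + - k) * t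
      l″ = solve-∀

  det-expands : ∀ {fs ws} → Pointwise Weighs fs ws → ∀ ys φ → ⟪ RDet.det fs ys B , φ ⟫ ≡ Multi (ev ys) λ ms → ℤDet.det ws ms * total φ ms
  det-expands {fs} {ws} rel ys φ = trans (go rel ys φ) (trans (ℤ.+-identityʳ _) (trans (ℤ.*-identityˡ _) (Multi-cong (ev ys) λ ms →
      cong (ℤDet.det ws ms *_) (total-cong (λ a b c → cong₃ φ (ℤ.+-identityˡ a) (ℤ.+-identityˡ b) (ℤ.+-identityˡ c)) ms))))
    where
    go : ∀ {fs ws} → Pointwise Weighs fs ws → Expands (tt ∷ []) (λ _ → 1ℤ) (λ _ → mon 0 0ℤ 0ℤ) (λ _ → ℤDet.det ws) (RDet.det fs)
    go [] [] φ = trans (⟪⟫-ι 1ℤ B φ) (l (φ 0ℤ 0ℤ 0ℤ))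
      where
      l : ∀ x → 1ℤ * x ≡ 1ℤ * (1ℤ * x) + 0ℤ
      l = solve-∀
    go [] (y ∷ ys) φ = trans (⟪⟫-[] φ) (sym (cong (λ x → 1ℤ * x + 0ℤ) (trans (∑-cong (y B) λ t →
      trans (cong (coef t *_) (Multi-0 (ev ys) λ ms → ℤ.*-zeroˡ (total (translateᴹ (monomial t) (translateᴹ (mon 0 0ℤ 0ℤ) φ)) ms))) (ℤ.*-zeroʳ (coef t))) (∑-0 (y B)))))
    go {f ∷ fs} {w ∷ ws} (h ∷ rel) = contract-expands (tt ∷ []) (λ _ → 1ℤ) (λ _ → mon 0 0ℤ 0ℤ) (λ _ → ℤDet.det ws) (RDet.det fs) f w h (go rel)

  xdeg : Mon → ℤ
  xdeg m = mu m + mv m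

  iterate-weighs : ∀ n → Weighs (RDet.iterate ∂x-derivation n) (λ m → xdeg m ℤDet.^ n)
  iterate-weighs zero p φ = trans (⟪⟫-∑ (p B) φ) (∑-cong (p B) λ t → cong (coef t *_) (sym (ℤ.*-identityˡ _)))
  iterate-weighs (suc n) p φ = trans (⟪⟫-scale _+_ (RDet.iterate ∂x-derivation n p B) φ) (trans (iterate-weighs n p _)
    (∑-cong (p B) λ t → cong (coef t *_) (sym (ℤ.*-assoc (xdeg (monomial t) ℤDet.^ n) (xdeg (monomial t)) _))))

  iterates-weigh : ∀ n → Pointwise Weighs (RDet.iterates ∂x-derivation n) (ℤDet.Vandermonde.powers xdeg n)
  iterates-weigh zero = []
  iterates-weigh (suc n) = iterate-weighs n ∷ iterates-weigh n

-- Sums over tuples and symmetrisation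

Mu : {X : Set} → List X → ℕ → (List X → ℤ) → ℤ
Mu xs zero G = G []
Mu xs (suc n) G = ∑ xs λ x → Mu xs n λ ys → G (x ∷ ys)

module _ {X : Set} (xs : List X) where
  Mu-cong : ∀ n {G G′ : List X → ℤ} → (∀ ys → length ys ≡ n → G ys ≡ G′ ys) → Mu xs n G ≡ Mu xs n G′
  Mu-cong zero e = e [] refl
  Mu-cong (suc n) e = ∑-cong xs λ x → Mu-cong n λ ys p → e (x ∷ ys) (cong suc p)

  Mu-*ˡ : ∀ n k (G : List X → ℤ) → Mu xs n (λ ys → k * G ys) ≡ k * Mu xs n G
  Mu-*ˡ zero k G = refl
  Mu-*ˡ (suc n) k G = trans (∑-cong xs λ x → Mu-*ˡ n k _) (∑-*ˡ xs k _)

  Mu-- : ∀ n (G G′ : List X → ℤ) → Mu xs n (λ ys → G ys - G′ ys) ≡ Mu xs n G - Mu xs n G′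
  Mu-- zero G G′ = refl
  Mu-- (suc n) G G′ = trans (∑-cong xs λ x → Mu-- n _ _) (trans (∑-+ xs (λ x → Mu xs n λ ys → G (x ∷ ys)) (λ x → - Mu xs n λ ys → G′ (x ∷ ys)))
    (cong (λ z → Mu xs (suc n) G + z) (∑-neg xs _)))

  Mu-neg : ∀ n (G : List X → ℤ) → Mu xs n (λ ys → - G ys) ≡ - Mu xs n G
  Mu-neg zero G = refl
  Mu-neg (suc n) G = trans (∑-cong xs λ x → Mu-neg n _) (∑-neg xs _)

  Swaps : (List X → ℤ) → Set
  Swaps H = ∀ pre x y zs → H (pre ++ x ∷ y ∷ zs) ≡ - H (pre ++ y ∷ x ∷ zs)

  headTail : (X → ℤ) → (List X → ℤ) → (List X → ℤ) → List X → ℤ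
  headTail f F H [] = 0ℤ
  headTail f F H (x ∷ ys) = f x * F ys * H (x ∷ ys)

  -- Against an alternating H all terms of a contraction contribute equally.
  Mu-contract : ∀ n f F H → Swaps H → Mu xs (suc n) (λ ys → ℤDet.contract f ys F * H ys) ≡ + suc n * Mu xs (suc n) (headTail f F H)
  Mu-contract n f F H alt = trans (∑-cong xs λ x → trans (Mu-cong n λ ys _ → l (f x * F ys) (ℤDet.contract f ys (λ zs → F (x ∷ zs))) (H (x ∷ ys))) (Mu-- n _ _))
    (trans (∑-+ xs (λ x → Mu xs n λ ys → f x * F ys * H (x ∷ ys)) (λ x → - Mu xs n λ ys → ℤDet.contract f ys (λ zs → F (x ∷ zs)) * H (x ∷ ys)))
    (trans (cong (λ z → Mu xs (suc n) (headTail f F H) + z) (∑-neg xs _)) (trans (cong (λ z → Mu xs (suc n) (headTail f F H) - z) (rest n alt)) (l′ (Mu xs (suc n) (headTail f F H)) (+ n)))))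
    where
    l : ∀ a b c → (a + - b) * c ≡ a * c - b * c
    l = solve-∀
    l′ : ∀ m n → m - - (n * m) ≡ (1ℤ + n) * m
    l′ = solve-∀
    -- If a later entry is the one removed, one exchange of arguments of `H` brings it to the front;
    -- the resulting sign cancels the sign of the contraction.
    rest : ∀ n → Swaps H → ∑ xs (λ x → Mu xs n λ ys → ℤDet.contract f ys (λ zs → F (x ∷ zs)) * H (x ∷ ys)) ≡ - (+ n * Mu xs (suc n) (headTail f F H))
    rest zero alt = trans (∑-0 xs) (sym (cong -_ (ℤ.*-zeroˡ (Mu xs 1 (headTail f F H)))))
    rest (suc n) alt = trans (∑-cong xs λ x → Mu-contract n f (λ zs → F (x ∷ zs)) (λ ys → H (x ∷ ys)) (λ pre → alt (x ∷ pre)))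
      (trans (∑-*ˡ xs (+ suc n) _) (trans (cong (+ suc n *_) (trans (∑-comm xs xs _) (trans (∑-cong xs λ x → trans (∑-cong xs λ y →
          trans (Mu-cong n λ ys _ → trans (cong (f x * F (y ∷ ys) *_) (alt [] y x ys)) (sym (ℤ.neg-distribʳ-* (f x * F (y ∷ ys)) _))) (Mu-neg n _)) (∑-neg xs _)) (∑-neg xs _))))
        (sym (ℤ.neg-distribʳ-* (+ suc n) _))))

  diagonal : List (X → ℤ) → List X → ℤ
  diagonal [] ys = 1ℤ
  diagonal (f ∷ fs) [] = 1ℤ
  diagonal (f ∷ fs) (y ∷ ys) = f y * diagonal fs ys

  symmetrisation : ∀ fs H → Swaps H → Mu xs (length fs) (λ ys → ℤDet.det fs ys * H ys) ≡ + (length fs !) * Mu xs (length fs) (λ ys → diagonal fs ys * H ys)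
  symmetrisation [] H alt = sym (ℤ.*-identityˡ _)
  symmetrisation (f ∷ fs) H alt = trans (Mu-contract n f (ℤDet.det fs) H alt) (trans (cong (+ suc n *_) (trans (∑-cong xs λ x →
      trans (Mu-cong n λ ys _ → l (f x) (ℤDet.det fs ys) (H (x ∷ ys))) (trans (Mu-*ˡ n (f x) _) (trans (cong (f x *_) (symmetrisation fs (λ ys → H (x ∷ ys)) (λ pre → alt (x ∷ pre))))
        (trans (l₂ (f x) (+ (n !)) _) (cong (+ (n !) *_) (trans (sym (Mu-*ˡ n (f x) _)) (Mu-cong n λ ys _ → sym (ℤ.*-assoc (f x) _ _))))))))
      (∑-*ˡ xs (+ (n !)) _)))
    (trans (sym (ℤ.*-assoc (+ suc n) (+ (n !)) _)) (cong (_* Mu xs (suc n) (λ ys → diagonal (f ∷ fs) ys * H ys)) (sym (ℤ.pos-* (suc n) (n !))))))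
    where
    n = length fs
    l : ∀ a b c → a * b * c ≡ a * (b * c)
    l = solve-∀
    l₂ : ∀ a b c → a * (b * c) ≡ b * (a * c)
    l₂ = solve-∀

Mu-map : ∀ {X Y : Set} (g : X → Y) xs n (G : List Y → ℤ) → Mu (map g xs) n G ≡ Mu xs n (λ ys → G (map g ys))
Mu-map g xs zero G = refl
Mu-map g xs (suc n) G = trans (∑-map g xs _) (∑-cong xs λ x → Mu-map g xs n _)

coefs : List Term → ℤ
coefs [] = 1ℤ
coefs (t ∷ ts) = coef t * coefs ts

module _ (B : ℕ) where
  vpow : ℕ → List (Term → ℤ)
  vpow = ℤDet.Vandermonde.powers vdeg

  ∑-iterate-∂y : ∀ l (h : Mon → ℤ) → ∑ (RDet.iterate ∂y-derivation l A B) (λ t → coef t * h (monomial t)) ≡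
    ∑ (A B) (λ t → coef t * (vdeg t ℤDet.^ l * h (monomial t)))
  ∑-iterate-∂y zero h = ∑-cong (A B) λ t → cong (coef t *_) (sym (ℤ.*-identityˡ _))
  ∑-iterate-∂y (suc l) h = trans (∑-map _ (RDet.iterate ∂y-derivation l A B) _) (trans (∑-cong (RDet.iterate ∂y-derivation l A B) λ t → ℤ.*-assoc (coef t) (vdeg t) (h (monomial t)))
    (trans (∑-iterate-∂y l (λ m → mv m * h m)) (∑-cong (A B) λ t → cong (coef t *_) (sym (ℤ.*-assoc (vdeg t ℤDet.^ l) (vdeg t) (h (monomial t)))))))

  last-row : (List Mon → ℤ) → List Term → ℤ
  last-row H ts = coefs ts * ∑ (θ B) λ t₀ → coef t₀ * H (map monomial ts ++ monomial t₀ ∷ [])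

  Multi-rows : ∀ m H → Multi (ev B (RW.rows m)) H ≡ Mu (A B) m (λ ts → diagonal (A B) (vpow m) ts * last-row H ts)
  Multi-rows zero H = l _
    where
    l : ∀ x → x ≡ 1ℤ * (1ℤ * x)
    l = solve-∀
  Multi-rows (suc m) H = trans (∑-iterate-∂y m (λ n → Multi (ev B (RW.rows m)) λ ms → H (n ∷ ms))) (∑-cong (A B) λ t →
    trans (cong (λ x → coef t * (vdeg t ℤDet.^ m * x)) (Multi-rows m _)) (trans (sym (ℤ.*-assoc (coef t) (vdeg t ℤDet.^ m) _))
    (trans (sym (Mu-*ˡ (A B) m (coef t * vdeg t ℤDet.^ m) _)) (Mu-cong (A B) m λ ts _ → l (coef t) (vdeg t ℤDet.^ m) (diagonal (A B) (vpow m) ts) (coefs ts) _))))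
    where
    l : ∀ c v d k s → c * v * (d * (k * s)) ≡ v * d * (c * k * s)
    l = solve-∀

  last-row-swaps : ∀ H → (∀ pre x y zs → H (pre ++ x ∷ y ∷ zs) ≡ - H (pre ++ y ∷ x ∷ zs)) → Swaps (A B) (last-row H)
  last-row-swaps H alt pre x y zs = trans (cong₂ _*_ (coefs-swap pre) (trans (∑-cong (θ B) λ t₀ → trans (cong (coef t₀ *_) (trans (cong H (shape x y t₀)) (trans (alt (map monomial pre) (monomial x) (monomial y) _) (cong (λ z → - H z) (sym (shape y x t₀))))))
      (sym (ℤ.neg-distribʳ-* (coef t₀) _))) (∑-neg (θ B) (swapped y x)))) (sym (ℤ.neg-distribʳ-* (coefs (pre ++ y ∷ x ∷ zs)) (∑ (θ B) (swapped y x))))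
    where
    swapped : Term → Term → Term → ℤ
    swapped y x t₀ = coef t₀ * H (map monomial (pre ++ y ∷ x ∷ zs) ++ monomial t₀ ∷ [])
    coefs-swap : ∀ pre → coefs (pre ++ x ∷ y ∷ zs) ≡ coefs (pre ++ y ∷ x ∷ zs)
    coefs-swap [] = l (coef x) (coef y) (coefs zs)
      where
      l : ∀ a b c → a * (b * c) ≡ b * (a * c)
      l = solve-∀
    coefs-swap (p ∷ pre) = cong (coef p *_) (coefs-swap pre)
    shape : ∀ x y t₀ → map monomial (pre ++ x ∷ y ∷ zs) ++ monomial t₀ ∷ [] ≡ map monomial pre ++ monomial x ∷ monomial y ∷ (map monomial zs ++ monomial t₀ ∷ [])
    shape x y t₀ = trans (cong (_++ monomial t₀ ∷ []) (List.map-++ monomial pre (x ∷ y ∷ zs))) (List.++-assoc (map monomial pre) _ _)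

  vandermondeᵛ : List Term → ℤ
  vandermondeᵛ = ℤDet.Vandermonde.difference-product vdeg

  vandermondeˣ : List Mon → ℤ
  vandermondeˣ = ℤDet.Vandermonde.difference-product (xdeg B)

  -- The rows `∂y^l A` supply only a diagonal product of powers of the v-degrees. As the determinant
  -- in the x-degrees is alternating, the factor `m !` symmetrises this product into a second
  -- Vandermonde determinant.
  W-expansion : ∀ m φ → + (m !) * ⟪ W m B , φ ⟫ ≡
    Mu (A B) m λ ts → vandermondeᵛ ts * last-row (λ ms → vandermondeˣ ms * total φ ms) ts
  W-expansion m φ = begin
    + (m !) * ⟪ W m B , φ ⟫
      ≡⟨ cong (+ (m !) *_) (trans (det-expands B (iterates-weigh B (suc m)) (RW.rows m) φ) (Multi-rows m H)) ⟩
    + (m !) * Mu (A B) m (λ ts → diagonal (A B) (vpow m) ts * last-row H ts)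
      ≡⟨ sym symm ⟩
    Mu (A B) m (λ ts → ℤDet.det (vpow m) ts * last-row H ts)
      ≡⟨ Mu-cong (A B) m (λ ts p → cong₂ _*_ (vdm-v ts p) (cong (coefs ts *_) (∑-cong (θ B) λ t₀ → cong (λ z → coef t₀ * (z * total φ (map monomial ts ++ monomial t₀ ∷ []))) (vdm-x ts t₀ p)))) ⟩
    Mu (A B) m (λ ts → vandermondeᵛ ts * last-row (λ ms → vandermondeˣ ms * total φ ms) ts) ∎
    where
    open ≡-Reasoning
    H : List Mon → ℤ
    H ms = ℤDet.det (ℤDet.Vandermonde.powers (xdeg B) (suc m)) ms * total φ ms
    H-swaps : ∀ pre x y zs → H (pre ++ x ∷ y ∷ zs) ≡ - H (pre ++ y ∷ x ∷ zs)
    H-swaps pre x y zs = trans (cong₂ _*_ (ℤDet.Alternating.swap (ℤDet.det-alternating (ℤDet.Vandermonde.powers (xdeg B) (suc m))) pre x y zs) (total-swap φ pre x y zs))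
      (sym (ℤ.neg-distribˡ-* (ℤDet.det (ℤDet.Vandermonde.powers (xdeg B) (suc m)) (pre ++ y ∷ x ∷ zs)) _))
    length-vpow : ∀ n → length (vpow n) ≡ n
    length-vpow zero = refl
    length-vpow (suc n) = cong suc (length-vpow n)
    symm : Mu (A B) m (λ ts → ℤDet.det (vpow m) ts * last-row H ts) ≡ + (m !) * Mu (A B) m (λ ts → diagonal (A B) (vpow m) ts * last-row H ts)
    symm = subst (λ n → Mu (A B) n (λ ts → ℤDet.det (vpow m) ts * last-row H ts) ≡ + (n !) * Mu (A B) n (λ ts → diagonal (A B) (vpow m) ts * last-row H ts)) (length-vpow m)
      (symmetrisation (A B) (vpow m) (last-row H) (last-row-swaps H H-swaps))
    vdm-v : ∀ ts → length ts ≡ m → ℤDet.det (vpow m) ts ≡ vandermondeᵛ ts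
    vdm-v ts refl = ℤDet.Vandermonde.vandermonde vdeg ts
    vdm-x : ∀ ts t₀ → length ts ≡ m → ℤDet.det (ℤDet.Vandermonde.powers (xdeg B) (suc m)) (map monomial ts ++ monomial t₀ ∷ []) ≡ vandermondeˣ (map monomial ts ++ monomial t₀ ∷ [])
    vdm-x ts t₀ p = subst (λ n → ℤDet.det (ℤDet.Vandermonde.powers (xdeg B) n) (map monomial ts ++ monomial t₀ ∷ []) ≡ vandermondeˣ (map monomial ts ++ monomial t₀ ∷ []))
      (trans (List.length-++ (map monomial ts)) (trans (ℕ.+-comm _ 1) (cong suc (trans (List.length-map monomial ts) p))))
      (ℤDet.Vandermonde.vandermonde (xdeg B) (map monomial ts ++ monomial t₀ ∷ []))

-- Equations under deltas and sums over initial segments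

δ-iff : ∀ {x y x′ y′} → (x ≡ y → x′ ≡ y′) → (x′ ≡ y′ → x ≡ y) → δ x y ≡ δ x′ y′
δ-iff {x} {y} {x′} {y′} f g with x ≟ y
... | yes p = sym (trans (cong (δ x′) (sym (f p))) (δ-refl x′))
... | no p = sym (δ-≢ λ q → p (g q))

δ-shift : ∀ a x y → δ (a + x) (a + y) ≡ δ x y
δ-shift a x y = δ-iff (λ e → trans (l a x) (trans (cong (_- a) e) (sym (l a y)))) (cong (λ z → a + z))
  where
  l : ∀ a x → x ≡ a + x - a
  l = solve-∀

δ-double : ∀ x y → δ (+ 2 * x) (+ 2 * y) ≡ δ x y
δ-double x y = δ-iff {+ 2 * x} {+ 2 * y} (2a≡2b⇒a≡b {x} {y}) (cong (λ z → + 2 * z))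

∑-cong-∈ : ∀ {X : Set} (xs : List X) {f g : X → ℤ} → (∀ x → x ∈ᴸ xs → f x ≡ g x) → ∑ xs f ≡ ∑ xs g
∑-cong-∈ [] e = refl
∑-cong-∈ (x ∷ xs) e = cong₂ _+_ (e x (here refl)) (∑-cong-∈ xs λ y p → e y (there p))

∑-upTo : ∀ {L} n (g : ℤ → ℤ) → n ≤ suc L → ∑ (upTo n) (λ i → g (+ i)) ≡ ∑ (range L) (λ z → (ind 0ℤ z - ind (+ n) z) * g z)
∑-upTo {L} zero g _ = sym (trans (∑-cong (range L) λ z → trans (cong (_* g z) (ℤ.+-inverseʳ (ind 0ℤ z))) (ℤ.*-zeroˡ (g z))) (∑-0 (range L)))
∑-upTo {L} (suc n) g (s≤s n≤L) = begin
  ∑ (upTo (suc n)) (λ i → g (+ i))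
    ≡⟨ trans (cong (λ xs → ∑ xs (λ i → g (+ i))) (sym (List.upTo-∷ʳ n))) (trans (∑-++ (upTo n) (n ∷ []) _) (cong (λ z → ∑ (upTo n) (λ i → g (+ i)) + z) (ℤ.+-identityʳ (g (+ n))))) ⟩
  ∑ (upTo n) (λ i → g (+ i)) + g (+ n)
    ≡⟨ cong₂ _+_ (∑-upTo n g (ℕ.≤-trans n≤L (ℕ.n≤1+n L))) (sym (∑-δ {L} {+ n} g n≤L)) ⟩
  ∑ (range L) (λ z → (ind 0ℤ z - ind (+ n) z) * g z) + ∑ (range L) (λ z → δ (+ n) z * g z)
    ≡⟨ trans (sym (∑-+ (range L) _ _)) (∑-cong (range L) λ z → trans (cong (λ x → (ind 0ℤ z - x) * g z + δ (+ n) z * g z) (ind-step (+ n) z))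
         (trans (l (ind 0ℤ z) (ind (+ n + 1ℤ) z) (δ (+ n) z) (g z)) (cong (λ m → (ind 0ℤ z - ind m z) * g z) (cong +_ (ℕ.+-comm n 1))))) ⟩
  ∑ (range L) (λ z → (ind 0ℤ z - ind (+ suc n) z) * g z) ∎
  where
  open ≡-Reasoning
  l : ∀ a b d x → (a - (b + d)) * x + d * x ≡ (a - b) * x
  l = solve-∀

+-sumℕ : ∀ {X : Set} (f : X → ℕ) xs → + sumℕ (map f xs) ≡ ∑ xs (λ x → + f x)
+-sumℕ f [] = refl
+-sumℕ f (x ∷ xs) = cong (λ z → + f x + z) (+-sumℕ f xs)

-- Coefficients of powers of △

ind-complement : ∀ j → ind 0ℤ j + ind 0ℤ (- 1ℤ - j) ≡ 1ℤ
ind-complement j with 0ℤ ℤ.≤? j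
... | yes p = cong (λ z → 1ℤ + z) (ind-≰ {0ℤ} { - 1ℤ - j} λ q → suc≰ 0ℤ (subst (1ℤ ℤ.≤_) (l j) (ℤ.+-mono-≤ {1ℤ} {1ℤ + j} {0ℤ} { - 1ℤ - j} (ℤ.+-mono-≤ (ℤ.≤-refl {1ℤ}) p) q)))
  where
  l : ∀ j → 1ℤ + j + (- 1ℤ - j) ≡ 0ℤ
  l = solve-∀
... | no p = trans (ℤ.+-identityˡ _) (ind-≤ (subst (0ℤ ℤ.≤_) (l j) (ℤ.neg-mono-≤ (≰⇒suc≤ p))))
  where
  l : ∀ j → - (j + 1ℤ) ≡ - 1ℤ - j
  l = solve-∀

ind-double : ∀ j → ind 0ℤ (+ 2 * j) ≡ ind 0ℤ j
ind-double (+ n) = trans (ind-≤ (*-nonneg (0≤+ {2}) (0≤+ {n}))) (sym (ind-≤ (0≤+ {n})))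
ind-double -[1+ n ] = refl

ind-double+1 : ∀ j → ind 0ℤ (+ 2 * j + 1ℤ) ≡ ind 0ℤ j
ind-double+1 j with 0ℤ ℤ.≤? j
... | yes p = ind-≤ (+-nonneg (*-nonneg (0≤+ {2}) p) (0≤+ {1}))
... | no p = ind-≰ λ q → p (half-nonneg j q)
  where
  half-nonneg : ∀ j → 0ℤ ℤ.≤ + 2 * j + 1ℤ → 0ℤ ℤ.≤ j
  half-nonneg (+ n) _ = 0≤+
  half-nonneg -[1+ n ] q = ⊥-elim (absurd (subst (0ℤ ℤ.≤_) (l (+ n)) q))
    where
    l : ∀ n → + 2 * (- (1ℤ + n)) + 1ℤ ≡ - (1ℤ + + 2 * n)
    l = solve-∀
    absurd : ¬ 0ℤ ℤ.≤ - (1ℤ + + 2 * + n)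
    absurd h = suc≰ 0ℤ (ℤ.≤-trans (subst (ℤ._≤ 1ℤ + + 2 * + n) refl (subst (1ℤ ℤ.≤_) refl (ℤ.+-monoʳ-≤ 1ℤ (*-nonneg (0≤+ {2}) (0≤+ {n})))))
      (subst (ℤ._≤ 0ℤ) (ℤ.neg-involutive (1ℤ + + 2 * + n)) (ℤ.neg-mono-≤ h)))

-- The triangular number with index `k` equals `j (2j + 1)` for exactly one integer `j`: `k = 2j`
-- when `j ≥ 0`, and `k = −1 − 2j` when `j < 0`.
triangular-count : ∀ {L} n → suc n ≤ L → ∑ (range L) (λ j → δ (j * (+ 2 * j + 1ℤ)) (+ n)) ≡ + triCoeff n
triangular-count {L} n n<L = sym (begin
  + triCoeff n                                                  ≡⟨ +-sumℕ _ (upTo (suc n)) ⟩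
  ∑ (upTo (suc n)) (λ k → + (if does (k ℕ.* suc k ℕ.≟ 2 ℕ.* n) then 1 else 0))  ≡⟨ ∑-cong (upTo (suc n)) as-δ ⟩
  ∑ (upTo (suc n)) (λ k → δ (+ k * (+ k + 1ℤ)) (+ 2 * + n))     ≡⟨ ∑-upTo {L} (suc n) (λ z → δ (z * (z + 1ℤ)) (+ 2 * + n)) (ℕ.≤-trans n<L (ℕ.n≤1+n L)) ⟩
  ∑ (range L) (λ z → (ind 0ℤ z - ind (+ suc n) z) * δ (z * (z + 1ℤ)) (+ 2 * + n))   ≡⟨ ∑-cong (range L) drop-large ⟩
  ∑ (range L) f
    ≡⟨ parity-split {L} {n} f (ℕ.≤-trans (ℕ.n≤1+n n) n<L) suppf ⟩
  ∑ (range L) (λ j → f (+ 2 * j)) + ∑ (range L) (λ j → f (+ 2 * j + 1ℤ))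
    ≡⟨ cong₂ _+_ (∑-cong (range L) even-terms) (trans (reflect (- 1ℤ) (λ j → f (+ 2 * j + 1ℤ)) supp-odd) (∑-cong (range L) odd-terms)) ⟩
  ∑ (range L) (λ j → ind 0ℤ j * δ (j * (+ 2 * j + 1ℤ)) (+ n)) + ∑ (range L) (λ j → ind 0ℤ (- 1ℤ - j) * δ (j * (+ 2 * j + 1ℤ)) (+ n))
    ≡⟨ trans (sym (∑-+ (range L) _ _)) (∑-cong (range L) λ j → trans (sym (ℤ.*-distribʳ-+ (δ (j * (+ 2 * j + 1ℤ)) (+ n)) (ind 0ℤ j) (ind 0ℤ (- 1ℤ - j))))
         (trans (cong (_* δ (j * (+ 2 * j + 1ℤ)) (+ n)) (ind-complement j)) (ℤ.*-identityˡ _))) ⟩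
  ∑ (range L) (λ j → δ (j * (+ 2 * j + 1ℤ)) (+ n)) ∎)
  where
  open ≡-Reasoning
  f : ℤ → ℤ
  f z = ind 0ℤ z * δ (z * (z + 1ℤ)) (+ 2 * + n)
  as-δ : ∀ k → + (if does (k ℕ.* suc k ℕ.≟ 2 ℕ.* n) then 1 else 0) ≡ δ (+ k * (+ k + 1ℤ)) (+ 2 * + n)
  as-δ k = trans (nat-δ (k ℕ.* suc k) (2 ℕ.* n)) (cong₂ δ (trans (ℤ.pos-* k (suc k)) (cong (λ z → + k * + z) (ℕ.+-comm 1 k))) (ℤ.pos-* 2 n))
    where
    nat-δ : ∀ a b → + (if does (a ℕ.≟ b) then 1 else 0) ≡ δ (+ a) (+ b)
    nat-δ a b with a ℕ.≡ᵇ b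
    ... | true = refl
    ... | false = refl
  large : ∀ z → + suc n ℤ.≤ z → z * (z + 1ℤ) ≢ + 2 * + n
  large z h e = suc≰ (+ n) (subst (ℤ._≤ + n) (cong +_ (ℕ.+-comm 1 n)) (ℤ.≤-trans h (ℤ.*-cancelˡ-≤-pos z (+ n) (+ 2) (ℤ.≤-trans 2z≤ (ℤ.≤-reflexive e)))))
    where
    l : ∀ z → + 2 * z + (- z * - z + - z) ≡ z * (z + 1ℤ)
    l = solve-∀
    2z≤ : + 2 * z ℤ.≤ z * (z + 1ℤ)
    2z≤ = subst₂ ℤ._≤_ (ℤ.+-identityʳ (+ 2 * z)) (l z) (ℤ.+-monoʳ-≤ (+ 2 * z) (pronic-nonneg (- z)))
  drop-large : ∀ z → (ind 0ℤ z - ind (+ suc n) z) * δ (z * (z + 1ℤ)) (+ 2 * + n) ≡ f z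
  drop-large z with (+ suc n) ℤ.≤? z
  ... | yes h = trans (cong (λ x → (ind 0ℤ z - 1ℤ) * x) (δ-≢ (large z h))) (trans (ℤ.*-zeroʳ (ind 0ℤ z - 1ℤ)) (sym (trans (cong (ind 0ℤ z *_) (δ-≢ (large z h))) (ℤ.*-zeroʳ (ind 0ℤ z)))))
  ... | no _ = cong (_* δ (z * (z + 1ℤ)) (+ 2 * + n)) (ℤ.+-identityʳ (ind 0ℤ z))
  pred≤ : ∀ {z} → z + 1ℤ ℤ.≤ + suc n → z ℤ.≤ + n
  pred≤ {z} h = subst₂ ℤ._≤_ (l z) (l′ (+ n)) (ℤ.+-monoˡ-≤ (- 1ℤ) h)
    where
    l : ∀ z → z + 1ℤ + - 1ℤ ≡ z
    l = solve-∀
    l′ : ∀ n → 1ℤ + n + - 1ℤ ≡ n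
    l′ = solve-∀
  suppf : ∀ z → f z ≢ 0ℤ → ∣ z ∣ ≤ n
  suppf z p with 0ℤ ℤ.≤? z | (+ suc n) ℤ.≤? z
  ... | no q | _ = ⊥-elim (p refl)
  ... | yes q | yes h = ⊥-elim (p (cong (1ℤ *_) (δ-≢ (large z h))))
  ... | yes q | no h = ℤ.drop‿+≤+ (subst (ℤ._≤ + n) (sym (ℤ.0≤i⇒+∣i∣≡i q)) (pred≤ (≰⇒suc≤ h)))
  supp-odd : ∀ j → f (+ 2 * j + 1ℤ) ≢ 0ℤ → ∣ j ∣ ≤ L × ∣ - 1ℤ - j ∣ ≤ L
  supp-odd j p = let b = ℕ.≤-trans (∣i∣≤∣2i+1∣ j) (suppf (+ 2 * j + 1ℤ) p) in
    ℕ.≤-trans b (ℕ.≤-trans (ℕ.n≤1+n n) n<L) , ℕ.≤-trans (∣-∣ { - 1ℤ} {j} (ℕ.≤-refl {1}) b) n<L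
  even-terms : ∀ j → f (+ 2 * j) ≡ ind 0ℤ j * δ (j * (+ 2 * j + 1ℤ)) (+ n)
  even-terms j = cong₂ _*_ (ind-double j) (trans (cong (λ z → δ z (+ 2 * + n)) (l j)) (δ-double (j * (+ 2 * j + 1ℤ)) (+ n)))
    where
    l : ∀ j → + 2 * j * (+ 2 * j + 1ℤ) ≡ + 2 * (j * (+ 2 * j + 1ℤ))
    l = solve-∀
  odd-terms : ∀ j → f (+ 2 * (- 1ℤ - j) + 1ℤ) ≡ ind 0ℤ (- 1ℤ - j) * δ (j * (+ 2 * j + 1ℤ)) (+ n)
  odd-terms j = cong₂ _*_ (ind-double+1 (- 1ℤ - j)) (trans (cong (λ z → δ z (+ 2 * + n)) (l j)) (δ-double (j * (+ 2 * j + 1ℤ)) (+ n)))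
    where
    l : ∀ j → (+ 2 * (- 1ℤ - j) + 1ℤ) * (+ 2 * (- 1ℤ - j) + 1ℤ + 1ℤ) ≡ + 2 * (j * (+ 2 * j + 1ℤ))
    l = solve-∀

-- Elements in which neither u nor v occurs.
Flat : R → Set
Flat p = ∀ B φ φ′ → (∀ a → φ (+ a) 0ℤ 0ℤ ≡ φ′ (+ a) 0ℤ 0ℤ) → ⟪ p B , φ ⟫ ≡ ⟪ p B , φ′ ⟫

Flat-△^ : ∀ n → Flat (△ ^ n)
Flat-△^ zero B φ φ′ e = trans (⟪⟫-ι 1ℤ B φ) (trans (cong (1ℤ *_) (e 0)) (sym (⟪⟫-ι 1ℤ B φ′)))
Flat-△^ (suc n) B φ φ′ e = trans (⟪⟫-⊗ ((△ ^ n) B) (△ B) φ) (trans (Flat-△^ n B _ _ λ a → Flat-△ B _ _ λ a′ → e (a ℕ.+ a′)) (sym (⟪⟫-⊗ ((△ ^ n) B) (△ B) φ′)))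
  where
  Flat-△ : Flat △
  Flat-△ B φ φ′ e = trans (pairing rep-△ B φ) (trans (∑-cong (range B) λ j → cong (1ℤ *_) (subst (λ z → φ z 0ℤ 0ℤ ≡ φ′ z 0ℤ 0ℤ)
    (ℤ.0≤i⇒+∣i∣≡i (*-nonneg (0≤+ {2}) (hexagonal-nonneg j))) (e _))) (sym (pairing rep-△ B φ′)))

coefficient : ℤ → Test
coefficient n a b c = δ (+ 2 * n) a

-- The convolution index is the q-exponent contributed by one factor `△`. The box has to exceed `N`
-- so that `triangular-count` applies to every such index up to `N`.
△^-coefficient : ∀ e N B → suc N ≤ B → ⟪ (△ ^ e) B , coefficient (+ N) ⟫ ≡ + (triCoeff ^ˢ e) N
△^-coefficient zero zero B _ = ⟪⟫-ι 1ℤ B _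
△^-coefficient zero (suc N) B _ = ⟪⟫-ι 1ℤ B _
△^-coefficient (suc e) N B N<B = begin
  ⟪ (△ ^ e ⊙ △) B , coefficient (+ N) ⟫
    ≡⟨ trans (⟪⟫-⊗ ((△ ^ e) B) (△ B) _) (⟪⟫-comm ((△ ^ e) B) (△ B) _) ⟩
  ⟪ △ B , (λ a b c → ⟪ (△ ^ e) B , (λ a′ b′ c′ → δ (+ 2 * + N) (a′ + a)) ⟫) ⟫
    ≡⟨ trans (pairing rep-△ B _) (∑-cong (range B) λ j → trans (ℤ.*-identityˡ _) (⟪⟫-cong ((△ ^ e) B) λ a _ _ → cong (δ (+ 2 * + N)) (ℤ.+-comm a _))) ⟩
  ∑ (range B) (λ j → F (t j))
    ≡⟨ ∑-cong (range B) (λ j → sym (select (t j) (hexagonal-nonneg j))) ⟩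
  ∑ (range B) (λ j → ∑ (upTo (suc N)) λ i → δ (t j) (+ i) * F (+ i))
    ≡⟨ trans (∑-comm (range B) (upTo (suc N)) _) (∑-cong-∈ (upTo (suc N)) λ i p → let i≤N = ℕ.≤-pred (∈-upTo⁻ p) in
         trans (∑-*ʳ (range B) (F (+ i)) _) (trans (cong₂ _*_ (triangular-count i (ℕ.≤-trans (s≤s i≤N) N<B)) (F-small i i≤N)) (sym (ℤ.pos-* (triCoeff i) _)))) ⟩
  ∑ (upTo (suc N)) (λ i → + (triCoeff i ℕ.* (triCoeff ^ˢ e) (N ℕ.∸ i)))
    ≡⟨ +-sumℕ _ (upTo (suc N)) ⟨
  + (triCoeff ⊛ (triCoeff ^ˢ e)) N ∎
  where
  open ≡-Reasoning
  t : ℤ → ℤ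
  t j = j * (+ 2 * j + 1ℤ)
  F : ℤ → ℤ
  F z = ⟪ (△ ^ e) B , (λ a b c → δ (+ 2 * + N) (+ 2 * z + a)) ⟫
  F-small : ∀ i → i ≤ N → F (+ i) ≡ + (triCoeff ^ˢ e) (N ℕ.∸ i)
  F-small i i≤N = trans (⟪⟫-cong ((△ ^ e) B) λ a _ _ → trans (cong (λ z → δ z (+ 2 * + i + a)) (trans (cong (λ z → + 2 * + z) (sym (ℕ.m+[n∸m]≡n i≤N))) (l (+ i) (+ (N ℕ.∸ i)))))
      (δ-shift (+ 2 * + i) (+ 2 * + (N ℕ.∸ i)) a))
    (△^-coefficient e (N ℕ.∸ i) B (ℕ.≤-trans (s≤s (ℕ.m∸n≤m N i)) N<B))
    where
    l : ∀ x y → + 2 * (x + y) ≡ + 2 * x + + 2 * y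
    l = solve-∀
  F-large : ∀ z → + suc N ℤ.≤ z → F z ≡ 0ℤ
  F-large z h = ⟪⟫-0 ((△ ^ e) B) λ a _ _ → δ-≢ λ q → suc≰ (+ N) (subst (ℤ._≤ + N) (cong +_ (ℕ.+-comm 1 N)) (ℤ.≤-trans h
    (ℤ.*-cancelˡ-≤-pos z (+ N) (+ 2) (subst (+ 2 * z ℤ.≤_) (sym q) (subst (ℤ._≤ + 2 * z + + a) (ℤ.+-identityʳ (+ 2 * z)) (ℤ.+-monoʳ-≤ (+ 2 * z) (0≤+ {a})))))))
  select : ∀ z → 0ℤ ℤ.≤ z → ∑ (upTo (suc N)) (λ i → δ z (+ i) * F (+ i)) ≡ F z
  -- The auxiliary range is large enough for both `z` and the segment from 0 to `N`.
  select z 0≤z = trans (∑-upTo {∣ z ∣ ℕ.+ N} (suc N) (λ y → δ z y * F y) (s≤s (ℕ.m≤n+m N ∣ z ∣)))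
    (trans (∑-cong (range (∣ z ∣ ℕ.+ N)) λ y → l (ind 0ℤ y - ind (+ suc N) y) (δ z y) (F y))
    (trans (∑-δ {∣ z ∣ ℕ.+ N} {z} (λ y → (ind 0ℤ y - ind (+ suc N) y) * F y) (ℕ.m≤m+n ∣ z ∣ N)) last))
    where
    l : ∀ a b c → a * (b * c) ≡ b * (a * c)
    l = solve-∀
    last : (ind 0ℤ z - ind (+ suc N) z) * F z ≡ F z
    last with (+ suc N) ℤ.≤? z
    ... | yes h = trans (cong (λ x → (ind 0ℤ z - 1ℤ) * x) (F-large z h)) (trans (ℤ.*-zeroʳ (ind 0ℤ z - 1ℤ)) (sym (F-large z h)))
    ... | no _ = trans (cong (λ x → (x - 0ℤ) * F z) (ind-≤ 0≤z)) (ℤ.*-identityˡ (F z))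

-- The constant term of the product side

double-tri : ∀ m → + 2 * tri m ≡ + exponent m
double-tri zero = refl
double-tri (suc m) = trans (ℤ.*-distribˡ-+ (+ 2) (tri m) (+ suc m)) (trans (cong₂ _+_ (double-tri m) (sym (ℤ.pos-* 2 (suc m)))) (cong +_ (lem m)))
  where
  lem : ∀ m → m ℕ.* (1 ℕ.+ m) ℕ.+ 2 ℕ.* (1 ℕ.+ m) ≡ (1 ℕ.+ m) ℕ.* (2 ℕ.+ m)
  lem = ℕ-solve

tri-nonneg : ∀ m → 0ℤ ℤ.≤ tri m
tri-nonneg zero = 0≤+
tri-nonneg (suc m) = +-nonneg (tri-nonneg m) 0≤+

exponent/2 : ∀ m → + (exponent m ℕ./ 2) ≡ tri m
exponent/2 m = trans (cong +_ (trans (cong (ℕ._/ 2) e) (m*n/n≡m ∣ tri m ∣ 2))) (ℤ.0≤i⇒+∣i∣≡i (tri-nonneg m))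
  where
  e : exponent m ≡ ∣ tri m ∣ ℕ.* 2
  e = trans (cong ∣_∣ (sym (double-tri m))) (trans (ℤ.abs-* (+ 2) (tri m)) (ℕ.*-comm 2 ∣ tri m ∣))

factorial-leadingCoefficient : ∀ m → m ! ℕ.* leadingCoefficient m ≡ facProd m ℕ.* facProd m
factorial-leadingCoefficient zero = refl
factorial-leadingCoefficient (suc m) = trans (l₁ (suc m !) (leadingCoefficient m) (m !)) (trans (cong (suc m ! ℕ.* suc m ! ℕ.*_) (factorial-leadingCoefficient m)) (l₂ (suc m !) (facProd m)))
  where
  l₁ : ∀ a l f → a ℕ.* (l ℕ.* (a ℕ.* f)) ≡ a ℕ.* a ℕ.* (f ℕ.* l)
  l₁ = ℕ-solve
  l₂ : ∀ a p → a ℕ.* a ℕ.* (p ℕ.* p) ≡ a ℕ.* p ℕ.* (a ℕ.* p)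
  l₂ = ℕ-solve

-- The degree is twice the q-exponent plus the u-exponent, so the coefficient of `q^n` at `u^0` sits
-- in degree `2n`. The v-exponent is ignored, as befits `v = 1`.
constantTerm : ℤ → Test
constantTerm n a b c = δ (+ 2 * n) a * δ 0ℤ b

△-power : ∀ n → (△ ⊙ △) ^ n ≈ △ ^ (n ℕ.+ n)
△-power n = ≈-trans (^-⊙ △ △ n) (≈-sym (RToda.^-+ △ n n))

-- Only the index 0 has u-exponent 0; it contributes `q^(m (m + 1) / 2)`, which is the reason for
-- the shift of `N` by `tri m`.
coefficient-T : ∀ m N B a → ⟪ at-v=1 (T m) B , shift (+ a) 0ℤ 0ℤ (constantTerm (N + tri m)) ⟫ ≡ coefficient N (+ a) 0ℤ 0ℤ
coefficient-T m N B a = trans (pairing (rep-pow 1 1ℤ 0ℤ (rep-T m)) B _) (trans (∑-cong (range B) swap) (trans (∑-δ {B} {0ℤ} F z≤n) at-0))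
  where
  F : ℤ → ℤ
  F k = δ (+ 2 * (N + tri m)) (+ a + 1ℤ * degT (+ m) k)
  swap : ∀ k → 1ℤ * (δ (+ 2 * (N + tri m)) (+ a + 1ℤ * degT (+ m) k) * δ 0ℤ (0ℤ + 1ℤ * k)) ≡ δ 0ℤ k * F k
  swap k = trans (cong (λ z → 1ℤ * (F k * δ 0ℤ z)) (l k)) (l′ (F k) (δ 0ℤ k))
    where
    l : ∀ k → 0ℤ + 1ℤ * k ≡ k
    l = solve-∀
    l′ : ∀ f d → 1ℤ * (f * d) ≡ d * f
    l′ = solve-∀
  at-0 : F 0ℤ ≡ δ (+ 2 * N) (+ a)
  at-0 = trans (cong₂ δ (l (tri m) N) (trans (l′ (+ a) (+ m)) (cong (_+ + a) (sym 2tri)))) (δ-shift (+ 2 * tri m) (+ 2 * N) (+ a))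
    where
    2tri : + 2 * tri m ≡ + m * (+ m + 1ℤ)
    2tri = trans (double-tri m) (trans (ℤ.pos-* m (suc m)) (cong (λ z → + m * + z) (ℕ.+-comm 1 m)))
    l : ∀ t n → + 2 * (n + t) ≡ + 2 * t + + 2 * n
    l = solve-∀
    l′ : ∀ a m → a + 1ℤ * (+ 2 * (0ℤ * 0ℤ - 0ℤ * m) + 0ℤ + m * (m + 1ℤ)) ≡ m * (m + 1ℤ) + a
    l′ = solve-∀

△^-lhsCoeff : ∀ m N B → suc ∣ N ∣ ≤ B → ⟪ (△ ^ (2 ℕ.* m ℕ.* suc m)) B , coefficient N ⟫ ≡ lhsCoeff m N
△^-lhsCoeff m (+ n) B p = △^-coefficient (2 ℕ.* m ℕ.* suc m) n B p
△^-lhsCoeff m -[1+ n ] B p = ⟪⟫-0 ((△ ^ (2 ℕ.* m ℕ.* suc m)) B) λ a b c → δ-≢ { + 2 * -[1+ n ]} {+ a} λ ()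

specialised-W : ∀ m → at-v=1 (W m) ≈ ι (+ leadingCoefficient m) ⊙ (△ ^ (2 ℕ.* m ℕ.* suc m) ⊙ at-v=1 (T m))
specialised-W m = ≈-trans (specialised m) (⊙-congʳ (ι (+ leadingCoefficient m)) (⊙-cong (subst (λ n → (△ ⊙ △) ^ exponent m ≈ △ ^ n) (lem m) (△-power (exponent m))) ≈-refl))
  where
  lem : ∀ m → m ℕ.* (1 ℕ.+ m) ℕ.+ m ℕ.* (1 ℕ.+ m) ≡ 2 ℕ.* m ℕ.* (1 ℕ.+ m)
  lem = ℕ-solve

constant-term-of-product : ∀ m N B → suc ∣ N ∣ ≤ B →
  + (m !) * ⟪ (ι (+ leadingCoefficient m) ⊙ (△ ^ (2 ℕ.* m ℕ.* suc m) ⊙ at-v=1 (T m))) B , constantTerm (N + tri m) ⟫ ≡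
  (+ facProd m * + facProd m) * lhsCoeff m N
constant-term-of-product m N B p = begin
  + (m !) * ⟪ (ι c ⊙ (P ⊙ T₁)) B , χ ⟫      ≡⟨ cong (+ (m !) *_) (⟪⟫-ι⊙ c (P ⊙ T₁) B χ) ⟩
  + (m !) * (c * ⟪ (P ⊙ T₁) B , χ ⟫)        ≡⟨ ℤ.*-assoc (+ (m !)) c _ ⟨
  + (m !) * c * ⟪ (P ⊙ T₁) B , χ ⟫          ≡⟨ cong₂ _*_ (trans (sym (ℤ.pos-* (m !) (leadingCoefficient m))) (trans (cong +_ (factorial-leadingCoefficient m)) (ℤ.pos-* (facProd m) (facProd m)))) extract ⟩
  (+ facProd m * + facProd m) * lhsCoeff m N ∎
  where
  open ≡-Reasoning
  c = + leadingCoefficient m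
  P = △ ^ (2 ℕ.* m ℕ.* suc m)
  T₁ = at-v=1 (T m)
  χ = constantTerm (N + tri m)
  extract : ⟪ (P ⊙ T₁) B , χ ⟫ ≡ lhsCoeff m N
  extract = trans (⟪⟫-⊗ (P B) (T₁ B) χ) (trans (Flat-△^ (2 ℕ.* m ℕ.* suc m) B _ (coefficient N) (coefficient-T m N B)) (△^-lhsCoeff m N B p))

-- The index sets of the sum

map-allFin-suc : ∀ {A : Set} {m} (f : Fin (suc m) → A) → map f (tabulate {n = m} suc) ≡ map (f ∘ suc) (allFin m)
map-allFin-suc f = trans (List.map-tabulate suc f) (sym (List.map-tabulate id (f ∘ suc)))

filterᵇ-cong : ∀ {A : Set} {p q : A → Bool} → (∀ x → p x ≡ q x) → ∀ xs → filterᵇ p xs ≡ filterᵇ q xs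
filterᵇ-cong e [] = refl
filterᵇ-cong {p = p} {q} e (x ∷ xs) with p x | q x | e x
... | true | true | refl = cong (x ∷_) (filterᵇ-cong e xs)
... | false | false | refl = filterᵇ-cong e xs

filterᵇ-map : ∀ {A B : Set} (p : B → Bool) (f : A → B) xs → filterᵇ p (map f xs) ≡ map f (filterᵇ (p ∘ f) xs)
filterᵇ-map p f [] = refl
filterᵇ-map p f (x ∷ xs) with p (f x)
... | true = cong (f x ∷_) (filterᵇ-map p f xs)
... | false = filterᵇ-map p f xs

filterᵇ-true : ∀ {A : Set} (xs : List A) → filterᵇ (λ _ → true) xs ≡ xs
filterᵇ-true [] = refl
filterᵇ-true (x ∷ xs) = cong (x ∷_) (filterᵇ-true xs)

both : ∀ {m} → Fin m × Fin m → Fin (suc m) × Fin (suc m)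
both (i , j) = suc i , suc j

-- Treats `pairsLe` and `pairsLt` together: the pairs on `suc m` indices are those that start with 0
-- and the successors of the pairs on `m` indices.
module _ (P : ∀ {m} → Fin m → Fin m → Bool)
  (P-zero : ∀ {m} (j : Fin m) → P zero (suc j) ≡ true) (P-suc : ∀ {m} (i j : Fin m) → P (suc i) (suc j) ≡ P i j) (P-suc-zero : ∀ {m} (i : Fin m) → P (suc i) zero ≡ false) where

  pairs : (m : ℕ) → List (Fin m × Fin m)
  pairs m = concatMap (λ i → map (i ,_) (filterᵇ (P i) (allFin m))) (allFin m)

  above-zero : ∀ m → filterᵇ (P zero) (tabulate {n = m} suc) ≡ map suc (allFin m)
  above-zero m = trans (cong (filterᵇ (P zero)) (sym (List.map-tabulate id suc))) (trans (filterᵇ-map (P zero) suc (allFin m))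
    (cong (map suc) (trans (filterᵇ-cong P-zero (allFin m)) (filterᵇ-true (allFin m)))))

  above-suc : ∀ m (i : Fin m) → map (suc i ,_) (filterᵇ (P (suc i)) (zero ∷ tabulate suc)) ≡ map both (map (i ,_) (filterᵇ (P i) (allFin m)))
  above-suc m i with P (suc i) zero | P-suc-zero i
  ... | false | refl = trans (cong (λ xs → map (suc i ,_) (filterᵇ (P (suc i)) xs)) (sym (List.map-tabulate id suc)))
    (trans (cong (map (suc i ,_)) (trans (filterᵇ-map (P (suc i)) suc (allFin m)) (cong (map suc) (filterᵇ-cong (P-suc i) (allFin m)))))
    (trans (sym (List.map-∘ _)) (List.map-∘ _)))

  pairs-suc : ∀ m → pairs (suc m) ≡ map (zero ,_) (filterᵇ (P zero) (zero ∷ tabulate suc)) ++ map both (pairs m)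
  pairs-suc m = cong (map (zero ,_) (filterᵇ (P zero) (zero ∷ tabulate suc)) ++_)
    (trans (cong (concatMap row) (sym (List.map-tabulate id suc))) (trans (List.concatMap-map row suc (allFin m))
      (trans (List.concatMap-cong (above-suc m) (allFin m)) (sym (List.map-concatMap both (λ i → map (i ,_) (filterᵇ (P i) (allFin m))) (allFin m))))))
    where
    row : Fin (suc m) → List (Fin (suc m) × Fin (suc m))
    row i = map (i ,_) (filterᵇ (P i) (zero ∷ tabulate suc))

pairsLt-suc : ∀ m → pairsLt (suc m) ≡ map (λ j → zero , suc j) (allFin m) ++ map both (pairsLt m)
pairsLt-suc m = trans (pairs-suc P (λ _ → refl) (λ _ _ → refl) (λ _ → refl) m) (cong (_++ map both (pairsLt m))
  (trans (cong (map (zero ,_)) (above-zero P (λ _ → refl) (λ _ _ → refl) (λ _ → refl) m)) (sym (List.map-∘ (allFin m)))))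
  where
  P : ∀ {m} → Fin m → Fin m → Bool
  P i j = does (i F.<? j)

pairsLe-suc : ∀ m → pairsLe (suc m) ≡ (zero , zero) ∷ map (λ j → zero , suc j) (allFin m) ++ map both (pairsLe m)
pairsLe-suc m = trans (pairs-suc P (λ _ → refl) P-suc (λ _ → refl) m) (cong (λ xs → (zero , zero) ∷ xs ++ map both (pairsLe m))
  (trans (cong (map (zero ,_)) (above-zero P (λ _ → refl) P-suc (λ _ → refl) m)) (sym (List.map-∘ (allFin m)))))
  where
  P : ∀ {m} → Fin m → Fin m → Bool
  P i j = does (i F.≤? j)
  P-suc : ∀ {m} (i j : Fin m) → P (suc i) (suc j) ≡ P i j
  P-suc zero j = refl
  P-suc (suc i) j = refl

sumℤ-∑ : ∀ {A : Set} (f : A → ℤ) xs → sumℤ (map f xs) ≡ ∑ xs f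
sumℤ-∑ f [] = refl
sumℤ-∑ f (x ∷ xs) = cong (λ z → f x + z) (sumℤ-∑ f xs)

prodℤ-++ : ∀ xs ys → prodℤ (xs ++ ys) ≡ prodℤ xs * prodℤ ys
prodℤ-++ [] ys = sym (ℤ.*-identityˡ _)
prodℤ-++ (x ∷ xs) ys = trans (cong (x *_) (prodℤ-++ xs ys)) (sym (ℤ.*-assoc x _ _))

normℤ-∷ : ∀ {m} x (k : Vec ℤ m) → normℤ (x ∷ k) ≡ x + normℤ k
normℤ-∷ x k = cong (λ xs → x + sumℤ xs) (map-allFin-suc (lookup (x ∷ k)))

quadratic : ∀ {m} → Vec ℤ m → ℤ
quadratic {m} k = sumℤ (map (λ p → lookup k (proj₁ p) * lookup k (proj₂ p)) (pairsLe m))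

quadratic-∷ : ∀ {m} x (k : Vec ℤ m) → quadratic (x ∷ k) ≡ x * x + (x * normℤ k + quadratic k)
quadratic-∷ {m} x k = begin
  sumℤ (map f (pairsLe (suc m)))     ≡⟨ cong (λ ps → sumℤ (map f ps)) (pairsLe-suc m) ⟩
  x * x + sumℤ (map f (map (λ j → zero , suc j) (allFin m) ++ map both (pairsLe m)))
    ≡⟨ cong (λ z → x * x + z) (trans (sumℤ-∑ f (map (λ j → zero , suc j) (allFin m) ++ map both (pairsLe m)))
         (trans (∑-++ (map (λ j → zero , suc j) (allFin m)) (map both (pairsLe m)) f) (cong₂ _+_
           (trans (∑-map (λ j → zero , suc j) (allFin m) f) (trans (∑-*ˡ (allFin m) x (lookup k)) (cong (x *_) (sym (sumℤ-∑ (lookup k) (allFin m))))))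
           (trans (∑-map both (pairsLe m) f) (sym (sumℤ-∑ (λ p → lookup k (proj₁ p) * lookup k (proj₂ p)) (pairsLe m))))))) ⟩
  x * x + (x * normℤ k + quadratic k) ∎
  where
  open ≡-Reasoning
  f : Fin (suc m) × Fin (suc m) → ℤ
  f p = lookup (x ∷ k) (proj₁ p) * lookup (x ∷ k) (proj₂ p)

linear : ∀ {m} → Vec ℤ m → Vec ℤ m → ℤ
linear [] [] = 0ℤ
linear (x ∷ k) (y ∷ r) = (+ 2 * x - 1ℤ) * y + linear k r

linear-sum : ∀ {m} (k r : Vec ℤ m) → sumℤ (map (λ j → (+ 2 * lookup k j - + 1) * lookup r j) (allFin m)) ≡ linear k r
linear-sum [] [] = refl
linear-sum (x ∷ k) (y ∷ r) = cong (λ z → (+ 2 * x - 1ℤ) * y + z) (trans (cong sumℤ (map-allFin-suc (λ j → (+ 2 * lookup (x ∷ k) j - + 1) * lookup (y ∷ r) j))) (linear-sum k r))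

expo+tri : ∀ {m} (k r : Vec ℤ m) → expo k r + tri m ≡ + 2 * quadratic k + linear k r
expo+tri {m} k r = trans (cong₃ (λ q n t → + 2 * q + n - t + tri m) (cong sumℤ (List.map-cong (λ { (i , j) → refl }) (pairsLe m))) (linear-sum k r) (exponent/2 m)) (l (+ 2 * quadratic k + linear k r) (tri m))
  where
  l : ∀ a t → a - t + t ≡ a
  l = solve-∀

degree : ∀ {m} → Vec ℤ m → Vec ℤ m → ℤ
degree [] [] = 0ℤ
degree (x ∷ k) (y ∷ r) = degA x y + degree k r

-- The term of `θ` has index `−|k|`, so the u-exponents cancel, and the squares `k_i²` together with
-- `|k|²` add up to twice the sum of `k_i k_j` over `i ≤ j`.
degree-expo : ∀ {m} (k r : Vec ℤ m) → degree k r + - normℤ k * (+ 2 * - normℤ k + 1ℤ) ≡ + 2 * (expo k r + tri m)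
degree-expo k r = trans (trans (cong (λ z → z + - normℤ k * (+ 2 * - normℤ k + 1ℤ)) (go k r)) (l (quadratic k) (linear k r) (normℤ k))) (cong (+ 2 *_) (sym (expo+tri k r)))
  where
  l : ∀ q n k → + 2 * (+ 2 * q + n) - (+ 2 * (k * k) - k) + - k * (+ 2 * - k + 1ℤ) ≡ + 2 * (+ 2 * q + n)
  l = solve-∀
  go : ∀ {m} (k r : Vec ℤ m) → degree k r ≡ + 2 * (+ 2 * quadratic k + linear k r) - (+ 2 * (normℤ k * normℤ k) - normℤ k)
  go [] [] = refl
  go (x ∷ k) (y ∷ r) = trans (cong (λ z → degA x y + z) (go k r)) (trans (step x y (quadratic k) (linear k r) (normℤ k))
    (sym (cong₂ (λ q n → + 2 * (+ 2 * q + ((+ 2 * x - 1ℤ) * y + linear k r)) - (+ 2 * (n * n) - n)) (quadratic-∷ x k) (normℤ-∷ x k))))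
    where
    step : ∀ x y q n k → + 2 * (x * x + (+ 2 * x - 1ℤ) * y) + x + (+ 2 * (+ 2 * q + n) - (+ 2 * (k * k) - k)) ≡
      + 2 * (+ 2 * (x * x + (x * k + q)) + ((+ 2 * x - 1ℤ) * y + n)) - (+ 2 * ((x + k) * (x + k)) - (x + k))
    step = solve-∀

-- The weight as a product of two Vandermonde products

termA : Vec ℤ 2 → Term
termA x = term (on₂ ε x) ∣ on₂ degA x ∣ (on₂ (λ k r → k) x) (on₂ (λ k r → r) x)

termθ : Vec ℤ 1 → Term
termθ v = term 1ℤ ∣ head v * (+ 2 * head v + 1ℤ) ∣ (head v) 0ℤ

columns : ∀ {m} → Vec ℤ m → Vec ℤ m → List (Vec ℤ 2)
columns [] [] = []
columns (x ∷ k) (y ∷ r) = (x ∷ y ∷ []) ∷ columns k r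

terms : ∀ {m} → Vec ℤ m → Vec ℤ m → List Term
terms k r = map termA (columns k r)

monomials : ∀ {m} → Vec ℤ m → Vec ℤ m → List Mon
monomials k r = map monomial (terms k r)

difference-product-snoc : ∀ {X : Set} (g : X → ℤ) xs y →
  ℤDet.Vandermonde.difference-product g (xs ++ y ∷ []) ≡ ℤDet.product (λ x → g x - g y) xs * ℤDet.Vandermonde.difference-product g xs
difference-product-snoc g [] y = refl
difference-product-snoc g (x ∷ xs) y = trans (cong₂ _*_ (product-snoc xs) (difference-product-snoc g xs y)) (l (ℤDet.product (λ z → g x - g z) xs) (g x - g y) _ _)
  where
  product-snoc : ∀ xs → ℤDet.product (λ z → g x - g z) (xs ++ y ∷ []) ≡ ℤDet.product (λ z → g x - g z) xs * (g x - g y)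
  product-snoc [] = trans (ℤ.*-identityʳ (g x - g y)) (sym (ℤ.*-identityˡ (g x - g y)))
  product-snoc (z ∷ zs) = trans (cong ((g x - g z) *_) (product-snoc zs)) (sym (ℤ.*-assoc (g x - g z) _ (g x - g y)))
  l : ∀ p d q v → p * d * (q * v) ≡ d * q * (p * v)
  l = solve-∀

module _ (B : ℕ) where
  pairFactor : ∀ {m} → Vec ℤ m → Vec ℤ m → Fin m × Fin m → ℤ
  pairFactor k r p = (lookup k (proj₁ p) + lookup r (proj₁ p) - lookup k (proj₂ p) - lookup r (proj₂ p)) * (lookup r (proj₁ p) - lookup r (proj₂ p))

  pair-product : ∀ {m} (k r : Vec ℤ m) → prodℤ (map (pairFactor k r) (pairsLt m)) ≡ vandermondeˣ B (monomials k r) * vandermondeᵛ B (terms k r)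
  pair-product [] [] = refl
  pair-product {suc m} (x ∷ k) (y ∷ r) = begin
    prodℤ (map f (pairsLt (suc m)))
      ≡⟨ cong prodℤ (trans (cong (map f) (pairsLt-suc m)) (trans (List.map-++ f (map (λ j → zero , suc j) (allFin m)) (map both (pairsLt m))) (cong₂ _++_ (sym (List.map-∘ (allFin m))) (sym (List.map-∘ (pairsLt m)))))) ⟩
    prodℤ (map (λ j → f (zero , suc j)) (allFin m) ++ map (pairFactor k r) (pairsLt m))
      ≡⟨ trans (prodℤ-++ (map (λ j → f (zero , suc j)) (allFin m)) _) (cong₂ _*_ (first-row k r) (pair-product k r)) ⟩
    (ℤDet.product (λ m → x + y - xdeg B m) (monomials k r) * ℤDet.product (λ t → y - vdeg t) (terms k r)) * (vandermondeˣ B (monomials k r) * vandermondeᵛ B (terms k r))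
      ≡⟨ l (ℤDet.product (λ m → x + y - xdeg B m) (monomials k r)) (ℤDet.product (λ t → y - vdeg t) (terms k r)) _ _ ⟩
    vandermondeˣ B (monomials (x ∷ k) (y ∷ r)) * vandermondeᵛ B (terms (x ∷ k) (y ∷ r)) ∎
    where
    open ≡-Reasoning
    open Term
    f = pairFactor (x ∷ k) (y ∷ r)
    l : ∀ a b c d → a * b * (c * d) ≡ a * c * (b * d)
    l = solve-∀
    l′ : ∀ x y k r p q → (x + y - k - r) * (y - r) * (p * q) ≡ (x + y - (k + r)) * p * ((y - r) * q)
    l′ = solve-∀
    first-row : ∀ {n} (k r : Vec ℤ n) → prodℤ (map (λ j → (x + y - lookup k j - lookup r j) * (y - lookup r j)) (allFin n)) ≡
      ℤDet.product (λ m → x + y - xdeg B m) (monomials k r) * ℤDet.product (λ t → y - vdeg t) (terms k r)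
    first-row [] [] = refl
    first-row (x′ ∷ k) (y′ ∷ r) = trans (cong (λ xs → (x + y - x′ - y′) * (y - y′) * prodℤ xs) (map-allFin-suc (λ j → (x + y - lookup (x′ ∷ k) j - lookup (y′ ∷ r) j) * (y - lookup (y′ ∷ r) j))))
      (trans (cong ((x + y - x′ - y′) * (y - y′) *_) (first-row k r)) (l′ x y x′ y′ _ _))

  diagonal-product : ∀ {m} K d (k r : Vec ℤ m) → prodℤ (map (λ i → lookup k i + lookup r i + K) (allFin m)) ≡
    ℤDet.product (λ m → xdeg B m - xdeg B (mon d (- K) 0ℤ)) (monomials k r)
  diagonal-product K d [] [] = refl
  diagonal-product K d (x ∷ k) (y ∷ r) = trans (cong (λ xs → (x + y + K) * prodℤ xs) (map-allFin-suc (λ i → lookup (x ∷ k) i + lookup (y ∷ r) i + K)))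
    (cong₂ _*_ (l x y K) (diagonal-product K d k r))
    where
    l : ∀ x y K → x + y + K ≡ x + y - (- K + 0ℤ)
    l = solve-∀

  -- The row of `θ` has x-degree `−|k|`, so the factors `k_i + r_i + |k|` are its differences to the
  -- other rows; they extend the Vandermonde product in the x-degrees by one entry.
  weight-vandermonde : ∀ {m} d (k r : Vec ℤ m) → weight k r ≡
    vandermondeᵛ B (terms k r) * vandermondeˣ B (monomials k r ++ mon d (- normℤ k) 0ℤ ∷ [])
  weight-vandermonde {m} d k r = trans (cong₂ _*_ (diagonal-product (normℤ k) d k r)
      (trans (cong prodℤ (List.map-cong (λ { (i , j) → refl }) (pairsLt m))) (pair-product k r)))
    (trans (l (ℤDet.product (λ m → xdeg B m - xdeg B (mon d (- normℤ k) 0ℤ)) (monomials k r)) (vandermondeˣ B (monomials k r)) (vandermondeᵛ B (terms k r)))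
      (cong (vandermondeᵛ B (terms k r) *_) (sym (difference-product-snoc (xdeg B) (monomials k r) (mon d (- normℤ k) 0ℤ)))))
    where
    l : ∀ p x v → p * (x * v) ≡ v * (p * x)
    l = solve-∀

-- The signed sum over subsets J

bit : Bool → ℤ
bit b = if b then 1ℤ else 0ℤ

bit-∧ : ∀ a b → bit (a ∧ b) ≡ bit a * bit b
bit-∧ true b = sym (ℤ.*-identityˡ (bit b))
bit-∧ false b = sym (ℤ.*-zeroˡ (bit b))

agrees : Bool → Bool → Bool
agrees true b = b
agrees false b = not b

-- The test inside inZJ, recovered by unification because it is a local definition there.
inZJ-test : ∀ {m} (J : Subset m) (k : Vec ℤ m) → Σ[ h ∈ (Fin m → Bool) ] inZJ J k ≡ foldr _∧_ true (map h (allFin m))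
inZJ-test J k = _ , refl

inZJ-agrees : ∀ {m} (J : Subset m) (k : Vec ℤ m) j → proj₁ (inZJ-test J k) j ≡ agrees (does (j ∈? J)) (does (lookup k j ℤ.≤? 0ℤ))
inZJ-agrees J k j with does (j ∈? J) | does (lookup k j ℤ.≤? 0ℤ)
... | true | b = refl
... | false | true = refl
... | false | false = refl

inZJ-∷ : ∀ {m} s (J : Subset m) x k → inZJ (s ∷ J) (x ∷ k) ≡ agrees (does (zero ∈? (s ∷ J))) (does (x ℤ.≤? 0ℤ)) ∧ inZJ J k
inZJ-∷ {m} s J x k = cong₂ _∧_ (inZJ-agrees (s ∷ J) (x ∷ k) zero) (trans (cong (foldr _∧_ true) (trans (map-allFin-suc (proj₁ (inZJ-test (s ∷ J) (x ∷ k))))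
    (List.map-cong (λ j → trans (inZJ-agrees (s ∷ J) (x ∷ k) (suc j)) (sym (inZJ-agrees J k j))) (allFin m)))) (sym (proj₂ (inZJ-test J k))))

signs : ∀ {m} → Vec ℤ m → Vec ℤ m → ℤ
signs k r = coefs (terms k r)

-- The coordinates separate. With `a = [x ≤ 0]` and `b = [y ≤ 0]`, a coordinate inside `J`
-- contributes `−ab` and one outside `(1 − a)(1 − b)`; together this is `(1 − b) − a`, which is
-- `ε x y`.
signed-count : ∀ {m} (k r : Vec ℤ m) → ∑ (allSubsets m) (λ J → sgn ∣ J ∣ˢ * (bit (inZJ J k) * bit (inZJ J r))) ≡ signs k r
signed-count [] [] = refl
signed-count {suc m} (x ∷ k) (y ∷ r) = trans (∑-concatMap (λ J → (inside ∷ J) ∷ (outside ∷ J) ∷ []) (allSubsets m) f)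
  (trans (∑-cong (allSubsets m) λ J → trans (cong₂ (λ a b → a + (b + 0ℤ)) (factor inside J) (factor outside J))
    (trans (l (sgn ∣ J ∣ˢ) (bit a) (bit b) (bit (not a)) (bit (not b)) (bit (inZJ J k)) (bit (inZJ J r))) (cong (_* (sgn ∣ J ∣ˢ * (bit (inZJ J k) * bit (inZJ J r)))) (four a b))))
  (trans (∑-*ˡ (allSubsets m) (bit (not b) - bit a) _) (cong₂ _*_ (cong (_- bit a) (sym (positive y))) (signed-count k r))))
  where
  a = does (x ℤ.≤? 0ℤ)
  b = does (y ℤ.≤? 0ℤ)
  f : Subset (suc m) → ℤ
  f J = sgn ∣ J ∣ˢ * (bit (inZJ J (x ∷ k)) * bit (inZJ J (y ∷ r)))
  factor : ∀ s J → f (s ∷ J) ≡ sgn ∣ s ∷ J ∣ˢ * (bit (agrees (does (zero ∈? (s ∷ J))) a) * bit (inZJ J k) * (bit (agrees (does (zero ∈? (s ∷ J))) b) * bit (inZJ J r)))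
  factor s J = cong (sgn ∣ s ∷ J ∣ˢ *_) (cong₂ _*_ (trans (cong bit (inZJ-∷ s J x k)) (bit-∧ _ (inZJ J k))) (trans (cong bit (inZJ-∷ s J y r)) (bit-∧ _ (inZJ J r))))
  l : ∀ s a b a′ b′ p q → - s * (a * p * (b * q)) + (s * (a′ * p * (b′ * q)) + 0ℤ) ≡ (a′ * b′ - a * b) * (s * (p * q))
  l = solve-∀
  four : ∀ a b → bit (not a) * bit (not b) - bit a * bit b ≡ bit (not b) - bit a
  four true true = refl
  four true false = refl
  four false true = refl
  four false false = refl
  positive : ∀ y → ind 1ℤ y ≡ bit (not (does (y ℤ.≤? 0ℤ)))
  positive (+ zero) = refl
  positive (+ suc n) = refl
  positive -[1+ n ] = refl

truncated-sum : ∀ m B N → rhsCoeffTrunc m B N ≡ S B m λ k → S B m λ r → signs k r * (bit (does (expo k r ≟ N)) * weight k r)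
truncated-sum m B N = begin
  rhsCoeffTrunc m B N                             ≡⟨ sumℤ-∑ _ (allSubsets m) ⟩
  ∑ (allSubsets m) (λ J → sgn ∣ J ∣ˢ * sumℤ (concatMap (λ k → concatMap (entry J k) (box B m)) (box B m)))
    ≡⟨ ∑-cong (allSubsets m) (λ J → trans (cong (sgn ∣ J ∣ˢ *_) (inner J)) (trans (sym (S-*ˡ B m (sgn ∣ J ∣ˢ) _)) (S-cong B m λ k → sym (S-*ˡ B m (sgn ∣ J ∣ˢ) _)))) ⟩
  ∑ (allSubsets m) (λ J → S B m λ k → S B m λ r → sgn ∣ J ∣ˢ * (bit (inZJ J k) * (bit (inZJ J r) * c k r)))
    ≡⟨ trans (sym (S-∑-comm B m (allSubsets m) _)) (S-cong B m λ k → sym (S-∑-comm B m (allSubsets m) _)) ⟩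
  S B m (λ k → S B m λ r → ∑ (allSubsets m) λ J → sgn ∣ J ∣ˢ * (bit (inZJ J k) * (bit (inZJ J r) * c k r)))
    ≡⟨ S-cong B m (λ k → S-cong B m λ r → trans (∑-cong (allSubsets m) λ J → l (sgn ∣ J ∣ˢ) (bit (inZJ J k)) (bit (inZJ J r)) (c k r))
         (trans (∑-*ʳ (allSubsets m) (c k r) _) (cong (_* c k r) (signed-count k r)))) ⟩
  S B m (λ k → S B m λ r → signs k r * c k r) ∎
  where
  open ≡-Reasoning
  c : Vec ℤ m → Vec ℤ m → ℤ
  c k r = bit (does (expo k r ≟ N)) * weight k r
  entry : Subset m → Vec ℤ m → Vec ℤ m → List ℤ
  entry J k r = if inZJ J k ∧ inZJ J r ∧ does (expo k r ≟ N) then weight k r ∷ [] else []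
  row : Subset m → Vec ℤ m → List ℤ
  row J k = concatMap (entry J k) (box B m)
  sumℤ≡∑ : ∀ xs → sumℤ xs ≡ ∑ xs id
  sumℤ≡∑ xs = trans (cong sumℤ (sym (List.map-id xs))) (sumℤ-∑ id xs)
  l : ∀ s a b c → s * (a * (b * c)) ≡ s * (a * b) * c
  l = solve-∀
  ∑-if : ∀ b x → ∑ (if b then x ∷ [] else []) id ≡ bit b * x
  ∑-if true x = trans (ℤ.+-identityʳ x) (sym (ℤ.*-identityˡ x))
  ∑-if false x = sym (ℤ.*-zeroˡ x)
  inner : ∀ J → sumℤ (concatMap (λ k → concatMap (entry J k) (box B m)) (box B m)) ≡ S B m λ k → S B m λ r → bit (inZJ J k) * (bit (inZJ J r) * c k r)
  inner J = trans (sumℤ≡∑ (concatMap (row J) (box B m))) (trans (∑-concatMap (row J) (box B m) id) (trans (∑-box B m (λ k → ∑ (row J k) id)) (S-cong B m λ k →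
    trans (∑-concatMap (entry J k) (box B m) id) (trans (∑-box B m (λ r → ∑ (entry J k r) id)) (S-cong B m λ r → trans (∑-if (inZJ J k ∧ inZJ J r ∧ does (expo k r ≟ N)) (weight k r))
      (trans (cong (_* weight k r) (trans (bit-∧ (inZJ J k) _) (cong (bit (inZJ J k) *_) (bit-∧ (inZJ J r) _)))) (l′ (bit (inZJ J k)) (bit (inZJ J r)) _ (weight k r))))))))
    where
    l′ : ∀ a b c d → a * (b * c) * d ≡ a * (b * (c * d))
    l′ = solve-∀

-- The truncated sum as a constant term

δ-≢0 : ∀ {x y} → δ x y ≢ 0ℤ → x ≡ y
δ-≢0 {x} {y} p with x ≟ y
... | yes e = e
... | no _ = ⊥-elim (p refl)

Mu-box : ∀ B m (H : List (Vec ℤ 2) → ℤ) → Mu (box B 2) m H ≡ S B m λ k → S B m λ r → H (columns k r)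
Mu-box B zero H = refl
Mu-box B (suc m) H = trans (∑-box B 2 (λ v → Mu (box B 2) m λ zs → H (v ∷ zs))) (∑-cong (range B) λ x →
  trans (∑-cong (range B) λ y → Mu-box B m λ zs → H ((x ∷ y ∷ []) ∷ zs))
    (sym (S-∑-comm B m (range B) λ k y → S B m λ r → H (columns (x ∷ k) (y ∷ r)))))

-- The degree carried by the terms of `A`, in which absolute values were taken; it agrees with
-- `degree` where `signs` does not vanish.
absDegree : ∀ {m} → Vec ℤ m → Vec ℤ m → ℤ
absDegree [] [] = 0ℤ
absDegree (x ∷ k) (y ∷ r) = + ∣ degA x y ∣ + absDegree k r

absDegree-nonneg : ∀ {m} (k r : Vec ℤ m) → 0ℤ ℤ.≤ absDegree k r
absDegree-nonneg [] [] = 0≤+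
absDegree-nonneg (x ∷ k) (y ∷ r) = +-nonneg (0≤+ {∣ degA x y ∣}) (absDegree-nonneg k r)

absDegree-degree : ∀ {m} (k r : Vec ℤ m) → signs k r ≢ 0ℤ → absDegree k r ≡ degree k r
absDegree-degree [] [] p = refl
absDegree-degree (x ∷ k) (y ∷ r) p = cong₂ _+_ (ℤ.0≤i⇒+∣i∣≡i (ℤ.≤-trans 0≤+ (proj₂ (degA-bounds x y (*-≢0ˡ (ε x y) {signs k r} p))))) (absDegree-degree k r (*-≢0ʳ (ε x y) p))

vsum : ∀ {m} → Vec ℤ m → ℤ
vsum [] = 0ℤ
vsum (y ∷ r) = y + vsum r

total-monomials : ∀ φ {m} (k r : Vec ℤ m) d b c →
  total φ (monomials k r ++ mon d b c ∷ []) ≡ φ (absDegree k r + + d) (normℤ k + b) (vsum r + c)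
total-monomials φ [] [] d b c = cong₃ φ (ℤ.+-comm (+ d) 0ℤ) (ℤ.+-comm b 0ℤ) (ℤ.+-comm c 0ℤ)
total-monomials φ (x ∷ k) (y ∷ r) d b c = trans (total-monomials _ k r d b c) (cong₃ φ (sym (ℤ.+-assoc (+ ∣ degA x y ∣) (absDegree k r) (+ d)))
  (trans (sym (ℤ.+-assoc x (normℤ k) b)) (cong (_+ b) (sym (normℤ-∷ x k)))) (sym (ℤ.+-assoc y (vsum r) c)))

-- `constantTerm` pulled back along `at-v=1`, in the form that `⟪⟫-pow` produces.
constantTerm₁ : ℤ → Test
constantTerm₁ n a b c = constantTerm n (1ℤ * a) (1ℤ * b) (0ℤ * c)

-- Vanishing of the u-exponent forces the index of `θ` to be `−|k|`. If the degree condition holds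
-- as well, it bounds this index by the prescribed degree, so the index lies in the box.
expansion-term : ∀ {m} B N (k r : Vec ℤ m) → ∣ + 2 * (N + tri m) ∣ ≤ B →
  vandermondeᵛ B (terms k r) * last-row B (λ ms → vandermondeˣ B ms * total (constantTerm₁ (N + tri m)) ms) (terms k r) ≡
  signs k r * (bit (does (expo k r ≟ N)) * weight k r)
expansion-term {m} B N k r big = begin
  V * (signs k r * ∑ (θ B) λ t₀ → Term.coef t₀ * H (monomials k r ++ monomial t₀ ∷ []))
    ≡⟨ cong (λ z → V * (signs k r * z)) (trans (trans (∑-map termθ (box B 1) (λ t₀ → Term.coef t₀ * H (monomials k r ++ monomial t₀ ∷ []))) (∑-box B 1 (λ v → 1ℤ * H (monomials k r ++ mon ∣ hex (head v) ∣ (head v) 0ℤ ∷ [])))) (trans (∑-cong (range B) select) (∑-δ′ (- K) F support))) ⟩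
  V * (signs k r * (X (- K) * D (- K)))
    ≡⟨ finish (signs k r ≟ 0ℤ) ⟩
  signs k r * (bit (does (expo k r ≟ N)) * weight k r) ∎
  where
  open ≡-Reasoning
  V = vandermondeᵛ B (terms k r)
  K = normℤ k
  H : List Mon → ℤ
  H ms = vandermondeˣ B ms * total (constantTerm₁ (N + tri m)) ms
  hex X D F : ℤ → ℤ
  hex l = l * (+ 2 * l + 1ℤ)
  X l = vandermondeˣ B (monomials k r ++ mon ∣ hex l ∣ l 0ℤ ∷ [])
  D l = δ (+ 2 * (N + tri m)) (1ℤ * (absDegree k r + + ∣ hex l ∣))
  F l = X l * D l
  select : ∀ l → 1ℤ * H (monomials k r ++ mon ∣ hex l ∣ l 0ℤ ∷ []) ≡ δ (- K) l * F l
  select l = trans (cong (λ z → 1ℤ * (X l * z)) (trans (total-monomials (constantTerm₁ (N + tri m)) k r ∣ hex l ∣ l 0ℤ) (cong (D l *_) K+l≡0))) (swap (X l) (D l) (δ (- K) l))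
    where
    swap : ∀ x d e → 1ℤ * (x * (d * e)) ≡ e * (x * d)
    swap = solve-∀
    to : ∀ k l → - k + 1ℤ * (k + l) ≡ l
    to = solve-∀
    from : ∀ k → 1ℤ * (k + - k) ≡ 0ℤ
    from = solve-∀
    K+l≡0 : δ 0ℤ (1ℤ * (K + l)) ≡ δ (- K) l
    K+l≡0 = δ-iff {0ℤ} {1ℤ * (K + l)} { - K} {l} (λ e → trans (sym (ℤ.+-identityʳ (- K))) (trans (cong (λ z → - K + z) e) (to K l)))
      (λ e → trans (sym (from K)) (cong (λ z → 1ℤ * (K + z)) e))
  support : F (- K) ≢ 0ℤ → ∣ - K ∣ ≤ B
  support p = ℕ.≤-trans (ℤ.drop‿+≤+ (ℤ.≤-trans (∣x∣≤x[2x+1] (- K)) (ℤ.≤-trans (subst (hex (- K) ℤ.≤_) e₂ hex≤) (i≤∣i∣ (+ 2 * (N + tri m)))))) big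
    where
    e₁ : + 2 * (N + tri m) ≡ 1ℤ * (absDegree k r + + ∣ hex (- K) ∣)
    e₁ = δ-≢0 (*-≢0ʳ (X (- K)) p)
    e₂ : absDegree k r + hex (- K) ≡ + 2 * (N + tri m)
    e₂ = sym (trans e₁ (trans (ℤ.*-identityˡ _) (cong (λ z → absDegree k r + z) (ℤ.0≤i⇒+∣i∣≡i (hexagonal-nonneg (- K))))))
    hex≤ : hex (- K) ℤ.≤ absDegree k r + hex (- K)
    hex≤ = subst (ℤ._≤ absDegree k r + hex (- K)) (ℤ.+-identityˡ (hex (- K))) (ℤ.+-monoˡ-≤ (hex (- K)) (absDegree-nonneg k r))
  finish : Dec (signs k r ≡ 0ℤ) → V * (signs k r * (X (- K) * D (- K))) ≡ signs k r * (bit (does (expo k r ≟ N)) * weight k r)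
  finish (yes z) = trans (cong (λ s → V * (s * (X (- K) * D (- K)))) z) (trans (l V (X (- K) * D (- K)) (bit (does (expo k r ≟ N)) * weight k r)) (cong (_* (bit (does (expo k r ≟ N)) * weight k r)) (sym z)))
    where
    l : ∀ v x w → v * (0ℤ * x) ≡ 0ℤ * w
    l = solve-∀
  finish (no ¬z) = trans (l V (signs k r) (X (- K)) (D (- K))) (cong₂ (λ d w → signs k r * (d * w)) D≡ (sym (weight-vandermonde B ∣ hex (- K) ∣ k r)))
    where
    l : ∀ v s x d → v * (s * (x * d)) ≡ s * (d * (v * x))
    l = solve-∀
    total-degree : 1ℤ * (absDegree k r + + ∣ hex (- K) ∣) ≡ + 2 * (expo k r + tri m)
    total-degree = trans (ℤ.*-identityˡ _) (trans (cong₂ _+_ (absDegree-degree k r ¬z) (ℤ.0≤i⇒+∣i∣≡i (hexagonal-nonneg (- K)))) (degree-expo k r))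
    D≡ : D (- K) ≡ bit (does (expo k r ≟ N))
    D≡ = trans (cong (δ (+ 2 * (N + tri m))) total-degree) (trans (δ-double (N + tri m) (expo k r + tri m))
      (trans (cong₂ δ (ℤ.+-comm N (tri m)) (ℤ.+-comm (expo k r) (tri m))) (trans (δ-shift (tri m) N (expo k r)) (δ-iff {N} {expo k r} {expo k r} {N} sym sym))))

truncated-sum-constant-term : ∀ m B N → ∣ + 2 * (N + tri m) ∣ ≤ B → rhsCoeffTrunc m B N ≡ + (m !) * ⟪ at-v=1 (W m) B , constantTerm (N + tri m) ⟫
truncated-sum-constant-term m B N big = begin
  rhsCoeffTrunc m B N
    ≡⟨ truncated-sum m B N ⟩
  S B m (λ k → S B m λ r → signs k r * (bit (does (expo k r ≟ N)) * weight k r))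
    ≡⟨ S-cong B m (λ k → S-cong B m λ r → expansion-term B N k r big) ⟨
  S B m (λ k → S B m λ r → G (terms k r))
    ≡⟨ Mu-box B m (λ zs → G (map termA zs)) ⟨
  Mu (box B 2) m (λ zs → G (map termA zs))
    ≡⟨ Mu-map termA (box B 2) m G ⟨
  Mu (A B) m G
    ≡⟨ W-expansion B m (constantTerm₁ (N + tri m)) ⟨
  + (m !) * ⟪ W m B , constantTerm₁ (N + tri m) ⟫
    ≡⟨ cong (+ (m !) *_) (⟪⟫-pow 1 1ℤ 0ℤ (W m B) (constantTerm (N + tri m))) ⟨
  + (m !) * ⟪ at-v=1 (W m) B , constantTerm (N + tri m) ⟫ ∎
  where
  open ≡-Reasoning
  G : List Term → ℤ
  G ts = vandermondeᵛ B ts * last-row B (λ ms → vandermondeˣ B ms * total (constantTerm₁ (N + tri m)) ms) ts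

theorem5p10 : (m : ℕ) → 1 ≤ m → (N : ℤ) →
  ∃[ B₀ ] ((B : ℕ) → B₀ ≤ B →
    (+ facProd m * + facProd m) * lhsCoeff m N ≡ rhsCoeffTrunc m B N)
-- `B₁` makes the evaluation of `W m` at `v = 1` exact below degree `suc ∣ n ∣`, `suc ∣ N ∣`
-- captures all triangular numbers up to `N`, and `∣ n ∣` leaves room for the index of `θ`.
theorem5p10 m _ N = B₁ ℕ.+ (suc ∣ N ∣ ℕ.+ ∣ n ∣) , λ B h →
  let h₁ = ℕ.≤-trans (ℕ.m≤m+n B₁ (suc ∣ N ∣ ℕ.+ ∣ n ∣)) h
      h₂ = ℕ.≤-trans (ℕ.m≤n+m (suc ∣ N ∣ ℕ.+ ∣ n ∣) B₁) h
  in sym (trans (truncated-sum-constant-term m B N (ℕ.≤-trans (ℕ.m≤n+m ∣ n ∣ (suc ∣ N ∣)) h₂))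
    (trans (cong (+ (m !) *_) (_≈[_]_.agree evaluated B h₁ (constantTerm (N + tri m)) cut))
      (constant-term-of-product m N B (ℕ.≤-trans (ℕ.m≤m+n (suc ∣ N ∣) ∣ n ∣) h₂))))
  where
  n = + 2 * (N + tri m)
  evaluated : at-v=1 (W m) ≈[ suc ∣ n ∣ ] ι (+ leadingCoefficient m) ⊙ (△ ^ (2 ℕ.* m ℕ.* suc m) ⊙ at-v=1 (T m))
  evaluated = _≈_.at (specialised-W m) (suc ∣ n ∣)
  B₁ = _≈[_]_.bound evaluated
  cut : Cut (suc ∣ n ∣) (constantTerm (N + tri m))
  cut a b c h = cong (_* δ 0ℤ b) (δ-≢ λ e → ℕ.<-irrefl refl (ℤ.drop‿+≤+ (ℤ.≤-trans h (subst (ℤ._≤ + ∣ n ∣) e (i≤∣i∣ n)))))
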